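{- Let $k$ be a positive integer and let $H^k$ be the $3$-graph with the $5+3k$ vertices $a,b,c_0,\ldots,c_k,d_0,\ldots,d_k,e_0,\ldots,e_k$ and the following $3(k+2)$ edges: $abc_0$, $bc_0c_1$, $c_{i}c_{i+1}c_{i+2}$ for $0\le i\le k-2$, $c_{k-1}c_kd_k$; $abd_0$, $bd_0d_1$, $d_{i}d_{i+1}d_{i+2}$ for $0\le i\le k-2$, $d_{k-1}d_ke_k$; $abe_0$, $be_0e_1$, $e_{i}e_{i+1}e_{i+2}$ for $0\le i\le k-2$, $e_{k-1}e_kc_k$. Then the uniform Tur\'an density of $H^k$ is equal to $1/27$.
   Context: A $3$-graph is a $3$-uniform hypergraph; $xyz$ denotes the edge $\{x,y,z\}$. A $3$-graph $G$ on $n$ vertices is $(d,\varepsilon)$-dense if every subset $W$ of its vertices induces at least $d\binom{|W|}{3}-\varepsilon n^3$ edges. The uniform Tur\'an density of a $3$-graph $H_0$ is the supremum of all $d\in[0,1]$ such that for every $\varepsilon>0$ there exist arbitrarily large $(d,\varepsilon)$-dense $3$-graphs not containing $H_0$ as a (not necessarily induced) subhypergraph. -}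

module Defs where

open import Data.Nat as ℕ using (ℕ; zero; suc; _+_; _<_; _≤_)
open import Data.Nat.Combinatorics using (_C_)
open import Data.Fin using (Fin; zero; suc; toℕ; fromℕ)
open import Data.Fin.Subset using (Subset; _∈_; ∣_∣)
open import Data.Vec using (lookup)
open import Data.Bool using (Bool; true; false; _∧_)
import Data.Bool
open import Data.List using (List; length; filter; allFin; cartesianProduct)
open import Data.Product using (Σ; _×_; _,_; ∃)
open import Data.Integer using (+_)
open import Data.Rational as ℚ using (ℚ)
open import Relation.Binary.PropositionalEquality using (_≡_)
open import Relation.Nullary using (¬_)
open import Relation.Nullary.Decidable using (⌊_⌋)
open import Function.Definitions using (Injective)

-- A 3-graph on vertex set Fin n: a Bool-valued edge indicator on triples,
-- invariant under permutations of the triple (so it encodes a set of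
-- unordered triples); its value on triples with repeated vertices is
-- irrelevant (never consulted by the definitions below).
record ThreeGraph (n : ℕ) : Set where
  field
    E     : Fin n → Fin n → Fin n → Bool
    sym₁₂ : ∀ x y z → E x y z ≡ E y x z
    sym₂₃ : ∀ x y z → E x y z ≡ E x z y
open ThreeGraph public

toℚ : ℕ → ℚ
toℚ m = (+ m) ℚ./ 1

inducedEdges : ∀ {n} → ThreeGraph n → Subset n → ℕ
inducedEdges {n} G W =
  length (filter (λ t → good t Data.Bool.≟ true) triples)
  where
  triples : List (Fin n × Fin n × Fin n)
  triples = cartesianProduct (allFin n) (cartesianProduct (allFin n) (allFin n))
  inW : Fin n → Bool
  inW x = lookup W x
  good : Fin n × Fin n × Fin n → Bool
  good (x , y , z) =
    ⌊ toℕ x ℕ.<? toℕ y ⌋ ∧ ⌊ toℕ y ℕ.<? toℕ z ⌋ ∧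
    inW x ∧ inW y ∧ inW z ∧ E G x y z

Dense : ∀ {n} → ℚ → ℚ → ThreeGraph n → Set
Dense {n} d ε G = ∀ (W : Subset n) →
  (d ℚ.* toℚ (∣ W ∣ C 3)) ℚ.- (ε ℚ.* toℚ (n ℕ.^ 3)) ℚ.≤ toℚ (inducedEdges G W)

data V (k : ℕ) : Set where
  va vb : V k
  vc vd ve : Fin (suc k) → V k

-- Edges of H^k (as triples; the order within a triple is immaterial
-- since host 3-graphs are symmetric).
data HEdge (k : ℕ) : V k → V k → V k → Set where
  abc₀   : HEdge k va vb (vc zero)
  bc₀c₁  : ∀ (j : Fin (suc k)) → toℕ j ≡ 1 → HEdge k vb (vc zero) (vc j)
  ccc    : ∀ (i j l : Fin (suc k)) → toℕ j ≡ suc (toℕ i) → toℕ l ≡ suc (toℕ j) →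
           HEdge k (vc i) (vc j) (vc l)
  cckdk  : ∀ (i : Fin (suc k)) → suc (toℕ i) ≡ k →
           HEdge k (vc i) (vc (fromℕ k)) (vd (fromℕ k))
  abd₀   : HEdge k va vb (vd zero)
  bd₀d₁  : ∀ (j : Fin (suc k)) → toℕ j ≡ 1 → HEdge k vb (vd zero) (vd j)
  ddd    : ∀ (i j l : Fin (suc k)) → toℕ j ≡ suc (toℕ i) → toℕ l ≡ suc (toℕ j) →
           HEdge k (vd i) (vd j) (vd l)
  ddkek  : ∀ (i : Fin (suc k)) → suc (toℕ i) ≡ k →
           HEdge k (vd i) (vd (fromℕ k)) (ve (fromℕ k))
  abe₀   : HEdge k va vb (ve zero)
  be₀e₁  : ∀ (j : Fin (suc k)) → toℕ j ≡ 1 → HEdge k vb (ve zero) (ve j)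
  eee    : ∀ (i j l : Fin (suc k)) → toℕ j ≡ suc (toℕ i) → toℕ l ≡ suc (toℕ j) →
           HEdge k (ve i) (ve j) (ve l)
  eekck  : ∀ (i : Fin (suc k)) → suc (toℕ i) ≡ k →
           HEdge k (ve i) (ve (fromℕ k)) (vc (fromℕ k))

ContainsH : ∀ {n} → ℕ → ThreeGraph n → Set
ContainsH {n} k G = Σ (V k → Fin n) λ f → Injective _≡_ _≡_ f ×
  (∀ x y z → HEdge k x y z → E G (f x) (f y) (f z) ≡ true)

1/27 : ℚ
1/27 = (+ 1) ℚ./ 27

{-# OPTIONS --safe #-}
-- Upper bound. In a dense 3-graph, choose probability weights w₁, ..., w_N on the
-- vertices, one for each of many positions, such that every triple of positions
-- has average edge density at least 1/27 + η. By tilting the weights, which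
-- increases a bounded energy, they become regular against the test functions
-- that occur, and by Ramsey's theorem all small tuples of positions look alike.
-- Density above 1/27 = (1/3)³ then forces the links of a pair of positions to
-- overlap; the overlaps give petals, and closing three petals in a cycle gives a
-- positive weighted count of H¹. A blow-up of H¹ contains H^k.
-- Lower bound. Split the vertices into blocks and give every pair of vertices
-- from different blocks one of three colours at random, here by a table of all
-- colourings; xyz is an edge if its three pairs have the colours prescribed by
-- their order. Along a tight path in this graph, order and colour of a pair of
-- consecutive vertices determine those of the next pair, so in a copy of H^k the
-- pairs c_k d_k, d_k e_k, e_k c_k would all be ordered in the same direction. The
-- density is 1/27 on every subset by Bessel's inequality.

module Submission where
open import Defs renaming (V to Label; E to edge)
open import Algebra.Bundles using (CommutativeRing)
open import Algebra.Solver.Ring.AlmostCommutativeRing using (AlmostCommutativeRing; IsAlmostCommutativeRing; fromCommutativeRing; _-Raw-AlmostCommutative⟶_)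
import Algebra.Solver.Ring as RingSolver
import Data.Bool
open import Data.Bool using (Bool; true; false; if_then_else_; _∧_; _∨_)
open import Data.Empty using (⊥; ⊥-elim)
open import Data.Fin using (Fin; zero; suc)
import Data.Fin as Fin
import Data.Fin.Properties as Fin
open import Data.Integer as ℤ using (ℤ; -[1+_])
import Data.Integer.Properties as ℤ
open import Data.List using (List; []; _∷_)
import Data.List as List
open import Data.Maybe as Maybe using (Maybe)
open import Data.Nat as ℕ using (ℕ; zero; suc)
import Data.Nat.Properties as ℕ
open import Data.Product using (Σ; _×_; _,_; proj₁; proj₂; ∃)
open import Data.Rational as ℚ using (ℚ; mkℚ; 0ℚ; _≤_; _<_; *≤*; *<*)
import Data.Rational.Properties as ℚ
import Data.Rational.Unnormalised as ℚᵘ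
import Data.Rational.Unnormalised.Properties as ℚᵘ
open import Data.Sum using (_⊎_; inj₁; inj₂; [_,_]′)
import Data.Sum
open import Data.Unit using (⊤; tt)
open import Data.Vec as Vec using (Vec; []; _∷_; lookup; _[_]≔_)
import Data.Vec.Properties as Vec
open import Function using (_∘_; id; case_of_)
open import Relation.Binary.PropositionalEquality using (_≡_; _≢_; refl; sym; trans; cong; cong₂; subst; subst₂; ≢-sym)
open import Relation.Nullary using (¬_; Dec; yes; no)
open import Relation.Nullary.Decidable using (⌊_⌋; dec⇒maybe)
open import Relation.Binary.Definitions using (tri<; tri≈; tri>)
open import Relation.Nullary.Decidable using (_×-dec_)
import Data.Nat.Combinatorics as Comb
open import Data.Nat.Combinatorics using (nC1≡n; nCk+nC[k+1]≡[n+1]C[k+1])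
open import Data.Fin.Subset using (∣_∣)

-- The third vertex of an edge lies right of, left of or between a given pair. If these three ways
-- of being covered excluded each other, their frequencies `p`, `q`, `r` would have sum at most 1
-- and the density would be at most `pqr`, hence at most 1/27; the three colours of the lower bound
-- realise this. Above 1/27 some pairs are covered from two sides, which is what a cycle of petals
-- needs: of three petals at `i < j < h`, two end at a later position and one at an earlier one. The
-- common neighbour `k` of a pair stands in for a later vertex, `l` for an earlier one. Stand-ins
-- can be exchanged, because links with nearly equal pairwise codegrees have almost orthogonal
-- differences, and by Bessel's inequality a petal sees few of these. Regularity quantifies over
-- infinitely many functions `g`, and no violation is searched for. Instead the blow-up that is
-- sought is decidable: if there is none, no admissible weights are regular and the energy would
-- grow beyond its bound. The weights stay below a constant divided by `n`, so that the density
-- hypothesis still applies to them and single vertices have negligible weight.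

infixl 6 _+_ _-_
infixl 7 _*_
infix  8 -_

-- Opaque copies of the operations of ℚ, so that no term ever reduces to
-- numerators and denominators.
opaque
  _+_ _*_ : ℚ → ℚ → ℚ
  _+_ = ℚ._+_
  _*_ = ℚ._*_

  -_ : ℚ → ℚ
  -_ = ℚ.-_

  fromℤ : ℤ → ℚ
  fromℤ z = z ℚ./ 1

ι : ℕ → ℚ
ι n = fromℤ (ℤ.+ n)

𝟎 𝟏 : ℚ
𝟎 = ι 0
𝟏 = ι 1

_-_ : ℚ → ℚ → ℚ
x - y = x + - y

opaque
  unfolding _+_ _*_ -_ fromℤ

  +-def : ∀ x y → x + y ≡ x ℚ.+ y
  +-def x y = refl

  *-def : ∀ x y → x * y ≡ x ℚ.* y
  *-def x y = refl

  neg-def : ∀ x → - x ≡ ℚ.- x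
  neg-def x = refl

  ι-def : ∀ n → ι n ≡ toℚ n
  ι-def n = refl

  𝟎-def : 𝟎 ≡ 0ℚ
  𝟎-def = refl

  private
    /1-def : ∀ z → z ℚ./ 1 ≡ ℚ.fromℚᵘ (ℚᵘ.mkℚᵘ z 0)
    /1-def (ℤ.+ n) = refl
    /1-def -[1+ n ] = refl

    toℚᵘ-/1 : ∀ z → ℚ.toℚᵘ (z ℚ./ 1) ℚᵘ.≃ ℚᵘ.mkℚᵘ z 0
    toℚᵘ-/1 z = subst (λ q → ℚ.toℚᵘ q ℚᵘ.≃ ℚᵘ.mkℚᵘ z 0) (sym (/1-def z)) (ℚ.toℚᵘ-fromℚᵘ _)

  fromℤ-+ : ∀ a b → fromℤ (a ℤ.+ b) ≡ fromℤ a + fromℤ b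
  fromℤ-+ a b = ℚ.toℚᵘ-injective (ℚᵘ.≃-trans (toℚᵘ-/1 (a ℤ.+ b))
    (ℚᵘ.≃-sym (ℚᵘ.≃-trans (ℚ.toℚᵘ-homo-+ (a ℚ./ 1) (b ℚ./ 1))
      (ℚᵘ.≃-trans (ℚᵘ.+-cong (toℚᵘ-/1 a) (toℚᵘ-/1 b))
        (ℚᵘ.*≡* (cong (ℤ._* (ℤ.+ 1)) (cong₂ ℤ._+_ (ℤ.*-identityʳ a) (ℤ.*-identityʳ b))))))))

  fromℤ-* : ∀ a b → fromℤ (a ℤ.* b) ≡ fromℤ a * fromℤ b
  fromℤ-* a b = ℚ.toℚᵘ-injective (ℚᵘ.≃-trans (toℚᵘ-/1 (a ℤ.* b))
    (ℚᵘ.≃-sym (ℚᵘ.≃-trans (ℚ.toℚᵘ-homo-* (a ℚ./ 1) (b ℚ./ 1))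
      (ℚᵘ.*-cong (toℚᵘ-/1 a) (toℚᵘ-/1 b)))))

  fromℤ-neg : ∀ a → fromℤ (ℤ.- a) ≡ - fromℤ a
  fromℤ-neg a = ℚ.toℚᵘ-injective (ℚᵘ.≃-trans (toℚᵘ-/1 (ℤ.- a))
    (ℚᵘ.≃-sym (ℚᵘ.≃-trans (ℚ.toℚᵘ-homo‿- (a ℚ./ 1))
      (ℚᵘ.-‿cong (toℚᵘ-/1 a)))))

  ℚ-isRing : IsAlmostCommutativeRing _≡_ _+_ _*_ -_ 𝟎 𝟏
  ℚ-isRing = AlmostCommutativeRing.isAlmostCommutativeRing (fromCommutativeRing ℚ.+-*-commutativeRing)

  +-mono : ∀ {a b c d} → a ≤ b → c ≤ d → a + c ≤ b + d
  +-mono = ℚ.+-mono-≤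

  *-nonneg : ∀ {a b} → 𝟎 ≤ a → 𝟎 ≤ b → 𝟎 ≤ a * b
  *-nonneg {a} {b} p q = subst (ℚ._≤ a ℚ.* b) (ℚ.*-zeroʳ a)
    (ℚ.*-monoˡ-≤-nonNeg a {{ℚ.nonNegative p}} q)

  *-pos : ∀ {a b} → 𝟎 < a → 𝟎 < b → 𝟎 < a * b
  *-pos {a} {b} p q = subst (ℚ._< a ℚ.* b) (ℚ.*-zeroʳ a)
    (ℚ.*-monoʳ-<-pos a {{ℚ.positive p}} q)

  +-mono-< : ∀ {a b c d} → a < b → c ≤ d → a + c < b + d
  +-mono-< = ℚ.+-mono-<-≤

  ι-mono : ∀ {m n} → m ℕ.≤ n → ι m ≤ ι n
  ι-mono {m} {n} p = ℚ.toℚᵘ-cancel-≤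
    (ℚᵘ.≤-respʳ-≃ (ℚᵘ.≃-sym (toℚᵘ-/1 (ℤ.+ n))) (ℚᵘ.≤-respˡ-≃ (ℚᵘ.≃-sym (toℚᵘ-/1 (ℤ.+ m)))
      (ℚᵘ.*≤* (ℤ.*-monoʳ-≤-nonNeg (ℤ.+ 1) (ℤ.+≤+ p)))))

  0<1 : 𝟎 < 𝟏
  0<1 = *<* (ℤ.+<+ (ℕ.s≤s ℕ.z≤n))

  1/27-def : ι 27 * 1/27 ≡ 𝟏
  1/27-def = refl

  reciprocal : ∀ x → 𝟎 < x → Σ ℚ λ y → 𝟎 < y × x * y ≡ 𝟏
  reciprocal x p = ℚ.1/_ x {{nz}} , ℚ.positive⁻¹ _ {{ℚ.1/pos⇒pos x {{ℚ.positive p}}}} , ℚ.*-inverseʳ x {{nz}}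
    where
    nz : ℚ.NonZero x
    nz = ℚ.pos⇒nonZero x {{ℚ.positive p}}

  archimedean : ∀ x → 𝟎 < x → Σ ℕ λ m → 𝟏 ≤ ι m * x
  archimedean (mkℚ (ℤ.+ zero) d c) (*<* (ℤ.+<+ ()))
  archimedean (mkℚ -[1+ n ] d c) (*<* ())
  archimedean x@(mkℚ (ℤ.+ (suc n)) d c) p =
    suc d , subst (𝟏 ≤_) (sym (ℚ.toℚᵘ-injective eq)) (ι-mono {1} {suc n} (ℕ.s≤s ℕ.z≤n))
    where
    eq : ℚ.toℚᵘ (ι (suc d) * x) ℚᵘ.≃ ℚ.toℚᵘ (ι (suc n))
    eq = ℚᵘ.≃-trans (ℚ.toℚᵘ-homo-* (ι (suc d)) x)
      (ℚᵘ.≃-trans (ℚᵘ.*-cong (toℚᵘ-/1 (ℤ.+ suc d)) (ℚᵘ.≃-refl {ℚ.toℚᵘ x}))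
        (ℚᵘ.≃-trans
          (ℚᵘ.*≡* (trans (ℤ.*-identityʳ ((ℤ.+ suc d) ℤ.* (ℤ.+ suc n)))
            (trans (ℤ.*-comm (ℤ.+ suc d) (ℤ.+ suc n))
              (cong (λ z → (ℤ.+ suc n) ℤ.* ℤ.+ z) (sym (ℕ.*-identityˡ (suc d)))))))
          (ℚᵘ.≃-sym (toℚᵘ-/1 (ℤ.+ suc n)))))

ℚ-ring : AlmostCommutativeRing _ _
ℚ-ring = record { isAlmostCommutativeRing = ℚ-isRing }

ℤ⟶ℚ : CommutativeRing.rawRing ℤ.+-*-commutativeRing -Raw-AlmostCommutative⟶ ℚ-ring
ℤ⟶ℚ = record
  { ⟦_⟧ = fromℤ
  ; +-homo = fromℤ-+ ; *-homo = fromℤ-* ; -‿homo = fromℤ-neg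
  ; 0-homo = refl ; 1-homo = refl
  }

module Solver = RingSolver (CommutativeRing.rawRing ℤ.+-*-commutativeRing) ℚ-ring ℤ⟶ℚ
  (λ a b → Maybe.map (cong fromℤ) (dec⇒maybe (a ℤ.≟ b)))

open Solver using (Polynomial; solve; con; _:=_; _:+_; _:*_; _:-_; :-_)

lit : ∀ {n} → ℕ → Polynomial n
lit k = con (ℤ.+ k)

-- Inequalities over ℚ certified by polynomial identities

infixr 5 _⊕_
infixr 6 _⊗_

-- Linear arithmetic by certificates: the inequality c ≤ d follows from a ≤ b
-- once d - c and b - a agree as polynomials.
≤-by : ∀ {a b c d} → a ≤ b → d - c ≡ b - a → c ≤ d
≤-by {a} {b} {c} {d} p e = subst₂ _≤_ l r (+-mono p (ℚ.≤-refl {c - a}))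
  where
  l : a + (c - a) ≡ c
  l = solve 2 (λ a b → a :+ (b :- a) := b) refl _ _
  r : b + (c - a) ≡ d
  r = trans {j = (b - a) + c} (solve 3 (λ a b c → a :+ (b :- c) := a :- c :+ b) refl _ _ _) (trans (cong (_+ c) (sym e)) (solve 2 (λ a b → a :- b :+ b := a) refl _ _))

_⊕_ : ∀ {a b c d} → a ≤ b → c ≤ d → a + c ≤ b + d
_⊕_ = +-mono

≤⇒0≤ : ∀ {a b} → a ≤ b → 𝟎 ≤ b - a
≤⇒0≤ {a} {b} p = ≤-by p (solve 2 (λ a b → a :- b :- (lit 0) := a :- b) refl _ _)

_⊗_ : ∀ {a b c d} → a ≤ b → c ≤ d → 𝟎 ≤ (b - a) * (d - c)
p ⊗ q = *-nonneg (≤⇒0≤ p) (≤⇒0≤ q)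

*-monoˡ : ∀ {k a b} → 𝟎 ≤ k → a ≤ b → k * a ≤ k * b
*-monoˡ {k} {a} {b} p q = ≤-by (p ⊗ q) (solve 3 (λ a b c → a :* b :- a :* c := (a :- (lit 0)) :* (b :- c) :- (lit 0)) refl _ _ _)

*-monoʳ : ∀ {k a b} → 𝟎 ≤ k → a ≤ b → a * k ≤ b * k
*-monoʳ {k} {a} {b} p q = ≤-by (p ⊗ q) (solve 3 (λ a b c → a :* b :- c :* b := (b :- (lit 0)) :* (a :- c) :- (lit 0)) refl _ _ _)

≤-refl′ : ∀ {a b} → a ≡ b → a ≤ b
≤-refl′ = ℚ.≤-reflexive

0≤1 : 𝟎 ≤ 𝟏
0≤1 = ℚ.<⇒≤ 0<1

ι-nonneg : ∀ n → 𝟎 ≤ ι n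
ι-nonneg n = ι-mono ℕ.z≤n

ι-suc : ∀ n → ι (suc n) ≡ 𝟏 + ι n
ι-suc n = fromℤ-+ (ℤ.+ 1) (ℤ.+ n)

ι-+ : ∀ m n → ι (m ℕ.+ n) ≡ ι m + ι n
ι-+ m n = fromℤ-+ (ℤ.+ m) (ℤ.+ n)

ι-* : ∀ m n → ι (m ℕ.* n) ≡ ι m * ι n
ι-* m n = trans (cong fromℤ (ℤ.pos-* m n)) (fromℤ-* (ℤ.+ m) (ℤ.+ n))

ι-pos : ∀ n → 𝟎 < ι (suc n)
ι-pos n = ℚ.<-≤-trans 0<1 (ι-mono {1} {suc n} (ℕ.s≤s ℕ.z≤n))

*-cancel-≤ : ∀ {k a b} → 𝟎 < k → k * a ≤ k * b → a ≤ b
*-cancel-≤ {k} {a} {b} k>0 p with reciprocal k k>0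
... | y , y>0 , e = subst₂ _≤_ (cancel a) (cancel b) (*-monoˡ (ℚ.<⇒≤ y>0) p)
  where
  cancel : ∀ x → y * (k * x) ≡ x
  cancel x = trans {j = (k * y) * x} (solve 3 (λ a b c → a :* (b :* c) := b :* a :* c) refl _ _ _) (trans (cong (_* x) e) (solve 1 (λ a → (lit 1) :* a := a) refl _))

sq-nonneg : ∀ x → 𝟎 ≤ x * x
sq-nonneg x with ℚ.≤-total 𝟎 x
... | inj₁ p = *-nonneg p p
... | inj₂ p = ≤-by (p ⊗ p) (solve 1 (λ a → a :* a :- (lit 0) := ((lit 0) :- a) :* ((lit 0) :- a) :- (lit 0)) refl _)

<⇒0< : ∀ {a b} → a < b → 𝟎 < b - a
<⇒0< {a} {b} p = subst (_< b - a) {a - a} {𝟎} (solve 1 (λ a → a :- a := (lit 0)) refl _) (+-mono-< {a} {b} { - a} { - a} p ℚ.≤-refl)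

≤⇒≯ : ∀ {a b} → a ≤ b → ¬ b < a
≤⇒≯ p q = ℚ.<-irrefl refl (ℚ.≤-<-trans p q)

sq-cancel-≤ : ∀ {x y} → 𝟎 ≤ y → x * x ≤ y * y → x ≤ y
sq-cancel-≤ {x} {y} y≥0 p with x ℚ.≤? y
... | yes q = q
... | no q = ⊥-elim (≤⇒≯ x²-y²≤0 (*-pos (<⇒0< y<x) (ℚ.<-≤-trans (<⇒0< y<x) (≤-by (y≥0 ⊕ y≥0) (solve 2 (λ a b → a :+ b :- (a :- b) := b :+ b :- ((lit 0) :+ (lit 0))) refl _ _)))))
  where
  y<x : y < x
  y<x = ℚ.≰⇒> q
  x²-y²≤0 : (x - y) * (x + y) ≤ 𝟎
  x²-y²≤0 = ≤-by p (solve 2 (λ a b → (lit 0) :- (a :- b) :* (a :+ b) := b :* b :- a :* a) refl _ _)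

opaque
  fraction : ∀ n {θ} → 𝟎 < θ → Σ ℚ λ c → 𝟎 < c × ι (suc n) * c ≡ θ
  fraction n {θ} θ>0 with reciprocal (ι (suc n)) (ι-pos n)
  ... | y , y>0 , e = y * θ , *-pos y>0 θ>0 ,
    trans {j = (ι (suc n) * y) * θ} (solve 3 (λ a b c → a :* (b :* c) := a :* b :* c) refl _ _ _) (trans (cong (_* θ) e) (solve 1 (λ a → (lit 1) :* a := a) refl _))

+-nonneg : ∀ {a b} → 𝟎 ≤ a → 𝟎 ≤ b → 𝟎 ≤ a + b
+-nonneg p q = ≤-by (p ⊕ q) (solve 2 (λ a b → a :+ b :- (lit 0) := a :+ b :- ((lit 0) :+ (lit 0))) refl _ _)

sq-mono : ∀ {a b} → 𝟎 ≤ a → a ≤ b → a * a ≤ b * b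
sq-mono {a} {b} a≥0 p = ≤-by (*-nonneg (≤⇒0≤ p) (+-nonneg a≥0 (ℚ.≤-trans a≥0 p))) (solve 2 (λ a b → a :* a :- b :* b := (a :- b) :* (b :+ a) :- (lit 0)) refl _ _)

-- A probability measure, kept only as its expectation functional: linear, positive and normalised.
-- Independent samples, single positions and tilted weights are then treated alike.
record Mean (A : Set) : Set where
  field
    𝔼       : (A → ℚ) → ℚ
    𝔼-+     : ∀ f g → 𝔼 (λ x → f x + g x) ≡ 𝔼 f + 𝔼 g
    𝔼-*     : ∀ c f → 𝔼 (λ x → c * f x) ≡ c * 𝔼 f
    𝔼-mono  : ∀ {f g} → (∀ x → f x ≤ g x) → 𝔼 f ≤ 𝔼 g
    𝔼-const : ∀ c → 𝔼 (λ _ → c) ≡ c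

  𝔼-cong : ∀ {f g} → (∀ x → f x ≡ g x) → 𝔼 f ≡ 𝔼 g
  𝔼-cong e = ℚ.≤-antisym (𝔼-mono (λ x → ≤-refl′ (e x))) (𝔼-mono (λ x → ≤-refl′ (sym (e x))))

  𝔼-*ʳ : ∀ c f → 𝔼 (λ x → f x * c) ≡ 𝔼 f * c
  𝔼-*ʳ c f = trans (𝔼-cong {g = λ x → c * f x} (λ x → (solve 2 (λ a b → a :* b := b :* a) refl _ _))) (trans (𝔼-* c f) (solve 2 (λ a b → a :* b := b :* a) refl _ _))

  𝔼-neg : ∀ f → 𝔼 (λ x → - f x) ≡ - 𝔼 f
  𝔼-neg f = trans (𝔼-cong {g = λ x → - 𝟏 * f x} (λ x → (solve 1 (λ a → (:- a) := (:- (lit 1)) :* a) refl _))) (trans (𝔼-* (- 𝟏) f) (solve 1 (λ a → (:- (lit 1)) :* a := (:- a)) refl _))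

  𝔼-sub : ∀ f g → 𝔼 (λ x → f x - g x) ≡ 𝔼 f - 𝔼 g
  𝔼-sub f g = trans (𝔼-+ f (λ x → - g x)) (cong (𝔼 f +_) (𝔼-neg g))

  𝔼-≤ : ∀ {f c} → (∀ x → f x ≤ c) → 𝔼 f ≤ c
  𝔼-≤ {c = c} p = ℚ.≤-trans (𝔼-mono p) (≤-refl′ (𝔼-const c))

  ≤-𝔼 : ∀ {f c} → (∀ x → c ≤ f x) → c ≤ 𝔼 f
  ≤-𝔼 {c = c} p = ℚ.≤-trans (≤-refl′ (sym (𝔼-const c))) (𝔼-mono p)

  -- The variance of `f` is a mean of squares; expanding it gives the difference of the two sides.
  jensen : ∀ f → 𝔼 f * 𝔼 f ≤ 𝔼 (λ x → f x * f x)
  jensen f = ≤-by (≤-𝔼 {c = 𝟎} (λ x → sq-nonneg (f x - 𝔼 f))) (trans (solve 2 (λ a b → a :- b :* b := a :- b :* b :- (lit 0)) refl _ _) (sym (cong (_- 𝟎) expand)))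
    where
    expand : 𝔼 (λ x → (f x - 𝔼 f) * (f x - 𝔼 f)) ≡ 𝔼 (λ x → f x * f x) - 𝔼 f * 𝔼 f
    expand = trans (𝔼-cong {g = λ x → f x * f x + ((- (ι 2 * 𝔼 f)) * f x + 𝔼 f * 𝔼 f)} (λ x → (solve 2 (λ a b → (a :- b) :* (a :- b) := a :* a :+ ((:- ((lit 2) :* b)) :* a :+ b :* b)) refl _ _)))
      (trans (𝔼-+ _ _) (trans (cong (𝔼 (λ x → f x * f x) +_)
        (trans (𝔼-+ _ _) (cong₂ _+_ (𝔼-* _ _) (𝔼-const _)))) (solve 2 (λ a b → a :+ ((:- ((lit 2) :* b)) :* b :+ b :* b) := a :- b :* b) refl _ _)))

open Mean public

_⊗ᴹ_ : ∀ {A B} → Mean A → Mean B → Mean (A × B)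
M ⊗ᴹ N = record
  { 𝔼 = λ f → 𝔼 M λ x → 𝔼 N λ y → f (x , y)
  ; 𝔼-+ = λ f g → trans (𝔼-cong M (λ x → 𝔼-+ N _ _)) (𝔼-+ M _ _)
  ; 𝔼-* = λ c f → trans (𝔼-cong M (λ x → 𝔼-* N _ _)) (𝔼-* M _ _)
  ; 𝔼-mono = λ p → 𝔼-mono M λ x → 𝔼-mono N λ y → p (x , y)
  ; 𝔼-const = λ c → trans (𝔼-cong M (λ x → 𝔼-const N c)) (𝔼-const M c)
  }

Unit : ℚ → Set
Unit x = 𝟎 ≤ x × x ≤ 𝟏

Unit-* : ∀ {x y} → Unit x → Unit y → Unit (x * y)
Unit-* {x} {y} (p , q) (r , s) = *-nonneg p r , ≤-by (*-nonneg p (≤⇒0≤ s) ⊕ q) (solve 2 (λ a b → (lit 1) :- a :* b := a :* ((lit 1) :- b) :+ (lit 1) :- ((lit 0) :+ a)) refl _ _)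

Unit-1- : ∀ {x} → Unit x → Unit (𝟏 - x)
Unit-1- (p , q) = ≤-by q (solve 1 (λ a → (lit 1) :- a :- (lit 0) := (lit 1) :- a) refl _) , ≤-by p (solve 1 (λ a → (lit 1) :- ((lit 1) :- a) := a :- (lit 0)) refl _)

Unit-1 : Unit 𝟏
Unit-1 = 0≤1 , ℚ.≤-refl

Unit-0 : Unit 𝟎
Unit-0 = ℚ.≤-refl , 0≤1

Unit-𝔼 : ∀ {A} (M : Mean A) {f} → (∀ x → Unit (f x)) → Unit (𝔼 M f)
Unit-𝔼 M u = ≤-𝔼 M (proj₁ ∘ u) , 𝔼-≤ M (proj₂ ∘ u)

*-≤ˡ : ∀ {x y} → 𝟎 ≤ x → y ≤ 𝟏 → x * y ≤ x
*-≤ˡ {x} {y} p q = ≤-by (p ⊗ q) (solve 2 (λ a b → a :- a :* b := (a :- (lit 0)) :* ((lit 1) :- b) :- (lit 0)) refl _ _)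

*-≤ʳ : ∀ {x y} → x ≤ 𝟏 → 𝟎 ≤ y → x * y ≤ y
*-≤ʳ {x} {y} p q = ≤-by (p ⊗ q) (solve 2 (λ a b → a :- b :* a := ((lit 1) :- b) :* (a :- (lit 0)) :- (lit 0)) refl _ _)

+-zero : 𝟎 + 𝟎 ≡ 𝟎
+-zero = solve 0 ((lit 0) :+ (lit 0) := (lit 0)) refl

*-zero : ∀ c → c * 𝟎 ≡ 𝟎
*-zero c = solve 1 (λ a → a :* (lit 0) := (lit 0)) refl _

zero-* : ∀ c → 𝟎 * c ≡ 𝟎
zero-* c = solve 1 (λ a → (lit 0) :* a := (lit 0)) refl _

-- Finite sums, the pigeonhole principle for functions, and Bessel's inequality

∑ : ∀ {n} → (Fin n → ℚ) → ℚ
∑ {zero} f = 𝟎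
∑ {suc n} f = f zero + ∑ (f ∘ suc)

∑-cong : ∀ {n} {f g : Fin n → ℚ} → (∀ i → f i ≡ g i) → ∑ f ≡ ∑ g
∑-cong {zero} e = refl
∑-cong {suc n} e = cong₂ _+_ (e zero) (∑-cong (e ∘ suc))

∑-mono : ∀ {n} {f g : Fin n → ℚ} → (∀ i → f i ≤ g i) → ∑ f ≤ ∑ g
∑-mono {zero} p = ℚ.≤-refl
∑-mono {suc n} p = p zero ⊕ ∑-mono (p ∘ suc)

∑-+ : ∀ {n} (f g : Fin n → ℚ) → ∑ (λ i → f i + g i) ≡ ∑ f + ∑ g
∑-+ {zero} f g = sym +-zero
∑-+ {suc n} f g = trans (cong ((f zero + g zero) +_) (∑-+ (f ∘ suc) (g ∘ suc))) (solve 4 (λ a b c d → a :+ b :+ (c :+ d) := a :+ c :+ (b :+ d)) refl _ _ _ _)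

∑-* : ∀ {n} c (f : Fin n → ℚ) → ∑ (λ i → c * f i) ≡ c * ∑ f
∑-* {zero} c f = sym (*-zero c)
∑-* {suc n} c f = trans (cong (c * f zero +_) (∑-* c (f ∘ suc))) (solve 3 (λ a b c → a :* b :+ a :* c := a :* (b :+ c)) refl _ _ _)

∑-*ʳ : ∀ {n} c (f : Fin n → ℚ) → ∑ (λ i → f i * c) ≡ ∑ f * c
∑-*ʳ {zero} c f = sym (zero-* c)
∑-*ʳ {suc n} c f = trans (cong (f zero * c +_) (∑-*ʳ c (f ∘ suc))) (solve 3 (λ a b c → a :* b :+ c :* b := (a :+ c) :* b) refl _ _ _)

∑-const : ∀ n c → ∑ {n} (λ _ → c) ≡ ι n * c
∑-const zero c = sym (zero-* c)
∑-const (suc n) c = trans (cong (c +_) (∑-const n c)) (trans {j = (𝟏 + ι n) * c} (solve 2 (λ a b → a :+ b :* a := ((lit 1) :+ b) :* a) refl _ _) (cong (_* c) (sym (ι-suc n))))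

∑-zero : ∀ n → ∑ {n} (λ _ → 𝟎) ≡ 𝟎
∑-zero n = trans (∑-const n 𝟎) (solve 1 (λ a → a :* (lit 0) := (lit 0)) refl _)

∑-nonneg : ∀ {n} {f : Fin n → ℚ} → (∀ i → 𝟎 ≤ f i) → 𝟎 ≤ ∑ f
∑-nonneg {n} p = ℚ.≤-trans (≤-refl′ (sym (∑-zero n))) (∑-mono p)

∑-swap : ∀ {m n} (f : Fin m → Fin n → ℚ) → ∑ (λ i → ∑ (λ j → f i j)) ≡ ∑ (λ j → ∑ (λ i → f i j))
∑-swap {zero} {n} f = sym (∑-zero n)
∑-swap {suc m} f = trans (cong (∑ (f zero) +_) (∑-swap (f ∘ suc))) (sym (∑-+ (f zero) _))

𝔼-∑ : ∀ {A n} (M : Mean A) (f : Fin n → A → ℚ) → 𝔼 M (λ x → ∑ (λ i → f i x)) ≡ ∑ (λ i → 𝔼 M (f i))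
𝔼-∑ {n = zero} M f = 𝔼-const M 𝟎
𝔼-∑ {n = suc n} M f = trans (𝔼-+ M _ _) (cong (𝔼 M (f zero) +_) (𝔼-∑ M (f ∘ suc)))

∑-≤-term : ∀ {n c} (f : Fin n → ℚ) → ι n * c < ∑ f → ∃ λ i → c < f i
∑-≤-term {n} {c} f p with Fin.any? (λ i → c ℚ.<? f i)
... | yes q = q
... | no q = ⊥-elim (≤⇒≯ (ℚ.≤-trans (∑-mono (λ i → ℚ.≮⇒≥ (λ r → q (i , r)))) (≤-refl′ (∑-const n c))) p)

∑-term-≤ : ∀ {n c} (f : Fin (suc n) → ℚ) → ∑ f ≤ ι (suc n) * c → ∃ λ i → f i ≤ c
∑-term-≤ {n} {c} f p with Fin.any? (λ i → f i ℚ.≤? c)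
... | yes q = q
... | no q = ⊥-elim (≤⇒≯ p (strict f (λ i → ℚ.≰⇒> (λ r → q (i , r)))))
  where
  strict : ∀ {m} (f : Fin (suc m) → ℚ) → (∀ i → c < f i) → ι (suc m) * c < ∑ f
  strict {m} f r = subst (_< ∑ f) (trans (cong (c +_) (∑-const m c))
    (trans {j = (𝟏 + ι m) * c} (solve 2 (λ a b → a :+ b :* a := ((lit 1) :+ b) :* a) refl _ _) (cong (_* c) (sym (ι-suc m)))))
    (+-mono-< (r zero) (∑-mono {g = f ∘ suc} (λ i → ℚ.<⇒≤ (r (suc i)))))

opaque
  δ : ∀ {n} → Fin n → Fin n → ℚ
  δ i j = if ⌊ i Fin.≟ j ⌋ then 𝟏 else 𝟎

  δ-diagonal : ∀ {n} (i : Fin n) → δ i i ≡ 𝟏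
  δ-diagonal i with i Fin.≟ i
  ... | yes _ = refl
  ... | no p = ⊥-elim (p refl)

  δ-off : ∀ {n} {i j : Fin n} → i ≢ j → δ i j ≡ 𝟎
  δ-off {i = i} {j} p with i Fin.≟ j
  ... | yes q = ⊥-elim (p q)
  ... | no _ = refl

  δ-sym : ∀ {n} (i j : Fin n) → δ i j ≡ δ j i
  δ-sym i j with i Fin.≟ j
  ... | yes refl = sym (δ-diagonal i)
  ... | no p = sym (δ-off (≢-sym p))

  Unit-δ : ∀ {n} (i j : Fin n) → Unit (δ i j)
  Unit-δ i j with i Fin.≟ j
  ... | yes _ = Unit-1
  ... | no _ = Unit-0

  δ-suc : ∀ {n} (i j : Fin n) → δ (suc i) (suc j) ≡ δ i j
  δ-suc i j = case i Fin.≟ j of λ where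
    (yes refl) → trans (δ-diagonal (suc i)) (sym (δ-diagonal i))
    (no p) → trans (δ-off (p ∘ Fin.suc-injective)) (sym (δ-off p))

∑-δ : ∀ {n} (i : Fin n) (f : Fin n → ℚ) → ∑ (λ j → δ i j * f j) ≡ f i
∑-δ {suc n} zero f = trans (cong₂ _+_ (cong (_* f zero) (δ-diagonal zero))
    (trans (∑-cong {g = λ j → 𝟎 * f (suc j)} (λ j → cong (_* f (suc j)) (δ-off (λ ())))) (∑-* 𝟎 (f ∘ suc)))) (ones (f zero) _)
  where
  ones : ∀ a b → 𝟏 * a + 𝟎 * b ≡ a
  ones a b = solve 2 (λ a b → (lit 1) :* a :+ (lit 0) :* b := a) refl _ _
∑-δ {suc n} (suc i) f = trans (cong₂ _+_ (cong (_* f zero) (δ-off (λ ())))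
  (trans (∑-cong (λ j → cong (_* f (suc j)) (δ-suc i j))) (∑-δ i (f ∘ suc)))) (zeros (f zero) _)
  where
  zeros : ∀ a b → 𝟎 * a + b ≡ b
  zeros a b = solve 2 (λ a b → (lit 0) :* a :+ b := b) refl _ _

∑-δ′ : ∀ {n} (i : Fin n) → ∑ (δ i) ≡ 𝟏
∑-δ′ i = trans (∑-cong {g = λ j → δ i j * 𝟏} (λ j → (solve 1 (λ a → a := a :* (lit 1)) refl _))) (∑-δ i (λ _ → 𝟏))

module _ {A : Set} (M : Mean A) where

  𝔼-square : ∀ {n} (f : Fin n → A → ℚ) →
    𝔼 M (λ x → ∑ (λ i → f i x) * ∑ (λ i → f i x)) ≡ ∑ (λ i → ∑ (λ j → 𝔼 M (λ x → f i x * f j x)))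
  𝔼-square f = trans (𝔼-cong M (λ x → trans (sym (∑-*ʳ (∑ (λ j → f j x)) (λ i → f i x)))
      (∑-cong (λ i → sym (∑-* (f i x) (λ j → f j x))))))
    (trans (𝔼-∑ M (λ i x → ∑ (λ j → f i x * f j x))) (∑-cong (λ i → 𝔼-∑ M (λ j x → f i x * f j x))))

  -- Second moment of the sum of all `h i`. It is at least `m²θ²` by Jensen; if every product of two
  -- different functions had mean at most `c`, it would be at most `m + m²c`, which is less than
  -- `2m²c` because `mc > 1`.
  pigeonhole : ∀ {m θ c} (h : Fin m → A → ℚ) → (∀ i x → Unit (h i x)) → 𝟎 ≤ θ → (∀ i → θ ≤ 𝔼 M (h i)) →
    𝟎 < c → c + c ≤ θ * θ → 𝟏 < ι m * c →
    ∃ λ i → ∃ λ j → i Fin.< j × c ≤ 𝔼 M (λ x → h i x * h j x)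
  pigeonhole {m} {θ} {c} h u θ≥0 lower c>0 2c≤θ² big
    with Fin.any? (λ i → Fin.any? (λ j → i Fin.<? j ×-dec c ℚ.≤? 𝔼 M (λ x → h i x * h j x)))
  ... | yes (i , j , p , q) = i , j , p , q
  ... | no none = ⊥-elim (≤⇒≯ upper strict)
    where
    C : Fin m → Fin m → ℚ
    C i j = 𝔼 M (λ x → h i x * h j x)

    C-sym : ∀ i j → C i j ≡ C j i
    C-sym i j = 𝔼-cong M (λ x → (solve 2 (λ a b → a :* b := b :* a) refl _ _))

    small : ∀ i j → i Fin.< j → C i j ≤ c
    small i j p = ℚ.<⇒≤ (ℚ.≰⇒> (λ q → none (i , j , p , q)))

    C-bound : ∀ i j → C i j ≤ δ i j + c
    C-bound i j with ℕ.<-cmp (Fin.toℕ i) (Fin.toℕ j)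
    ... | tri< p _ _ = ≤-by (small i j p ⊕ proj₁ (Unit-δ i j)) (solve 3 (λ a b c → a :+ b :- c := b :+ a :- (c :+ (lit 0))) refl _ _ _)
    ... | tri> _ _ p = ≤-by (ℚ.≤-trans (≤-refl′ (C-sym i j)) (small j i p) ⊕ proj₁ (Unit-δ i j)) (solve 3 (λ a b c → a :+ b :- c := b :+ a :- (c :+ (lit 0))) refl _ _ _)
    ... | tri≈ _ p _ with Fin.toℕ-injective p
    ... | refl = ≤-by (𝔼-≤ M (λ x → proj₂ (Unit-* (u i x) (u i x))) ⊕ ℚ.<⇒≤ c>0 ⊕ ≤-refl′ (sym (δ-diagonal i))) (solve 3 (λ a b c → a :+ b :- c := (lit 1) :+ (b :+ a) :- (c :+ ((lit 0) :+ (lit 1)))) refl _ _ _)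

    total : ι m * θ ≤ 𝔼 M (λ x → ∑ (λ i → h i x))
    total = ℚ.≤-trans (≤-refl′ (sym (∑-const m θ))) (ℚ.≤-trans (∑-mono lower) (≤-refl′ (sym (𝔼-∑ M h))))

    upper : (ι m * θ) * (ι m * θ) ≤ ι m * (𝟏 + ι m * c)
    upper = ℚ.≤-trans (sq-mono (*-nonneg (ι-nonneg m) θ≥0) total)
      (ℚ.≤-trans (jensen M _) (ℚ.≤-trans (≤-refl′ (𝔼-square h))
        (ℚ.≤-trans (∑-mono {m} (λ i → ∑-mono {m} (C-bound i)))
          (≤-refl′ (trans (∑-cong {m} (λ i → trans (∑-+ (δ i) (λ _ → c)) (cong₂ _+_ (∑-δ′ i) (∑-const m c)))) (∑-const m _))))))

    m>0 : 𝟎 < ι m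
    m>0 = ℚ.≰⇒> (λ p → ≤⇒≯ (ℚ.≤-trans (*-monoʳ (ℚ.<⇒≤ c>0) p) (≤-by 0≤1 (solve 1 (λ a → (lit 1) :- (lit 0) :* a := (lit 1) :- (lit 0)) refl _))) big)

    strict : ι m * (𝟏 + ι m * c) < (ι m * θ) * (ι m * θ)
    strict = ℚ.<-≤-trans (subst₂ _<_ {y = ι m * (𝟏 + ι m * c)} {v = ι m * (ι m * c + ι m * c)} (solve 2 (λ a b → (lit 0) :+ a :* ((lit 1) :+ a :* b) := a :* ((lit 1) :+ a :* b)) refl _ _) (solve 2 (λ a b → a :* (a :* b :- (lit 1)) :+ a :* ((lit 1) :+ a :* b) := a :* (a :* b :+ a :* b)) refl _ _)
        (+-mono-< (*-pos m>0 (<⇒0< big)) (ℚ.≤-refl {ι m * (𝟏 + ι m * c)})))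
      (≤-by (*-monoˡ (sq-nonneg (ι m)) 2c≤θ²) (solve 3 (λ a b c → a :* b :* (a :* b) :- a :* (a :* c :+ a :* c) := a :* a :* (b :* b) :- a :* a :* (c :+ c)) refl _ _ _))

  -- With `P = ∑ u i * e i`, the mean of `P * F` is the sum `S` on the left, and near-orthogonality
  -- gives `P²` a mean of at most `C * S`, where `C = 1 + ν m`. The mean of `(C * F - P)²` is
  -- nonnegative and at most `C² - C * S`, whence `S ≤ C`.
  bessel : ∀ {m ν} (e : Fin m → A → ℚ) (F : A → ℚ) →
    (∀ i → 𝔼 M (λ x → e i x * e i x) ≤ 𝟏) →
    (∀ i j → i ≢ j → - ν ≤ 𝔼 M (λ x → e i x * e j x) × 𝔼 M (λ x → e i x * e j x) ≤ ν) →
    𝔼 M (λ x → F x * F x) ≤ 𝟏 → 𝟎 ≤ ν →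
    ∑ (λ i → 𝔼 M (λ x → e i x * F x) * 𝔼 M (λ x → e i x * F x)) ≤ 𝟏 + ν * ι m
  bessel {m} {ν} e F norm orth F≤1 ν≥0 = result
    where
    u : Fin m → ℚ
    u i = 𝔼 M (λ x → e i x * F x)

    S C : ℚ
    S = ∑ (λ i → u i * u i)
    C = 𝟏 + ν * ι m

    P : A → ℚ
    P x = ∑ (λ i → u i * e i x)

    C>0 : 𝟎 < C
    C>0 = ℚ.<-≤-trans 0<1 (≤-by (*-nonneg ν≥0 (ι-nonneg m)) (solve 2 (λ a b → (lit 1) :+ a :* b :- (lit 1) := a :* b :- (lit 0)) refl _ _))

    PF : 𝔼 M (λ x → P x * F x) ≡ S
    PF = trans (𝔼-cong M (λ x → sym (∑-*ʳ (F x) (λ i → u i * e i x))))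
      (trans (𝔼-∑ M (λ i x → u i * e i x * F x))
        (∑-cong {m} (λ i → trans (𝔼-cong M {g = λ x → u i * (e i x * F x)} (λ x → (solve 3 (λ a b c → a :* b :* c := a :* (b :* c)) refl _ _ _))) (𝔼-* M (u i) _))))

    expand : 𝔼 M (λ x → (C * F x - P x) * (C * F x - P x)) ≡ C * C * 𝔼 M (λ x → F x * F x) - ι 2 * C * S + 𝔼 M (λ x → P x * P x)
    expand = trans (𝔼-cong M {g = λ x → C * C * (F x * F x) + (- (ι 2 * C) * (P x * F x) + P x * P x)} (λ x → (solve 4 (λ a b c d → (((lit 1) :+ a :* b) :* c :- d) :* (((lit 1) :+ a :* b) :* c :- d) := ((lit 1) :+ a :* b) :* ((lit 1) :+ a :* b) :* (c :* c) :+ ((:- ((lit 2) :* ((lit 1) :+ a :* b))) :* (d :* c) :+ d :* d)) refl _ _ _ _)))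
      (trans (𝔼-+ M _ _) (trans (cong₂ _+_ (𝔼-* M _ _) (trans (𝔼-+ M _ _) (cong (_+ 𝔼 M (λ x → P x * P x)) (trans (𝔼-* M _ _) (cong (- (ι 2 * C) *_) PF))))) (solve 5 (λ a b c d e → ((lit 1) :+ a :* b) :* ((lit 1) :+ a :* b) :* c :+ ((:- ((lit 2) :* ((lit 1) :+ a :* b))) :* d :+ e) := ((lit 1) :+ a :* b) :* ((lit 1) :+ a :* b) :* c :- (lit 2) :* ((lit 1) :+ a :* b) :* d :+ e) refl _ _ _ _ _)))

    G : Fin m → Fin m → ℚ
    G i j = 𝔼 M (λ x → e i x * e j x)

    term : ∀ i j → ι 2 * (u i * u j * G i j) ≤ ν * (u i * u i) + ν * (u j * u j) + ι 2 * (δ i j * (u j * u j))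
    term i j with i Fin.≟ j
    ... | yes refl = subst (λ d → ι 2 * (u i * u i * G i i) ≤ ν * (u i * u i) + ν * (u i * u i) + ι 2 * (d * (u i * u i))) (sym (δ-diagonal i))
      (≤-by (*-monoˡ (*-nonneg (ι-nonneg 2) (sq-nonneg (u i))) (norm i) ⊕ *-nonneg ν≥0 (+-nonneg (sq-nonneg (u i)) (sq-nonneg (u i)))) (solve 3 (λ a b c → a :* (b :* b) :+ a :* (b :* b) :+ (lit 2) :* ((lit 1) :* (b :* b)) :- (lit 2) :* (b :* b :* c) := (lit 2) :* (b :* b) :* (lit 1) :+ a :* (b :* b :+ b :* b) :- ((lit 2) :* (b :* b) :* c :+ (lit 0))) refl _ _ _))
    ... | no p = *-cancel-≤ (ι-pos 1) (≤-by (*-nonneg (≤⇒0≤ (proj₂ (orth i j p))) (sq-nonneg (u i + u j)) ⊕ *-nonneg (≤⇒0≤ (proj₁ (orth i j p))) (sq-nonneg (u i - u j)) ⊕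
        *-nonneg (ι-nonneg 4) (*-nonneg (proj₁ (Unit-δ i j)) (sq-nonneg (u j))))
        (solve 5 (λ a b c d e → (lit 2) :* (a :* (b :* b) :+ a :* (c :* c) :+ (lit 2) :* (d :* (c :* c))) :- (lit 2) :* ((lit 2) :* (b :* c :* e)) := (a :- e) :* ((b :+ c) :* (b :+ c)) :+ ((e :- (:- a)) :* ((b :- c) :* (b :- c)) :+ (lit 4) :* (d :* (c :* c))) :- ((lit 0) :+ ((lit 0) :+ (lit 0)))) refl _ _ _ _ _))

    cross : 𝔼 M (λ x → P x * P x) ≤ C * S
    cross = *-cancel-≤ (ι-pos 1) (ℚ.≤-trans (≤-refl′ lhs) (ℚ.≤-trans (∑-mono {m} (λ i → ∑-mono {m} (term i))) (≤-refl′ rhs)))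
      where
      lhs : ι 2 * 𝔼 M (λ x → P x * P x) ≡ ∑ (λ i → ∑ (λ j → ι 2 * (u i * u j * G i j)))
      lhs = trans (cong (ι 2 *_) (trans (𝔼-square (λ i x → u i * e i x))
          (∑-cong {m} (λ i → ∑-cong {m} (λ j → trans (𝔼-cong M {g = λ x → u i * u j * (e i x * e j x)} (λ x → (solve 4 (λ a b c d → a :* b :* (c :* d) := a :* c :* (b :* d)) refl _ _ _ _))) (𝔼-* M _ _))))))
        (trans (sym (∑-* {m} (ι 2) _)) (∑-cong {m} (λ i → sym (∑-* {m} (ι 2) _))))
      rhs : ∑ (λ i → ∑ (λ j → ν * (u i * u i) + ν * (u j * u j) + ι 2 * (δ i j * (u j * u j)))) ≡ ι 2 * (C * S)
      rhs = trans (∑-cong {m} (λ i → trans (∑-+ {m} _ (λ j → ι 2 * (δ i j * (u j * u j))))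
          (cong₂ _+_ (trans (∑-+ {m} (λ _ → ν * (u i * u i)) _) (cong₂ _+_ (∑-const m _) (∑-* {m} ν (λ j → u j * u j))))
            (trans (∑-* {m} (ι 2) (λ j → δ i j * (u j * u j))) (cong (ι 2 *_) (∑-δ i (λ j → u j * u j)))))))
        (trans (∑-+ (λ i → ι m * (ν * (u i * u i)) + ν * S) _)
          (trans (cong₂ _+_ (trans (∑-+ (λ i → ι m * (ν * (u i * u i))) (λ _ → ν * S)) (cong₂ _+_ (trans (∑-cong {m} {g = λ i → ι m * ν * (u i * u i)} (λ i → (solve 3 (λ a b c → a :* (b :* (c :* c)) := a :* b :* (c :* c)) refl _ _ _))) (∑-* {m} (ι m * ν) (λ i → u i * u i))) (∑-const m _))) (∑-* {m} (ι 2) (λ i → u i * u i)))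
            (collect S)))
        where
        collect : ∀ s → (ι m * ν * s + ι m * (ν * s)) + ι 2 * s ≡ ι 2 * ((𝟏 + ν * ι m) * s)
        collect s = solve 3 (λ a b c → a :* b :* c :+ a :* (b :* c) :+ (lit 2) :* c := (lit 2) :* (((lit 1) :+ b :* a) :* c)) refl _ _ _

    result : S ≤ C
    result = *-cancel-≤ C>0 (≤-by
      (ℚ.≤-trans (≤-𝔼 M (λ x → sq-nonneg (C * F x - P x))) (≤-refl′ expand) ⊕ *-monoˡ (sq-nonneg C) F≤1 ⊕ cross) (solve 5 (λ a b c d e → ((lit 1) :+ a :* b) :* ((lit 1) :+ a :* b) :- ((lit 1) :+ a :* b) :* c := ((lit 1) :+ a :* b) :* ((lit 1) :+ a :* b) :* d :- (lit 2) :* ((lit 1) :+ a :* b) :* c :+ e :+ (((lit 1) :+ a :* b) :* ((lit 1) :+ a :* b) :* (lit 1) :+ ((lit 1) :+ a :* b) :* c) :- ((lit 0) :+ (((lit 1) :+ a :* b) :* ((lit 1) :+ a :* b) :* d :+ e))) refl _ _ _ _ _))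

-- Jensen bounds the square of the correlation by the mean of `h² u²`, and `h² ≤ 1`. This turns
-- every bound in the mean square into an additive error.
square-bound : ∀ {A} (M : Mean A) {ε} (h u : A → ℚ) → (∀ x → Unit (h x)) → 𝟎 ≤ ε → 𝔼 M (λ x → u x * u x) ≤ ε * ε →
  - ε ≤ 𝔼 M (λ x → h x * u x) × 𝔼 M (λ x → h x * u x) ≤ ε
square-bound M {ε} h u hu ε≥0 p =
    ≤-by (sq-cancel-≤ {x = - X} ε≥0 (ℚ.≤-trans (≤-refl′ (solve 1 (λ a → (:- a) :* (:- a) := a :* a) refl _)) X²)) (solve 2 (λ a b → a :- (:- b) := b :- (:- a)) refl _ _) , sq-cancel-≤ ε≥0 X²
  where
  X : ℚ
  X = 𝔼 M (λ x → h x * u x)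
  X² : X * X ≤ ε * ε
  X² = ℚ.≤-trans (jensen M _) (ℚ.≤-trans (𝔼-mono M (λ x → ≤-by (*-nonneg (sq-nonneg (u x)) (≤⇒0≤ (proj₂ (Unit-* (hu x) (hu x))))) (solve 2 (λ a b → a :* a :- b :* a :* (b :* a) := a :* a :* ((lit 1) :- b :* b) :- (lit 0)) refl _ _))) p)

-- Sublists and Ramsey's theorem

data _⊑_ {A : Set} : ∀ {m n} → Vec A m → Vec A n → Set where
  []   : [] ⊑ []
  skip : ∀ {m n y} {xs : Vec A m} {ys : Vec A n} → xs ⊑ ys → xs ⊑ (y ∷ ys)
  keep : ∀ {m n x} {xs : Vec A m} {ys : Vec A n} → xs ⊑ ys → (x ∷ xs) ⊑ (x ∷ ys)

infix 4 _⊑_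

⊑-refl : ∀ {A n} {xs : Vec A n} → xs ⊑ xs
⊑-refl {xs = []} = []
⊑-refl {xs = x ∷ xs} = keep ⊑-refl

⊑-trans : ∀ {A k m n} {xs : Vec A k} {ys : Vec A m} {zs : Vec A n} → xs ⊑ ys → ys ⊑ zs → xs ⊑ zs
⊑-trans p [] = p
⊑-trans p (skip q) = skip (⊑-trans p q)
⊑-trans (skip p) (keep q) = skip (⊑-trans p q)
⊑-trans (keep p) (keep q) = keep (⊑-trans p q)

⊑-min : ∀ {A n} {xs : Vec A n} → [] ⊑ xs
⊑-min {xs = []} = []
⊑-min {xs = x ∷ xs} = skip ⊑-min

⊑-++ : ∀ {A k l m n} {us : Vec A k} {vs : Vec A l} {xs : Vec A m} {ys : Vec A n} →
  us ⊑ xs → vs ⊑ ys → us Vec.++ vs ⊑ xs Vec.++ ys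
⊑-++ [] q = q
⊑-++ (skip p) q = skip (⊑-++ p q)
⊑-++ (keep p) q = keep (⊑-++ p q)

⊑-++ˡ : ∀ {A m n} (xs : Vec A m) {ys : Vec A n} → xs ⊑ xs Vec.++ ys
⊑-++ˡ [] = ⊑-min
⊑-++ˡ (x ∷ xs) = keep (⊑-++ˡ xs)

⊑-++ʳ : ∀ {A m n} (xs : Vec A m) {ys : Vec A n} → ys ⊑ xs Vec.++ ys
⊑-++ʳ [] = ⊑-refl
⊑-++ʳ (x ∷ xs) = skip (⊑-++ʳ xs)

⊑-lookup : ∀ {A n} (xs : Vec A n) i → lookup xs i ∷ [] ⊑ xs
⊑-lookup (x ∷ xs) zero = keep ⊑-min
⊑-lookup (x ∷ xs) (suc i) = skip (⊑-lookup xs i)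

⊑-lookup₂ : ∀ {A n} (xs : Vec A n) {i j} → i Fin.< j → lookup xs i ∷ lookup xs j ∷ [] ⊑ xs
⊑-lookup₂ (x ∷ xs) {zero} {suc j} p = keep (⊑-lookup xs j)
⊑-lookup₂ (x ∷ xs) {suc i} {suc j} (ℕ.s≤s p) = skip (⊑-lookup₂ xs p)

⊑-concat : ∀ {A k m n} {xs : Vec (Vec A k) m} {ys : Vec (Vec A k) n} → xs ⊑ ys → Vec.concat xs ⊑ Vec.concat ys
⊑-concat [] = []
⊑-concat {ys = y ∷ _} (skip p) = ⊑-trans (⊑-concat p) (⊑-++ʳ y)
⊑-concat {ys = y ∷ _} (keep p) = ⊑-++ (⊑-refl {xs = y}) (⊑-concat p)

⊑-∷ʳ : ∀ {A m n x} {xs : Vec A m} {ys : Vec A n} → xs ⊑ ys → xs ⊑ ys Vec.∷ʳ x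
⊑-∷ʳ [] = skip []
⊑-∷ʳ (skip p) = skip (⊑-∷ʳ p)
⊑-∷ʳ (keep p) = keep (⊑-∷ʳ p)

⊑-∷ʳ-keep : ∀ {A m n x} {xs : Vec A m} {ys : Vec A n} → xs ⊑ ys → xs Vec.∷ʳ x ⊑ ys Vec.∷ʳ x
⊑-∷ʳ-keep [] = keep []
⊑-∷ʳ-keep (skip p) = skip (⊑-∷ʳ-keep p)
⊑-∷ʳ-keep (keep p) = keep (⊑-∷ʳ-keep p)

rev : ∀ {A : Set} {n} → Vec A n → Vec A n
rev [] = []
rev (x ∷ xs) = rev xs Vec.∷ʳ x

⊑-rev : ∀ {A m n} {xs : Vec A m} {ys : Vec A n} → xs ⊑ ys → rev xs ⊑ rev ys
⊑-rev [] = []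
⊑-rev (skip p) = ⊑-∷ʳ (⊑-rev p)
⊑-rev (keep p) = ⊑-∷ʳ-keep (⊑-rev p)

rev-∷ʳ : ∀ {A : Set} {n} (xs : Vec A n) x → rev (xs Vec.∷ʳ x) ≡ x ∷ rev xs
rev-∷ʳ [] x = refl
rev-∷ʳ (y ∷ xs) x = cong (Vec._∷ʳ y) (rev-∷ʳ xs x)

rev-involutive : ∀ {A : Set} {n} (xs : Vec A n) → rev (rev xs) ≡ xs
rev-involutive [] = refl
rev-involutive (x ∷ xs) = trans (rev-∷ʳ (rev xs) x) (cong (x ∷_) (rev-involutive xs))

⊑-unrev : ∀ {A m n} {xs : Vec A m} {ys : Vec A n} → xs ⊑ rev ys → rev xs ⊑ ys
⊑-unrev {ys = ys} p = subst (_ ⊑_) (rev-involutive ys) (⊑-rev p)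

Hom : ∀ {A : Set} {r n} → (Vec A r → Set) → Vec A n → Set
Hom {A} {r} T L = ∀ (t : Vec A r) → t ⊑ L → T t

Hom-⊑ : ∀ {A r m n} {T : Vec A r → Set} {K : Vec A m} {L : Vec A n} → K ⊑ L → Hom T L → Hom T K
Hom-⊑ p h t q = h t (⊑-trans q p)

private
  Hom-∷ : ∀ {A r n} {T : Vec A (suc r) → Set} {x} {L : Vec A n} →
    Hom (λ t → T (x ∷ t)) L → Hom T L → Hom T (x ∷ L)
  Hom-∷ h g t (skip p) = g t p
  Hom-∷ h g (_ ∷ t) (keep p) = h t p

  Mono : ∀ {A r n} → (Vec A r → Set) → ℕ → ℕ → Vec A n → Set
  Mono {A} T a b L = (Σ (Vec A a) λ K → K ⊑ L × Hom T K) ⊎ (Σ (Vec A b) λ K → K ⊑ L × Hom (λ t → ¬ T t) K)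

  -- On `K` every tuple headed by `x` satisfies `T`. A homogeneous list found inside `K` can
  -- therefore take `x` in front if it is of the kind `T`; the opposite kind is kept unchanged.
  -- `grow-not` is the mirror image.
  grow : ∀ {A r m n a b x} (T : Vec A (suc r) → Set) {L : Vec A n} → (∀ (K : Vec A m) → Mono T a b K) →
    (Σ (Vec A m) λ K → K ⊑ L × Hom (λ t → T (x ∷ t)) K) → Mono T (suc a) b (x ∷ L)
  grow T rec (K , K⊑L , h) = Data.Sum.map
    (λ (J , J⊑K , g) → _ ∷ J , keep (⊑-trans J⊑K K⊑L) , Hom-∷ (Hom-⊑ J⊑K h) g)
    (λ (J , J⊑K , g) → J , skip (⊑-trans J⊑K K⊑L) , g)
    (rec K)

  grow-not : ∀ {A r m n a b x} (T : Vec A (suc r) → Set) {L : Vec A n} → (∀ (K : Vec A m) → Mono T a b K) →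
    (Σ (Vec A m) λ K → K ⊑ L × Hom (λ t → ¬ T (x ∷ t)) K) → Mono T a (suc b) (x ∷ L)
  grow-not T rec (K , K⊑L , h) = Data.Sum.map
    (λ (J , J⊑K , g) → J , skip (⊑-trans J⊑K K⊑L) , g)
    (λ (J , J⊑K , g) → _ ∷ J , keep (⊑-trans J⊑K K⊑L) , Hom-∷ (Hom-⊑ J⊑K h) g)
    (rec K)

opaque
  -- The recursion of Erdős and Rado: the first element `x` is split off, Ramsey's theorem for one
  -- argument fewer fixes the colour of all tuples headed by `x`, and one of the two targets
  -- decreases.
  ramseyNumber : ℕ → ℕ → ℕ → ℕ
  ramseyNumber zero a b = a ℕ.+ b
  ramseyNumber (suc r) zero b = 0
  ramseyNumber (suc r) (suc a) zero = 0
  ramseyNumber (suc r) (suc a) (suc b) =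
    suc (ramseyNumber r (ramseyNumber (suc r) a (suc b)) (ramseyNumber (suc r) (suc a) b))

  ramsey : ∀ r a b {A} (T : Vec A r → Set) → (∀ t → Dec (T t)) → (L : Vec A (ramseyNumber r a b)) →
    Mono T a b L
  ramsey zero a b T T? L with Vec.splitAt a L | T? []
  ... | xs , ys , refl | yes p = inj₁ (xs , ⊑-++ˡ xs , λ { [] _ → p })
  ... | xs , ys , refl | no p = inj₂ (ys , ⊑-++ʳ xs , λ { [] _ → p })
  ramsey (suc r) zero b T T? L = inj₁ ([] , ⊑-min , λ { (_ ∷ _) () })
  ramsey (suc r) (suc a) zero T T? L = inj₂ ([] , ⊑-min , λ { (_ ∷ _) () })
  ramsey (suc r) (suc a) (suc b) T T? (x ∷ L) =
    [ grow T (ramsey (suc r) a (suc b) T T?) , grow-not T (ramsey (suc r) (suc a) b T T?) ]′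
      (ramsey r (ramseyNumber (suc r) a (suc b)) (ramseyNumber (suc r) (suc a) b) (λ t → T (x ∷ t)) (λ t → T? (x ∷ t)) L)

-- The alternative offered by Ramsey's theorem is a list of length `k` on which `T` fails
-- throughout, and `find` excludes it. A property that occurs once in every long list thus holds
-- everywhere on a sublist.
homogenize : ∀ r k m {A} (T : Vec A r → Set) → (∀ t → Dec (T t)) → (L : Vec A (ramseyNumber r m k)) →
  (∀ (K : Vec A k) → K ⊑ L → Σ (Vec A r) λ t → t ⊑ K × T t) → Σ (Vec A m) λ K → K ⊑ L × Hom T K
homogenize r k m T T? L find with ramsey r m k T T? L
... | inj₁ found = found
... | inj₂ (K , K⊑L , h) with find K K⊑L
...   | t , t⊑K , p = ⊥-elim (h t t⊑K p)

Within : ℚ → ℚ → ℚ → Set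
Within ν ρ x = ρ ≤ x × x ≤ ρ + ν

private
  levelNumber : ℕ → ℕ → ℕ → ℕ
  levelNumber r m zero = m
  levelNumber r m (suc k) = ramseyNumber r m (levelNumber r m k)

  -- The range is cut into steps of length `ν`. Ramsey's theorem either confines `f` to the lowest
  -- step, or yields a list where all values exceed it, and `lo` rises by one step.
  levels : ∀ r m k {A} (f : Vec A r → ℚ) ν lo (L : Vec A (levelNumber r m k)) →
    Hom (λ t → lo ≤ f t × f t ≤ lo + ι (suc k) * ν) L →
    𝟎 ≤ ν → Σ (Vec A m) λ K → K ⊑ L × Σ ℚ λ ρ → lo ≤ ρ × Hom (λ t → Within ν ρ (f t)) K
  levels r m zero f ν lo L h _ = L , ⊑-refl , lo , ℚ.≤-refl , λ t p → proj₁ (h t p) , ≤-by (proj₂ (h t p)) (solve 3 (λ a b c → a :+ b :- c := a :+ (lit 1) :* b :- c) refl _ _ _)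
  levels r m (suc k) f ν lo L h ν≥0 with ramsey r m (levelNumber r m k) (λ t → f t ≤ lo + ν) (λ t → f t ℚ.≤? lo + ν) L
  ... | inj₁ (K , K⊑L , g) = K , K⊑L , lo , ℚ.≤-refl , λ t p → proj₁ (h t (⊑-trans p K⊑L)) , g t p
  ... | inj₂ (K , K⊑L , g) with levels r m k f ν (lo + ν) K
         (λ t p → ℚ.<⇒≤ (ℚ.≰⇒> (g t p)) , ℚ.≤-trans (proj₂ (h t (⊑-trans p K⊑L)))
           (≤-refl′ (trans (cong (λ z → lo + z * ν) (ι-suc (suc k))) (regroup (ι (suc k)))))) ν≥0
    where
    regroup : ∀ x → lo + (𝟏 + x) * ν ≡ (lo + ν) + x * ν
    regroup x = solve 3 (λ a b c → a :+ ((lit 1) :+ b) :* c := a :+ c :+ b :* c) refl _ _ _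
  ...   | J , J⊑K , ρ , lo+ν≤ρ , found = J , ⊑-trans J⊑K K⊑L , ρ , ≤-by (lo+ν≤ρ ⊕ ν≥0) (solve 3 (λ a b c → a :- b := a :+ c :- (b :+ c :+ (lit 0))) refl _ _ _) , found

opaque
  -- The functions are levelled one after the other, each on a sublist of the previous list. The
  -- length `N` precedes the set and the functions in the quantifiers, as the functions of the
  -- application depend on the graph and its weights.
  levelled : ∀ ν → 𝟎 < ν → ∀ k (arity : Fin k → ℕ) m → Σ ℕ λ N → ∀ {A} (f : ∀ i → Vec A (arity i) → ℚ) →
    (∀ i t → Unit (f i t)) → (L : Vec A N) →
    Σ (Vec A m) λ K → K ⊑ L × (∀ i → Σ ℚ λ ρ → 𝟎 ≤ ρ × Hom (λ t → Within ν ρ (f i t)) K)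
  levelled ν ν>0 zero arity m = m , λ f u L → L , ⊑-refl , λ ()
  levelled ν ν>0 (suc k) arity m with archimedean ν ν>0 | levelled ν ν>0 k (arity ∘ suc) m
  ... | s , big | N , next = levelNumber (arity zero) N s , λ f u L →
    case levels (arity zero) N s (f zero) ν 𝟎 L (λ t _ → proj₁ (u zero t) ,
        ℚ.≤-trans (proj₂ (u zero t)) (ℚ.≤-trans {j = 𝟎 + (𝟏 + ι s) * ν} (≤-by (big ⊕ ℚ.<⇒≤ ν>0) (solve 2 (λ a b → (lit 0) :+ ((lit 1) :+ a) :* b :- (lit 1) := a :* b :+ b :- ((lit 1) :+ (lit 0))) refl _ _)) (≤-refl′ (cong (λ z → 𝟎 + z * ν) (sym (ι-suc s)))))) (ℚ.<⇒≤ ν>0) of λ where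
      (K , K⊑L , lv) → case next (f ∘ suc) (u ∘ suc) K of λ where
        (J , J⊑K , lvs) → J , ⊑-trans J⊑K K⊑L , λ where
          zero → proj₁ lv , proj₁ (proj₂ lv) , Hom-⊑ J⊑K (proj₂ (proj₂ lv))
          (suc i) → lvs i

-- Weighted systems of positions

product : ∀ {V P : Set} {n} → (P → Mean V) → Vec P n → Mean (Vec V n)
product μ [] = record
  { 𝔼 = λ f → f [] ; 𝔼-+ = λ f g → refl ; 𝔼-* = λ c f → refl ; 𝔼-mono = λ p → p [] ; 𝔼-const = λ c → refl }
product μ (p ∷ ps) = record
  { 𝔼 = λ f → 𝔼 (μ p) λ x → 𝔼 (product μ ps) λ xs → f (x ∷ xs)
  ; 𝔼-+ = λ f g → trans (𝔼-cong (μ p) (λ x → 𝔼-+ (product μ ps) _ _)) (𝔼-+ (μ p) _ _)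
  ; 𝔼-* = λ c f → trans (𝔼-cong (μ p) (λ x → 𝔼-* (product μ ps) _ _)) (𝔼-* (μ p) _ _)
  ; 𝔼-mono = λ q → 𝔼-mono (μ p) λ x → 𝔼-mono (product μ ps) λ xs → q (x ∷ xs)
  ; 𝔼-const = λ c → trans (𝔼-cong (μ p) (λ x → 𝔼-const (product μ ps) c)) (𝔼-const (μ p) c)
  }

avoid : ∀ {V : Set} {n} → (V → V → V → ℚ) → V → V → Vec V n → ℚ
avoid E x y [] = 𝟏
avoid E x y (z ∷ zs) = (𝟏 - E x y z) * avoid E x y zs

avoiding : ∀ {V : Set} {n} → (V → V → V → ℚ) → Vec V (suc n) → V → ℚ
avoiding E (x ∷ zs) y = avoid E x y zs

hitting : ∀ {V : Set} → (V → V → V → ℚ) → Vec V 3 → V → ℚ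
hitting E (x ∷ z ∷ w ∷ []) y = E x y z * E x y w

Fresh : ∀ {P : Set} {n} → P → Vec P n → Set
Fresh p K = ∀ q → q ∷ [] ⊑ K → p ≢ q

Distinct : ∀ {P : Set} {n} → Vec P n → Set
Distinct L = ∀ p q → p ∷ q ∷ [] ⊑ L → p ≢ q

Distinct-⊑ : ∀ {P : Set} {m n} {K : Vec P m} {L : Vec P n} → K ⊑ L → Distinct L → Distinct K
Distinct-⊑ s h p q t = h p q (⊑-trans t s)

Distinct-∷ : ∀ {P : Set} {n} {p : P} {K : Vec P n} → Fresh p K → Distinct K → Distinct (p ∷ K)
Distinct-∷ f h p q (skip t) = h p q t
Distinct-∷ f h p q (keep t) = f q t

Fresh-∷ : ∀ {P : Set} {n} {p q : P} {K : Vec P n} → p ≢ q → Fresh p K → Fresh p (q ∷ K)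
Fresh-∷ r f q (skip t) = f q t
Fresh-∷ r f q (keep t) = r

record System : Set₁ where
  field
    V P    : Set
    E      : V → V → V → ℚ
    E-unit : ∀ x y z → Unit (E x y z)
    E-sym₁ : ∀ x y z → E x y z ≡ E y x z
    E-sym₂ : ∀ x y z → E x y z ≡ E x z y
    μ      : P → Mean V
    fubini : ∀ p q (f : V → V → ℚ) →
      𝔼 (μ p) (λ x → 𝔼 (μ q) (λ y → f x y)) ≡ 𝔼 (μ q) (λ y → 𝔼 (μ p) (λ x → f x y))

  μ* : ∀ {n} → Vec P n → Mean (Vec V n)
  μ* = product μ

  fubini* : ∀ p {n} (ps : Vec P n) (f : V → Vec V n → ℚ) →
    𝔼 (μ p) (λ x → 𝔼 (μ* ps) (f x)) ≡ 𝔼 (μ* ps) (λ xs → 𝔼 (μ p) (λ x → f x xs))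
  fubini* p [] f = refl
  fubini* p (q ∷ ps) f = trans (fubini p q _) (𝔼-cong (μ q) (λ y → fubini* p ps (λ x xs → f x (y ∷ xs))))

  tower : ∀ {n} (ps : Vec P n) i (f : Vec V n → ℚ) →
    𝔼 (μ* ps) f ≡ 𝔼 (μ* ps) (λ xs → 𝔼 (μ (lookup ps i)) λ v → f (xs [ i ]≔ v))
  tower (p ∷ ps) zero f = trans (fubini* p ps (λ x xs → f (x ∷ xs))) (sym (𝔼-const (μ p) _))
  tower (p ∷ ps) (suc i) f = 𝔼-cong (μ p) (λ x → tower ps i (λ xs → f (x ∷ xs)))

  d : P → V → V → ℚ
  d k x y = 𝔼 (μ k) (λ z → E x y z)

  d-unit : ∀ k x y → Unit (d k x y)
  d-unit k x y = Unit-𝔼 (μ k) (λ z → E-unit x y z)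

  d-sym : ∀ k x y → d k x y ≡ d k y x
  d-sym k x y = 𝔼-cong (μ k) (λ z → E-sym₁ x y z)

  -- The probability that independent vertices, one from each position of `K`, all miss the link of
  -- `xy`; `𝔼-avoid` says so.
  uncovered : ∀ {n} → Vec P n → V → V → ℚ
  uncovered [] x y = 𝟏
  uncovered (k ∷ K) x y = (𝟏 - d k x y) * uncovered K x y

  avoid-unit : ∀ {n} x y (zs : Vec V n) → Unit (avoid E x y zs)
  avoid-unit x y [] = Unit-1
  avoid-unit x y (z ∷ zs) = Unit-* (Unit-1- (E-unit x y z)) (avoid-unit x y zs)

  uncovered-unit : ∀ {n} (K : Vec P n) x y → Unit (uncovered K x y)
  uncovered-unit [] x y = Unit-1
  uncovered-unit (k ∷ K) x y = Unit-* (Unit-1- (d-unit k x y)) (uncovered-unit K x y)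

  uncovered-sym : ∀ {n} (K : Vec P n) x y → uncovered K x y ≡ uncovered K y x
  uncovered-sym [] x y = refl
  uncovered-sym (k ∷ K) x y = cong₂ (λ a b → (𝟏 - a) * b) (d-sym k x y) (uncovered-sym K x y)

  𝔼-avoid : ∀ {n} (K : Vec P n) x y → 𝔼 (μ* K) (avoid E x y) ≡ uncovered K x y
  𝔼-avoid [] x y = refl
  𝔼-avoid (k ∷ K) x y = trans (𝔼-cong (μ k) (λ z → trans (𝔼-* (μ* K) _ _) (cong ((𝟏 - E x y z) *_) (𝔼-avoid K x y))))
    (trans (𝔼-*ʳ (μ k) _ _) (cong (_* uncovered K x y) (trans (𝔼-sub (μ k) _ _) (cong (_- d k x y) (𝔼-const (μ k) 𝟏)))))

  -- The test functions φ against which positions are regular: for a typical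
  -- choice of the outer vertices, every g is uncorrelated with φ.
  Uncorrelated : ∀ {n} → ℚ → (Vec V n → V → ℚ) → Vec P n → P → Set
  Uncorrelated ε φ os j = ∀ g → (∀ y → Unit (g y)) →
    𝔼 (μ* os) (λ xs → let u = 𝔼 (μ j) (λ y → (g y - 𝔼 (μ j) g) * φ xs y) in u * u) ≤ ε * ε

  -- Regularity against `avoiding` functions makes the covering of a pair independent of other
  -- conditions on its vertices. `hitting` functions are products of two edges at the tested vertex;
  -- they later allow the density of an edge to be exchanged for the edge itself. The position `j`
  -- differs from the outer ones because regularity is reached by tilting the weights at `j` alone.
  record Regular (r : ℕ) (ε : ℚ) : Set where
    field
      regular-avoiding : ∀ {n} → n ℕ.≤ r → (os : Vec P (suc n)) → ∀ j → Distinct (j ∷ os) → Uncorrelated ε (avoiding E) os j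
      regular-hitting  : (os : Vec P 3) → ∀ j → Distinct (j ∷ os) → Uncorrelated ε (hitting E) os j

  module _ {r ε} (reg : Regular r ε) (ε≥0 : 𝟎 ≤ ε) where
    open Regular reg

    -- The error is the correlation of `h` with `u`, the deviation of `g` tested against
    -- `uncovered K x`. Sampling one vertex from each position of `K` writes `u` as a mean of
    -- deviations tested against `avoiding` functions, so Jensen and regularity bound its mean
    -- square.
    decouple : ∀ {n} → n ℕ.≤ r → (x₀ j : P) (K : Vec P n) → Distinct (j ∷ x₀ ∷ K) →
      (h g : V → ℚ) → (∀ x → Unit (h x)) → (∀ y → Unit (g y)) →
      𝔼 (μ x₀) (λ x → h x * 𝔼 (μ j) (λ y → g y * (𝟏 - uncovered K x y))) ≤
      ε + 𝔼 (μ x₀) (λ x → h x * (𝔼 (μ j) g * 𝔼 (μ j) (λ y → 𝟏 - uncovered K x y)))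
    decouple n≤r x₀ j K dist h g hu gu =
      ≤-by (proj₁ (square-bound (μ x₀) h u hu ε≥0 u-small))
        (trans (cong (λ z → ε + B - z) A≡) (regroup B (𝔼 (μ x₀) (λ x → h x * u x))))
      where
      ḡ A B : ℚ
      ḡ = 𝔼 (μ j) g
      A = 𝔼 (μ x₀) (λ x → h x * 𝔼 (μ j) (λ y → g y * (𝟏 - uncovered K x y)))
      B = 𝔼 (μ x₀) (λ x → h x * (ḡ * 𝔼 (μ j) (λ y → 𝟏 - uncovered K x y)))
      u : V → ℚ
      u x = 𝔼 (μ j) (λ y → (g y - ḡ) * uncovered K x y)

      regroup : ∀ b c → ε + b - (b - c) ≡ c - - ε
      regroup b c = solve 3 (λ a b c → a :+ b :- (b :- c) := c :- (:- a)) refl _ _ _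

      sampled : ∀ x → u x ≡ 𝔼 (μ* K) (λ zs → 𝔼 (μ j) (λ y → (g y - ḡ) * avoid E x y zs))
      sampled x = trans (𝔼-cong (μ j) (λ y → trans (cong ((g y - ḡ) *_) (sym (𝔼-avoid K x y))) (sym (𝔼-* (μ* K) _ _)))) (fubini* j K _)

      u-small : 𝔼 (μ x₀) (λ x → u x * u x) ≤ ε * ε
      u-small = ℚ.≤-trans (𝔼-mono (μ x₀) (λ x → ℚ.≤-trans (≤-refl′ (cong₂ _*_ (sampled x) (sampled x))) (jensen (μ* K) _)))
        (regular-avoiding n≤r (x₀ ∷ K) j dist g gu)

      pointwise : ∀ x → 𝔼 (μ j) (λ y → g y * (𝟏 - uncovered K x y)) ≡ ḡ * 𝔼 (μ j) (λ y → 𝟏 - uncovered K x y) - u x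
      pointwise x = trans (𝔼-cong (μ j) {g = λ y → ḡ * (𝟏 - uncovered K x y) + ((g y - ḡ) - (g y - ḡ) * uncovered K x y)} (λ y → (solve 3 (λ a b c → a :* ((lit 1) :- b) := c :* ((lit 1) :- b) :+ (a :- c :- (a :- c) :* b)) refl _ _ _)))
        (trans (𝔼-+ (μ j) _ _) (trans (cong₂ _+_ (𝔼-* (μ j) _ _) (trans (𝔼-sub (μ j) _ _)
          (cong (_- u x) (trans (𝔼-sub (μ j) _ _) (cong (λ z → ḡ - z) (𝔼-const (μ j) ḡ)))))) (collapse _ ḡ (u x))))
        where
        collapse : ∀ a b c → a + ((b - b) - c) ≡ a - c
        collapse a b c = solve 3 (λ a b c → a :+ (b :- b :- c) := a :- c) refl _ _ _

      A≡ : A ≡ B - 𝔼 (μ x₀) (λ x → h x * u x)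
      A≡ = trans (𝔼-cong (μ x₀) {g = λ x → h x * (ḡ * 𝔼 (μ j) (λ y → 𝟏 - uncovered K x y)) - h x * u x}
        (λ x → trans (cong (h x *_) (pointwise x)) (solve 4 (λ a b c d → a :* (b :* c :- d) := a :* (b :* c) :- a :* d) refl _ _ _ _))) (𝔼-sub (μ x₀) _ _)

-- Density above 1/27 makes links overlap

opaque
  exceed : ∀ k {c} → 𝟎 < c → Σ ℕ λ r → ι k < ι r * c
  exceed k {c} c>0 with archimedean c c>0
  ... | m , big = suc (k ℕ.* m) , subst (λ z → ι k < z * c) (trans (cong (𝟏 +_) (sym (ι-* k m))) (sym (ι-suc (k ℕ.* m))))
    (subst₂ _<_ {x = 𝟎 + ι k} {u = c + ι k * (ι m * c)} (solve 1 (λ a → (lit 0) :+ a := a) refl _) (solve 3 (λ a b c → a :+ b :* (c :* a) := ((lit 1) :+ b :* c) :* a) refl _ _ _)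
      (+-mono-< c>0 (≤-by (*-monoˡ (ι-nonneg k) big) (solve 3 (λ a b c → a :* (b :* c) :- a := a :* (b :* c) :- a :* (lit 1)) refl _ _ _))))

  -- The price of one use of `pigeonhole`: from means `θ` to a mean `c` about half of `θ²`, with `n`
  -- functions sufficient.
  halve : ∀ {θ} → 𝟎 < θ → Σ ℚ λ c → 𝟎 < c × c + c ≤ θ * θ × Σ ℕ λ n → 𝟏 < ι n * c
  halve {θ} θ>0 with fraction 1 (*-pos θ>0 θ>0)
  ... | c , c>0 , e = c , c>0 , ≤-by (≤-refl′ e) (solve 2 (λ a b → a :* a :- (b :+ b) := a :* a :- (lit 2) :* b) refl _ _) , exceed 1 c>0

lookup-ℕ : ∀ {r} (Q : ℕ → Set) → (∀ (i : Fin (suc r)) → Q (Fin.toℕ i)) → ∀ s → s ℕ.≤ r → Q s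
lookup-ℕ Q q s s≤r = subst Q (Fin.toℕ-fromℕ< (ℕ.s≤s s≤r)) (q (Fin.fromℕ< (ℕ.s≤s s≤r)))

tuple : ∀ {A : Set} {r n} → r ℕ.≤ n → (L : Vec A n) → Σ (Vec A r) λ t → t ⊑ L
tuple ℕ.z≤n L = [] , ⊑-min
tuple (ℕ.s≤s p) (x ∷ L) with tuple p L
... | t , t⊑L = x ∷ t , keep t⊑L

over : ∀ {A k m n} (xs : Vec A m) {ys : Vec A k} {zs : Vec A n} → ys ⊑ zs → ys ⊑ xs Vec.++ zs
over xs p = ⊑-trans p (⊑-++ʳ xs)

split : ∀ {A : Set} s {n} → Vec A (s ℕ.+ n) → Vec A s × Vec A n
split zero xs = [] , xs
split (suc s) (x ∷ xs) = x ∷ proj₁ (split s xs) , proj₂ (split s xs)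

split-++ : ∀ {A : Set} {s n} (K : Vec A s) (J : Vec A n) → split s (K Vec.++ J) ≡ (K , J)
split-++ [] J = refl
split-++ (x ∷ K) J = cong (λ z → x ∷ proj₁ z , proj₂ z) (split-++ K J)

-- A nonnegative sequence starting below k κ cannot drop by more than κ each time.
small-drop : ∀ {Lev : ℕ → Set} (val : ∀ {s} → Lev s → ℚ) → (∀ {s} (x : Lev s) → 𝟎 ≤ val x) → ∀ κ k s →
  (∀ t → t ℕ.≤ s ℕ.+ k → Lev t) → (x : Lev s) → val x < ι k * κ →
  Σ ℕ λ t → t ℕ.< s ℕ.+ k × Σ (Lev t) λ x → Σ (Lev (suc t)) λ y → val x ≤ κ + val y
small-drop val pos κ zero s lev x p = ⊥-elim (≤⇒≯ (pos x) (ℚ.<-≤-trans p (≤-refl′ (zero-* κ))))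
small-drop {Lev} val pos κ (suc k) s lev x p with lev (suc s) (ℕ.≤-trans (ℕ.s≤s (ℕ.m≤m+n s k)) (ℕ.≤-reflexive (sym (ℕ.+-suc s k))))
... | y with val x ℚ.≤? κ + val y
...   | yes q = s , ℕ.≤-trans (ℕ.s≤s (ℕ.m≤m+n s k)) (ℕ.≤-reflexive (sym (ℕ.+-suc s k))) , x , y , q
...   | no q with small-drop val pos κ k (suc s) (λ t t≤ → lev t (ℕ.≤-trans t≤ (ℕ.≤-reflexive (sym (ℕ.+-suc s k))))) y
               (ℚ.≰⇒> (λ r → ≤⇒≯ (≤-refl′ (trans (cong (_* κ) (ι-suc k)) (distrib (ι k)))) (ℚ.<-trans (ℚ.≤-<-trans (+-mono (ℚ.≤-refl {κ}) r) (ℚ.≰⇒> q)) p)))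
    where
    distrib : ∀ z → (𝟏 + z) * κ ≡ κ + z * κ
    distrib z = solve 2 (λ a b → ((lit 1) :+ a) :* b := b :+ a :* b) refl _ _
...     | t , t< , found = t , ℕ.≤-trans t< (ℕ.≤-reflexive (sym (ℕ.+-suc s k))) , found

-- Read `a`, `b`, `c` as probabilities that the three pairs of a triple are uncovered: an edge has
-- an uncovered pair, or all its pairs are covered.
cover : ∀ {e a b c} → Unit e → Unit a → Unit b → Unit c →
  e ≤ e * a + e * b + e * c + (𝟏 - a) * (𝟏 - b) * (𝟏 - c)
cover {e} {a} {b} {c} ue ua ub uc = ≤-by
  (*-nonneg (proj₁ ue) (+-nonneg (*-nonneg (*-nonneg (proj₁ ua) (proj₁ ub)) (≤⇒0≤ (proj₂ uc)))
      (+-nonneg (*-nonneg (proj₁ ua) (proj₁ uc)) (*-nonneg (proj₁ ub) (proj₁ uc))))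
    ⊕ *-nonneg (≤⇒0≤ (proj₂ ue)) (*-nonneg (*-nonneg (≤⇒0≤ (proj₂ ua)) (≤⇒0≤ (proj₂ ub))) (≤⇒0≤ (proj₂ uc)))) (solve 4 (λ a b c d → a :* b :+ a :* c :+ a :* d :+ ((lit 1) :- b) :* ((lit 1) :- c) :* ((lit 1) :- d) :- a := a :* (b :* c :* ((lit 1) :- d) :+ (b :* d :+ c :* d)) :+ ((lit 1) :- a) :* (((lit 1) :- b) :* ((lit 1) :- c) :* ((lit 1) :- d)) :- ((lit 0) :+ (lit 0))) refl _ _ _ _)

am-gm : ∀ {a b c} → 𝟎 ≤ a → 𝟎 ≤ b → 𝟎 ≤ c → ι 27 * (a * b * c) ≤ (a + b + c) * (a + b + c) * (a + b + c)
am-gm {a} {b} {c} p q r = *-cancel-≤ (ι-pos 1) (≤-by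
  (*-nonneg (+-nonneg p (+-nonneg q r)) (+-nonneg (sq-nonneg (a - b)) (+-nonneg (sq-nonneg (b - c)) (sq-nonneg (a - c))))
    ⊕ *-nonneg (ι-nonneg 6) (+-nonneg (*-nonneg p (sq-nonneg (b - c))) (+-nonneg (*-nonneg q (sq-nonneg (a - c))) (*-nonneg r (sq-nonneg (a - b)))))) (solve 3 (λ a b c → (lit 2) :* ((a :+ b :+ c) :* (a :+ b :+ c) :* (a :+ b :+ c)) :- (lit 2) :* ((lit 27) :* (a :* b :* c)) := (a :+ (b :+ c)) :* ((a :- b) :* (a :- b) :+ ((b :- c) :* (b :- c) :+ (a :- c) :* (a :- c))) :+ (lit 6) :* (a :* ((b :- c) :* (b :- c)) :+ (b :* ((a :- c) :* (a :- c)) :+ c :* ((a :- b) :* (a :- b)))) :- ((lit 0) :+ (lit 0))) refl _ _ _))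

-- `s³ - 1 = (s - 1)(s² + s + 1)`, and the second factor is at most 13 for `s ≤ 3`.
cube-excess : ∀ {s η} → 𝟎 ≤ s → s ≤ ι 3 → 𝟎 < η → 𝟏 + η ≤ s * s * s → 𝟏 + η ≤ 𝟏 + ι 13 * (s - 𝟏)
cube-excess {s} {η} s≥0 s≤3 η>0 p with s ℚ.≤? 𝟏
... | yes q = ⊥-elim (≤⇒≯ {η} {𝟎} (≤-by (p ⊕ *-nonneg (≤⇒0≤ q) (+-nonneg 0≤1 (+-nonneg s≥0 (sq-nonneg s)))) (solve 2 (λ a b → (lit 0) :- a := b :* b :* b :+ ((lit 1) :- b) :* ((lit 1) :+ (b :+ b :* b)) :- ((lit 1) :+ a :+ (lit 0))) refl _ _)) η>0)
... | no q = ≤-by (p ⊕ *-nonneg (≤⇒0≤ (ℚ.<⇒≤ (ℚ.≰⇒> q))) (+-nonneg (*-nonneg s≥0 (≤⇒0≤ s≤3)) (*-nonneg (ι-nonneg 4) (≤⇒0≤ s≤3)))) (solve 2 (λ a b → (lit 1) :+ (lit 13) :* (a :- (lit 1)) :- ((lit 1) :+ b) := a :* a :* a :+ (a :- (lit 1)) :* (a :* ((lit 3) :- a) :+ (lit 4) :* ((lit 3) :- a)) :- ((lit 1) :+ b :+ (lit 0))) refl _ _)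

module Overlap (S : System) where
  open System S

  density : P → P → P → ℚ
  density i j k = 𝔼 (μ i) λ x → 𝔼 (μ j) λ y → 𝔼 (μ k) λ z → E x y z

  free : ∀ {n} → P → P → Vec P n → ℚ
  free p q K = 𝔼 (μ p) λ x → 𝔼 (μ q) λ y → uncovered K x y

  free-unit : ∀ {n} p q (K : Vec P n) → Unit (free p q K)
  free-unit p q K = Unit-𝔼 (μ p) λ x → Unit-𝔼 (μ q) λ y → uncovered-unit K x y

  -- Homogeneity concerns increasing tuples of positions only, so the probability that `K` misses
  -- the pair `pq` has a separate value for each order type: `K` to the right of the pair, to its
  -- left, or between its members.
  freeʳ : ∀ s → Vec P (2 ℕ.+ s) → ℚ
  freeʳ s (p ∷ q ∷ K) = free p q K

  freeˡ : ∀ s → Vec P (s ℕ.+ 2) → ℚ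
  freeˡ s t with split s t
  ... | K , p ∷ q ∷ [] = free p q K

  freeᵐ : ∀ s → Vec P (suc (s ℕ.+ 1)) → ℚ
  freeᵐ s (p ∷ t) with split s t
  ... | K , q ∷ [] = free p q K

  freeˡ-++ : ∀ {s} (K : Vec P s) p q → freeˡ s (K Vec.++ p ∷ q ∷ []) ≡ free p q K
  freeˡ-++ {s} K p q rewrite split-++ K (p ∷ q ∷ []) = refl

  freeᵐ-++ : ∀ {s} (K : Vec P s) p q → freeᵐ s (p ∷ (K Vec.++ q ∷ [])) ≡ free p q K
  freeᵐ-++ {s} K p q rewrite split-++ K (q ∷ []) = refl

  -- Being covered by `k` but not by `K` is exactly what `free` loses when `k` joins `K`. Where
  -- `free` has almost stopped dropping, an edge through a further position hardly ever meets an
  -- uncovered pair.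
  meet : ∀ {n} p q k (K : Vec P n) →
    𝔼 (μ p) (λ x → 𝔼 (μ q) λ y → d k x y * uncovered K x y) ≡ free p q K - free p q (k ∷ K)
  meet p q k K = trans (𝔼-cong (μ p) (λ x → trans
      (𝔼-cong (μ q) {g = λ y → uncovered K x y - uncovered (k ∷ K) x y} (λ y → (solve 2 (λ a b → a :* b := b :- ((lit 1) :- a) :* b) refl _ _))) (𝔼-sub (μ q) _ _)))
    (𝔼-sub (μ p) _ _)

  𝔼-1- : ∀ p q {n} (K : Vec P n) → 𝔼 (μ p) (λ x → 𝔼 (μ q) λ y → 𝟏 - uncovered K x y) ≡ 𝟏 - free p q K
  𝔼-1- p q K = trans (𝔼-cong (μ p) (λ x → trans (𝔼-sub (μ q) _ _) (cong (_- 𝔼 (μ q) (uncovered K x)) (𝔼-const (μ q) 𝟏))))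
    (trans (𝔼-sub (μ p) _ _) (cong (_- free p q K) (𝔼-const (μ p) 𝟏)))

  module _ {r ε} (reg : Regular r ε) (ε≥0 : 𝟎 ≤ ε) {s} (s≤r : s ℕ.≤ r) (i j k : P) (A B C : Vec P s)
    (dist₁ : Distinct (j ∷ k ∷ A)) (dist₂ : Distinct (k ∷ i ∷ B)) (dist₃ : Distinct (i ∷ k ∷ B)) where

    private
      a b c : V → V → ℚ
      a x y = 𝟏 - uncovered C x y
      b x z = 𝟏 - uncovered B x z
      c z y = 𝟏 - uncovered A z y

      a-unit : ∀ x y → Unit (a x y)
      a-unit x y = Unit-1- (uncovered-unit C x y)
      b-unit : ∀ x y → Unit (b x y)
      b-unit x y = Unit-1- (uncovered-unit B x y)
      c-unit : ∀ x y → Unit (c x y)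
      c-unit x y = Unit-1- (uncovered-unit A x y)

      ā c̄ : V → ℚ
      ā x = 𝔼 (μ j) (a x)
      c̄ z = 𝔼 (μ j) (c z)

      ā-unit : ∀ x → Unit (ā x)
      ā-unit x = Unit-𝔼 (μ j) (a-unit x)
      c̄-unit : ∀ x → Unit (c̄ x)
      c̄-unit x = Unit-𝔼 (μ j) (c-unit x)

      Ā C̄ B̄ : ℚ
      Ā = 𝔼 (μ i) ā
      C̄ = 𝔼 (μ k) c̄
      B̄ = 𝔼 (μ i) (λ x → 𝔼 (μ k) (b x))

    -- Three decouplings: of `y` between `a` and `c` for fixed `x`, then of `c̄ z` from `b x z`,
    -- then of `ā x` from `b x z`. Each costs `ε`.
    triangle-bound : 𝔼 (μ i) (λ x → 𝔼 (μ j) λ y → 𝔼 (μ k) λ z → a x y * c z y * b x z) ≤ ι 3 * ε + Ā * B̄ * C̄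
    triangle-bound = ℚ.≤-trans (𝔼-mono (μ i) step₁) (ℚ.≤-trans (≤-refl′ (trans (𝔼-+ (μ i) _ _) (cong (_+ Y) (𝔼-const (μ i) ε))))
        (≤-by (step₂ ⊕ *-monoˡ (proj₁ (Unit-𝔼 (μ k) c̄-unit)) step₃ ⊕ *-monoʳ ε≥0 (proj₂ (Unit-𝔼 (μ k) c̄-unit)))
          (solve 6 (λ a b c d e f → (lit 3) :* a :+ b :* c :* d :- (a :+ e) := a :+ d :* f :+ (d :* (a :+ b :* c) :+ (lit 1) :* a) :- (e :+ (d :* f :+ d :* a))) refl _ _ _ _ _ _)))
      where
      Y Z : ℚ
      Y = 𝔼 (μ i) λ x → ā x * 𝔼 (μ k) λ z → c̄ z * b x z
      Z = 𝔼 (μ i) λ x → ā x * 𝔼 (μ k) λ z → b x z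

      step₁ : ∀ x → 𝔼 (μ j) (λ y → 𝔼 (μ k) λ z → a x y * c z y * b x z) ≤ ε + ā x * 𝔼 (μ k) (λ z → c̄ z * b x z)
      step₁ x = ℚ.≤-trans (≤-refl′ (trans (fubini j k _) (𝔼-cong (μ k) (λ z → 𝔼-*ʳ (μ j) (b x z) (λ y → a x y * c z y)))))
        (ℚ.≤-trans (≤-refl′ (𝔼-cong (μ k) {g = λ z → b x z * 𝔼 (μ j) (λ y → a x y * c z y)} (λ z → swap _ (b x z))))
        (ℚ.≤-trans (decouple reg ε≥0 s≤r k j A dist₁ (b x) (a x) (b-unit x) (a-unit x))
          (≤-refl′ (cong (ε +_) (trans (𝔼-cong (μ k) {g = λ z → ā x * (c̄ z * b x z)} (λ z → rotate (b x z) (ā x) (c̄ z))) (𝔼-* (μ k) _ _))))))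
        where
        swap : ∀ u v → u * v ≡ v * u
        swap u v = solve 2 (λ a b → a :* b := b :* a) refl _ _
        rotate : ∀ u v w → u * (v * w) ≡ v * (w * u)
        rotate u v w = solve 3 (λ a b c → a :* (b :* c) := b :* (c :* a)) refl _ _ _

      step₂ : Y ≤ ε + C̄ * Z
      step₂ = ℚ.≤-trans (decouple reg ε≥0 s≤r i k B dist₂ ā c̄ ā-unit c̄-unit)
        (≤-refl′ (cong (ε +_) (trans (𝔼-cong (μ i) {g = λ x → C̄ * (ā x * 𝔼 (μ k) (b x))} (λ x → rotate (ā x) C̄ _)) (𝔼-* (μ i) _ _))))
        where
        rotate : ∀ u v w → u * (v * w) ≡ v * (u * w)
        rotate u v w = solve 3 (λ a b c → a :* (b :* c) := b :* (a :* c)) refl _ _ _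

      step₃ : Z ≤ ε + Ā * B̄
      step₃ = ℚ.≤-trans (≤-refl′ (trans (𝔼-cong (μ i) (λ x → sym (𝔼-* (μ k) (ā x) (b x)))) (trans (fubini i k _)
            (𝔼-cong (μ k) (λ z → trans (𝔼-cong (μ i) (λ x → cong (λ w → ā x * (𝟏 - w)) (uncovered-sym B x z))) (sym (one (𝔼 (μ i) (λ x → ā x * b z x)))))))))
        (ℚ.≤-trans (decouple reg ε≥0 s≤r k i B dist₃ (λ _ → 𝟏) ā (λ _ → Unit-1) ā-unit)
          (≤-refl′ (cong (ε +_) (trans (𝔼-cong (μ k) (λ z → one _)) (trans (𝔼-* (μ k) Ā _)
            (cong (Ā *_) (trans (fubini k i _) (𝔼-cong (μ i) (λ x → 𝔼-cong (μ k) (λ z → cong (λ w → 𝟏 - w) (uncovered-sym B z x)))))))))))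
        where
        one : ∀ u → 𝟏 * u ≡ u
        one u = solve 1 (λ a → (lit 1) :* a := a) refl _

    -- Average `cover` over a triple. The three terms with an uncovered pair are drops of `free` by
    -- `meet`, and the term with all pairs covered factorises by `triangle-bound`.
    density-bound : density i j k ≤
      (free i j C - free i j (k ∷ C)) + (free j k A - free j k (i ∷ A)) + (free i k B - free i k (j ∷ B))
        + (ι 3 * ε + (𝟏 - free i j C) * (𝟏 - free i k B) * (𝟏 - free j k A))
    density-bound = ℚ.≤-trans (𝔼-mono (μ i) λ x → 𝔼-mono (μ j) λ y → 𝔼-mono (μ k) λ z →
        cover (E-unit x y z) (uncovered-unit C x y) (uncovered-unit A z y) (uncovered-unit B x z))
      (ℚ.≤-trans (≤-refl′ split₄) (+-mono (≤-refl′ (cong₂ _+_ (cong₂ _+_ termC termA) termB)) last))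
      where
      Sum : (V → V → V → ℚ) → ℚ
      Sum f = 𝔼 (μ i) λ x → 𝔼 (μ j) λ y → 𝔼 (μ k) λ z → f x y z

      Sum-+ : ∀ f g → Sum (λ x y z → f x y z + g x y z) ≡ Sum f + Sum g
      Sum-+ f g = trans (𝔼-cong (μ i) (λ x → trans (𝔼-cong (μ j) (λ y → 𝔼-+ (μ k) _ _)) (𝔼-+ (μ j) _ _))) (𝔼-+ (μ i) _ _)

      fC fA fB fD : V → V → V → ℚ
      fC x y z = E x y z * uncovered C x y
      fA x y z = E x y z * uncovered A z y
      fB x y z = E x y z * uncovered B x z
      fD x y z = a x y * c z y * b x z

      split₄ : Sum (λ x y z → fC x y z + fA x y z + fB x y z + fD x y z) ≡ Sum fC + Sum fA + Sum fB + Sum fD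
      split₄ = trans (Sum-+ _ fD) (cong (_+ Sum fD) (trans (Sum-+ _ fB) (cong (_+ Sum fB) (Sum-+ fC fA))))

      termC : Sum fC ≡ free i j C - free i j (k ∷ C)
      termC = trans (𝔼-cong (μ i) (λ x → 𝔼-cong (μ j) (λ y → 𝔼-*ʳ (μ k) _ _))) (meet i j k C)

      termA : Sum fA ≡ free j k A - free j k (i ∷ A)
      termA = trans (fubini i j _) (trans (𝔼-cong (μ j) (λ y → trans (fubini i k _) (𝔼-cong (μ k) (λ z →
        trans (𝔼-cong (μ i) (λ x → cong₂ _*_ (trans (E-sym₁ x y z) (E-sym₂ y x z)) (uncovered-sym A z y))) (𝔼-*ʳ (μ i) _ _))))) (meet j k i A))

      termB : Sum fB ≡ free i k B - free i k (j ∷ B)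
      termB = trans (𝔼-cong (μ i) (λ x → trans (fubini j k _) (𝔼-cong (μ k) (λ z →
        trans (𝔼-cong (μ j) (λ y → cong (_* uncovered B x z) (E-sym₂ x y z))) (𝔼-*ʳ (μ j) _ _))))) (meet i k j B)

      C̄≡ : C̄ ≡ 𝟏 - free j k A
      C̄≡ = trans (fubini k j _) (trans (𝔼-cong (μ j) (λ y → 𝔼-cong (μ k) (λ z → cong (λ w → 𝟏 - w) (uncovered-sym A z y)))) (𝔼-1- j k A))

      last : Sum fD ≤ ι 3 * ε + (𝟏 - free i j C) * (𝟏 - free i k B) * (𝟏 - free j k A)
      last = ℚ.≤-trans (≤-refl′ (𝔼-cong (μ i) (λ x → 𝔼-cong (μ j) (λ y → 𝔼-cong (μ k) (λ z → refl)))))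
        (ℚ.≤-trans triangle-bound (≤-refl′ (cong (ι 3 * ε +_) (cong₂ _*_ (cong₂ _*_ (𝔼-1- i j C) (𝔼-1- i k B)) C̄≡))))

module Overlapping (S : System) where
  open System S
  open Overlap S

  codegree : P → P → P → P → ℚ
  codegree x y l k = 𝔼 (μ x) λ u → 𝔼 (μ y) λ v → d l u v * d k u v

  -- The common neighbours l and k of the pair xy, listed in the order of the positions.
  T₁₂ T₁₃ T₂₃ : ℚ → Vec P 4 → Set
  T₁₂ θ (l ∷ x ∷ y ∷ k ∷ []) = θ ≤ codegree x y l k
  T₁₃ θ (x ∷ l ∷ y ∷ k ∷ []) = θ ≤ codegree x y l k
  T₂₃ θ (l ∷ x ∷ k ∷ y ∷ []) = θ ≤ codegree x y l k

  T₁₂? : ∀ θ t → Dec (T₁₂ θ t)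
  T₁₂? θ (l ∷ x ∷ y ∷ k ∷ []) = θ ℚ.≤? codegree x y l k

  T₁₃? : ∀ θ t → Dec (T₁₃ θ t)
  T₁₃? θ (x ∷ l ∷ y ∷ k ∷ []) = θ ℚ.≤? codegree x y l k

  T₂₃? : ∀ θ t → Dec (T₂₃ θ t)
  T₂₃? θ (l ∷ x ∷ k ∷ y ∷ []) = θ ℚ.≤? codegree x y l k

  covered-≤ : ∀ {n} (K : Vec P n) x y → 𝟏 - uncovered K x y ≤ ∑ (λ i → d (lookup K i) x y)
  covered-≤ [] x y = ≤-by (ℚ.≤-refl {𝟎}) (solve 0 ((lit 0) :- ((lit 1) :- (lit 1)) := (lit 0) :- (lit 0)) refl)
  covered-≤ (k ∷ K) x y = ≤-by (covered-≤ K x y ⊕ *-≤ˡ (proj₁ (d-unit k x y)) (proj₂ (uncovered-unit K x y))) (solve 3 (λ a b c → a :+ b :- ((lit 1) :- ((lit 1) :- a) :* c) := b :+ a :- ((lit 1) :- c :+ a :* c)) refl _ _ _)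

  -- A pair covered by `A` and by `C` is covered by one position of each; the union bound leaves
  -- `n²` codegrees, one of which is large.
  common : ∀ {n} p q (A C : Vec P n) θ →
    ι n * (ι n * θ) < 𝔼 (μ p) (λ x → 𝔼 (μ q) λ y → (𝟏 - uncovered A x y) * (𝟏 - uncovered C x y)) →
    ∃ λ i → ∃ λ j → θ ≤ codegree p q (lookup A i) (lookup C j)
  common {n} p q A C θ big =
    let (i , big′) = ∑-≤-term {n} (λ i → ∑ {n} λ j → codegree p q (lookup A i) (lookup C j)) (ℚ.<-≤-trans big bound)
        (j , big″) = ∑-≤-term {n} (λ j → codegree p q (lookup A i) (lookup C j)) big′
    in i , j , ℚ.<⇒≤ big″
    where
    bound : 𝔼 (μ p) (λ x → 𝔼 (μ q) λ y → (𝟏 - uncovered A x y) * (𝟏 - uncovered C x y)) ≤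
      ∑ {n} (λ i → ∑ {n} λ j → codegree p q (lookup A i) (lookup C j))
    bound = ℚ.≤-trans (𝔼-mono (μ p) λ x → 𝔼-mono (μ q) λ y → ℚ.≤-trans
        (ℚ.≤-trans (*-monoˡ (≤⇒0≤ (proj₂ (uncovered-unit A x y))) (covered-≤ C x y))
          (*-monoʳ (∑-nonneg {n} (λ i → proj₁ (d-unit (lookup C i) x y))) (covered-≤ A x y)))
        (≤-refl′ (trans (sym (∑-*ʳ {n} _ (λ i → d (lookup A i) x y))) (∑-cong {n} (λ i → sym (∑-* {n} (d (lookup A i) x y) (λ j → d (lookup C j) x y)))))))
      (≤-refl′ (trans (𝔼-cong (μ p) (λ x → trans (𝔼-∑ {n = n} (μ q) (λ i y → ∑ {n} λ j → d (lookup A i) x y * d (lookup C j) x y)) (∑-cong {n} (λ i → 𝔼-∑ {n = n} (μ q) _))))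
        (trans (𝔼-∑ {n = n} (μ p) (λ i x → ∑ {n} λ j → 𝔼 (μ q) λ y → d (lookup A i) x y * d (lookup C j) x y)) (∑-cong {n} (λ i → 𝔼-∑ {n = n} (μ p) _)))))

  one-large : ∀ {x y z t} → ι 3 * t < x + y + z → t < x ⊎ t < y ⊎ t < z
  one-large {x} {y} {z} {t} p with t ℚ.<? x | t ℚ.<? y | t ℚ.<? z
  ... | yes q | _ | _ = inj₁ q
  ... | no _ | yes q | _ = inj₂ (inj₁ q)
  ... | no _ | no _ | yes q = inj₂ (inj₂ q)
  ... | no a | no b | no c = ⊥-elim (≤⇒≯ (≤-by (ℚ.≮⇒≥ a ⊕ ℚ.≮⇒≥ b ⊕ ℚ.≮⇒≥ c) (solve 4 (λ a b c d → (lit 3) :* a :- (b :+ c :+ d) := a :+ (a :+ a) :- (b :+ (c :+ d))) refl _ _ _ _)) p)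

  -- Numbers `a`, `b`, `c` in [0,1] satisfy `a + b + c ≤ 1 + ab + bc + ca`, the difference being
  -- `abc + (1 - a)(1 - b)(1 - c)`. Coverings of total frequency above 1 therefore overlap in two of
  -- the three lists, to which `common` applies.
  crowded : ∀ {n} p q (A B C : Vec P n) θ →
    𝟏 + ι 3 * (ι n * (ι n * θ)) < (𝟏 - free p q A) + (𝟏 - free p q B) + (𝟏 - free p q C) →
    (∃ λ i → ∃ λ j → θ ≤ codegree p q (lookup A i) (lookup C j)) ⊎
    (∃ λ i → ∃ λ j → θ ≤ codegree p q (lookup A i) (lookup B j)) ⊎
    (∃ λ i → ∃ λ j → θ ≤ codegree p q (lookup B i) (lookup C j))
  crowded {n} p q A B C θ big = Data.Sum.map (common p q A C θ) (Data.Sum.map (common p q A B θ) (common p q B C θ))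
    (one-large (subst₂ _<_ {x = (𝟏 + ι 3 * t) + - 𝟏} {u = ((𝟏 - free p q A) + (𝟏 - free p q B) + (𝟏 - free p q C)) + - 𝟏} (solve 2 (λ a b → (lit 1) :+ (lit 3) :* (a :* (a :* b)) :- (lit 1) := (lit 3) :* (a :* (a :* b))) refl _ _) (solve 3 (λ a b c → (lit 1) :- a :+ ((lit 1) :- b) :+ ((lit 1) :- c) :- (lit 1) := (lit 1) :- a :+ ((lit 1) :- b) :+ ((lit 1) :- c) :- (lit 1)) refl _ _ _)
      (+-mono-< big (ℚ.≤-refl { - 𝟏})) ⟨<≤⟩ pairs))
    where
    t : ℚ
    t = ι n * (ι n * θ)
    _⟨<≤⟩_ : ∀ {a b c} → a < b → b ≤ c → a < c
    _⟨<≤⟩_ = ℚ.<-≤-trans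
    Sum : (V → V → ℚ) → ℚ
    Sum f = 𝔼 (μ p) λ x → 𝔼 (μ q) λ y → f x y
    Sum-+ : ∀ f g → Sum (λ x y → f x y + g x y) ≡ Sum f + Sum g
    Sum-+ f g = trans (𝔼-cong (μ p) (λ x → 𝔼-+ (μ q) _ _)) (𝔼-+ (μ p) _ _)
    a b c : V → V → ℚ
    a x y = 𝟏 - uncovered A x y
    b x y = 𝟏 - uncovered B x y
    c x y = 𝟏 - uncovered C x y
    pointwise : ∀ x y → a x y + b x y + c x y ≤ 𝟏 + (a x y * c x y + a x y * b x y + b x y * c x y)
    pointwise x y = ≤-by (*-nonneg (*-nonneg (proj₁ (uncovered-unit A x y)) (proj₁ (uncovered-unit B x y))) (proj₁ (uncovered-unit C x y))
      ⊕ *-nonneg (*-nonneg (≤⇒0≤ (proj₂ (uncovered-unit A x y))) (≤⇒0≤ (proj₂ (uncovered-unit B x y)))) (≤⇒0≤ (proj₂ (uncovered-unit C x y)))) (solve 3 (λ a b c → (lit 1) :+ (((lit 1) :- a) :* ((lit 1) :- b) :+ ((lit 1) :- a) :* ((lit 1) :- c) :+ ((lit 1) :- c) :* ((lit 1) :- b)) :- ((lit 1) :- a :+ ((lit 1) :- c) :+ ((lit 1) :- b)) := a :* c :* b :+ ((lit 1) :- a) :* ((lit 1) :- c) :* ((lit 1) :- b) :- ((lit 0) :+ (lit 0))) refl _ _ _)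
    pairs : ((𝟏 - free p q A) + (𝟏 - free p q B) + (𝟏 - free p q C)) + - 𝟏 ≤
      Sum (λ x y → a x y * c x y) + Sum (λ x y → a x y * b x y) + Sum (λ x y → b x y * c x y)
    pairs = ≤-by (𝔼-mono (μ p) λ x → 𝔼-mono (μ q) λ y → pointwise x y)
      (trans (regroup (𝟏 - free p q A) (𝟏 - free p q B) (𝟏 - free p q C) _) (cong₂ _-_ (sym right) (sym left)))
      where
      regroup : ∀ u v w r → r - (u + v + w + - 𝟏) ≡ (𝟏 + r) - (u + v + w)
      regroup u v w r = solve 4 (λ a b c d → a :- (b :+ c :+ d :- (lit 1)) := (lit 1) :+ a :- (b :+ c :+ d)) refl _ _ _ _
      left : Sum (λ x y → a x y + b x y + c x y) ≡ (𝟏 - free p q A) + (𝟏 - free p q B) + (𝟏 - free p q C)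
      left = trans (Sum-+ _ c) (cong₂ _+_ (trans (Sum-+ a b) (cong₂ _+_ (𝔼-1- p q A) (𝔼-1- p q B))) (𝔼-1- p q C))
      right : Sum (λ x y → 𝟏 + (a x y * c x y + a x y * b x y + b x y * c x y)) ≡
        𝟏 + (Sum (λ x y → a x y * c x y) + Sum (λ x y → a x y * b x y) + Sum (λ x y → b x y * c x y))
      right = trans (Sum-+ (λ _ _ → 𝟏) _) (cong₂ _+_ (trans (𝔼-cong (μ p) (λ _ → 𝔼-const (μ q) 𝟏)) (𝔼-const (μ p) 𝟏))
        (trans (Sum-+ _ (λ x y → b x y * c x y)) (cong (_+ Sum (λ x y → b x y * c x y)) (Sum-+ _ _))))

  module _ {n} (K : Vec P n) (ν : ℚ) where
    record Level (s : ℕ) : Set where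
      field
        ρʳ ρˡ ρᵐ : ℚ
        0≤ρʳ : 𝟎 ≤ ρʳ
        0≤ρˡ : 𝟎 ≤ ρˡ
        0≤ρᵐ : 𝟎 ≤ ρᵐ
        homʳ : Hom (λ t → Within ν ρʳ (freeʳ s t)) K
        homˡ : Hom (λ t → Within ν ρˡ (freeˡ s t)) K
        homᵐ : Hom (λ t → Within ν ρᵐ (freeᵐ s t)) K

    height : ∀ {s} → Level s → ℚ
    height l = Level.ρʳ l + Level.ρˡ l + Level.ρᵐ l

    height-nonneg : ∀ {s} (l : Level s) → 𝟎 ≤ height l
    height-nonneg l = +-nonneg (+-nonneg (Level.0≤ρʳ l) (Level.0≤ρˡ l)) (Level.0≤ρᵐ l)

    height₀ : ∀ (l : Level 0) → 2 ℕ.≤ n → height l ≤ ι 3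
    height₀ l 2≤n with tuple 2≤n K
    ... | (p ∷ q ∷ []) , t = ≤-by (bound (homʳ _ t) ⊕ bound (homˡ _ t) ⊕ bound (homᵐ _ t)) (solve 3 (λ a b c → (lit 3) :- (a :+ b :+ c) := (lit 1) :+ ((lit 1) :+ (lit 1)) :- (a :+ (b :+ c))) refl _ _ _)
      where
      open Level l
      bound : ∀ {ρ} → Within ν ρ (free p q []) → ρ ≤ 𝟏
      bound w = ℚ.≤-trans (proj₁ w) (proj₂ (free-unit p q []))

  layout : ∀ {s} → P → P → P → Vec P s → Vec P s → Vec P s → Vec P (suc (s ℕ.+ suc (s ℕ.+ suc s)))
  layout i j k A B C = i ∷ (A Vec.++ j ∷ (B Vec.++ k ∷ C))

  module _ {r c η θ} (c>0 : 𝟎 < c) (η≡ : ι 2000 * c ≡ η) (reg : Regular r c)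
    {n} (K : Vec P n) (D : Distinct K) (dense : ∀ i j k → i ∷ j ∷ k ∷ [] ⊑ K → 𝟏 + η ≤ ι 27 * density i j k)
    {s} (s≤r : s ℕ.≤ r) (l : Level K c s) (l′ : Level K c (suc s)) (drop : height K c l ≤ c + height K c l′)
    (θ-small : ι 3 * (ι s * (ι s * θ)) ≤ c) where

    -- The pair `ij` is considered with `C` on its right, `ik` with `B` between and `jk` with `A` on
    -- its left. Density above 1/27 and the inequality of the means make the three covering
    -- frequencies sum to more than 1. By homogeneity all three may be moved to the pair `jk`, where
    -- they become crowded.
    find : ∀ i j k (A B C : Vec P s) → layout i j k A B C ⊑ K →
      (Σ (Vec P 4) λ t → t ⊑ layout i j k A B C × (T₁₂ θ t ⊎ T₁₃ θ t ⊎ T₂₃ θ t))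
    find i j k A B C sub = case crowded j k A B C θ crowd of λ where
        (inj₁ (a , b , p)) → (lookup A a ∷ j ∷ k ∷ lookup C b ∷ []) ,
          skip (⊑-++ (⊑-lookup A a) (keep (over B (keep (⊑-lookup C b))))) , inj₁ p
        (inj₂ (inj₁ (a , b , p))) → (lookup A a ∷ j ∷ lookup B b ∷ k ∷ []) ,
          skip (⊑-++ (⊑-lookup A a) (keep (⊑-++ (⊑-lookup B b) (keep ⊑-min)))) , inj₂ (inj₂ p)
        (inj₂ (inj₂ (a , b , p))) → (j ∷ lookup B a ∷ k ∷ lookup C b ∷ []) ,
          skip (over A (keep (⊑-++ (⊑-lookup B a) (keep (⊑-lookup C b))))) , inj₂ (inj₁ p)
      where
      module l = Level l
      module l′ = Level l′

      at : ∀ {m} {t : Vec P m} → t ⊑ layout i j k A B C → t ⊑ K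
      at t = ⊑-trans t sub

      apart : ∀ {p q} → p ∷ q ∷ [] ⊑ layout i j k A B C → p ≢ q
      apart t = D _ _ (at t)

      i<j : i ∷ j ∷ [] ⊑ layout i j k A B C
      i<j = keep (over A (keep ⊑-min))
      i<k : i ∷ k ∷ [] ⊑ layout i j k A B C
      i<k = keep (over A (skip (over B (keep ⊑-min))))
      j<k : j ∷ k ∷ [] ⊑ layout i j k A B C
      j<k = skip (over A (keep (over B (keep ⊑-min))))

      dist₁ : Distinct (j ∷ k ∷ A)
      dist₁ = Distinct-∷ (Fresh-∷ (apart j<k) (λ q t → ≢-sym (apart (skip (⊑-++ t (keep ⊑-min))))))
        (Distinct-∷ (λ q t → ≢-sym (apart (skip (⊑-++ t (skip (over B (keep ⊑-min)))))))
          (Distinct-⊑ (at (skip (⊑-++ˡ A))) D))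
      B<k : ∀ q → q ∷ [] ⊑ B → k ≢ q
      B<k q t = ≢-sym (apart (skip (over A (skip (⊑-++ t (keep ⊑-min))))))
      i<B : ∀ q → q ∷ [] ⊑ B → i ≢ q
      i<B q t = apart (keep (over A (skip (⊑-trans t (⊑-++ˡ B)))))
      dist-B : Distinct B
      dist-B = Distinct-⊑ (at (skip (over A (skip (⊑-++ˡ B))))) D
      dist₂ : Distinct (k ∷ i ∷ B)
      dist₂ = Distinct-∷ (Fresh-∷ (≢-sym (apart i<k)) B<k) (Distinct-∷ i<B dist-B)
      dist₃ : Distinct (i ∷ k ∷ B)
      dist₃ = Distinct-∷ (Fresh-∷ (apart i<k) i<B) (Distinct-∷ B<k dist-B)

      ijC : Within c l.ρʳ (free i j C)
      ijC = l.homʳ _ (at (keep (over A (keep (over B (skip ⊑-refl))))))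
      ijkC : Within c l′.ρʳ (free i j (k ∷ C))
      ijkC = l′.homʳ _ (at (keep (over A (keep (over B ⊑-refl)))))
      jkC : Within c l.ρʳ (free j k C)
      jkC = l.homʳ _ (at (skip (over A (keep (over B ⊑-refl)))))
      jkA : Within c l.ρˡ (free j k A)
      jkA = subst (Within c l.ρˡ) (freeˡ-++ A j k) (l.homˡ _ (at (skip (⊑-++ (⊑-refl {xs = A}) (keep (over B (keep ⊑-min)))))))
      ijkA : Within c l′.ρˡ (free j k (i ∷ A))
      ijkA = subst (Within c l′.ρˡ) (freeˡ-++ (i ∷ A) j k) (l′.homˡ _ (at (keep (⊑-++ (⊑-refl {xs = A}) (keep (over B (keep ⊑-min)))))))
      ikB : Within c l.ρᵐ (free i k B)
      ikB = subst (Within c l.ρᵐ) (freeᵐ-++ B i k) (l.homᵐ _ (at (keep (over A (skip (⊑-++ (⊑-refl {xs = B}) (keep ⊑-min)))))))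
      ijkB : Within c l′.ρᵐ (free i k (j ∷ B))
      ijkB = subst (Within c l′.ρᵐ) (freeᵐ-++ (j ∷ B) i k) (l′.homᵐ _ (at (keep (over A (keep (⊑-++ (⊑-refl {xs = B}) (keep ⊑-min)))))))
      jkB : Within c l.ρᵐ (free j k B)
      jkB = subst (Within c l.ρᵐ) (freeᵐ-++ B j k) (l.homᵐ _ (at (skip (over A (keep (⊑-++ (⊑-refl {xs = B}) (keep ⊑-min)))))))

      c≥0 : 𝟎 ≤ c
      c≥0 = ℚ.<⇒≤ c>0

      a b e : ℚ
      a = 𝟏 - free i j C
      b = 𝟏 - free i k B
      e = 𝟏 - free j k A

      a-unit : Unit a
      a-unit = Unit-1- (free-unit i j C)
      b-unit : Unit b
      b-unit = Unit-1- (free-unit i k B)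
      e-unit : Unit e
      e-unit = Unit-1- (free-unit j k A)

      -- The three drops amount to at most `4c`, namely `3c` of inaccuracy and `c` from `drop`, and
      -- decoupling costs `3c`. Multiplied by 27 this takes 189 of the 2000 units `c` in `η`.
      product-large : 𝟏 + ι 1811 * c ≤ ι 27 * (a * b * e)
      product-large = ≤-by
        (ℚ.≤-trans (subst (λ z → 𝟏 + z ≤ ι 27 * density i j k) (sym η≡) (dense i j k (at (keep (over A (keep (over B (keep ⊑-min)))))))) (*-monoˡ (ι-nonneg 27) (density-bound reg c≥0 s≤r i j k A B C dist₁ dist₂ dist₃))
          ⊕ *-monoˡ (ι-nonneg 27) (proj₂ ijC ⊕ proj₁ ijkC ⊕ proj₂ jkA ⊕ proj₁ ijkA ⊕ proj₂ ikB ⊕ proj₁ ijkB ⊕ drop))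
        (solve 13 (λ a b c d e f g h i j k l m → (lit 27) :* (((lit 1) :- a) :* ((lit 1) :- b) :* ((lit 1) :- c)) :- ((lit 1) :+ (lit 1811) :* d) := (lit 27) :* (a :- e :+ (c :- f) :+ (b :- g) :+ ((lit 3) :* d :+ ((lit 1) :- a) :* ((lit 1) :- b) :* ((lit 1) :- c))) :+ (lit 27) :* (h :+ d :+ (e :+ (i :+ d :+ (f :+ (j :+ d :+ (g :+ (d :+ (k :+ l :+ m)))))))) :- ((lit 1) :+ (lit 2000) :* d :+ (lit 27) :* (a :+ (k :+ (c :+ (l :+ (b :+ (m :+ (h :+ i :+ j))))))))) refl _ _ _ _ _ _ _ _ _ _ _ _ _)

      sum-large : 𝟏 + ι 1811 * c ≤ 𝟏 + ι 13 * ((a + b + e) - 𝟏)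
      sum-large = cube-excess (+-nonneg (+-nonneg (proj₁ a-unit) (proj₁ b-unit)) (proj₁ e-unit))
        (≤-by (proj₂ a-unit ⊕ proj₂ b-unit ⊕ proj₂ e-unit) (solve 3 (λ a b c → (lit 3) :- ((lit 1) :- a :+ ((lit 1) :- b) :+ ((lit 1) :- c)) := (lit 1) :+ ((lit 1) :+ (lit 1)) :- ((lit 1) :- a :+ ((lit 1) :- b :+ ((lit 1) :- c)))) refl _ _ _)) (*-pos (ι-pos 1810) c>0)
        (ℚ.≤-trans product-large (am-gm (proj₁ a-unit) (proj₁ b-unit) (proj₁ e-unit)))

      -- If the sum were at most `1 + c`, multiplication by 13 and the two changes of pair, at cost
      -- `c` each, would leave 1811 - 13 - 26 = 1772 positive units `c` below zero.
      crowd : 𝟏 + ι 3 * (ι s * (ι s * θ)) < (𝟏 - free j k A) + (𝟏 - free j k B) + (𝟏 - free j k C)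
      crowd = ℚ.≤-<-trans {j = 𝟏 + c} (≤-by θ-small (solve 3 (λ a b c → (lit 1) :+ a :- ((lit 1) :+ (lit 3) :* (b :* (b :* c))) := a :- (lit 3) :* (b :* (b :* c))) refl _ _ _)) (ℚ.≰⇒> λ p → ≤⇒≯
        (≤-by {c = ι 1772 * c} {d = 𝟎} (*-monoˡ (ι-nonneg 13) p ⊕ sum-large ⊕ *-monoˡ (ι-nonneg 13) (proj₂ jkB ⊕ proj₁ ikB ⊕ proj₂ jkC ⊕ proj₁ ijC)) (solve 8 (λ a b c d e f g h → (lit 0) :- (lit 1772) :* a := (lit 13) :* ((lit 1) :+ a) :+ ((lit 1) :+ (lit 13) :* ((lit 1) :- b :+ ((lit 1) :- c) :+ ((lit 1) :- d) :- (lit 1)) :+ (lit 13) :* (e :+ a :+ (c :+ (f :+ a :+ b)))) :- ((lit 13) :* ((lit 1) :- d :+ ((lit 1) :- g) :+ ((lit 1) :- h)) :+ ((lit 1) :+ (lit 1811) :* a :+ (lit 13) :* (g :+ (e :+ (h :+ f)))))) refl _ _ _ _ _ _ _ _)) (*-pos (ι-pos 1771) c>0))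

Levelling : (ℕ → ℕ) → ℕ → ℚ → ℕ → Set₁
Levelling arity r c m = Σ ℕ λ N → ∀ {A} (f : ∀ (i : Fin (suc r)) → Vec A (arity (Fin.toℕ i)) → ℚ) → (∀ i t → Unit (f i t)) → (L : Vec A N) →
  Σ (Vec A m) λ K → K ⊑ L × (∀ i → Σ ℚ λ ρ → 𝟎 ≤ ρ × Hom (λ t → Within c ρ (f i t)) K)

-- `c` is the unit of error. The three values of `free` have sum at most 3, so `r` levels with
-- `r c > 3` contain one where the sum drops by at most `c`. `θ` is small enough to survive the
-- division by `s²` in `common` for all levels `s ≤ r`.
record Constants (η : ℚ) : Set where
  field
    c   : ℚ
    c>0 : 𝟎 < c
    c≡  : ι 2000 * c ≡ η
    r   : ℕ
    r>  : ι 3 < ι r * c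
    θ   : ℚ
    θ>0 : 𝟎 < θ
    θ-small : ∀ {s} → s ℕ.≤ r → ι 3 * (ι s * (ι s * θ)) ≤ c

record Parameters {η : ℚ} (C : Constants η) (m : ℕ) : Set₁ where
  open Constants C public

  size : ℕ
  size = suc (r ℕ.+ suc (r ℕ.+ suc r))
  n₂₃ : ℕ
  n₂₃ = ramseyNumber 4 m size
  n₁₃ : ℕ
  n₁₃ = ramseyNumber 4 m n₂₃
  n₁₂ : ℕ
  -- The summand `size` provides the two positions by which `height₀` bounds the initial height.
  n₁₂ = ramseyNumber 4 m n₁₃ ℕ.+ size

  field
    levelʳ : Levelling (2 ℕ.+_) r c n₁₂
    levelˡ : Levelling (ℕ._+ 2) r c (proj₁ levelʳ)
    levelᵐ : Levelling (λ s → suc (s ℕ.+ 1)) r c (proj₁ levelˡ)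

constants : ∀ η → 𝟎 < η → Constants η
constants η η>0 = record
  { c = c ; c>0 = c>0 ; c≡ = proj₂ (proj₂ small) ; r = r ; r> = proj₂ (exceed 3 c>0)
  ; θ = θ ; θ>0 = proj₁ (proj₂ small-θ) ; θ-small = θ-small
  }
  where
  small : Σ ℚ λ c → 𝟎 < c × ι 2000 * c ≡ η
  small = fraction 1999 η>0
  c : ℚ
  c = proj₁ small
  c>0 : 𝟎 < c
  c>0 = proj₁ (proj₂ small)
  r : ℕ
  r = proj₁ (exceed 3 c>0)
  small-θ : Σ ℚ λ θ → 𝟎 < θ × ι (suc (3 ℕ.* (r ℕ.* r))) * θ ≡ c
  small-θ = fraction (3 ℕ.* (r ℕ.* r)) c>0
  θ : ℚ
  θ = proj₁ small-θ

  θ-small : ∀ {s} → s ℕ.≤ r → ι 3 * (ι s * (ι s * θ)) ≤ c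
  θ-small {s} s≤r = fit (ι r) (ι s) θ (ι-nonneg s) (ι-mono s≤r) (ℚ.<⇒≤ (proj₁ (proj₂ small-θ)))
    (trans (cong (_* θ) (trans (cong (𝟏 +_) (sym (trans (ι-* 3 (r ℕ.* r)) (cong (ι 3 *_) (ι-* r r))))) (sym (ι-suc (3 ℕ.* (r ℕ.* r)))))) (proj₂ (proj₂ small-θ)))
    where
    fit : ∀ x y z → 𝟎 ≤ y → y ≤ x → 𝟎 ≤ z → (𝟏 + ι 3 * (x * x)) * z ≡ c → ι 3 * (y * (y * z)) ≤ c
    fit x y z y≥0 y≤x z≥0 e = ℚ.≤-trans (≤-by (z≥0 ⊕ *-monoˡ z≥0 (*-monoˡ (ι-nonneg 3) (sq-mono y≥0 y≤x))) (solve 3 (λ a b c → ((lit 1) :+ (lit 3) :* (a :* a)) :* b :- (lit 3) :* (c :* (c :* b)) := b :+ b :* ((lit 3) :* (a :* a)) :- ((lit 0) :+ b :* ((lit 3) :* (c :* c)))) refl _ _ _)) (≤-refl′ e)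

parameters : ∀ {η} (C : Constants η) m → Parameters C m
parameters C m = record { levelʳ = levelʳ ; levelˡ = levelˡ ; levelᵐ = levelled c c>0 (suc r) (λ i → suc (Fin.toℕ i ℕ.+ 1)) (proj₁ levelˡ) }
  where
  open Constants C
  levelʳ : Levelling (2 ℕ.+_) r c _
  levelʳ = levelled c c>0 (suc r) (λ i → 2 ℕ.+ Fin.toℕ i) _
  levelˡ : Levelling (ℕ._+ 2) r c (proj₁ levelʳ)
  levelˡ = levelled c c>0 (suc r) (λ i → Fin.toℕ i ℕ.+ 2) (proj₁ levelʳ)

module _ {η m} {C : Constants η} (par : Parameters C m) (s₀ : ℕ) where
  open Parameters par

  module _ (S : System) where
    open System S
    open Overlap S
    open Overlapping S

    private
      DenseTriple : Vec P 3 → Set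
      DenseTriple (i ∷ j ∷ k ∷ []) = 𝟏 + η ≤ ι 27 * density i j k

      DenseTriple? : ∀ t → Dec (DenseTriple t)
      DenseTriple? (i ∷ j ∷ k ∷ []) = 𝟏 + η ℚ.≤? ι 27 * density i j k

      freeʳ-unit : ∀ s t → Unit (freeʳ s t)
      freeʳ-unit s (p ∷ q ∷ K) = free-unit p q K
      freeˡ-unit : ∀ s t → Unit (freeˡ s t)
      freeˡ-unit s t with split s t
      ... | K , p ∷ q ∷ [] = free-unit p q K
      freeᵐ-unit : ∀ s t → Unit (freeᵐ s t)
      freeᵐ-unit s (p ∷ t) with split s t
      ... | K , q ∷ [] = free-unit p q K

    module _ (reg : Regular r c) where
      -- On a level with a small drop every list of length `size` contains one of the three overlap
      -- patterns. Ramsey's theorem is applied first to `T₁₂`, then to `T₁₃`; if both are absent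
      -- everywhere, `T₂₃` can be made homogeneous.
      homogeneous-codegree : ∀ {n} (K : Vec P n) → Distinct K → Hom DenseTriple K →
        (∀ s → s ℕ.≤ r → Level K c s) → n ≡ n₁₂ → Σ (Vec P m) λ J → Distinct J × (Hom (T₁₂ θ) J ⊎ Hom (T₁₃ θ) J)
      homogeneous-codegree K D dense lev refl =
          from-drop (small-drop {Level K c} (height K c) (height-nonneg K c) c r 0 lev (lev 0 ℕ.z≤n)
            (ℚ.≤-<-trans (height₀ K c (lev 0 ℕ.z≤n) (ℕ.≤-trans (ℕ.s≤s (ℕ.≤-trans (ℕ.s≤s ℕ.z≤n) (ℕ.m≤n+m (suc (r ℕ.+ suc r)) r))) (ℕ.m≤n+m size _))) r>))
        where
        Drop : Set
        Drop = Σ ℕ λ s → s ℕ.< r × Σ (Level K c s) λ l → Σ (Level K c (suc s)) λ l′ → height K c l ≤ c + height K c l′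
        Goal : Set
        Goal = Σ (Vec P m) λ J → Distinct J × (Hom (T₁₂ θ) J ⊎ Hom (T₁₃ θ) J)
        K₀ : Vec P (ramseyNumber 4 m n₁₃)
        K₀ = proj₁ (tuple (ℕ.m≤m+n _ size) K)
        K₀⊑K : K₀ ⊑ K
        K₀⊑K = proj₂ (tuple (ℕ.m≤m+n _ size) K)

        find′ : Drop → (J : Vec P size) → J ⊑ K → Σ (Vec P 4) λ t → t ⊑ J × (T₁₂ θ t ⊎ T₁₃ θ t ⊎ T₂₃ θ t)
        find′ (s , s<r , l , l′ , drop) (i ∷ J) sub = from₁ (Vec.splitAt r J) sub
          where
          s≤r : s ℕ.≤ r
          s≤r = ℕ.<⇒≤ s<r
          from₂ : ∀ {A : Vec P r} {j J′} → (∃ λ (B : Vec P r) → ∃ λ R → J′ ≡ B Vec.++ R) → i ∷ (A Vec.++ j ∷ J′) ⊑ K →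
            Σ (Vec P 4) λ t → t ⊑ i ∷ (A Vec.++ j ∷ J′) × (T₁₂ θ t ⊎ T₁₃ θ t ⊎ T₂₃ θ t)
          from₂ {A} {j} (B , k ∷ C , refl) sub =
            let (A′ , A⊑) = tuple s≤r A ; (B′ , B⊑) = tuple s≤r B ; (C′ , C⊑) = tuple s≤r C
                shrink = keep (⊑-++ A⊑ (keep (⊑-++ B⊑ (keep C⊑))))
                (t , t⊑ , p) = find c>0 c≡ reg K D (λ i j k → dense (i ∷ j ∷ k ∷ [])) s≤r l l′ drop (θ-small s≤r)
                  i j k A′ B′ C′ (⊑-trans shrink sub)
            in t , ⊑-trans t⊑ shrink , p
          from₁ : ∀ {J} → (∃ λ (A : Vec P r) → ∃ λ R → J ≡ A Vec.++ R) → i ∷ J ⊑ K →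
            Σ (Vec P 4) λ t → t ⊑ i ∷ J × (T₁₂ θ t ⊎ T₁₃ θ t ⊎ T₂₃ θ t)
          from₁ (A , j ∷ J′ , refl) sub = from₂ {A} {j} (Vec.splitAt r J′) sub

        -- Reading the positions backwards exchanges left and right: an overlap from the left and
        -- the middle becomes one from the middle and the right. Two of the three patterns thus
        -- remain.
        flip : ∀ t → T₂₃ θ (rev t) → T₁₃ θ t
        flip (x ∷ l ∷ y ∷ k ∷ []) p = ℚ.≤-trans p (≤-refl′ (trans (fubini y x _)
          (𝔼-cong (μ x) λ u → 𝔼-cong (μ y) λ v → trans (cong₂ _*_ (d-sym k v u) (d-sym l v u)) (swap _ _))))
          where
          swap : ∀ a b → a * b ≡ b * a
          swap a b = solve 2 (λ a b → a :* b := b :* a) refl _ _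

        twentythree : Drop → ∀ (J : Vec P n₂₃) → J ⊑ K → Hom (λ t → ¬ T₁₂ θ t) J → Hom (λ t → ¬ T₁₃ θ t) J → Goal
        twentythree D′ J sub not₁₂ not₁₃ with homogenize 4 size m (T₂₃ θ) (T₂₃? θ) J
          (λ I I⊑J → case find′ D′ I (⊑-trans I⊑J sub) of λ where
            (t , t⊑I , inj₁ p) → ⊥-elim (not₁₂ t (⊑-trans t⊑I I⊑J) p)
            (t , t⊑I , inj₂ (inj₁ p)) → ⊥-elim (not₁₃ t (⊑-trans t⊑I I⊑J) p)
            (t , t⊑I , inj₂ (inj₂ p)) → t , t⊑I , p)
        ... | I , I⊑J , h = rev I , (λ p q t → ≢-sym (D q p (⊑-trans (⊑-unrev t) (⊑-trans I⊑J sub)))) ,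
          inj₂ (λ t t⊑ → flip t (h (rev t) (⊑-unrev t⊑)))

        thirteen : Drop → ∀ (J : Vec P n₁₃) → J ⊑ K → Hom (λ t → ¬ T₁₂ θ t) J → Goal
        thirteen D′ J sub not₁₂ with ramsey 4 m n₂₃ (T₁₃ θ) (T₁₃? θ) J
        ... | inj₁ (I , I⊑J , h) = I , Distinct-⊑ (⊑-trans I⊑J sub) D , inj₂ h
        ... | inj₂ (I , I⊑J , h) = twentythree D′ I (⊑-trans I⊑J sub) (Hom-⊑ I⊑J not₁₂) h

        twelve : Drop → (Σ (Vec P m) λ J → J ⊑ K₀ × Hom (T₁₂ θ) J) ⊎ (Σ (Vec P n₁₃) λ J → J ⊑ K₀ × Hom (λ t → ¬ T₁₂ θ t) J) → Goal
        twelve D′ (inj₁ (J , J⊑K , h)) = J , Distinct-⊑ (⊑-trans J⊑K K₀⊑K) D , inj₁ h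
        twelve D′ (inj₂ (J , J⊑K , h)) = thirteen D′ J (⊑-trans J⊑K K₀⊑K) h

        from-drop : Drop → Goal
        from-drop D′ = twelve D′ (ramsey 4 m n₁₃ (T₁₂ θ) (T₁₂? θ) K₀)

      codegree-from-density : (L : Vec P (ramseyNumber 3 (proj₁ levelᵐ) s₀)) → Distinct L →
        (∀ (K : Vec P s₀) → K ⊑ L → Σ (Vec P 3) λ t → t ⊑ K × DenseTriple t) →
        Σ (Vec P m) λ J → Distinct J × (Hom (T₁₂ θ) J ⊎ Hom (T₁₃ θ) J)
      codegree-from-density L D dense =
        let (L₁ , ⊑₁ , dense₁) = homogenize 3 s₀ (proj₁ levelᵐ) DenseTriple DenseTriple? L dense
            (L₂ , ⊑₂ , levm) = proj₂ levelᵐ (λ i → freeᵐ (Fin.toℕ i)) (λ i → freeᵐ-unit (Fin.toℕ i)) L₁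
            (L₃ , ⊑₃ , levl) = proj₂ levelˡ (λ i → freeˡ (Fin.toℕ i)) (λ i → freeˡ-unit (Fin.toℕ i)) L₂
            (K , ⊑₄ , levr) = proj₂ levelʳ (λ i → freeʳ (Fin.toℕ i)) (λ i → freeʳ-unit (Fin.toℕ i)) L₃
        in homogeneous-codegree K (Distinct-⊑ (⊑-trans ⊑₄ (⊑-trans ⊑₃ (⊑-trans ⊑₂ ⊑₁))) D) (Hom-⊑ (⊑-trans ⊑₄ (⊑-trans ⊑₃ ⊑₂)) dense₁)
          (λ s s≤r →
            let (ρ , ρ≥0 , h) = lookup-ℕ (λ s → Σ ℚ λ ρ → 𝟎 ≤ ρ × Hom (λ t → Within c ρ (freeʳ s t)) K) levr s s≤r
                (ρ′ , ρ′≥0 , h′) = lookup-ℕ (λ s → Σ ℚ λ ρ → 𝟎 ≤ ρ × Hom (λ t → Within c ρ (freeˡ s t)) L₃) levl s s≤r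
                (ρ″ , ρ″≥0 , h″) = lookup-ℕ (λ s → Σ ℚ λ ρ → 𝟎 ≤ ρ × Hom (λ t → Within c ρ (freeᵐ s t)) L₂) levm s s≤r
            in record { ρʳ = ρ ; ρˡ = ρ′ ; ρᵐ = ρ″ ; 0≤ρʳ = ρ≥0 ; 0≤ρˡ = ρ′≥0 ; 0≤ρᵐ = ρ″≥0
                      ; homʳ = h ; homˡ = Hom-⊑ ⊑₄ h′ ; homᵐ = Hom-⊑ (⊑-trans ⊑₄ ⊑₃) h″ })
          refl

DenseTriples : (S : System) → ℚ → ∀ {n} → Vec (System.P S) n → Set
DenseTriples S η K = Σ P λ i → Σ P λ j → Σ P λ k → i ∷ j ∷ k ∷ [] ⊑ K × 𝟏 + η ≤ ι 27 * Overlap.density S i j k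
  where open System S

LargeCodegree : ℚ → ℕ → Set₁
LargeCodegree η s₀ = Σ ℕ λ r → Σ ℚ λ ε → 𝟎 < ε × Σ ℚ λ θ → 𝟎 < θ × (∀ m → Σ ℕ λ N → ∀ (S : System) →
  let open System S in let open Overlapping S in
  Regular r ε → (L : Vec P N) → Distinct L → (∀ (K : Vec P s₀) → K ⊑ L → DenseTriples S η K) →
  Σ (Vec P m) λ J → Distinct J × (Hom (T₁₂ θ) J ⊎ Hom (T₁₃ θ) J))

large-codegree : ∀ η → 𝟎 < η → ∀ s₀ → LargeCodegree η s₀
large-codegree η η>0 s₀ = with-constants (constants η η>0)
  where
  with-constants : Constants η → LargeCodegree η s₀
  with-constants C = r , c , c>0 , θ , θ>0 , λ m → with-parameters (parameters C m)
    where
    open Constants C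
    with-parameters : ∀ {m} → Parameters C m → Σ ℕ λ N → ∀ (S : System) →
      let open System S in let open Overlapping S in
      Regular r c → (L : Vec P N) → Distinct L → (∀ (K : Vec P s₀) → K ⊑ L → DenseTriples S η K) →
      Σ (Vec P m) λ J → Distinct J × (Hom (T₁₂ θ) J ⊎ Hom (T₁₃ θ) J)
    with-parameters par = ramseyNumber 3 (proj₁ (Parameters.levelᵐ par)) s₀ ,
      λ S reg L D dense → codegree-from-density par s₀ S reg L D
        (λ K K⊑L → let (i , j , k , t , p) = dense K K⊑L in (i ∷ j ∷ k ∷ []) , t , p)

-- Petals and their closing into a cycle

combine-monoʳ-< : ∀ {m n} (β : Fin m) {i j : Fin n} → i Fin.< j → Fin.combine β i Fin.< Fin.combine β j
combine-monoʳ-< {n = n} β {i} {j} p = subst₂ ℕ._<_ (sym (Fin.toℕ-combine β i)) (sym (Fin.toℕ-combine β j)) (ℕ.+-monoʳ-< (n ℕ.* Fin.toℕ β) p)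

-- The indices form `m` blocks of length `n`. `pigeonhole` finds a good pair in every block, then
-- two blocks whose products agree well; of the four functions one is dropped.
pigeonhole₃ : ∀ {A : Set} (M : Mean A) {m n θ c c′} (h : Fin (m ℕ.* n) → A → ℚ) → (∀ i x → Unit (h i x)) →
  𝟎 ≤ θ → (∀ i → θ ≤ 𝔼 M (h i)) → 𝟎 < c → c + c ≤ θ * θ → 𝟏 < ι n * c → 𝟎 < c′ → c′ + c′ ≤ c * c → 𝟏 < ι m * c′ →
  ∃ λ i → ∃ λ j → ∃ λ k → i Fin.< j × j Fin.< k × c′ ≤ 𝔼 M (λ x → h i x * h j x * h k x)
pigeonhole₃ M {m} {n} {θ} {c} {c′} h u θ≥0 lower c>0 2c≤ n-big c′>0 2c′≤ m-big =
  let (β , γ , β<γ , p) = pigeonhole M q q-unit (ℚ.<⇒≤ c>0) (λ β → proj₂ (proj₂ (proj₂ (inner β)))) c′>0 2c′≤ m-big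
      (i , j , i<j , _) = inner β
      k = proj₁ (inner γ)
  in Fin.combine β i , Fin.combine β j , Fin.combine γ k , combine-monoʳ-< β i<j , Fin.combine-monoˡ-< j k β<γ ,
     ℚ.≤-trans p (𝔼-mono M (λ x → *-monoˡ (proj₁ (q-unit β x)) (*-≤ˡ (proj₁ (u _ x)) (proj₂ (u _ x)))))
  where
  inner : ∀ β → ∃ λ i → ∃ λ j → i Fin.< j × c ≤ 𝔼 M (λ x → h (Fin.combine β i) x * h (Fin.combine β j) x)
  inner β = pigeonhole M (λ i → h (Fin.combine β i)) (λ i → u _) θ≥0 (λ i → lower _) c>0 2c≤ n-big
  q : Fin m → _ → ℚ
  q β x = h (Fin.combine β (proj₁ (inner β))) x * h (Fin.combine β (proj₁ (proj₂ (inner β)))) x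
  q-unit : ∀ β x → Unit (q β x)
  q-unit β x = Unit-* (u _ x) (u _ x)

odds evens : ∀ {A : Set} m → Vec A (m ℕ.* 2) → Fin m → A
odds (suc m) (x ∷ y ∷ L) zero = x
odds (suc m) (x ∷ y ∷ L) (suc i) = odds m L i
evens (suc m) (x ∷ y ∷ L) zero = y
evens (suc m) (x ∷ y ∷ L) (suc i) = evens m L i

⊑-pair : ∀ {A} m (L : Vec A (m ℕ.* 2)) i → odds m L i ∷ evens m L i ∷ [] ⊑ L
⊑-pair (suc m) (x ∷ y ∷ L) zero = keep (keep ⊑-min)
⊑-pair (suc m) (x ∷ y ∷ L) (suc i) = skip (skip (⊑-pair m L i))

⊑-pair₂ : ∀ {A} m (L : Vec A (m ℕ.* 2)) {i j} → i Fin.< j →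
  odds m L i ∷ evens m L i ∷ odds m L j ∷ evens m L j ∷ [] ⊑ L
⊑-pair₂ (suc m) (x ∷ y ∷ L) {zero} {suc j} p = keep (keep (⊑-pair m L j))
⊑-pair₂ (suc m) (x ∷ y ∷ L) {suc i} {suc j} (ℕ.s≤s p) = skip (skip (⊑-pair₂ m L p))

module Petals (S : System) where
  open System S
  open Overlapping S

  -- The weight of the petals x a b, x y b, x y z with z in position k.
  petal : P → P → P → V → V → ℚ
  petal x y k a b = 𝔼 (μ x) λ u → E u a b * 𝔼 (μ y) λ v → E u v b * d k u v

  -- A petal with two ends at once, `l` and `k`. It may be weakened to a petal with either end, so
  -- the choice can wait until the cycle is closed.
  petal₂ : P → P → P → P → V → V → ℚ
  petal₂ x y l k a b = 𝔼 (μ x) λ u → E u a b * 𝔼 (μ y) λ v → E u v b * (d l u v * d k u v)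

  petal-unit : ∀ x y k a b → Unit (petal x y k a b)
  petal-unit x y k a b = Unit-𝔼 (μ x) λ u → Unit-* (E-unit u a b) (Unit-𝔼 (μ y) λ v → Unit-* (E-unit u v b) (d-unit k u v))

  petal₂-unit : ∀ x y l k a b → Unit (petal₂ x y l k a b)
  petal₂-unit x y l k a b = Unit-𝔼 (μ x) λ u → Unit-* (E-unit u a b) (Unit-𝔼 (μ y) λ v → Unit-* (E-unit u v b) (Unit-* (d-unit l u v) (d-unit k u v)))

  petal₂-≤ˡ : ∀ x y l k a b → petal₂ x y l k a b ≤ petal x y l a b
  petal₂-≤ˡ x y l k a b = 𝔼-mono (μ x) λ u → *-monoˡ (proj₁ (E-unit u a b)) (𝔼-mono (μ y) λ v →
    *-monoˡ (proj₁ (E-unit u v b)) (*-≤ˡ (proj₁ (d-unit l u v)) (proj₂ (d-unit k u v))))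

  petal₂-≤ʳ : ∀ x y l k a b → petal₂ x y l k a b ≤ petal x y k a b
  petal₂-≤ʳ x y l k a b = 𝔼-mono (μ x) λ u → *-monoˡ (proj₁ (E-unit u a b)) (𝔼-mono (μ y) λ v →
    *-monoˡ (proj₁ (E-unit u v b)) (*-≤ʳ (proj₂ (d-unit l u v)) (proj₁ (d-unit k u v))))

  codegree₃ : P → P → P → P → P → ℚ
  codegree₃ x y l k b = 𝔼 (μ x) λ u → 𝔼 (μ y) λ v → d l u v * d k u v * d b u v

  fork : P → P → P → P → P → P → ℚ
  fork x y l k a b = 𝔼 (μ a) λ α → 𝔼 (μ b) λ β → petal₂ x y l k α β

  distance : P → P → P → P → P → P → ℚ
  distance x y k k′ a b = 𝔼 (μ a) λ α → 𝔼 (μ b) λ β →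
    (petal x y k α β - petal x y k′ α β) * (petal x y k α β - petal x y k′ α β)

  -- Two of the many ends `k` agree on many pairs `uv`. The earlier one remains an end and the later
  -- one becomes the position of `b`, which supplies the edge `u v b`.
  grow-b : ∀ {n θ c} x y l (ks : Vec P n) → 𝟎 ≤ θ → (∀ i → θ ≤ codegree x y l (lookup ks i)) →
    𝟎 < c → c + c ≤ θ * θ → 𝟏 < ι n * c →
    ∃ λ i → ∃ λ j → i Fin.< j × c ≤ codegree₃ x y l (lookup ks i) (lookup ks j)
  grow-b {n} x y l ks θ≥0 lower c>0 2c≤ big =
    let (i , j , i<j , p) = pigeonhole (μ x ⊗ᴹ μ y) {m = n} (λ i (u , v) → d l u v * d (lookup ks i) u v)
          (λ i (u , v) → Unit-* (d-unit l u v) (d-unit (lookup ks i) u v)) θ≥0 lower c>0 2c≤ big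
    in i , j , i<j , ℚ.≤-trans p (𝔼-mono (μ x) λ u → 𝔼-mono (μ y) λ v →
      *-monoˡ (proj₁ (Unit-* (d-unit l u v) (d-unit (lookup ks i) u v))) (*-≤ʳ (proj₂ (d-unit l u v)) (proj₁ (d-unit (lookup ks j) u v))))

  -- For fixed `u` and `b`, two of the positions `y` agree. One remains the position of `v`; at the
  -- other the edges to the ends are forgotten and its vertex becomes `a`, so that its edge with `u`
  -- and `b` is the edge `u a b`.
  grow-a : ∀ {n θ c} x l b (y k : Fin n → P) → 𝟎 ≤ θ → (∀ i → θ ≤ codegree₃ x (y i) l (k i) b) →
    𝟎 < c → c + c ≤ θ * θ → 𝟏 < ι n * c →
    ∃ λ i → ∃ λ j → i Fin.< j × c ≤ fork x (y i) l (k i) (y j) b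
  grow-a {n} x l b y k θ≥0 lower c>0 2c≤ big =
    let (i , j , i<j , p) = pigeonhole (μ x ⊗ᴹ μ b) {m = n} (λ i (u , β) → h i u β) (λ i (u , β) → h-unit i u β) θ≥0
          (λ i → ℚ.≤-trans (lower i) (≤-refl′ (𝔼-cong (μ x) λ u → 𝔼-h i u))) c>0 2c≤ big
    in i , j , i<j , ℚ.≤-trans p (ℚ.≤-trans
      (𝔼-mono (μ x) λ u → 𝔼-mono (μ b) λ β → *-monoˡ (proj₁ (h-unit i u β)) (h-≤ j u β))
      (≤-refl′ (trans (𝔼-cong (μ x) λ u → trans (𝔼-cong (μ b) λ β →
          trans (sym (𝔼-* (μ (y j)) (h i u β) (λ α → E u α β))) (𝔼-cong (μ (y j)) λ α → swap (h i u β) (E u α β)))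
          (fubini b (y j) _)) (trans (fubini x (y j) _) (𝔼-cong (μ (y j)) λ α → fubini x b _)))))
    where
    h : Fin n → V → V → ℚ
    h i u β = 𝔼 (μ (y i)) λ v → E u v β * (d l u v * d (k i) u v)
    h-unit : ∀ i u β → Unit (h i u β)
    h-unit i u β = Unit-𝔼 (μ (y i)) λ v → Unit-* (E-unit u v β) (Unit-* (d-unit l u v) (d-unit (k i) u v))
    h-≤ : ∀ j u β → h j u β ≤ 𝔼 (μ (y j)) (λ α → E u α β)
    h-≤ j u β = 𝔼-mono (μ (y j)) λ v → *-≤ˡ (proj₁ (E-unit u v β)) (proj₂ (Unit-* (d-unit l u v) (d-unit (k j) u v)))
    swap : ∀ s t → s * t ≡ t * s
    swap s t = solve 2 (λ a b → a :* b := b :* a) refl _ _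
    𝔼-h : ∀ i u → 𝔼 (μ (y i)) (λ v → d l u v * d (k i) u v * d b u v) ≡ 𝔼 (μ b) (h i u)
    𝔼-h i u = sym (trans (fubini b (y i) _) (𝔼-cong (μ (y i)) λ v → trans (𝔼-*ʳ (μ b) _ (λ β → E u v β)) (swap (d b u v) _)))

  -- Almost orthogonal differences of d's have small correlation with most functions.
  indistinct : ∀ {n ν ρ τ} x y a b (k k′ : Fin n → P) → 𝟎 ≤ ν → ι 2 * ν * ι n ≤ 𝟏 → ι 2 < ι n * (τ * τ) →
    (∀ {i j} → i Fin.< j → Within ν ρ (codegree x y (k i) (k j)) × Within ν ρ (codegree x y (k i) (k′ j)) ×
      Within ν ρ (codegree x y (k′ i) (k j)) × Within ν ρ (codegree x y (k′ i) (k′ j))) →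
    ∃ λ i → distance x y (k i) (k′ i) a b ≤ τ * τ
  indistinct {zero} x y a b k k′ ν≥0 fit big gram = ⊥-elim (≤⇒≯ (≤-by (ι-nonneg 2) (solve 1 (λ a → (lit 2) :- (lit 0) :* (a :* a) := (lit 2) :- (lit 0)) refl _)) big)
  indistinct {n@(suc _)} {ν} {ρ} {τ} x y a b k k′ ν≥0 fit big gram = ∑-term-≤ (λ i → distance x y (k i) (k′ i) a b)
      (ℚ.≤-trans (≤-refl′ (trans (sym (𝔼-∑ {n = n} (μ a) (λ i α → 𝔼 (μ b) (square i α)))) (𝔼-cong (μ a) λ α → sym (𝔼-∑ {n = n} (μ b) (λ i → square i α)))))
        (ℚ.≤-trans (𝔼-≤ (μ a) λ α → 𝔼-≤ (μ b) λ β → bound α β) (ℚ.<⇒≤ big)))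
    where
    square : Fin n → V → V → ℚ
    square i α β = (petal x y (k i) α β - petal x y (k′ i) α β) * (petal x y (k i) α β - petal x y (k′ i) α β)
    M : Mean (V × V)
    M = μ x ⊗ᴹ μ y
    e : Fin n → V × V → ℚ
    e i (u , v) = d (k i) u v - d (k′ i) u v
    F : V → V → V × V → ℚ
    F α β (u , v) = E u α β * E u v β
    inner : ∀ i j → 𝔼 M (λ z → e i z * e j z) ≡
      (codegree x y (k i) (k j) - codegree x y (k i) (k′ j)) - (codegree x y (k′ i) (k j) - codegree x y (k′ i) (k′ j))
    inner i j = trans (𝔼-cong M {g = λ (u , v) → (d (k i) u v * d (k j) u v - d (k i) u v * d (k′ j) u v) -
        (d (k′ i) u v * d (k j) u v - d (k′ i) u v * d (k′ j) u v)} (λ z → (solve 4 (λ a b c d → (a :- b) :* (c :- d) := a :* c :- a :* d :- (b :* c :- b :* d)) refl _ _ _ _)))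
      (trans (𝔼-sub M _ _) (cong₂ _-_ (𝔼-sub M _ _) (𝔼-sub M _ _)))
    -- The four codegrees enter with signs +, -, -, +. Their common value `ρ` cancels and an error
    -- of at most `2ν` is left.
    almost : ∀ {i j} → i Fin.< j → - (ι 2 * ν) ≤ 𝔼 M (λ z → e i z * e j z) × 𝔼 M (λ z → e i z * e j z) ≤ ι 2 * ν
    almost {i} {j} p with gram p
    ... | A , B , C , D = ℚ.≤-trans (≤-by (proj₁ A ⊕ proj₂ B ⊕ proj₂ C ⊕ proj₁ D) (solve 6 (λ a b c d e f → a :- b :- (c :- d) :- (:- ((lit 2) :* e)) := a :+ (f :+ e :+ (f :+ e :+ d)) :- (f :+ (b :+ (c :+ f)))) refl _ _ _ _ _ _)) (≤-refl′ (sym (inner i j))) ,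
      ℚ.≤-trans (≤-refl′ (inner i j)) (≤-by (proj₂ A ⊕ proj₁ B ⊕ proj₁ C ⊕ proj₂ D) (solve 6 (λ a b c d e f → (lit 2) :* a :- (b :- c :- (d :- e)) := f :+ a :+ (c :+ (d :+ (f :+ a))) :- (b :+ (f :+ (f :+ e)))) refl _ _ _ _ _ _))
    orth : ∀ i j → i ≢ j → - (ι 2 * ν) ≤ 𝔼 M (λ z → e i z * e j z) × 𝔼 M (λ z → e i z * e j z) ≤ ι 2 * ν
    orth i j i≢j with ℕ.<-cmp (Fin.toℕ i) (Fin.toℕ j)
    ... | tri< p _ _ = almost p
    ... | tri≈ _ p _ = ⊥-elim (i≢j (Fin.toℕ-injective p))
    ... | tri> _ _ p = subst (λ z → - (ι 2 * ν) ≤ z × z ≤ ι 2 * ν) (𝔼-cong M (λ z → swap (e j z) (e i z))) (almost p)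
      where
      swap : ∀ s t → s * t ≡ t * s
      swap s t = solve 2 (λ a b → a :* b := b :* a) refl _ _
    difference-square : ∀ {s t} → Unit s → Unit t → (s - t) * (s - t) ≤ 𝟏
    difference-square {s} {t} us ut = ≤-by ((≤-by {c = 𝟎} {d = 𝟏 - (t - s)} (proj₁ us ⊕ proj₂ ut) (solve 2 (λ a b → (lit 1) :- (a :- b) :- (lit 0) := b :+ (lit 1) :- ((lit 0) :+ a)) refl _ _)) ⊗′ ≤-by {c = 𝟎} {d = 𝟏 - (s - t)} (proj₂ us ⊕ proj₁ ut) (solve 2 (λ a b → (lit 1) :- (a :- b) :- (lit 0) := (lit 1) :+ b :- (a :+ (lit 0))) refl _ _)) (solve 2 (λ a b → (lit 1) :- (a :- b) :* (a :- b) := ((lit 1) :- (b :- a)) :* ((lit 1) :- (a :- b)) :- (lit 0)) refl _ _)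
      where
      _⊗′_ : ∀ {p q} → 𝟎 ≤ p → 𝟎 ≤ q → 𝟎 ≤ p * q
      _⊗′_ = *-nonneg
    petal-difference : ∀ i α β → 𝔼 M (λ z → e i z * F α β z) ≡ petal x y (k i) α β - petal x y (k′ i) α β
    petal-difference i α β = trans (𝔼-cong (μ x) λ u → trans
        (𝔼-cong (μ y) {g = λ v → E u α β * (E u v β * d (k i) u v) - E u α β * (E u v β * d (k′ i) u v)} (λ v → (solve 4 (λ a b c d → (a :- b) :* (c :* d) := c :* (d :* a) :- c :* (d :* b)) refl _ _ _ _)))
        (trans (𝔼-sub (μ y) _ _) (cong₂ _-_ (𝔼-* (μ y) _ _) (𝔼-* (μ y) _ _)))) (𝔼-sub (μ x) _ _)
    -- Bessel's inequality bounds this sum by `1 + 2νn`, hence by 2, for each `α` and `β`,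
    -- independently of the number `n` of differences. As `nτ² > 2`, one of them is small on
    -- average.
    bound : ∀ α β → ∑ (λ i → (petal x y (k i) α β - petal x y (k′ i) α β) * (petal x y (k i) α β - petal x y (k′ i) α β)) ≤ ι 2
    bound α β = ℚ.≤-trans (≤-refl′ (∑-cong {n} (λ i → cong₂ _*_ (sym (petal-difference i α β)) (sym (petal-difference i α β)))))
      (ℚ.≤-trans (bessel M {m = n} e (F α β) (λ i → 𝔼-≤ M (λ (u , v) → difference-square (d-unit (k i) u v) (d-unit (k′ i) u v))) orth
          (𝔼-≤ M (λ (u , v) → let w = Unit-* (E-unit u α β) (E-unit u v β) in proj₂ (Unit-* w w))) (*-nonneg (ι-nonneg 2) ν≥0))
        (≤-by fit (solve 2 (λ a b → (lit 2) :- ((lit 1) :+ (lit 2) :* a :* b) := (lit 1) :- (lit 2) :* a :* b) refl _ _)))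

-- H¹ with vertices a, b, c₀ = u₁, c₁ = v₁, d₀ = u₂, d₁ = v₂, e₀ = u₃, e₁ = v₃,
-- where f, g, h take the place of the edges c₀c₁d₁, d₀d₁e₁, e₀e₁c₁.
flower : ∀ {V : Set} (E f g h : V → V → V → ℚ) → Vec V 8 → ℚ
flower E f g h (α ∷ β ∷ u₁ ∷ v₁ ∷ u₂ ∷ v₂ ∷ u₃ ∷ v₃ ∷ []) =
  (E u₁ α β * (E u₁ v₁ β * f u₁ v₁ v₂)) * ((E u₂ α β * (E u₂ v₂ β * g u₂ v₂ v₃)) * (E u₃ α β * (E u₃ v₃ β * h u₃ v₃ v₁)))

module Cycle (S : System) where
  open System S
  open Petals S

  -- All petals share `a`, `b` and the ends `l` and `k`. The field `right` says that a later `Y j`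
  -- may take the place of the end `k`, the field `left` that an earlier `Y i` may take the place of
  -- `l`. This makes petals fit onto each other in both directions.
  record Chain (n : ℕ) (θ τ : ℚ) : Set where
    field
      X Y     : Fin n → P
      l k a b : P
      heavy   : ∀ i → θ ≤ fork (X i) (Y i) l k a b
      right   : ∀ {i j} → i Fin.< j → distance (X i) (Y i) (Y j) k a b ≤ τ * τ
      left    : ∀ {i j} → i Fin.< j → distance (X j) (Y j) l (Y i) a b ≤ τ * τ
      X≢Y     : ∀ i j → X i ≢ Y j
      Y≢Y     : ∀ {i j} → i Fin.< j → Y i ≢ Y j
      X≢b     : ∀ i → X i ≢ b
      Y≢b     : ∀ i → Y i ≢ b

  module _ {m n : ℕ} {θ τ c c′ : ℚ} (ch : Chain (m ℕ.* n) θ τ) (τ≥0 : 𝟎 ≤ τ) where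
    open Chain ch

    -- Three two-ended petals at `i < j < h` live on common `a` and `b`. The first two keep the end
    -- `k`, replaced by `Y j` and `Y h`; the last keeps `l`, replaced by `Y i`, which closes the
    -- cycle. Each replacement costs `τ`.
    closed-cycle : 𝟎 ≤ θ → 𝟎 < c → c + c ≤ θ * θ → 𝟏 < ι n * c → 𝟎 < c′ → c′ + c′ ≤ c * c → 𝟏 < ι m * c′ →
      ∃ λ i → ∃ λ j → ∃ λ h → i Fin.< j × j Fin.< h ×
        c′ ≤ ι 3 * τ + 𝔼 (μ a) (λ α → 𝔼 (μ b) λ β →
          petal (X i) (Y i) (Y j) α β * (petal (X j) (Y j) (Y h) α β * petal (X h) (Y h) (Y i) α β))
    closed-cycle θ≥0 c>0 2c≤ n-big c′>0 2c′≤ m-big =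
      let (i , j , h , i<j , j<h , p) = pigeonhole₃ M {m} {n} (λ i (α , β) → petal₂ (X i) (Y i) l k α β)
            (λ i (α , β) → petal₂-unit (X i) (Y i) l k α β) θ≥0 heavy c>0 2c≤ n-big c′>0 2c′≤ m-big
      in i , j , h , i<j , j<h , ℚ.≤-trans p (step i j h i<j j<h)
      where
      M : Mean (V × V)
      M = μ a ⊗ᴹ μ b

      step : ∀ i j h → i Fin.< j → j Fin.< h →
        𝔼 M (λ (α , β) → petal₂ (X i) (Y i) l k α β * petal₂ (X j) (Y j) l k α β * petal₂ (X h) (Y h) l k α β) ≤
        ι 3 * τ + 𝔼 M (λ (α , β) → petal (X i) (Y i) (Y j) α β * (petal (X j) (Y j) (Y h) α β * petal (X h) (Y h) (Y i) α β))
      step i j h i<j j<h = ℚ.≤-trans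
          (𝔼-mono M λ (α , β) → product-mono (proj₁ (petal₂-unit (X i) (Y i) l k α β)) (proj₁ (petal₂-unit (X j) (Y j) l k α β)) (proj₁ (petal₂-unit (X h) (Y h) l k α β))
            (petal₂-≤ʳ (X i) (Y i) l k α β) (petal₂-≤ʳ (X j) (Y j) l k α β) (petal₂-≤ˡ (X h) (Y h) l k α β))
          (≤-by (proj₁ (square-bound M (λ z → p₂ z * p₃ z) (λ z → q₁ z - p₁ z) (λ z → Unit-* (p₂-unit z) (p₃-unit z)) τ≥0 (right i<j))
              ⊕ proj₁ (square-bound M (λ z → q₁ z * p₃ z) (λ z → q₂ z - p₂ z) (λ z → Unit-* (q₁-unit z) (p₃-unit z)) τ≥0 (right j<h))
              ⊕ proj₂ (square-bound M (λ z → q₁ z * q₂ z) (λ z → p₃ z - q₃ z) (λ z → Unit-* (q₁-unit z) (q₂-unit z)) τ≥0 (left (ℕ.<-trans i<j j<h))))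
            (trans (cong (λ z → ι 3 * τ + 𝔼 M (λ z → q₁ z * (q₂ z * q₃ z)) - z) telescope) (regroup _ _ _ _ τ)))
        where
        p₁ p₂ p₃ q₁ q₂ q₃ : V × V → ℚ
        p₁ (α , β) = petal (X i) (Y i) k α β
        p₂ (α , β) = petal (X j) (Y j) k α β
        p₃ (α , β) = petal (X h) (Y h) l α β
        q₁ (α , β) = petal (X i) (Y i) (Y j) α β
        q₂ (α , β) = petal (X j) (Y j) (Y h) α β
        q₃ (α , β) = petal (X h) (Y h) (Y i) α β
        p₂-unit : ∀ z → Unit (p₂ z)
        p₂-unit (α , β) = petal-unit _ _ _ α β
        p₃-unit : ∀ z → Unit (p₃ z)
        p₃-unit (α , β) = petal-unit _ _ _ α β
        q₁-unit : ∀ z → Unit (q₁ z)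
        q₁-unit (α , β) = petal-unit _ _ _ α β
        q₂-unit : ∀ z → Unit (q₂ z)
        q₂-unit (α , β) = petal-unit _ _ _ α β

        product-mono : ∀ {u v w u′ v′ w′} → 𝟎 ≤ u → 𝟎 ≤ v → 𝟎 ≤ w → u ≤ u′ → v ≤ v′ → w ≤ w′ → u * v * w ≤ u′ * v′ * w′
        product-mono u≥0 v≥0 w≥0 p q r = ℚ.≤-trans (*-monoˡ (*-nonneg u≥0 v≥0) r)
          (*-monoʳ (ℚ.≤-trans w≥0 r) (ℚ.≤-trans (*-monoˡ u≥0 q) (*-monoʳ (ℚ.≤-trans v≥0 q) p)))

        telescope : 𝔼 M (λ z → p₁ z * p₂ z * p₃ z) ≡ 𝔼 M (λ z → q₁ z * (q₂ z * q₃ z)) +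
          (𝔼 M (λ z → (q₁ z * q₂ z) * (p₃ z - q₃ z)) - (𝔼 M (λ z → (p₂ z * p₃ z) * (q₁ z - p₁ z)) + 𝔼 M (λ z → (q₁ z * p₃ z) * (q₂ z - p₂ z))))
        telescope = trans (𝔼-cong M {g = λ z → q₁ z * (q₂ z * q₃ z) + ((q₁ z * q₂ z) * (p₃ z - q₃ z) -
            ((p₂ z * p₃ z) * (q₁ z - p₁ z) + (q₁ z * p₃ z) * (q₂ z - p₂ z)))} (λ z → identity (p₁ z) (p₂ z) (p₃ z) (q₁ z) (q₂ z) (q₃ z)))
          (trans (𝔼-+ M _ _) (cong (𝔼 M (λ z → q₁ z * (q₂ z * q₃ z)) +_) (trans (𝔼-sub M _ _)
            (cong (λ w → 𝔼 M (λ z → (q₁ z * q₂ z) * (p₃ z - q₃ z)) - w) (𝔼-+ M _ _)))))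
          where
          identity : ∀ p q r s t u → p * q * r ≡ s * (t * u) + ((s * t) * (r - u) - ((q * r) * (s - p) + (s * r) * (t - q)))
          identity p q r s t u = solve 6 (λ a b c d e f → a :* b :* c := d :* (e :* f) :+ (d :* e :* (c :- f) :- (b :* c :* (d :- a) :+ d :* c :* (e :- b)))) refl _ _ _ _ _ _
        regroup : ∀ w x y z t → ι 3 * t + w - (w + (x - (y + z))) ≡ (y + (z + t)) - (- t + (- t + x))
        regroup w x y z t = solve 5 (λ a b c d e → (lit 3) :* a :+ b :- (b :+ (c :- (d :+ e))) := d :+ (e :+ a) :- ((:- a) :+ ((:- a) :+ c))) refl _ _ _ _ _

  -- `tower` isolates the coordinate `i`. Averaged over it, the two integrands differ by a bounded
  -- factor `R` times a deviation `u` that is small in the mean square.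
  replace : ∀ {n ε} (ps : Vec P n) i (F F′ R u : Vec V n → ℚ) →
    (∀ ρ → 𝔼 (μ (lookup ps i)) (λ v → F (ρ [ i ]≔ v) - F′ (ρ [ i ]≔ v)) ≡ R ρ * u ρ) →
    (∀ ρ → Unit (R ρ)) → 𝟎 ≤ ε → 𝔼 (μ* ps) (λ ρ → u ρ * u ρ) ≤ ε * ε → 𝔼 (μ* ps) F′ ≤ ε + 𝔼 (μ* ps) F
  replace {ε = ε} ps i F F′ R u e R-unit ε≥0 small = ≤-by (proj₁ (square-bound (μ* ps) R u R-unit ε≥0 small))
    (trans (regroup ε (𝔼 (μ* ps) F) (𝔼 (μ* ps) F′)) (cong (_- - ε) (trans (sym (𝔼-sub (μ* ps) F F′))
      (trans (tower ps i (λ ρ → F ρ - F′ ρ)) (𝔼-cong (μ* ps) e)))))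
    where
    regroup : ∀ ε x y → ε + x - y ≡ (x - y) - - ε
    regroup ε x y = solve 3 (λ a b c → a :+ b :- c := b :- c :- (:- a)) refl _ _ _

  module _ {r ε} (reg : Regular r ε) (ε≥0 : 𝟎 ≤ ε) (a b X₁ Y₁ X₂ Y₂ X₃ Y₃ : P)
    (D₁ : Distinct (Y₁ ∷ X₁ ∷ b ∷ Y₂ ∷ [])) (D₂ : Distinct (Y₂ ∷ X₂ ∷ b ∷ Y₃ ∷ [])) (D₃ : Distinct (Y₃ ∷ X₃ ∷ b ∷ Y₁ ∷ [])) where
    open Regular reg

    private
      ps : Vec P 8
      ps = a ∷ b ∷ X₁ ∷ Y₁ ∷ X₂ ∷ Y₂ ∷ X₃ ∷ Y₃ ∷ []
      M : Mean (Vec V 8)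
      M = μ* ps
      d′ : P → V → V → V → ℚ
      d′ k u v _ = d k u v
      i₁ i₂ i₃ i₄ i₅ i₆ i₇ : Fin 8
      i₁ = suc zero
      i₂ = suc (suc zero)
      i₃ = suc (suc (suc zero))
      i₄ = suc (suc (suc (suc zero)))
      i₅ = suc (suc (suc (suc (suc zero))))
      i₆ = suc (suc (suc (suc (suc (suc zero)))))
      i₇ = suc (suc (suc (suc (suc (suc (suc zero))))))

      deviation : P → (V → ℚ) → (V → ℚ) → ℚ
      deviation y g φ = 𝔼 (μ y) (λ v → (g v - 𝔼 (μ y) g) * φ v)

      u₁′ u₂′ u₃′ R₁ R₂ R₃ : Vec V 8 → ℚ
      u₁′ (α ∷ β ∷ u₁ ∷ v₁ ∷ u₂ ∷ v₂ ∷ u₃ ∷ v₃ ∷ []) = deviation Y₂ (E u₁ v₁) (hitting E (u₂ ∷ β ∷ v₃ ∷ []))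
      u₂′ (α ∷ β ∷ u₁ ∷ v₁ ∷ u₂ ∷ v₂ ∷ u₃ ∷ v₃ ∷ []) = deviation Y₃ (E u₂ v₂) (hitting E (u₃ ∷ β ∷ v₁ ∷ []))
      u₃′ (α ∷ β ∷ u₁ ∷ v₁ ∷ u₂ ∷ v₂ ∷ u₃ ∷ v₃ ∷ []) = deviation Y₁ (E u₃ v₃) (λ v → E u₁ v β * d Y₂ u₁ v)
      R₁ (α ∷ β ∷ u₁ ∷ v₁ ∷ u₂ ∷ v₂ ∷ u₃ ∷ v₃ ∷ []) = (E u₁ α β * E u₁ v₁ β) * (E u₂ α β * (E u₃ α β * (E u₃ v₃ β * E u₃ v₃ v₁)))
      R₂ (α ∷ β ∷ u₁ ∷ v₁ ∷ u₂ ∷ v₂ ∷ u₃ ∷ v₃ ∷ []) = (E u₁ α β * (E u₁ v₁ β * d Y₂ u₁ v₁)) * ((E u₂ α β * E u₂ v₂ β) * E u₃ α β)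
      R₃ (α ∷ β ∷ u₁ ∷ v₁ ∷ u₂ ∷ v₂ ∷ u₃ ∷ v₃ ∷ []) = E u₁ α β * ((E u₂ α β * (E u₂ v₂ β * d Y₃ u₂ v₂)) * (E u₃ α β * E u₃ v₃ β))

      tower₂ : ∀ i j {c} (f : Vec V 8 → ℚ) →
        (∀ ρ → 𝔼 (μ (lookup ps j)) (λ w → 𝔼 (μ (lookup ps i)) λ v → f ((ρ [ j ]≔ w) [ i ]≔ v)) ≤ c) → 𝔼 M f ≤ c
      tower₂ i j f p = ℚ.≤-trans (≤-refl′ (trans (tower ps i f) (tower ps j (λ ρ → 𝔼 (μ (lookup ps i)) λ v → f (ρ [ i ]≔ v))))) (𝔼-≤ M p)

      tower₃ : ∀ i j k {c} (f : Vec V 8 → ℚ) → (∀ ρ → 𝔼 (μ (lookup ps k)) (λ x →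
        𝔼 (μ (lookup ps j)) λ w → 𝔼 (μ (lookup ps i)) λ v → f (((ρ [ k ]≔ x) [ j ]≔ w) [ i ]≔ v)) ≤ c) → 𝔼 M f ≤ c
      tower₃ i j k f p = ℚ.≤-trans (≤-refl′ (tower ps i f)) (tower₂ j k (λ ρ → 𝔼 (μ (lookup ps i)) λ v → f (ρ [ i ]≔ v)) p)

      pull : ∀ y c g φ f → (∀ v → f v ≡ c * ((g v - 𝔼 (μ y) g) * φ v)) → 𝔼 (μ y) f ≡ c * deviation y g φ
      pull y c g φ f e = trans (𝔼-cong (μ y) e) (𝔼-* (μ y) c _)

      replace₁ : 𝔼 M (flower E (d′ Y₂) E E) ≤ ε + 𝔼 M (flower E E E E)
      replace₁ = replace ps i₅ (flower E E E E) (flower E (d′ Y₂) E E) R₁ u₁′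
        (λ { (α ∷ β ∷ u₁ ∷ v₁ ∷ u₂ ∷ v₂ ∷ u₃ ∷ v₃ ∷ []) → pull Y₂ _ (E u₁ v₁) (hitting E (u₂ ∷ β ∷ v₃ ∷ [])) _ (λ v →
          identity (E u₁ α β) (E u₁ v₁ β) (E u₁ v₁ v) (d Y₂ u₁ v₁) (E u₂ α β) (E u₂ v β) (E u₂ v v₃) (E u₃ α β) (E u₃ v₃ β) (E u₃ v₃ v₁)) })
        (λ { (α ∷ β ∷ u₁ ∷ v₁ ∷ u₂ ∷ v₂ ∷ u₃ ∷ v₃ ∷ []) → Unit-* (Unit-* (E-unit _ _ _) (E-unit _ _ _))
          (Unit-* (E-unit _ _ _) (Unit-* (E-unit _ _ _) (Unit-* (E-unit _ _ _) (E-unit _ _ _)))) })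
        ε≥0
        (tower₃ i₇ i₁ i₄ (λ ρ → u₁′ ρ * u₁′ ρ)
          (λ { (α ∷ β ∷ u₁ ∷ v₁ ∷ u₂ ∷ v₂ ∷ u₃ ∷ v₃ ∷ []) → regular-hitting (X₂ ∷ b ∷ Y₃ ∷ []) Y₂ D₂ (E u₁ v₁) (E-unit u₁ v₁) }))
        where
        identity : ∀ a b c c′ d e f g h i → (a * (b * c)) * ((d * (e * f)) * (g * (h * i))) - (a * (b * c′)) * ((d * (e * f)) * (g * (h * i)))
          ≡ ((a * b) * (d * (g * (h * i)))) * ((c - c′) * (e * f))
        identity a b c c′ d e f g h i = solve 10 (λ a b c d e f g h i j → a :* (b :* c) :* (d :* (e :* f) :* (g :* (h :* i))) :- a :* (b :* j) :* (d :* (e :* f) :* (g :* (h :* i))) := a :* b :* (d :* (g :* (h :* i))) :* ((c :- j) :* (e :* f))) refl _ _ _ _ _ _ _ _ _ _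

      replace₂ : 𝔼 M (flower E (d′ Y₂) (d′ Y₃) E) ≤ ε + 𝔼 M (flower E (d′ Y₂) E E)
      replace₂ = replace ps i₇ (flower E (d′ Y₂) E E) (flower E (d′ Y₂) (d′ Y₃) E) R₂ u₂′
        (λ { (α ∷ β ∷ u₁ ∷ v₁ ∷ u₂ ∷ v₂ ∷ u₃ ∷ v₃ ∷ []) → pull Y₃ _ (E u₂ v₂) (hitting E (u₃ ∷ β ∷ v₁ ∷ [])) _ (λ v →
          identity (E u₁ α β * (E u₁ v₁ β * d Y₂ u₁ v₁)) (E u₂ α β) (E u₂ v₂ β) (E u₂ v₂ v) (d Y₃ u₂ v₂) (E u₃ α β) (E u₃ v β) (E u₃ v v₁)) })
        (λ { (α ∷ β ∷ u₁ ∷ v₁ ∷ u₂ ∷ v₂ ∷ u₃ ∷ v₃ ∷ []) → Unit-* (Unit-* (E-unit _ _ _) (Unit-* (E-unit _ _ _) (d-unit _ _ _)))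
          (Unit-* (Unit-* (E-unit _ _ _) (E-unit _ _ _)) (E-unit _ _ _)) })
        ε≥0
        (tower₃ i₃ i₁ i₆ (λ ρ → u₂′ ρ * u₂′ ρ)
          (λ { (α ∷ β ∷ u₁ ∷ v₁ ∷ u₂ ∷ v₂ ∷ u₃ ∷ v₃ ∷ []) → regular-hitting (X₃ ∷ b ∷ Y₁ ∷ []) Y₃ D₃ (E u₂ v₂) (E-unit u₂ v₂) }))
        where
        identity : ∀ a d e f f′ g h i → a * ((d * (e * f)) * (g * (h * i))) - a * ((d * (e * f′)) * (g * (h * i)))
          ≡ (a * ((d * e) * g)) * ((f - f′) * (h * i))
        identity a d e f f′ g h i = solve 8 (λ a b c d e f g h → a :* (b :* (c :* d) :* (e :* (f :* g))) :- a :* (b :* (c :* h) :* (e :* (f :* g))) := a :* (b :* c :* e) :* ((d :- h) :* (f :* g))) refl _ _ _ _ _ _ _ _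

      -- The vertex `v₁` becomes the true end of the third petal while the first petal still carries
      -- the density `d Y₂`. Sampling a vertex from `Y₂` turns the product of `E u₁ v β` with this
      -- density into a mean of `hitting` functions.
      replace₃ : 𝔼 M (flower E (d′ Y₂) (d′ Y₃) (d′ Y₁)) ≤ ε + 𝔼 M (flower E (d′ Y₂) (d′ Y₃) E)
      replace₃ = replace ps i₃ (flower E (d′ Y₂) (d′ Y₃) E) (flower E (d′ Y₂) (d′ Y₃) (d′ Y₁)) R₃ u₃′
        (λ { (α ∷ β ∷ u₁ ∷ v₁ ∷ u₂ ∷ v₂ ∷ u₃ ∷ v₃ ∷ []) → pull Y₁ _ (E u₃ v₃) (λ v → E u₁ v β * d Y₂ u₁ v) _ (λ v →
          identity (E u₁ α β) (E u₁ v β) (d Y₂ u₁ v) (E u₂ α β * (E u₂ v₂ β * d Y₃ u₂ v₂)) (E u₃ α β) (E u₃ v₃ β) (E u₃ v₃ v) (d Y₁ u₃ v₃)) })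
        (λ { (α ∷ β ∷ u₁ ∷ v₁ ∷ u₂ ∷ v₂ ∷ u₃ ∷ v₃ ∷ []) → Unit-* (E-unit _ _ _) (Unit-* (Unit-* (E-unit _ _ _) (Unit-* (E-unit _ _ _) (d-unit _ _ _)))
          (Unit-* (E-unit _ _ _) (E-unit _ _ _))) })
        ε≥0
        (tower₂ i₁ i₂ (λ ρ → u₃′ ρ * u₃′ ρ)
          (λ { (α ∷ β ∷ u₁ ∷ v₁ ∷ u₂ ∷ v₂ ∷ u₃ ∷ v₃ ∷ []) → ℚ.≤-trans
            (𝔼-mono (μ X₁) λ u → 𝔼-mono (μ b) λ β → sampled u β (E u₃ v₃))
            (regular-hitting (X₁ ∷ b ∷ Y₂ ∷ []) Y₁ D₁ (E u₃ v₃) (E-unit u₃ v₃)) }))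
        where
        identity : ∀ a b c d e f g g′ → (a * (b * c)) * (d * (e * (f * g))) - (a * (b * c)) * (d * (e * (f * g′)))
          ≡ (a * (d * (e * f))) * ((g - g′) * (b * c))
        identity a b c d e f g g′ = solve 8 (λ a b c d e f g h → a :* (b :* c) :* (d :* (e :* (f :* g))) :- a :* (b :* c) :* (d :* (e :* (f :* h))) := a :* (d :* (e :* f)) :* ((g :- h) :* (b :* c))) refl _ _ _ _ _ _ _ _
        sampled : ∀ u β g → deviation Y₁ g (λ v → E u v β * d Y₂ u v) * deviation Y₁ g (λ v → E u v β * d Y₂ u v) ≤
          𝔼 (μ Y₂) (λ w → deviation Y₁ g (hitting E (u ∷ β ∷ w ∷ [])) * deviation Y₁ g (hitting E (u ∷ β ∷ w ∷ [])))
        sampled u β g = ℚ.≤-trans (≤-refl′ (cong₂ _*_ e e)) (jensen (μ Y₂) _)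
          where
          e : deviation Y₁ g (λ v → E u v β * d Y₂ u v) ≡ 𝔼 (μ Y₂) (λ w → deviation Y₁ g (hitting E (u ∷ β ∷ w ∷ [])))
          e = trans (𝔼-cong (μ Y₁) (λ v → trans (cong ((g v - 𝔼 (μ Y₁) g) *_) (sym (𝔼-* (μ Y₂) _ _))) (sym (𝔼-* (μ Y₂) _ _)))) (fubini Y₁ Y₂ _)

      factor : ∀ (f g h : V → V → ℚ) → 𝔼 (μ X₁) (λ u₁ → 𝔼 (μ Y₁) λ v₁ → 𝔼 (μ X₂) λ u₂ → 𝔼 (μ Y₂) λ v₂ → 𝔼 (μ X₃) λ u₃ → 𝔼 (μ Y₃) λ v₃ →
          f u₁ v₁ * (g u₂ v₂ * h u₃ v₃)) ≡
        𝔼 (μ X₁) (λ u → 𝔼 (μ Y₁) λ v → f u v) * (𝔼 (μ X₂) (λ u → 𝔼 (μ Y₂) λ v → g u v) * 𝔼 (μ X₃) (λ u → 𝔼 (μ Y₃) λ v → h u v))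
      factor f g h = trans (𝔼-cong (μ X₁) λ u₁ → trans (𝔼-cong (μ Y₁) λ v₁ →
          trans (𝔼-cong (μ X₂) λ u₂ → trans (𝔼-cong (μ Y₂) λ v₂ → trans (𝔼-cong (μ X₃) λ u₃ → trans (𝔼-* (μ Y₃) _ _) (cong (f u₁ v₁ *_) (𝔼-* (μ Y₃) _ _)))
            (trans (𝔼-* (μ X₃) _ _) (cong (f u₁ v₁ *_) (𝔼-* (μ X₃) _ _)))) (trans (𝔼-* (μ Y₂) _ _) (cong (f u₁ v₁ *_) (𝔼-*ʳ (μ Y₂) _ _))))
            (trans (𝔼-* (μ X₂) _ _) (cong (f u₁ v₁ *_) (𝔼-*ʳ (μ X₂) _ _)))) (𝔼-*ʳ (μ Y₁) _ _)) (𝔼-*ʳ (μ X₁) _ _)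

    -- For fixed `a` and `b` the three petals occupy separate coordinates, so their product is one
    -- integral with densities at the ends. The densities are exchanged for edges at `v₁`, `v₃` and
    -- `v₂` in this order. At each of these vertices only two further edges, or an edge and a
    -- density, are in play, and regularity against `hitting` suffices.
    flower-bound : 𝔼 (μ a) (λ α → 𝔼 (μ b) λ β → petal X₁ Y₁ Y₂ α β * (petal X₂ Y₂ Y₃ α β * petal X₃ Y₃ Y₁ α β)) ≤ ι 3 * ε + 𝔼 (μ* ps) (flower E E E E)
    flower-bound = ℚ.≤-trans (≤-refl′ (𝔼-cong (μ a) λ α → 𝔼-cong (μ b) λ β → sym (trans (factor (weight Y₂ α β) (weight Y₃ α β) (weight Y₁ α β))
        (cong₂ _*_ (inner X₁ Y₁ Y₂ α β) (cong₂ _*_ (inner X₂ Y₂ Y₃ α β) (inner X₃ Y₃ Y₁ α β))))))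
      (≤-by (replace₁ ⊕ replace₂ ⊕ replace₃) (regroup (𝔼 M (flower E E E E)) (𝔼 M (flower E (d′ Y₂) E E)) (𝔼 M (flower E (d′ Y₂) (d′ Y₃) E)) (𝔼 M (flower E (d′ Y₂) (d′ Y₃) (d′ Y₁))) ε))
      where
      weight : P → V → V → V → V → ℚ
      weight k α β u v = E u α β * (E u v β * d k u v)
      inner : ∀ x y k α β → 𝔼 (μ x) (λ u → 𝔼 (μ y) λ v → weight k α β u v) ≡ petal x y k α β
      inner x y k α β = 𝔼-cong (μ x) λ u → 𝔼-* (μ y) _ _
      regroup : ∀ p q s t ε → ι 3 * ε + p - t ≡ ((ε + p) + ((ε + q) + (ε + s))) - (q + (s + t))
      regroup p q s t ε = solve 5 (λ a b c d e → (lit 3) :* a :+ b :- c := a :+ b :+ (a :+ d :+ (a :+ e)) :- (d :+ (e :+ c))) refl _ _ _ _ _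

-- `c₅`, `c₆`, `c₇`, `c₈` are the losses of `grow-b`, `grow-a` and the two uses of `pigeonhole`
-- inside `pigeonhole₃`. `τ` is a seventh of the last one; `ν` and `n₇` are what `indistinct`
-- requires for the distance `τ`.
record PetalConstants (θ : ℚ) : Set where
  field
    c₅ c₆ c₇ c₈ τ ν : ℚ
    n₅ n₆ n₇ m n : ℕ
    c₅>0 : 𝟎 < c₅
    c₆>0 : 𝟎 < c₆
    c₇>0 : 𝟎 < c₇
    c₈>0 : 𝟎 < c₈
    τ>0  : 𝟎 < τ
    ν>0  : 𝟎 < ν
    c₅≤  : c₅ + c₅ ≤ θ * θ
    c₆≤  : c₆ + c₆ ≤ c₅ * c₅
    c₇≤  : c₇ + c₇ ≤ c₆ * c₆
    c₈≤  : c₈ + c₈ ≤ c₇ * c₇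
    τ≤   : ι 7 * τ ≤ c₈
    ν≤   : ι 2 * ν * ι n₇ ≤ 𝟏
    n₅>  : 𝟏 < ι n₅ * c₅
    n₆>  : 𝟏 < ι n₆ * c₆
    n>   : 𝟏 < ι n * c₇
    m>   : 𝟏 < ι m * c₈
    n₇>  : ι 2 < ι n₇ * (τ * τ)

petalConstants : ∀ {θ} → 𝟎 < θ → PetalConstants θ
petalConstants θ>0 with halve θ>0
... | c₅ , c₅>0 , c₅≤ , n₅ , n₅> with halve c₅>0
...   | c₆ , c₆>0 , c₆≤ , n₆ , n₆> with halve c₆>0
...     | c₇ , c₇>0 , c₇≤ , n , n> with halve c₇>0
...       | c₈ , c₈>0 , c₈≤ , m , m> with fraction 6 c₈>0
...         | τ , τ>0 , τ≡ with exceed 2 (*-pos τ>0 τ>0)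
...           | n₇ , n₇> with fraction (2 ℕ.* n₇) 0<1
...             | ν , ν>0 , ν≡ = record
  { n₇ = n₇ ; ν = ν ; c₅>0 = c₅>0 ; c₆>0 = c₆>0 ; c₇>0 = c₇>0 ; c₈>0 = c₈>0 ; τ>0 = τ>0 ; ν>0 = ν>0
  ; c₅≤ = c₅≤ ; c₆≤ = c₆≤ ; c₇≤ = c₇≤ ; c₈≤ = c₈≤ ; τ≤ = ≤-refl′ τ≡
  ; ν≤ = fit ν (ι n₇) (ℚ.<⇒≤ ν>0) (trans (cong (_* ν) (trans (cong (𝟏 +_) (sym (ι-* 2 n₇))) (sym (ι-suc (2 ℕ.* n₇))))) ν≡)
  ; n₅> = n₅> ; n₆> = n₆> ; n> = n> ; m> = m> ; n₇> = n₇> }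
  where
  fit : ∀ ν x → 𝟎 ≤ ν → (𝟏 + ι 2 * x) * ν ≡ 𝟏 → ι 2 * ν * x ≤ 𝟏
  fit ν x ν≥0 e = ℚ.≤-trans {j = (𝟏 + ι 2 * x) * ν} (≤-by ν≥0 (solve 2 (λ a b → ((lit 1) :+ (lit 2) :* a) :* b :- (lit 2) :* b :* a := b :- (lit 0)) refl _ _)) (≤-refl′ e)

-- `k₅` to `k₈` are the lengths in which each pattern is sure to occur. The Ramsey numbers `N₈`,
-- `N₇`, `N₆`, `N₅` are computed backwards, each list leaving room for the steps after it. `n₁₂` and
-- `n₁₃` are the lengths used by the chains of the two modes.
record PetalParameters {θ} (C : PetalConstants θ) : Set₁ where
  open PetalConstants C public

  M : ℕ
  M = m ℕ.* n
  n₁₂ : ℕ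
  n₁₂ = suc (M ℕ.* 2 ℕ.+ 3)
  n₁₃ : ℕ
  n₁₃ = 2 ℕ.+ (M ℕ.+ 3)
  k₅ : ℕ
  k₅ = 3 ℕ.+ n₅
  k₆ : ℕ
  k₆ = 2 ℕ.+ (n₆ ℕ.* 2 ℕ.+ 1)
  k₇ : ℕ
  k₇ = 2 ℕ.+ (n₇ ℕ.* 2 ℕ.+ 2)
  k₈ : ℕ
  k₈ = suc (n₇ ℕ.* 2 ℕ.+ 3)
  N₈ : ℕ
  N₈ = ramseyNumber 6 (n₁₂ ℕ.+ n₁₃) k₈
  N₇ : ℕ
  N₇ = ramseyNumber 6 N₈ k₇

  field
    gram : Σ ℕ λ N → ∀ {A} (f : Fin 2 → Vec A 4 → ℚ) → (∀ i t → Unit (f i t)) → (L : Vec A N) →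
      Σ (Vec A N₇) λ K → K ⊑ L × (∀ i → Σ ℚ λ ρ → 𝟎 ≤ ρ × Hom (λ t → Within ν ρ (f i t)) K)

  N₆ : ℕ
  N₆ = ramseyNumber 6 (proj₁ gram) k₆
  N₅ : ℕ
  N₅ = ramseyNumber 5 N₆ k₅

-- In a quadruple p, q, y, k of positions with p < q < y < k the pair xy has the
-- common neighbours l and k, where {x, l} = {p, q}.
data Mode : Set where
  m₁₂ m₁₃ : Mode

module Petals′ (S : System) {θ} (θ>0 : 𝟎 < θ) {C : PetalConstants θ} (par : PetalParameters C) (mode : Mode) where
  open System S
  open Overlapping S
  open Petals S
  open Cycle S
  open PetalParameters par

  vertex ref : Mode → P → P → P
  vertex m₁₂ p q = q
  vertex m₁₃ p q = p
  ref m₁₂ p q = p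
  ref m₁₃ p q = q

  -- For the comparison of the end `l` with an earlier `Y`: two ends that both precede the vertex
  -- `x` in mode `m₁₂`, and both lie between `x` and `y` in mode `m₁₃`.
  vertex₃ ref₃ ref₃′ : Mode → P → P → P → P
  vertex₃ m₁₂ p q r = r
  vertex₃ m₁₃ p q r = p
  ref₃ m₁₂ p q r = p
  ref₃ m₁₃ p q r = q
  ref₃′ m₁₂ p q r = q
  ref₃′ m₁₃ p q r = r

  T₄ : Mode → Vec P 4 → Set
  T₄ o (p ∷ q ∷ y ∷ k ∷ []) = θ ≤ codegree (vertex o p q) y (ref o p q) k

  T₅ : Vec P 5 → Set
  T₅ (p ∷ q ∷ y ∷ k ∷ b ∷ []) = c₅ ≤ codegree₃ (vertex mode p q) y (ref mode p q) k b

  T₆ : Mode → Vec P 6 → Set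
  T₆ o (p ∷ q ∷ y ∷ k ∷ a ∷ b ∷ []) = c₆ ≤ fork (vertex o p q) y (ref o p q) k a b

  T₇ : Vec P 6 → Set
  T₇ (x ∷ y ∷ k ∷ k′ ∷ a ∷ b ∷ []) = distance x y k k′ a b ≤ τ * τ

  T₈ : Mode → Vec P 6 → Set
  T₈ o (p ∷ q ∷ r ∷ y ∷ a ∷ b ∷ []) = distance (vertex₃ o p q r) y (ref₃ o p q r) (ref₃′ o p q r) a b ≤ τ * τ

  T₅? : ∀ t → Dec (T₅ t)
  T₅? (p ∷ q ∷ y ∷ k ∷ b ∷ []) = c₅ ℚ.≤? codegree₃ (vertex mode p q) y (ref mode p q) k b

  T₆? : ∀ t → Dec (T₆ mode t)
  T₆? (p ∷ q ∷ y ∷ k ∷ a ∷ b ∷ []) = c₆ ℚ.≤? fork (vertex mode p q) y (ref mode p q) k a b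

  T₇? : ∀ t → Dec (T₇ t)
  T₇? (x ∷ y ∷ k ∷ k′ ∷ a ∷ b ∷ []) = distance x y k k′ a b ℚ.≤? τ * τ

  T₈? : ∀ t → Dec (T₈ mode t)
  T₈? (p ∷ q ∷ r ∷ y ∷ a ∷ b ∷ []) = distance (vertex₃ mode p q r) y (ref₃ mode p q r) (ref₃′ mode p q r) a b ℚ.≤? τ * τ

  find₅ : ∀ {N} {J : Vec P N} → Hom (T₄ mode) J → (K : Vec P k₅) → K ⊑ J → Σ (Vec P 5) λ t → t ⊑ K × T₅ t
  find₅ h (p ∷ q ∷ y ∷ ks) K⊑J =
    let (i , j , i<j , e) = grow-b (vertex mode p q) y (ref mode p q) ks (ℚ.<⇒≤ θ>0)
          (λ i → h (p ∷ q ∷ y ∷ lookup ks i ∷ []) (⊑-trans (keep (keep (keep (⊑-lookup ks i)))) K⊑J)) c₅>0 c₅≤ n₅>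
    in _ , keep (keep (keep (⊑-lookup₂ ks i<j))) , e

  find₆ : ∀ {N} {J : Vec P N} → Hom T₅ J → (K : Vec P k₆) → K ⊑ J → Σ (Vec P 6) λ t → t ⊑ K × T₆ mode t
  find₆ {J = J} h (p ∷ q ∷ K) = from (Vec.splitAt (n₆ ℕ.* 2) K)
    where
    from : ∀ {K} → (∃ λ (L : Vec P (n₆ ℕ.* 2)) → ∃ λ R → K ≡ L Vec.++ R) → p ∷ q ∷ K ⊑ J → Σ (Vec P 6) λ t → t ⊑ (p ∷ q ∷ K) × T₆ mode t
    from (L , b ∷ [] , refl) K⊑J =
      let (i , j , i<j , e) = grow-a {n₆} (vertex mode p q) (ref mode p q) b (odds n₆ L) (evens n₆ L) (ℚ.<⇒≤ c₅>0)
            (λ i → h (p ∷ q ∷ odds n₆ L i ∷ evens n₆ L i ∷ b ∷ []) (⊑-trans (keep (keep (⊑-++ (⊑-pair n₆ L i) ⊑-refl))) K⊑J)) c₆>0 c₆≤ n₆>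
      in (p ∷ q ∷ odds n₆ L i ∷ evens n₆ L i ∷ odds n₆ L j ∷ b ∷ []) ,
        keep (keep (⊑-++ (⊑-trans (keep (keep (keep (skip [])))) (⊑-pair₂ n₆ L i<j)) ⊑-refl)) , e

  gram₇ gram₈ : Vec P 4 → ℚ
  gram₇ (x ∷ y ∷ k ∷ k′ ∷ []) = codegree x y k k′
  gram₈ (p ∷ q ∷ r ∷ y ∷ []) = codegree (vertex₃ mode p q r) y (ref₃ mode p q r) (ref₃′ mode p q r)

  indistinct-pairs : ∀ {ρ} x y a b (L : Vec P (n₇ ℕ.* 2)) → (∀ {k k′} → k ∷ k′ ∷ [] ⊑ L → Within ν ρ (codegree x y k k′)) →
    ∃ λ i → distance x y (odds n₇ L i) (evens n₇ L i) a b ≤ τ * τ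
  indistinct-pairs x y a b L within = indistinct {n₇} {τ = τ} x y a b (odds n₇ L) (evens n₇ L) (ℚ.<⇒≤ ν>0) ν≤ n₇> (λ i<j →
    let s = ⊑-pair₂ n₇ L i<j in
    within (⊑-trans (keep (skip (keep (skip [])))) s) , within (⊑-trans (keep (skip (skip (keep [])))) s) ,
    within (⊑-trans (skip (keep (keep (skip [])))) s) , within (⊑-trans (skip (keep (skip (keep [])))) s))

  codegree-unit : ∀ x y k k′ → Unit (codegree x y k k′)
  codegree-unit x y k k′ = Unit-𝔼 (μ x) λ u → Unit-𝔼 (μ y) λ v → Unit-* (d-unit k u v) (d-unit k′ u v)

  find₇ : ∀ {N ρ} {J : Vec P N} → Hom (λ t → Within ν ρ (gram₇ t)) J → (K : Vec P k₇) → K ⊑ J → Σ (Vec P 6) λ t → t ⊑ K × T₇ t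
  find₇ {ρ = ρ} {J} h (x ∷ y ∷ K) = from (Vec.splitAt (n₇ ℕ.* 2) K)
    where
    from : ∀ {K} → (∃ λ (L : Vec P (n₇ ℕ.* 2)) → ∃ λ R → K ≡ L Vec.++ R) → x ∷ y ∷ K ⊑ J → Σ (Vec P 6) λ t → t ⊑ (x ∷ y ∷ K) × T₇ t
    from (L , a ∷ b ∷ [] , refl) K⊑J =
      let (i , e) = indistinct-pairs x y a b L (λ {k} {k′} t → h (x ∷ y ∷ k ∷ k′ ∷ []) (⊑-trans (keep (keep (⊑-trans t (⊑-++ˡ L)))) K⊑J))
      in (x ∷ y ∷ odds n₇ L i ∷ evens n₇ L i ∷ a ∷ b ∷ []) , keep (keep (⊑-++ (⊑-pair n₇ L i) ⊑-refl)) , e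

  grams : Fin 2 → Vec P 4 → ℚ
  grams zero = gram₇
  grams (suc zero) = gram₈

  grams-unit : ∀ i t → Unit (grams i t)
  grams-unit zero (x ∷ y ∷ k ∷ k′ ∷ []) = codegree-unit x y k k′
  grams-unit (suc zero) (p ∷ q ∷ r ∷ y ∷ []) = codegree-unit (vertex₃ mode p q r) y (ref₃ mode p q r) (ref₃′ mode p q r)

module Find₈ (S : System) {θ} (θ>0 : 𝟎 < θ) {C : PetalConstants θ} (par : PetalParameters C) where
  open System S
  open PetalParameters par
  open Petals S

  find₈ : ∀ mode → let open Petals′ S θ>0 par mode in
    ∀ {N ρ} {J : Vec P N} → Hom (λ t → Within ν ρ (gram₈ t)) J → (K : Vec P k₈) → K ⊑ J → Σ (Vec P 6) λ t → t ⊑ K × T₈ mode t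
  find₈ m₁₂ {ρ = ρ} {J} h K₀ K₀⊑J = shrink (tuple {r = n₇ ℕ.* 2 ℕ.+ 4} (ℕ.≤-reflexive (ℕ.+-suc (n₇ ℕ.* 2) 3)) K₀)
    where
    open Petals′ S θ>0 par m₁₂
    from : ∀ {K} → (∃ λ (L : Vec P (n₇ ℕ.* 2)) → ∃ λ R → K ≡ L Vec.++ R) → K ⊑ J → Σ (Vec P 6) λ t → t ⊑ K × T₈ m₁₂ t
    from (L , x ∷ y ∷ a ∷ b ∷ [] , refl) K⊑J =
      let (i , e) = indistinct-pairs x y a b L (λ {k} {k′} t → h (k ∷ k′ ∷ x ∷ y ∷ []) (⊑-trans (⊑-++ t (keep (keep (skip (skip []))))) K⊑J))
      in (odds n₇ L i ∷ evens n₇ L i ∷ x ∷ y ∷ a ∷ b ∷ []) , ⊑-++ (⊑-pair n₇ L i) ⊑-refl , e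
    shrink : (Σ (Vec P (n₇ ℕ.* 2 ℕ.+ 4)) λ K → K ⊑ K₀) → Σ (Vec P 6) λ t → t ⊑ K₀ × T₈ m₁₂ t
    shrink (K , K⊑) = let (t , t⊑ , p) = from (Vec.splitAt (n₇ ℕ.* 2) K) (⊑-trans K⊑ K₀⊑J) in t , ⊑-trans t⊑ K⊑ , p
  find₈ m₁₃ {ρ = ρ} {J} h (x ∷ K) = from (Vec.splitAt (n₇ ℕ.* 2) K)
    where
    open Petals′ S θ>0 par m₁₃
    from : ∀ {K} → (∃ λ (L : Vec P (n₇ ℕ.* 2)) → ∃ λ R → K ≡ L Vec.++ R) → x ∷ K ⊑ J → Σ (Vec P 6) λ t → t ⊑ (x ∷ K) × T₈ m₁₃ t
    from (L , y ∷ a ∷ b ∷ [] , refl) K⊑J =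
      let (i , e) = indistinct-pairs x y a b L (λ {k} {k′} t → h (x ∷ k ∷ k′ ∷ y ∷ []) (⊑-trans (keep (⊑-++ t (keep (skip (skip []))))) K⊑J))
      in (x ∷ odds n₇ L i ∷ evens n₇ L i ∷ y ∷ a ∷ b ∷ []) , keep (⊑-++ (⊑-pair n₇ L i) ⊑-refl) , e

module _ (S : System) {θ} (θ>0 : 𝟎 < θ) {C : PetalConstants θ} (par : PetalParameters C) where
  open System S
  open PetalParameters par
  open Petals S
  open Cycle S

  -- In mode `m₁₂` the positions are read as `l, X, Y, X, Y, ..., k, a, b`. In mode `m₁₃` the end
  -- `l` must lie between the vertices of a petal, so all petals share one vertex position:
  -- `x, l, Y, Y, ..., k, a, b`. In both readings the required tuples are increasing.
  chain : ∀ mode → let open Petals′ S θ>0 par mode in (K : Vec P (n₁₂ ℕ.+ n₁₃)) → Distinct K → Hom (T₆ mode) K → Hom T₇ K → Hom (T₈ mode) K →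
    Chain M c₆ τ
  chain m₁₂ K D h₆ h₇ h₈ with tuple {r = n₁₂} (ℕ.m≤m+n n₁₂ n₁₃) K
  ... | l ∷ K′ , K′⊑ with Vec.splitAt (M ℕ.* 2) K′
  ...   | L , k ∷ a ∷ b ∷ [] , refl = record
    { X = X ; Y = Y ; l = l ; k = k ; a = a ; b = b
    ; heavy = λ i → h₆ (l ∷ X i ∷ Y i ∷ k ∷ a ∷ b ∷ []) (⊑-trans (keep (⊑-++ (⊑-pair M L i) ⊑-refl)) K′⊑)
    ; right = λ {i} {j} p → h₇ (X i ∷ Y i ∷ Y j ∷ k ∷ a ∷ b ∷ []) (⊑-trans (skip (⊑-++ (⊑-trans (keep (keep (skip (keep [])))) (⊑-pair₂ M L p)) ⊑-refl)) K′⊑)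
    ; left = λ {i} {j} p → h₈ (l ∷ Y i ∷ X j ∷ Y j ∷ a ∷ b ∷ []) (⊑-trans (keep (⊑-++ (⊑-trans (skip (keep (keep (keep [])))) (⊑-pair₂ M L p)) (skip ⊑-refl))) K′⊑)
    ; X≢Y = λ i j → X≢Y i j (ℕ.<-cmp (Fin.toℕ i) (Fin.toℕ j))
    ; Y≢Y = λ p → apart (⊑-trans (skip (keep (skip (keep [])))) (⊑-pair₂ M L p))
    ; X≢b = λ i → D _ _ (⊑-trans (skip (⊑-++ (⊑-trans (keep (skip [])) (⊑-pair M L i)) (skip (skip (keep []))))) K′⊑)
    ; Y≢b = λ i → D _ _ (⊑-trans (skip (⊑-++ (⊑-trans (skip (keep [])) (⊑-pair M L i)) (skip (skip (keep []))))) K′⊑) }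
    where
    X Y : Fin M → P
    X = odds M L
    Y = evens M L
    apart : ∀ {p q} → p ∷ q ∷ [] ⊑ L → p ≢ q
    apart t = D _ _ (⊑-trans (skip (⊑-trans t (⊑-++ˡ L))) K′⊑)
    X≢Y : ∀ i j → Relation.Binary.Definitions.Tri (i Fin.< j) (Fin.toℕ i ≡ Fin.toℕ j) (j Fin.< i) → X i ≢ Y j
    X≢Y i j (tri< p _ _) = apart (⊑-trans (keep (skip (skip (keep [])))) (⊑-pair₂ M L p))
    X≢Y i j (tri≈ _ p _) with Fin.toℕ-injective p
    ... | refl = apart (⊑-pair M L i)
    X≢Y i j (tri> _ _ p) = ≢-sym (apart (⊑-trans (skip (keep (keep (skip [])))) (⊑-pair₂ M L p)))
  chain m₁₃ K D h₆ h₇ h₈ with tuple {r = n₁₃} (ℕ.m≤n+m n₁₃ n₁₂) K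
  ... | x ∷ l ∷ K′ , K′⊑ with Vec.splitAt M K′
  ...   | L , k ∷ a ∷ b ∷ [] , refl = record
    { X = λ _ → x ; Y = lookup L ; l = l ; k = k ; a = a ; b = b
    ; heavy = λ i → h₆ (x ∷ l ∷ lookup L i ∷ k ∷ a ∷ b ∷ []) (⊑-trans (keep (keep (⊑-++ (⊑-lookup L i) ⊑-refl))) K′⊑)
    ; right = λ {i} {j} p → h₇ (x ∷ lookup L i ∷ lookup L j ∷ k ∷ a ∷ b ∷ []) (⊑-trans (keep (skip (⊑-++ (⊑-lookup₂ L p) ⊑-refl))) K′⊑)
    ; left = λ {i} {j} p → h₈ (x ∷ l ∷ lookup L i ∷ lookup L j ∷ a ∷ b ∷ []) (⊑-trans (keep (keep (⊑-++ (⊑-lookup₂ L p) (skip ⊑-refl)))) K′⊑)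
    ; X≢Y = λ i j → D _ _ (⊑-trans (keep (skip (⊑-trans (⊑-lookup L j) (⊑-++ˡ L)))) K′⊑)
    ; Y≢Y = λ p → D _ _ (⊑-trans (skip (skip (⊑-trans (⊑-lookup₂ L p) (⊑-++ˡ L)))) K′⊑)
    ; X≢b = λ i → D _ _ (⊑-trans (keep (skip (over L (skip (skip (keep [])))))) K′⊑)
    ; Y≢b = λ i → D _ _ (⊑-trans (skip (skip (⊑-++ (⊑-lookup L i) (skip (skip (keep [])))))) K′⊑) }

  quadruple : ∀ {y x b y′ : P} → y ≢ x → y ≢ b → y ≢ y′ → x ≢ b → x ≢ y′ → b ≢ y′ → Distinct (y ∷ x ∷ b ∷ y′ ∷ [])
  quadruple e₁ e₂ e₃ e₄ e₅ e₆ = Distinct-∷ (Fresh-∷ e₁ (Fresh-∷ e₂ (Fresh-∷ e₃ (λ _ ()))))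
    (Distinct-∷ (Fresh-∷ e₄ (Fresh-∷ e₅ (λ _ ()))) (Distinct-∷ (Fresh-∷ e₆ (λ _ ())) (Distinct-∷ (λ _ ()) (λ _ _ ()))))

  -- Closing the cycle costs `3τ` and exchanging densities for edges another `3τ`; of `c₈ ≥ 7τ` at
  -- least `τ` remains.
  flower-from-chain : ∀ {r} → Regular r τ → Chain M c₆ τ → Σ (Vec P 8) λ ps → τ ≤ 𝔼 (μ* ps) (flower E E E E)
  flower-from-chain reg ch =
    let (i , j , h , i<j , j<h , p) = closed-cycle ch τ≥0 (ℚ.<⇒≤ c₆>0) c₇>0 c₇≤ n> c₈>0 c₈≤ m>
        i<h = ℕ.<-trans i<j j<h
    in (a ∷ b ∷ X i ∷ Y i ∷ X j ∷ Y j ∷ X h ∷ Y h ∷ []) ,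
      combine _ τ _ _ p (flower-bound reg τ≥0 a b (X i) (Y i) (X j) (Y j) (X h) (Y h)
          (quadruple (≢-sym (X≢Y i i)) (Y≢b i) (Y≢Y i<j) (X≢b i) (X≢Y i j) (≢-sym (Y≢b j)))
          (quadruple (≢-sym (X≢Y j j)) (Y≢b j) (Y≢Y j<h) (X≢b j) (X≢Y j h) (≢-sym (Y≢b h)))
          (quadruple (≢-sym (X≢Y h h)) (Y≢b h) (≢-sym (Y≢Y i<h)) (X≢b h) (X≢Y h i) (≢-sym (Y≢b i)))) τ≤
    where
    open Chain ch
    combine : ∀ c τ q D → c ≤ ι 3 * τ + q → q ≤ ι 3 * τ + D → ι 7 * τ ≤ c → τ ≤ D
    combine c τ q D p p′ p″ = ≤-by (p ⊕ p′ ⊕ p″) (solve 4 (λ a b c d → a :- b := (lit 3) :* b :+ c :+ ((lit 3) :* b :+ a :+ d) :- (d :+ (c :+ (lit 7) :* b))) refl _ _ _ _)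
    τ≥0 : 𝟎 ≤ τ
    τ≥0 = ℚ.<⇒≤ τ>0

  flower-from-codegree : ∀ {r} → Regular r τ → ∀ mode → let open Petals′ S θ>0 par mode in (J : Vec P N₅) → Distinct J → Hom (T₄ mode) J →
    Σ (Vec P 8) λ ps → τ ≤ 𝔼 (μ* ps) (flower E E E E)
  flower-from-codegree reg mode J D h₄ =
    let open Petals′ S θ>0 par mode
        (J₅ , ⊑₅ , h₅) = homogenize 5 k₅ N₆ T₅ T₅? J (find₅ h₄)
        (J₆ , ⊑₆ , h₆) = homogenize 6 k₆ (proj₁ gram) (T₆ mode) T₆? J₅ (find₆ h₅)
        (J₇ , ⊑₇ , lv) = proj₂ gram grams grams-unit J₆
        (J₈ , ⊑₈ , h₇) = homogenize 6 k₇ N₈ T₇ T₇? J₇ (find₇ (proj₂ (proj₂ (lv zero))))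
        (K , ⊑₉ , h₈) = homogenize 6 k₈ (n₁₂ ℕ.+ n₁₃) (T₈ mode) T₈? J₈ (Find₈.find₈ S θ>0 par mode (Hom-⊑ ⊑₈ (proj₂ (proj₂ (lv (suc zero))))))
    in flower-from-chain reg (chain mode K
      (Distinct-⊑ (⊑-trans ⊑₉ (⊑-trans ⊑₈ (⊑-trans ⊑₇ (⊑-trans ⊑₆ ⊑₅)))) D)
      (Hom-⊑ (⊑-trans ⊑₉ (⊑-trans ⊑₈ ⊑₇)) h₆) (Hom-⊑ ⊑₉ h₇) h₈)

-- A positive weighted density of H¹

FlowerDensity : ℚ → ℕ → Set₁
FlowerDensity η s₀ = Σ ℕ λ N → Σ ℕ λ r → Σ ℚ λ ε → 𝟎 < ε × Σ ℚ λ ξ → 𝟎 < ξ × (∀ (S : System) →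
  let open System S in let open Cycle S in
  Regular r ε → (L : Vec P N) → Distinct L → (∀ (K : Vec P s₀) → K ⊑ L → DenseTriples S η K) →
  Σ (Vec P 8) λ ps → ξ ≤ 𝔼 (μ* ps) (flower E E E E))

Regular-mono : ∀ (S : System) {r ε ε′} → 𝟎 ≤ ε → ε ≤ ε′ → System.Regular S r ε → System.Regular S r ε′
Regular-mono S ε≥0 ε≤ reg = record
  { regular-avoiding = λ p os j D g u → ℚ.≤-trans (regular-avoiding p os j D g u) (sq-mono ε≥0 ε≤)
  ; regular-hitting = λ os j D g u → ℚ.≤-trans (regular-hitting os j D g u) (sq-mono ε≥0 ε≤) }
  where open System.Regular reg

flower-density : ∀ η → 𝟎 < η → ∀ s₀ → FlowerDensity η s₀
flower-density η η>0 s₀ = from-codegree (large-codegree η η>0 s₀)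
  where
  from-codegree : LargeCodegree η s₀ → FlowerDensity η s₀
  from-codegree (r , ε , ε>0 , θ , θ>0 , codegree) = from-constants (petalConstants θ>0)
    where
    from-constants : PetalConstants θ → FlowerDensity η s₀
    from-constants C = from-parameters (record { gram = levelled ν ν>0 2 (λ _ → 4) _ })
      where
      open PetalConstants C
      from-parameters : PetalParameters C → FlowerDensity η s₀
      from-parameters par = from-list (codegree N₅)
        where
        open PetalParameters par using (N₅)
        from-list : (Σ ℕ λ N → ∀ (S : System) → let open System S in let open Overlapping S in
          Regular r ε → (L : Vec P N) → Distinct L → (∀ (K : Vec P s₀) → K ⊑ L → DenseTriples S η K) →
          Σ (Vec P N₅) λ J → Distinct J × (Hom (T₁₂ θ) J ⊎ Hom (T₁₃ θ) J)) → FlowerDensity η s₀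
        from-list (N , list) = N , r , ε ℚ.⊓ τ , ε⊓τ>0 , τ , τ>0 , λ S reg L D dense →
          finish S (Regular-mono S (ℚ.<⇒≤ ε⊓τ>0) (ℚ.p⊓q≤q ε τ) reg)
            (list S (Regular-mono S (ℚ.<⇒≤ ε⊓τ>0) (ℚ.p⊓q≤p ε τ) reg) L D dense)
          where
          ε⊓τ>0 : 𝟎 < ε ℚ.⊓ τ
          ε⊓τ>0 with ℚ.⊓-sel ε τ
          ... | inj₁ e = subst (𝟎 <_) (sym e) ε>0
          ... | inj₂ e = subst (𝟎 <_) (sym e) τ>0
          finish : ∀ (S : System) → let open System S in let open Overlapping S in let open Cycle S in Regular r τ →
            (Σ (Vec P N₅) λ J → Distinct J × (Hom (T₁₂ θ) J ⊎ Hom (T₁₃ θ) J)) → Σ (Vec P 8) λ ps → τ ≤ 𝔼 (μ* ps) (flower E E E E)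
          finish S reg (J , D , inj₁ h) = flower-from-codegree S θ>0 par reg m₁₂ J D λ { t@(_ ∷ _ ∷ _ ∷ _ ∷ []) s → h t s }
          finish S reg (J , D , inj₂ h) = flower-from-codegree S θ>0 par reg m₁₃ J D λ { t@(_ ∷ _ ∷ _ ∷ _ ∷ []) s → h t s }

-- Regularisation by energy increment

∑-bump : ∀ {n c} {f g : Fin n → ℚ} → (∀ i → f i ≤ g i) → ∀ i → f i + c ≤ g i → ∑ f + c ≤ ∑ g
∑-bump {suc n} {f = f} p zero q = ≤-by (q ⊕ ∑-mono {n} (p ∘ suc)) (solve 5 (λ a b c d e → a :+ b :- (c :+ d :+ e) := a :+ b :- (c :+ e :+ d)) refl _ _ _ _ _)
∑-bump {suc n} p (suc i) q = ≤-by (p zero ⊕ ∑-bump {n} (p ∘ suc) i q) (solve 5 (λ a b c d e → a :+ b :- (c :+ d :+ e) := a :+ b :- (c :+ (d :+ e))) refl _ _ _ _ _)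

∑ⱽ : ∀ {N} k → (Vec (Fin N) k → ℚ) → ℚ
∑ⱽ zero f = f []
∑ⱽ (suc k) f = ∑ λ p → ∑ⱽ k λ ps → f (p ∷ ps)

∑ⱽ-mono : ∀ {N} k {f g : Vec (Fin N) k → ℚ} → (∀ v → f v ≤ g v) → ∑ⱽ k f ≤ ∑ⱽ k g
∑ⱽ-mono zero p = p []
∑ⱽ-mono {N} (suc k) p = ∑-mono {N} λ x → ∑ⱽ-mono k λ xs → p (x ∷ xs)

∑ⱽ-+ : ∀ {N} k (f g : Vec (Fin N) k → ℚ) → ∑ⱽ k (λ v → f v + g v) ≡ ∑ⱽ k f + ∑ⱽ k g
∑ⱽ-+ zero f g = refl
∑ⱽ-+ {N} (suc k) f g = trans (∑-cong {N} λ x → ∑ⱽ-+ k _ _) (∑-+ {N} _ _)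

∑ⱽ-bump : ∀ {N} k {c} {f g : Vec (Fin N) k → ℚ} → (∀ v → f v ≤ g v) → ∀ v → f v + c ≤ g v → ∑ⱽ k f + c ≤ ∑ⱽ k g
∑ⱽ-bump zero p [] q = q
∑ⱽ-bump {N} (suc k) p (x ∷ xs) q = ∑-bump {N} (λ y → ∑ⱽ-mono k λ ys → p (y ∷ ys)) x (∑ⱽ-bump k (λ ys → p (x ∷ ys)) xs q)

∑ⱽ-nonneg : ∀ {N} k {f : Vec (Fin N) k → ℚ} → (∀ v → 𝟎 ≤ f v) → 𝟎 ≤ ∑ⱽ k f
∑ⱽ-nonneg zero p = p []
∑ⱽ-nonneg {N} (suc k) p = ∑-nonneg {N} λ x → ∑ⱽ-nonneg k λ xs → p (x ∷ xs)

-- One term for each test that occurs in `Regular`: the first entry is the tested position, the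
-- others are the outer ones.
data Term (N r : ℕ) : Set where
  avoidᵗ : (n : Fin (suc r)) → Vec (Fin N) (2 ℕ.+ Fin.toℕ n) → Term N r
  hitᵗ   : Vec (Fin N) 4 → Term N r

module _ {N r : ℕ} where
  opaque
    avoidSum : (Term N r → ℚ) → Fin (suc r) → ℚ
    avoidSum f n = ∑ⱽ (2 ℕ.+ Fin.toℕ n) (λ v → f (avoidᵗ n v))
    hitSum : (Term N r → ℚ) → ℚ
    hitSum f = ∑ⱽ 4 (λ v → f (hitᵗ v))

    total : (Term N r → ℚ) → ℚ
    total f = ∑ {suc r} (avoidSum f) + hitSum f

    total-mono : ∀ {f g} → (∀ t → f t ≤ g t) → total f ≤ total g
    total-mono p = ∑-mono {suc r} (λ n → ∑ⱽ-mono (2 ℕ.+ Fin.toℕ n) λ v → p (avoidᵗ n v)) ⊕ ∑ⱽ-mono 4 λ v → p (hitᵗ v)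

    total-+ : ∀ f g → total (λ t → f t + g t) ≡ total f + total g
    total-+ f g = trans (cong₂ _+_ (trans (∑-cong {suc r} (λ n → ∑ⱽ-+ (2 ℕ.+ Fin.toℕ n) (λ v → f (avoidᵗ n v)) (λ v → g (avoidᵗ n v))))
        (∑-+ {suc r} (avoidSum f) (avoidSum g))) (∑ⱽ-+ 4 (λ v → f (hitᵗ v)) (λ v → g (hitᵗ v))))
      (interchange (∑ (avoidSum f)) (∑ (avoidSum g)) (hitSum f) (hitSum g))
      where
      interchange : ∀ a b c d → (a + b) + (c + d) ≡ (a + c) + (b + d)
      interchange a b c d = solve 4 (λ a b c d → a :+ b :+ (c :+ d) := a :+ c :+ (b :+ d)) refl _ _ _ _

    total-bump : ∀ {c f g} → (∀ t → f t ≤ g t) → ∀ t → f t + c ≤ g t → total f + c ≤ total g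
    total-bump {c} {f} {g} p (avoidᵗ n v) q = ≤-by
      (∑-bump {suc r} {c} {avoidSum f} {avoidSum g} (λ m → ∑ⱽ-mono (2 ℕ.+ Fin.toℕ m) λ v → p (avoidᵗ m v)) n (∑ⱽ-bump (2 ℕ.+ Fin.toℕ n) (λ v → p (avoidᵗ n v)) v q)
        ⊕ ∑ⱽ-mono 4 {λ v → f (hitᵗ v)} {λ v → g (hitᵗ v)} λ v → p (hitᵗ v)) (regroup (∑ (avoidSum f)) (hitSum f) (∑ (avoidSum g)) (hitSum g) c)
      where
      regroup : ∀ x y z w c → (z + w) - (x + y + c) ≡ (z + w) - ((x + c) + y)
      regroup x y z w c = solve 5 (λ a b c d e → a :+ b :- (c :+ d :+ e) := a :+ b :- (c :+ e :+ d)) refl _ _ _ _ _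
    total-bump {c} {f} {g} p (hitᵗ v) q = ≤-by
      (∑-mono {suc r} {avoidSum f} {avoidSum g} (λ n → ∑ⱽ-mono (2 ℕ.+ Fin.toℕ n) λ v → p (avoidᵗ n v)) ⊕ ∑ⱽ-bump 4 {c} {λ v → f (hitᵗ v)} {λ v → g (hitᵗ v)} (λ v → p (hitᵗ v)) v q)
      (regroup (∑ (avoidSum f)) (hitSum f) (∑ (avoidSum g)) (hitSum g) c)
      where
      regroup : ∀ x y z w c → (z + w) - (x + y + c) ≡ (z + w) - (x + (y + c))
      regroup x y z w c = solve 5 (λ a b c d e → a :+ b :- (c :+ d :+ e) := a :+ b :- (c :+ (d :+ e))) refl _ _ _ _ _

    total-nonneg : ∀ {f} → (∀ t → 𝟎 ≤ f t) → 𝟎 ≤ total f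
    total-nonneg p = +-nonneg (∑-nonneg {suc r} λ m → ∑ⱽ-nonneg (2 ℕ.+ Fin.toℕ m) λ v → p (avoidᵗ m v)) (∑ⱽ-nonneg 4 λ v → p (hitᵗ v))

energy : ∀ {V P : Set} → (P → Mean V) → ∀ {n} → (Vec V n → V → ℚ) → Vec P n → P → ℚ
energy M φ os q = 𝔼 (product M os) (λ xs → 𝔼 (M q) (φ xs) * 𝔼 (M q) (φ xs))

-- M⁺ and M⁻ arise from M by tilting position j by ± a function h of mean zero.
module Tilt {V P : Set} (M M⁺ M⁻ : P → Mean V) (j : P) (_≟_ : (p q : P) → Dec (p ≡ q)) (h : V → ℚ)
  (same⁺ : ∀ {p} → j ≢ p → ∀ f → 𝔼 (M⁺ p) f ≡ 𝔼 (M p) f)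
  (same⁻ : ∀ {p} → j ≢ p → ∀ f → 𝔼 (M⁻ p) f ≡ 𝔼 (M p) f)
  (tilt⁺ : ∀ f → 𝔼 (M⁺ j) f ≡ 𝔼 (M j) f + 𝔼 (M j) (λ x → h x * f x))
  (tilt⁻ : ∀ f → 𝔼 (M⁻ j) f ≡ 𝔼 (M j) f - 𝔼 (M j) (λ x → h x * f x)) where

  fresh⁺ : ∀ {n} (K : Vec P n) → Fresh j K → ∀ f → 𝔼 (product M⁺ K) f ≡ 𝔼 (product M K) f
  fresh⁺ [] F f = refl
  fresh⁺ (p ∷ K) F f = trans (𝔼-cong (M⁺ p) (λ x → fresh⁺ K (λ q t → F q (skip t)) _)) (same⁺ (F p (keep ⊑-min)) _)

  fresh⁻ : ∀ {n} (K : Vec P n) → Fresh j K → ∀ f → 𝔼 (product M⁻ K) f ≡ 𝔼 (product M K) f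
  fresh⁻ [] F f = refl
  fresh⁻ (p ∷ K) F f = trans (𝔼-cong (M⁻ p) (λ x → fresh⁻ K (λ q t → F q (skip t)) _)) (same⁻ (F p (keep ⊑-min)) _)

  -- As the positions are distinct, at most one factor of the product is tilted, so the integral is
  -- affine in the tilt and the two signs cancel.
  balance : ∀ {n} (K : Vec P n) → Distinct K → ∀ f →
    𝔼 (product M⁺ K) f + 𝔼 (product M⁻ K) f ≡ ι 2 * 𝔼 (product M K) f
  balance [] D f = double (f [])
    where
    double : ∀ x → x + x ≡ ι 2 * x
    double x = solve 1 (λ a → a :+ a := (lit 2) :* a) refl _
  balance (p ∷ K) D f with j ≟ p
  ... | yes refl = trans (cong₂ _+_
      (trans (𝔼-cong (M⁺ j) (λ x → fresh⁺ K F _)) (tilt⁺ _)) (trans (𝔼-cong (M⁻ j) (λ x → fresh⁻ K F _)) (tilt⁻ _))) (cancel _ _)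
    where
    F : Fresh j K
    F q t = D j q (keep t)
    cancel : ∀ a b → (a + b) + (a - b) ≡ ι 2 * a
    cancel a b = solve 2 (λ a b → a :+ b :+ (a :- b) := (lit 2) :* a) refl _ _
  ... | no j≢p = trans (cong₂ _+_ (same⁺ j≢p _) (same⁻ j≢p _)) (trans (sym (𝔼-+ (M p) _ _))
      (trans (𝔼-cong (M p) (λ x → balance K (λ p q t → D p q (skip t)) _)) (𝔼-* (M p) _ _)))

  -- If `j` is tested, `energy-gain` adds squares. If `j` is an outer position or does not occur,
  -- the energy is affine in the tilt and `balance` gives equality. No term loses on average over
  -- the two signs.
  energy-convex : ∀ {n} (φ : Vec V n → V → ℚ) os q → Distinct (q ∷ os) →
    ι 2 * energy M φ os q ≤ energy M⁺ φ os q + energy M⁻ φ os q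
  -- The parallelogram law: tilting `j` changes the inner mean `e` into `e + u` and `e - u`, where
  -- `u` is the correlation of `h` with the test function. The outer positions do not change, as `j`
  -- is not among them.
  energy-gain : ∀ {n} (φ : Vec V n → V → ℚ) os → Distinct (j ∷ os) →
    ι 2 * energy M φ os j + ι 2 * 𝔼 (product M os) (λ xs → 𝔼 (M j) (λ x → h x * φ xs x) * 𝔼 (M j) (λ x → h x * φ xs x)) ≡
    energy M⁺ φ os j + energy M⁻ φ os j

  energy-convex φ os q D with j ≟ q
  ... | yes refl = ℚ.≤-trans (≤-by (*-monoˡ (ι-nonneg 2) (≤-𝔼 (product M os) (λ xs → sq-nonneg (𝔼 (M j) (λ x → h x * φ xs x))))) (pad _ _)) (≤-refl′ (energy-gain φ os D))
    where
    pad : ∀ e u → (ι 2 * e + ι 2 * u) - ι 2 * e ≡ ι 2 * u - ι 2 * 𝟎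
    pad e u = solve 2 (λ a b → (lit 2) :* a :+ (lit 2) :* b :- (lit 2) :* a := (lit 2) :* b :- (lit 2) :* (lit 0)) refl _ _
  ... | no j≢q = ≤-refl′ (sym (trans (cong₂ _+_
      (𝔼-cong (product M⁺ os) (λ xs → cong₂ _*_ (same⁺ j≢q _) (same⁺ j≢q _))) (𝔼-cong (product M⁻ os) (λ xs → cong₂ _*_ (same⁻ j≢q _) (same⁻ j≢q _))))
      (balance os (λ p p′ t → D p p′ (skip t)) _)))

  energy-gain φ os D = sym (trans (cong₂ _+_
      (trans (fresh⁺ os F _) (𝔼-cong (product M os) (λ xs → cong₂ _*_ (tilt⁺ _) (tilt⁺ _))))
      (trans (fresh⁻ os F _) (𝔼-cong (product M os) (λ xs → cong₂ _*_ (tilt⁻ _) (tilt⁻ _)))))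
    (trans (sym (𝔼-+ (product M os) _ _)) (trans (𝔼-cong (product M os) (λ xs → parallelogram _ _))
      (trans (𝔼-+ (product M os) _ _) (cong₂ _+_ (𝔼-* (product M os) _ _) (𝔼-* (product M os) _ _))))))
    where
    F : Fresh j os
    F q t = D j q (keep t)
    parallelogram : ∀ e u → (e + u) * (e + u) + (e - u) * (e - u) ≡ ι 2 * (e * e) + ι 2 * (u * u)
    parallelogram e u = solve 2 (λ a b → (a :+ b) :* (a :+ b) :+ (a :- b) :* (a :- b) := (lit 2) :* (a :* a) :+ (lit 2) :* (b :* b)) refl _ _

-- Means on Fin n given by weights, and their tilts

record IsWeight {n} (w : Fin n → ℚ) : Set where
  field
    nonneg : ∀ x → 𝟎 ≤ w x
    sum-1  : ∑ w ≡ 𝟏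

weighted : ∀ {n} (w : Fin n → ℚ) → IsWeight w → Mean (Fin n)
weighted {n} w W = record
  { 𝔼 = λ f → ∑ (λ x → w x * f x)
  ; 𝔼-+ = λ f g → trans (∑-cong {n} (λ x → distrib (w x) (f x) (g x))) (∑-+ {n} _ _)
  ; 𝔼-* = λ c f → trans (∑-cong {n} (λ x → rotate (w x) c (f x))) (∑-* {n} c _)
  ; 𝔼-mono = λ p → ∑-mono {n} (λ x → *-monoˡ (nonneg x) (p x))
  ; 𝔼-const = λ c → trans (∑-*ʳ {n} c w) (trans (cong (_* c) sum-1) (one c))
  }
  where
  open IsWeight W
  distrib : ∀ a b c → a * (b + c) ≡ a * b + a * c
  distrib a b c = solve 3 (λ a b c → a :* (b :+ c) := a :* b :+ a :* c) refl _ _ _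
  rotate : ∀ a b c → a * (b * c) ≡ b * (a * c)
  rotate a b c = solve 3 (λ a b c → a :* (b :* c) := b :* (a :* c)) refl _ _ _
  one : ∀ c → 𝟏 * c ≡ c
  one c = solve 1 (λ a → (lit 1) :* a := a) refl _

weighted-fubini : ∀ {m n} (v : Fin m → ℚ) (w : Fin n → ℚ) (f : Fin m → Fin n → ℚ) →
  ∑ (λ x → v x * ∑ (λ y → w y * f x y)) ≡ ∑ (λ y → w y * ∑ (λ x → v x * f x y))
weighted-fubini {m} {n} v w f = trans (∑-cong {m} (λ x → sym (∑-* {n} (v x) _))) (trans (∑-swap {m} {n} _)
  (∑-cong {n} (λ y → trans (∑-cong {m} (λ x → rotate (v x) (w y) (f x y))) (∑-* {m} (w y) _))))
  where
  rotate : ∀ a b c → a * (b * c) ≡ b * (a * c)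
  rotate a b c = solve 3 (λ a b c → a :* (b :* c) := b :* (a :* c)) refl _ _ _

tilted : ∀ {n} → (Fin n → ℚ) → (Fin n → ℚ) → Fin n → ℚ
tilted w h x = w x * (𝟏 + h x)

tilted-weight : ∀ {n} {w h : Fin n → ℚ} → IsWeight w → (∀ x → - 𝟏 ≤ h x) → ∑ (λ x → w x * h x) ≡ 𝟎 → IsWeight (tilted w h)
tilted-weight {n} {w} {h} W p e = record
  { nonneg = λ x → *-nonneg (IsWeight.nonneg W x) (≤-by (p x) (solve 1 (λ a → (lit 1) :+ a :- (lit 0) := a :- (:- (lit 1))) refl _))
  ; sum-1 = trans (∑-cong {n} (λ x → expand (w x) (h x))) (trans (∑-+ {n} w _) (trans (cong₂ _+_ (IsWeight.sum-1 W) e) unit)) }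
  where
  expand : ∀ a b → a * (𝟏 + b) ≡ a + a * b
  expand a b = solve 2 (λ a b → a :* ((lit 1) :+ b) := a :+ a :* b) refl _ _
  unit : 𝟏 + 𝟎 ≡ 𝟏
  unit = solve 0 ((lit 1) :+ (lit 0) := (lit 1)) refl

tilted-𝔼 : ∀ {n} (w h f : Fin n → ℚ) → ∑ (λ x → tilted w h x * f x) ≡ ∑ (λ x → w x * f x) + ∑ (λ x → w x * (h x * f x))
tilted-𝔼 {n} w h f = trans (∑-cong {n} (λ x → expand (w x) (h x) (f x))) (∑-+ {n} _ _)
  where
  expand : ∀ a b c → (a * (𝟏 + b)) * c ≡ a * c + a * (b * c)
  expand a b c = solve 3 (λ a b c → a :* ((lit 1) :+ b) :* c := a :* c :+ a :* (b :* c)) refl _ _ _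

fresh? : ∀ {N n} (p : Fin N) (K : Vec (Fin N) n) → Dec (Fresh p K)
fresh? p [] = yes (λ _ ())
fresh? p (q ∷ K) with p Fin.≟ q | fresh? p K
... | no r | yes f = yes (Fresh-∷ r f)
... | yes e | _ = no (λ f → f q (keep ⊑-min) e)
... | no _ | no f = no (λ g → f (λ q t → g q (skip t)))

distinct? : ∀ {N n} (K : Vec (Fin N) n) → Dec (Distinct K)
distinct? [] = yes (λ _ _ ())
distinct? (p ∷ K) with fresh? p K | distinct? K
... | yes f | yes D = yes (Distinct-∷ f D)
... | no f | _ = no (λ D → f (λ q t → D p q (keep t)))
... | yes _ | no D = no (λ D′ → D (Distinct-⊑ (skip ⊑-refl) D′))

-- Terms with repeated positions contribute nothing, for there the energy need not be convex in the
-- tilt.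
gated : ∀ {A : Set} → Dec A → ℚ → ℚ
gated (yes _) x = x
gated (no _) x = 𝟎

gated-mono : ∀ {A : Set} (a : Dec A) {x y z} → (A → x + x ≤ y + z) → gated a x + gated a x ≤ gated a y + gated a z
gated-mono (yes a) p = p a
gated-mono (no a) p = ℚ.≤-refl

gated-≤1 : ∀ {A : Set} (a : Dec A) {x} → x ≤ 𝟏 → gated a x ≤ 𝟏
gated-≤1 (yes _) p = p
gated-≤1 (no _) p = 0≤1

gated-yes : ∀ {A : Set} (a : Dec A) {x y z c} → A → (x + x) + c ≤ y + z → (gated a x + gated a x) + c ≤ gated a y + gated a z
gated-yes (yes _) a p = p
gated-yes (no b) a p = ⊥-elim (b a)

natural-bound : ∀ x → Σ ℕ λ b → x ≤ ι b
natural-bound x with x ℚ.≤? 𝟎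
... | yes p = 0 , p
... | no p with reciprocal x (ℚ.≰⇒> p)
...   | y , y>0 , e with archimedean y y>0
...     | m , big = m , ℚ.≤-trans (≤-by (*-monoʳ (ℚ.<⇒≤ (ℚ.≰⇒> p)) big) (regroup (ι m)))
            (≤-refl′ (trans (cong (ι m *_) e) (one (ι m))))
      where
      regroup : ∀ z → z * (x * y) - x ≡ z * y * x - 𝟏 * x
      regroup z = solve 3 (λ a b c → a :* (b :* c) :- b := a :* c :* b :- (lit 1) :* b) refl _ _ _
      one : ∀ z → z * 𝟏 ≡ z
      one z = solve 1 (λ a → a :* (lit 1) := a) refl _

update : ∀ {N} {A : Set} → Fin N → A → (Fin N → A) → Fin N → A
update j v w p with j Fin.≟ p
... | yes _ = v
... | no _ = w p

update-same : ∀ {N} {A : Set} (j : Fin N) (v : A) w → update j v w j ≡ v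
update-same j v w with j Fin.≟ j
... | yes _ = refl
... | no p = ⊥-elim (p refl)

update-other : ∀ {N} {A : Set} {j p : Fin N} (v : A) w → j ≢ p → update j v w p ≡ w p
update-other {j = j} {p} v w q with j Fin.≟ p
... | yes e = ⊥-elim (q e)
... | no _ = refl

update-all : ∀ {N} {A : Set} (Q : A → Set) (j : Fin N) (v : A) w → Q v → (∀ p → Q (w p)) → ∀ p → Q (update j v w p)
update-all Q j v w qv qw p with j Fin.≟ p
... | yes _ = qv
... | no _ = qw p

one-half : ∀ {x y z} → x + x ≤ y + z → x ≤ y ⊎ x ≤ z
one-half {x} {y} {z} p with x ℚ.≤? y | x ℚ.≤? z
... | yes q | _ = inj₁ q
... | no _ | yes q = inj₂ q
... | no q | no r = ⊥-elim (≤⇒≯ p (+-mono-< (ℚ.≰⇒> q) (ℚ.<⇒≤ (ℚ.≰⇒> r))))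

module Regularise {N n : ℕ} (r : ℕ) (E : Fin n → Fin n → Fin n → ℚ) (E-unit : ∀ x y z → Unit (E x y z))
  (E-sym₁ : ∀ x y z → E x y z ≡ E y x z) (E-sym₂ : ∀ x y z → E x y z ≡ E x z y) where

  Weights : Set
  Weights = Fin N → Fin n → ℚ

  Valid : ℚ → Weights → Set
  Valid K w = ∀ p x → ι n * w p x ≤ K

  system : (w : Weights) → (∀ p → IsWeight (w p)) → System
  system w W = record
    { V = Fin n ; P = Fin N ; E = E ; E-unit = E-unit ; E-sym₁ = E-sym₁ ; E-sym₂ = E-sym₂
    ; μ = λ p → weighted (w p) (W p) ; fubini = λ p q f → weighted-fubini (w p) (w q) f }

  means : (w : Weights) → (∀ p → IsWeight (w p)) → Fin N → Mean (Fin n)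
  means w W p = weighted (w p) (W p)

  termEnergy : (Fin N → Mean (Fin n)) → Term N r → ℚ
  termEnergy M (avoidᵗ m (j ∷ os)) = gated (distinct? (j ∷ os)) (energy M (avoiding E) os j)
  termEnergy M (hitᵗ (j ∷ os)) = gated (distinct? (j ∷ os)) (energy M (hitting E) os j)

  avoiding-unit : ∀ {k} (xs : Vec (Fin n) (suc k)) y → Unit (avoiding E xs y)
  avoiding-unit (x ∷ []) y = Unit-1
  avoiding-unit (x ∷ z ∷ zs) y = Unit-* (Unit-1- (E-unit x y z)) (avoiding-unit (x ∷ zs) y)

  hitting-unit : ∀ (xs : Vec (Fin n) 3) y → Unit (hitting E xs y)
  hitting-unit (x ∷ z ∷ w ∷ []) y = Unit-* (E-unit x y z) (E-unit x y w)

  energy-≤1 : ∀ (M : Fin N → Mean (Fin n)) {k} φ (os : Vec (Fin N) k) j → (∀ xs y → Unit (φ xs y)) → energy M φ os j ≤ 𝟏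
  energy-≤1 M φ os j u = 𝔼-≤ (product M os) (λ xs → let v = Unit-𝔼 (M j) (u xs) in proj₂ (Unit-* v v))

  termEnergy-≤1 : ∀ M t → termEnergy M t ≤ 𝟏
  termEnergy-≤1 M (avoidᵗ m (j ∷ os)) = gated-≤1 (distinct? (j ∷ os)) (energy-≤1 M (avoiding E) os j avoiding-unit)
  termEnergy-≤1 M (hitᵗ (j ∷ os)) = gated-≤1 (distinct? (j ∷ os)) (energy-≤1 M (hitting E) os j hitting-unit)

  -- The tilt is `h = g - 𝔼 g`. Its mean is zero, so total weight is preserved; its values lie in
  -- [-1,1], so weights stay nonnegative and at most double.
  module Step (w : Weights) (W : ∀ p → IsWeight (w p)) (j : Fin N) (g : Fin n → ℚ) (g-unit : ∀ x → Unit (g x)) where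
    M : Fin N → Mean (Fin n)
    M = means w W

    h h⁻ : Fin n → ℚ
    h x = g x - 𝔼 (M j) g
    h⁻ x = - h x

    mean-unit : Unit (𝔼 (M j) g)
    mean-unit = Unit-𝔼 (M j) g-unit

    h-lower : ∀ x → - 𝟏 ≤ h x
    h-lower x = ≤-by (proj₁ (g-unit x) ⊕ proj₂ mean-unit) (regroup (g x) (𝔼 (M j) g))
      where
      regroup : ∀ a b → a - b - - 𝟏 ≡ (a + 𝟏) - (𝟎 + b)
      regroup a b = solve 2 (λ a b → a :- b :- (:- (lit 1)) := a :+ (lit 1) :- ((lit 0) :+ b)) refl _ _

    h-upper : ∀ x → h x ≤ 𝟏
    h-upper x = ≤-by (proj₂ (g-unit x) ⊕ proj₁ mean-unit) (regroup (g x) (𝔼 (M j) g))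
      where
      regroup : ∀ a b → 𝟏 - (a - b) ≡ (𝟏 + b) - (a + 𝟎)
      regroup a b = solve 2 (λ a b → (lit 1) :- (a :- b) := (lit 1) :+ b :- (a :+ (lit 0))) refl _ _

    h⁻-lower : ∀ x → - 𝟏 ≤ h⁻ x
    h⁻-lower x = ≤-by (h-upper x) (regroup (h x))
      where
      regroup : ∀ a → - a - - 𝟏 ≡ 𝟏 - a
      regroup a = solve 1 (λ a → (:- a) :- (:- (lit 1)) := (lit 1) :- a) refl _

    h⁻-upper : ∀ x → h⁻ x ≤ 𝟏
    h⁻-upper x = ≤-by (h-lower x) (regroup (h x))
      where
      regroup : ∀ a → 𝟏 - - a ≡ a - - 𝟏
      regroup a = solve 1 (λ a → (lit 1) :- (:- a) := a :- (:- (lit 1))) refl _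

    h-sum : 𝔼 (M j) h ≡ 𝟎
    h-sum = trans (𝔼-sub (M j) g _) (trans (cong (λ z → 𝔼 (M j) g - z) (𝔼-const (M j) _)) (self (𝔼 (M j) g)))
      where
      self : ∀ a → a - a ≡ 𝟎
      self a = solve 1 (λ a → a :- a := (lit 0)) refl _

    h⁻-sum : 𝔼 (M j) h⁻ ≡ 𝟎
    h⁻-sum = trans (𝔼-neg (M j) h) (trans (cong -_ h-sum) neg-zero)
      where
      neg-zero : - 𝟎 ≡ 𝟎
      neg-zero = solve 0 ((:- (lit 0)) := (lit 0)) refl

    w⁺ w⁻ : Weights
    w⁺ = update j (tilted (w j) h) w
    w⁻ = update j (tilted (w j) h⁻) w

    W⁺ : ∀ p → IsWeight (w⁺ p)
    W⁺ = update-all IsWeight j _ w (tilted-weight (W j) h-lower h-sum) W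
    W⁻ : ∀ p → IsWeight (w⁻ p)
    W⁻ = update-all IsWeight j _ w (tilted-weight (W j) h⁻-lower h⁻-sum) W

    M⁺ M⁻ : Fin N → Mean (Fin n)
    M⁺ = means w⁺ W⁺
    M⁻ = means w⁻ W⁻

    negate : ∀ a b → - a * b ≡ - (a * b)
    negate a b = solve 2 (λ a b → (:- a) :* b := (:- (a :* b))) refl _ _

    same⁺ : ∀ {p} → j ≢ p → ∀ f → 𝔼 (M⁺ p) f ≡ 𝔼 (M p) f
    same⁺ {p} q f = cong (λ v → ∑ (λ x → v x * f x)) (update-other {j = j} {p} (tilted (w j) h) w q)
    same⁻ : ∀ {p} → j ≢ p → ∀ f → 𝔼 (M⁻ p) f ≡ 𝔼 (M p) f
    same⁻ {p} q f = cong (λ v → ∑ (λ x → v x * f x)) (update-other {j = j} {p} (tilted (w j) h⁻) w q)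
    tilt⁺ : ∀ f → 𝔼 (M⁺ j) f ≡ 𝔼 (M j) f + 𝔼 (M j) (λ x → h x * f x)
    tilt⁺ f = trans (cong (λ v → ∑ (λ x → v x * f x)) (update-same j (tilted (w j) h) w)) (tilted-𝔼 (w j) h f)
    tilt⁻ : ∀ f → 𝔼 (M⁻ j) f ≡ 𝔼 (M j) f - 𝔼 (M j) (λ x → h x * f x)
    tilt⁻ f = trans (cong (λ v → ∑ (λ x → v x * f x)) (update-same j (tilted (w j) h⁻) w)) (trans (tilted-𝔼 (w j) h⁻ f)
      (cong (𝔼 (M j) f +_) (trans (𝔼-cong (M j) (λ x → negate (h x) (f x))) (𝔼-neg (M j) _))))

    open Tilt M M⁺ M⁻ j Fin._≟_ h same⁺ same⁻ tilt⁺ tilt⁻ public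

    double : ∀ x → ι 2 * x ≡ x + x
    double x = solve 1 (λ a → (lit 2) :* a := a :+ a) refl _

    convex : ∀ t → termEnergy M t + termEnergy M t ≤ termEnergy M⁺ t + termEnergy M⁻ t
    convex (avoidᵗ m (q ∷ os)) = gated-mono (distinct? (q ∷ os)) (λ D → ℚ.≤-trans (≤-refl′ (sym (double _))) (energy-convex (avoiding E) os q D))
    convex (hitᵗ (q ∷ os)) = gated-mono (distinct? (q ∷ os)) (λ D → ℚ.≤-trans (≤-refl′ (sym (double _))) (energy-convex (hitting E) os q D))

    gain : ∀ {k c} φ (os : Vec (Fin N) k) → Distinct (j ∷ os) →
      c ≤ 𝔼 (product M os) (λ xs → 𝔼 (M j) (λ x → h x * φ xs x) * 𝔼 (M j) (λ x → h x * φ xs x)) →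
      (energy M φ os j + energy M φ os j) + (c + c) ≤ energy M⁺ φ os j + energy M⁻ φ os j
    gain {c = c} φ os D p = ℚ.≤-trans (≤-by (*-monoˡ (ι-nonneg 2) p) (regroup _ _ c)) (≤-refl′ (energy-gain φ os D))
      where
      regroup : ∀ e u c → (ι 2 * e + ι 2 * u) - ((e + e) + (c + c)) ≡ ι 2 * u - ι 2 * c
      regroup e u c = solve 3 (λ a b c → (lit 2) :* a :+ (lit 2) :* b :- (a :+ a :+ (c :+ c)) := (lit 2) :* b :- (lit 2) :* c) refl _ _ _

    -- Summed over both signs, the violated term gains `2c` and no other term loses, so one of the
    -- two signs gains at least `c`.
    improve : ∀ {c} t → (termEnergy M t + termEnergy M t) + (c + c) ≤ termEnergy M⁺ t + termEnergy M⁻ t →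
      total (termEnergy M) + c ≤ total (termEnergy M⁺) ⊎ total (termEnergy M) + c ≤ total (termEnergy M⁻)
    improve {c} t p = one-half (ℚ.≤-trans (≤-refl′ (trans (regroup (total (termEnergy M)) c) (cong (_+ (c + c)) (sym (total-+ (termEnergy M) (termEnergy M))))))
        (ℚ.≤-trans (total-bump convex t p) (≤-refl′ (total-+ (termEnergy M⁺) (termEnergy M⁻)))))
      where
      regroup : ∀ t c → (t + c) + (t + c) ≡ (t + t) + (c + c)
      regroup t c = solve 2 (λ a b → a :+ b :+ (a :+ b) := a :+ a :+ (b :+ b)) refl _ _

    tilted-valid : ∀ {K} (h : Fin n → ℚ) → (∀ x → h x ≤ 𝟏) → Valid K w → Valid (K + K) (update j (tilted (w j) h) w)
    tilted-valid {K} h h≤1 V = update-all (λ v → ∀ x → ι n * v x ≤ K + K) j _ w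
      (λ x → ≤-by (V j x ⊕ V j x ⊕ *-nonneg (*-nonneg (ι-nonneg n) (IsWeight.nonneg (W j) x)) (≤⇒0≤ (h≤1 x))) (regroup (ι n) (w j x) (h x)))
      (λ p x → ≤-by (V p x ⊕ *-nonneg (ι-nonneg n) (IsWeight.nonneg (W p) x) ⊕ V p x) (regroup′ (ι n) (w p x)))
      where
      regroup : ∀ m w h → K + K - m * (w * (𝟏 + h)) ≡ (K + (K + m * w * (𝟏 - h))) - (m * w + (m * w + 𝟎))
      regroup m w h = solve 4 (λ a b c d → a :+ a :- b :* (c :* ((lit 1) :+ d)) := a :+ (a :+ b :* c :* ((lit 1) :- d)) :- (b :* c :+ (b :* c :+ (lit 0)))) refl _ _ _ _
      regroup′ : ∀ m w → K + K - m * w ≡ (K + (m * w + K)) - (m * w + (𝟎 + m * w))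
      regroup′ m w = solve 3 (λ a b c → a :+ a :- b :* c := a :+ (b :* c :+ a) :- (b :* c :+ ((lit 0) :+ b :* c))) refl _ _ _

  module _ {ε K₀ : ℚ} {Goal : Set} (Goal? : Dec Goal)
    (core : ∀ w (W : ∀ p → IsWeight (w p)) → Valid K₀ w → System.Regular (system w W) r ε → Goal) where

    -- Energy increment as a refutation. Since `core` would give the goal, it is enough to prove
    -- regularity, and a comparison of rationals may be proved by contradiction; a violating `g`
    -- yields tilted weights with energy larger by `ε²`, to which the induction applies. The energy
    -- is within `fuel * ε²` of its maximum, so the process ends, and `K` doubles at most `fuel`
    -- times, which keeps all weights below `K₀`.
    refute : ¬ Goal → ∀ fuel w (W : ∀ p → IsWeight (w p)) K → 𝟎 ≤ K → Valid K w → K * ι (2 ℕ.^ fuel) ≤ K₀ →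
      total {N} {r} (λ _ → 𝟏) < total (termEnergy (means w W)) + ι fuel * (ε * ε) → ⊥
    refute ¬G zero w W K K≥0 V K≤ low = ≤⇒≯ (total-mono (termEnergy-≤1 (means w W))) (ℚ.<-≤-trans low (≤-refl′ (drop _ (ε * ε))))
      where
      drop : ∀ t e → t + 𝟎 * e ≡ t
      drop t e = solve 2 (λ a b → a :+ (lit 0) :* b := a) refl _ _
    refute ¬G (suc fuel) w W K K≥0 V K≤ low = ¬G (core w W valid₀ (record
        { regular-avoiding = λ {k} k≤r → lookup-ℕ (λ s → ∀ (os : Vec (Fin N) (suc s)) j → Distinct (j ∷ os) → System.Uncorrelated (system w W) ε (avoiding E) os j)
            (λ m os j D g u → ℚ.≮⇒≥ (λ viol → contradict j g u (avoidᵗ m (j ∷ os))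
              (gated-yes (distinct? (j ∷ os)) D (Step.gain w W j g u (avoiding E) os D (ℚ.<⇒≤ viol))))) k k≤r
        ; regular-hitting = λ os j D g u → ℚ.≮⇒≥ (λ viol → contradict j g u (hitᵗ (j ∷ os))
              (gated-yes (distinct? (j ∷ os)) D (Step.gain w W j g u (hitting E) os D (ℚ.<⇒≤ viol)))) }))
      where
      pow : ι (2 ℕ.^ suc fuel) ≡ ι 2 * ι (2 ℕ.^ fuel)
      pow = ι-* 2 (2 ℕ.^ fuel)
      K+K≤ : (K + K) * ι (2 ℕ.^ fuel) ≤ K₀
      K+K≤ = ℚ.≤-trans (≤-refl′ (trans (regroup K (ι (2 ℕ.^ fuel))) (cong (K *_) (sym pow)))) K≤
        where
        regroup : ∀ k p → (k + k) * p ≡ k * (ι 2 * p)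
        regroup k p = solve 2 (λ a b → (a :+ a) :* b := a :* ((lit 2) :* b)) refl _ _
      K≤K₀ : K ≤ K₀
      K≤K₀ = ℚ.≤-trans (≤-by (*-monoˡ K≥0 (ι-mono (ℕ.m^n>0 2 (suc fuel)))) (regroup K (ι (2 ℕ.^ suc fuel)))) K≤
        where
        regroup : ∀ k p → k * p - k ≡ k * p - k * 𝟏
        regroup k p = solve 2 (λ a b → a :* b :- a := a :* b :- a :* (lit 1)) refl _ _
      valid₀ : Valid K₀ w
      valid₀ p x = ℚ.≤-trans (V p x) K≤K₀
      next : ∀ {T} → total (termEnergy (means w W)) + ε * ε ≤ T → total {N} {r} (λ _ → 𝟏) < T + ι fuel * (ε * ε)
      next {T} p = ℚ.<-≤-trans low (≤-by p (trans (cong (λ z → T + ι fuel * (ε * ε) - (total (termEnergy (means w W)) + z * (ε * ε))) (ι-suc fuel))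
        (regroup T (ι fuel) (ε * ε) (total (termEnergy (means w W))))))
        where
        regroup : ∀ t f e s → t + f * e - (s + (𝟏 + f) * e) ≡ t - (s + e)
        regroup t f e s = solve 4 (λ a b c d → a :+ b :* c :- (d :+ ((lit 1) :+ b) :* c) := a :- (d :+ c)) refl _ _ _ _
      contradict : ∀ j g (u : ∀ x → Unit (g x)) t →
        (termEnergy (means w W) t + termEnergy (means w W) t) + (ε * ε + ε * ε) ≤
          termEnergy (Step.M⁺ w W j g u) t + termEnergy (Step.M⁻ w W j g u) t → ⊥
      contradict j g u t p = [ (λ q → refute ¬G fuel (Step.w⁺ w W j g u) (Step.W⁺ w W j g u) (K + K) (+-nonneg K≥0 K≥0) (Step.tilted-valid w W j g u _ (Step.h-upper w W j g u) V) K+K≤ (next q)) ,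
        (λ q → refute ¬G fuel (Step.w⁻ w W j g u) (Step.W⁻ w W j g u) (K + K) (+-nonneg K≥0 K≥0) (Step.tilted-valid w W j g u _ (Step.h⁻-upper w W j g u) V) K+K≤ (next q)) ]′ (Step.improve w W j g u t p)

Regularisation : ℕ → ℕ → ℚ → Set₁
Regularisation N r ε = Σ ℕ λ K → 𝟎 < ι K × (∀ {n} (E : Fin (suc n) → Fin (suc n) → Fin (suc n) → ℚ) (E-unit : ∀ x y z → Unit (E x y z))
  (E-sym₁ : ∀ x y z → E x y z ≡ E y x z) (E-sym₂ : ∀ x y z → E x y z ≡ E x z y) →
  let open Regularise {N} r E E-unit E-sym₁ E-sym₂ in
  ∀ {Goal : Set} → Dec Goal → (∀ w (W : ∀ p → IsWeight (w p)) → Valid (ι K) w → System.Regular (system w W) r ε → Goal) → Goal)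

-- The process starts from uniform weights, where `K = 1`. Every energy is at most 1, so the number
-- of steps is bounded by the number of terms divided by `ε²`. The cap on the weights, a power of
-- two, hence depends neither on `n` nor on the graph.
regularise : ∀ N r ε → 𝟎 < ε → Regularisation N r ε
regularise N r ε ε>0 with natural-bound (total {N} {r} (λ _ → 𝟏))
... | b , B≤b with exceed b (*-pos ε>0 ε>0)
...   | fuel , big = 2 ℕ.^ fuel , ℚ.<-≤-trans 0<1 (ι-mono (ℕ.m^n>0 2 fuel)) , conclude
  where
  conclude : ∀ {n} (E : Fin (suc n) → Fin (suc n) → Fin (suc n) → ℚ) (E-unit : ∀ x y z → Unit (E x y z))
    (E-sym₁ : ∀ x y z → E x y z ≡ E y x z) (E-sym₂ : ∀ x y z → E x y z ≡ E x z y) →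
    let open Regularise {N} r E E-unit E-sym₁ E-sym₂ in
    ∀ {Goal : Set} → Dec Goal → (∀ w (W : ∀ p → IsWeight (w p)) → Valid (ι (2 ℕ.^ fuel)) w → System.Regular (system w W) r ε → Goal) → Goal
  conclude E E-unit E-sym₁ E-sym₂ (yes G) core = G
  conclude {n} E E-unit E-sym₁ E-sym₂ (no ¬G) core with reciprocal (ι (suc n)) (ι-pos n)
  ... | y , y>0 , e = ⊥-elim (refute (no ¬G) core ¬G fuel (λ _ _ → y) (λ _ → uniform) 𝟏 0≤1 (λ _ _ → ≤-refl′ e) (≤-refl′ (one _))
      (ℚ.≤-<-trans B≤b (ℚ.<-≤-trans big (≤-by (total-nonneg (termEnergy-nonneg (means (λ _ _ → y) (λ _ → uniform)))) (regroup _ _)))))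
    where
    open Regularise {N} r E E-unit E-sym₁ E-sym₂
    uniform : IsWeight {suc n} (λ _ → y)
    uniform = record { nonneg = λ _ → ℚ.<⇒≤ y>0 ; sum-1 = trans (∑-const (suc n) y) e }
    one : ∀ x → 𝟏 * x ≡ x
    one x = solve 1 (λ a → (lit 1) :* a := a) refl _
    regroup : ∀ t f → t + f - f ≡ t - 𝟎
    regroup t f = solve 2 (λ a b → a :+ b :- b := a :- (lit 0)) refl _ _
    gated-nonneg : ∀ {A : Set} (a : Dec A) {x} → 𝟎 ≤ x → 𝟎 ≤ gated a x
    gated-nonneg (yes _) p = p
    gated-nonneg (no _) p = ℚ.≤-refl
    termEnergy-nonneg : ∀ M t → 𝟎 ≤ termEnergy M t
    termEnergy-nonneg M (avoidᵗ m (j ∷ os)) = gated-nonneg (distinct? (j ∷ os)) (≤-𝔼 (product M os) (λ xs → sq-nonneg _))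
    termEnergy-nonneg M (hitᵗ (j ∷ os)) = gated-nonneg (distinct? (j ∷ os)) (≤-𝔼 (product M os) (λ xs → sq-nonneg _))

-- From a dense flower to a blow-up

-- Small N ξ b: starting from ξ, the operation ξ ↦ c with 2c ≤ ξ² can be applied N
-- times before falling below b.
Small : ℕ → ℚ → ℚ → Set
Small zero ξ b = ⊤
Small (suc N) ξ b = Σ ℚ λ c → 𝟎 < c × c + c ≤ ξ * ξ × b < c × Small N c b

small-enough : ∀ N {ξ} → 𝟎 < ξ → Σ ℚ λ β → 𝟎 < β × (∀ b → b < β → Small N ξ b)
small-enough zero ξ>0 = 𝟏 , 0<1 , λ _ _ → tt
small-enough (suc N) ξ>0 with halve ξ>0
... | c , c>0 , c≤ , _ with small-enough N c>0
...   | β , β>0 , f with c ℚ.≤? β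
...     | yes p = c , c>0 , λ b q → c , c>0 , c≤ , q , f b (ℚ.<-≤-trans q p)
...     | no p = β , β>0 , λ b q → c , c>0 , c≤ , ℚ.<-trans q (ℚ.≰⇒> p) , f b q

*-pos-left : ∀ {a b} → 𝟎 ≤ b → 𝟎 < a * b → 𝟎 < a
*-pos-left b≥0 p = ℚ.≰⇒> (λ q → ≤⇒≯ (ℚ.≤-trans (*-monoʳ b≥0 q) (≤-refl′ (zero-* _))) p)

*-pos-right : ∀ {a b} → 𝟎 ≤ a → 𝟎 < a * b → 𝟎 < b
*-pos-right {a} a≥0 p = ℚ.≰⇒> (λ q → ≤⇒≯ (ℚ.≤-trans (*-monoˡ a≥0 q) (≤-refl′ (*-zero a))) p)

⊑-++-split : ∀ {A : Set} {m n} {q : A} (xs : Vec A m) {ys : Vec A n} → q ∷ [] ⊑ xs Vec.++ ys → q ∷ [] ⊑ xs ⊎ q ∷ [] ⊑ ys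
⊑-++-split [] t = inj₂ t
⊑-++-split (x ∷ xs) (keep t) = inj₁ (keep ⊑-min)
⊑-++-split (x ∷ xs) (skip t) = Data.Sum.map skip id (⊑-++-split xs t)

Distinct-++ : ∀ {A : Set} {m n} (xs : Vec A m) {ys : Vec A n} → Distinct xs → Distinct ys →
  (∀ p → p ∷ [] ⊑ xs → Fresh p ys) → Distinct (xs Vec.++ ys)
Distinct-++ [] D D′ F = D′
Distinct-++ (x ∷ xs) D D′ F = Distinct-∷
  (λ q t → [ (λ s → D x q (keep s)) , F x (keep ⊑-min) q ]′ (⊑-++-split xs t))
  (Distinct-++ xs (Distinct-⊑ (skip ⊑-refl) D) D′ (λ p t → F p (skip t)))

module Blowup {n : ℕ} (κ : ℚ) where
  V : Set
  V = Fin n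

  countIn : ∀ {m} → Vec V m → V → ℚ
  countIn [] x = 𝟎
  countIn (u ∷ us) x = δ u x + countIn us x

  module _ (w : V → ℚ) (W : IsWeight w) (w≤κ : ∀ x → w x ≤ κ) where
    private
      M : Mean V
      M = weighted w W

    countIn-𝔼 : ∀ {m} (us : Vec V m) → 𝔼 M (countIn us) ≤ ι m * κ
    countIn-𝔼 [] = ≤-refl′ (trans (𝔼-const M 𝟎) (sym (zero-* κ)))
    countIn-𝔼 {suc m} (u ∷ us) = ℚ.≤-trans (≤-refl′ (𝔼-+ M (δ u) (countIn us)))
      (ℚ.≤-trans (ℚ.≤-trans (≤-refl′ (trans (∑-cong {n} (λ x → swap (w x) (δ u x))) (∑-δ u w))) (w≤κ u) ⊕ countIn-𝔼 us)
        (≤-refl′ (trans (expand (ι m)) (cong (_* κ) (sym (ι-suc m))))))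
      where
      swap : ∀ a b → a * b ≡ b * a
      swap a b = solve 2 (λ a b → a :* b := b :* a) refl _ _
      expand : ∀ z → κ + z * κ ≡ (𝟏 + z) * κ
      expand z = solve 2 (λ a b → a :+ b :* a := ((lit 1) :+ b) :* a) refl _ _

    countIn-nonneg : ∀ {m} (us : Vec V m) x → 𝟎 ≤ countIn us x
    countIn-nonneg [] x = ℚ.≤-refl
    countIn-nonneg (u ∷ us) x = +-nonneg (proj₁ (Unit-δ u x)) (countIn-nonneg us x)

    countIn-≥1 : ∀ {m} (us : Vec V m) x → ¬ Fresh x us → 𝟏 ≤ countIn us x
    countIn-≥1 [] x p = ⊥-elim (p (λ _ ()))
    countIn-≥1 (u ∷ us) x p with x Fin.≟ u
    ... | yes refl = ≤-by (≤-refl′ (sym (δ-diagonal x)) ⊕ countIn-nonneg us x) (regroup (δ x x) (countIn us x))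
      where
      regroup : ∀ a b → a + b - 𝟏 ≡ (a + b) - (𝟏 + 𝟎)
      regroup a b = solve 2 (λ a b → a :+ b :- (lit 1) := a :+ b :- ((lit 1) :+ (lit 0))) refl _ _
    ... | no q = ≤-by (proj₁ (Unit-δ u x) ⊕ countIn-≥1 us x (λ F → p (Fresh-∷ q F))) (regroup (δ u x) (countIn us x))
      where
      regroup : ∀ a b → a + b - 𝟏 ≡ (a + b) - (𝟎 + 𝟏)
      regroup a b = solve 2 (λ a b → a :+ b :- (lit 1) := a :+ b :- ((lit 0) :+ (lit 1))) refl _ _

    -- The used vertices have total weight at most `m κ < c`. If `f` were below `c` at all other
    -- vertices, its mean would be less than `2c`.
    avoid-used : ∀ {m c} (f : V → ℚ) → (∀ x → Unit (f x)) → 𝟎 < c → c + c ≤ 𝔼 M f → (used : Vec V m) → ι m * κ < c →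
      Σ V λ x → Fresh x used × c ≤ f x
    avoid-used {m} {c} f u c>0 big used few with Fin.any? (λ x → fresh? x used ×-dec c ℚ.≤? f x)
    ... | yes found = found
    ... | no none = ⊥-elim (≤⇒≯ (ℚ.≤-trans big (ℚ.≤-trans (𝔼-mono M bound)
        (≤-refl′ (trans (𝔼-+ M (λ _ → c) (countIn used)) (cong (_+ 𝔼 M (countIn used)) (𝔼-const M c))))))
        (ℚ.≤-<-trans (+-mono (ℚ.≤-refl {c}) (countIn-𝔼 used)) (subst₂ _<_ (comm (ι m * κ) c) refl (+-mono-< few (ℚ.≤-refl {c})))))
      where
      comm : ∀ a b → a + b ≡ b + a
      comm a b = solve 2 (λ a b → a :+ b := b :+ a) refl _ _
      bound : ∀ x → f x ≤ c + countIn used x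
      bound x = from (fresh? x used)
        where
        regroup : ∀ a b → c + b - a ≡ (c + b) - (a + 𝟎)
        regroup a b = solve 3 (λ a b c → a :+ b :- c := a :+ b :- (c :+ (lit 0))) refl _ _ _
        regroup′ : ∀ a b → c + b - a ≡ (𝟏 + (b + c)) - (a + (𝟏 + 𝟎))
        regroup′ a b = solve 3 (λ a b c → a :+ b :- c := (lit 1) :+ (b :+ a) :- (c :+ ((lit 1) :+ (lit 0)))) refl _ _ _
        from : Dec (Fresh x used) → f x ≤ c + countIn used x
        from (yes F) = ≤-by (ℚ.<⇒≤ (ℚ.≰⇒> (λ p → none (x , F , p))) ⊕ countIn-nonneg used x) (regroup (f x) (countIn used x))
        from (no F) = ≤-by (proj₂ (u x) ⊕ countIn-≥1 used x F ⊕ ℚ.<⇒≤ c>0) (regroup′ (f x) (countIn used x))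

    record Picked {U : Set} (MU : Mean U) (A : V → U → ℚ) {m} (used : Vec V m) (s N : ℕ) (b : ℚ) : Set where
      field
        xs       : Vec V s
        distinct : Distinct xs
        fresh    : ∀ q → q ∷ [] ⊑ xs → Fresh q used
        ξ′       : ℚ
        ξ′>0     : 𝟎 < ξ′
        small-rest : Small N ξ′ b
        Q        : U → ℚ
        Q-unit   : ∀ u → Unit (Q u)
        Q-large  : ξ′ ≤ 𝔼 MU Q
        Q-pos    : ∀ u → 𝟎 < Q u → (∀ i → 𝟎 < A (lookup xs i) u) × Σ V λ x → 𝟎 < A x u

    -- Iterated Cauchy-Schwarz. The second moment of the mean of `A` provides a fresh `x` for which
    -- `A x u * A x′ u` still has a large mean, and this product replaces `A`. After `s` rounds `Q`
    -- averages the product of all the factors, so positivity of `Q u` makes every chosen vertex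
    -- positive at `u`.
    pick : ∀ {U : Set} (MU : Mean U) (fub : ∀ f → 𝔼 M (λ x → 𝔼 MU (f x)) ≡ 𝔼 MU (λ u → 𝔼 M (λ x → f x u))) →
      ∀ s {N ξ b} (A : V → U → ℚ) → (∀ x u → Unit (A x u)) → Small (s ℕ.+ N) ξ b → 𝟎 < ξ → ξ ≤ 𝔼 M (λ x → 𝔼 MU (A x)) →
      ∀ {m} (used : Vec V m) → ι (m ℕ.+ s) * κ ≤ b → 𝟎 ≤ κ → Picked MU A used s N b
    pick MU fub zero A A-unit small ξ>0 large used few κ≥0 = record
      { xs = [] ; distinct = λ _ _ () ; fresh = λ _ () ; ξ′>0 = ξ>0 ; small-rest = small
      ; Q = λ u → 𝔼 M (λ x → A x u) ; Q-unit = λ u → Unit-𝔼 M (λ x → A-unit x u) ; Q-large = ℚ.≤-trans large (≤-refl′ (fub A))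
      ; Q-pos = λ u p → (λ ()) , positive-somewhere u p }
      where
      positive-somewhere : ∀ u → 𝟎 < 𝔼 M (λ x → A x u) → Σ V λ x → 𝟎 < A x u
      positive-somewhere u p with Fin.any? (λ x → 𝟎 ℚ.<? A x u)
      ... | yes q = q
      ... | no q = ⊥-elim (≤⇒≯ (𝔼-≤ M (λ x → ℚ.≮⇒≥ (λ r → q (x , r)))) p)
    pick MU fub (suc s) {N} {ξ} {b} A A-unit (c , c>0 , 2c≤ , b<c , small) ξ>0 large {m} used few κ≥0 = extend
        (avoid-used (λ x → 𝔼 M (λ x′ → 𝔼 MU (λ u → A x u * A x′ u))) (λ x → Unit-𝔼 M λ x′ → Unit-𝔼 MU λ u → Unit-* (A-unit x u) (A-unit x′ u))
          c>0 (ℚ.≤-trans 2c≤ (ℚ.≤-trans (sq-mono (ℚ.<⇒≤ ξ>0) (ℚ.≤-trans large (≤-refl′ (fub A))))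
            (ℚ.≤-trans (jensen MU (λ u → 𝔼 M (λ x → A x u))) (≤-refl′ square))))
          used (ℚ.≤-<-trans (ℚ.≤-trans (*-monoʳ κ≥0 (ι-mono (ℕ.m≤m+n m (suc s)))) few) b<c))
      where
      square : 𝔼 MU (λ u → 𝔼 M (λ x → A x u) * 𝔼 M (λ x → A x u)) ≡ 𝔼 M (λ x → 𝔼 M (λ x′ → 𝔼 MU (λ u → A x u * A x′ u)))
      square = trans (𝔼-cong MU (λ u → trans (sym (𝔼-*ʳ M (𝔼 M (λ x → A x u)) (λ x → A x u))) (𝔼-cong M (λ x → sym (𝔼-* M (A x u) (λ x′ → A x′ u))))))
        (trans (sym (fub (λ x u → 𝔼 M (λ x′ → A x u * A x′ u)))) (𝔼-cong M (λ x → sym (fub (λ x′ u → A x u * A x′ u)))))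
      extend : (Σ V λ x → Fresh x used × c ≤ 𝔼 M (λ x′ → 𝔼 MU (λ u → A x u * A x′ u))) → Picked MU A used (suc s) N b
      extend (x , x-fresh , large′) = record
        { xs = x ∷ xs ; distinct = Distinct-∷ (λ q t → ≢-sym (fresh q t x (keep ⊑-min))) distinct
        ; fresh = λ { q (keep t) → x-fresh ; q (skip t) → λ p t′ → fresh q t p (skip t′) }
        ; ξ′ = ξ′ ; ξ′>0 = ξ′>0 ; small-rest = small-rest ; Q = Q ; Q-unit = Q-unit ; Q-large = Q-large
        ; Q-pos = λ u p → let (ys , x′ , q) = Q-pos u p in
            (λ { zero → *-pos-left (proj₁ (A-unit x′ u)) q ; (suc i) → *-pos-right (proj₁ (A-unit x u)) (ys i) }) ,
            x′ , *-pos-right (proj₁ (A-unit x u)) q }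
        where
        open Picked (pick MU fub s (λ x′ u → A x u * A x′ u) (λ x′ u → Unit-* (A-unit x u) (A-unit x′ u)) small c>0 large′
          (x ∷ used) (ℚ.≤-trans (≤-refl′ (cong (λ z → ι z * κ) (sym (ℕ.+-suc m s)))) few) κ≥0)

  module _ {N : ℕ} (w : Fin N → V → ℚ) (W : ∀ p → IsWeight (w p)) (w≤κ : ∀ p x → w p x ≤ κ) (κ≥0 : 𝟎 ≤ κ) where
    private
      μ : Fin N → Mean V
      μ p = weighted (w p) (W p)

      fub : ∀ p {k} (ps : Vec (Fin N) k) (f : V → Vec V k → ℚ) →
        𝔼 (μ p) (λ x → 𝔼 (product μ ps) (f x)) ≡ 𝔼 (product μ ps) (λ xs → 𝔼 (μ p) (λ x → f x xs))
      fub p [] f = refl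
      fub p (q ∷ ps) f = trans (weighted-fubini (w p) (w q) (λ x y → 𝔼 (product μ ps) (λ xs → f x (y ∷ xs)))) (𝔼-cong (μ q) (λ y → fub p ps (λ x xs → f x (y ∷ xs))))

    -- One position after the other: `pick` chooses `t` vertices of the first, with tuples of the
    -- remaining positions as `U`, and `Q` takes the place of `F`. This is the argument by which a
    -- dense multipartite hypergraph contains a complete one, here with distinctness enforced.
    clones : ∀ t {k} (ps : Vec (Fin N) k) {ξ b} (F : Vec V k → ℚ) → (∀ xs → Unit (F xs)) → Small (k ℕ.* t) ξ b → 𝟎 < ξ →
      ξ ≤ 𝔼 (product μ ps) F → ∀ {m} (used : Vec V m) → ι (m ℕ.+ k ℕ.* t) * κ ≤ b →
      Σ (Vec (Vec V t) k) λ X → Distinct (Vec.concat X) × (∀ q → q ∷ [] ⊑ Vec.concat X → Fresh q used) ×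
        (∀ (c : Vec (Fin t) k) → 𝟎 < F (Vec.zipWith lookup X c))
    clones t [] F u small ξ>0 large used few = [] , (λ _ _ ()) , (λ _ ()) , λ { [] → ℚ.<-≤-trans ξ>0 large }
    clones t {suc k} (p ∷ ps) {ξ} {b} F u small ξ>0 large {m} used few = extend
        (pick (w p) (W p) (w≤κ p) (product μ ps) (fub p ps) t (λ x xs → F (x ∷ xs)) (λ x xs → u (x ∷ xs)) small ξ>0 large used
          (ℚ.≤-trans (*-monoʳ κ≥0 (ι-mono (ℕ.+-monoʳ-≤ m (ℕ.m≤m+n t (k ℕ.* t))))) few) κ≥0)
      where
      extend : Picked (w p) (W p) (w≤κ p) (product μ ps) (λ x xs → F (x ∷ xs)) used t (k ℕ.* t) b →
        Σ (Vec (Vec V t) (suc k)) λ X → Distinct (Vec.concat X) × (∀ q → q ∷ [] ⊑ Vec.concat X → Fresh q used) ×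
          (∀ (c : Vec (Fin t) (suc k)) → 𝟎 < F (Vec.zipWith lookup X c))
      extend picked =
        let open Picked picked
            (X , D , fr , pos) = clones t ps Q Q-unit small-rest ξ′>0 Q-large (xs Vec.++ used)
              (ℚ.≤-trans (≤-refl′ (cong (λ z → ι z * κ) (trans (cong (ℕ._+ k ℕ.* t) (ℕ.+-comm t m)) (ℕ.+-assoc m t (k ℕ.* t))))) few)
        in xs ∷ X ,
           Distinct-++ xs distinct D (λ p s q s′ → ≢-sym (fr q s′ p (⊑-trans s (⊑-++ˡ xs)))) ,
           (λ q s → [ fresh q , (λ s′ p s″ → fr q s′ p (⊑-trans s″ (⊑-++ʳ xs))) ]′ (⊑-++-split xs s)) ,
           (λ { (i ∷ c) → proj₁ (Q-pos (Vec.zipWith lookup X c) (pos c)) i })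

-- Counting edges

χ : Bool → ℚ
χ true = 𝟏
χ false = 𝟎

Unit-χ : ∀ b → Unit (χ b)
Unit-χ true = Unit-1
Unit-χ false = Unit-0

χ-∧ : ∀ a b → χ (a ∧ b) ≡ χ a * χ b
χ-∧ true b = sym (one (χ b))
  where
  one : ∀ x → 𝟏 * x ≡ x
  one x = solve 1 (λ a → (lit 1) :* a := a) refl _
χ-∧ false b = sym (zero-* (χ b))

sumL : ∀ {A : Set} → List A → (A → ℚ) → ℚ
sumL [] f = 𝟎
sumL (x ∷ xs) f = f x + sumL xs f

sumL-++ : ∀ {A : Set} (xs ys : List A) f → sumL (xs List.++ ys) f ≡ sumL xs f + sumL ys f
sumL-++ [] ys f = zero-+ _
  where
  zero-+ : ∀ x → x ≡ 𝟎 + x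
  zero-+ x = solve 1 (λ a → a := (lit 0) :+ a) refl _
sumL-++ (x ∷ xs) ys f = trans (cong (f x +_) (sumL-++ xs ys f)) (assoc _ _ _)
  where
  assoc : ∀ a b c → a + (b + c) ≡ a + b + c
  assoc a b c = solve 3 (λ a b c → a :+ (b :+ c) := a :+ b :+ c) refl _ _ _

sumL-map : ∀ {A B : Set} (g : A → B) xs f → sumL (List.map g xs) f ≡ sumL xs (f ∘ g)
sumL-map g [] f = refl
sumL-map g (x ∷ xs) f = cong (f (g x) +_) (sumL-map g xs f)

sumL-cong : ∀ {A : Set} (xs : List A) {f g} → (∀ x → f x ≡ g x) → sumL xs f ≡ sumL xs g
sumL-cong [] e = refl
sumL-cong (x ∷ xs) e = cong₂ _+_ (e x) (sumL-cong xs e)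

sumL-× : ∀ {A B : Set} (xs : List A) (ys : List B) f →
  sumL (List.cartesianProduct xs ys) f ≡ sumL xs (λ x → sumL ys (λ y → f (x , y)))
sumL-× [] ys f = refl
sumL-× (x ∷ xs) ys f = trans (sumL-++ (List.map (x ,_) ys) _ f) (cong₂ _+_ (sumL-map (x ,_) ys f) (sumL-× xs ys f))

sumL-tabulate : ∀ {A : Set} {n} (g : Fin n → A) f → sumL (List.tabulate g) f ≡ ∑ (f ∘ g)
sumL-tabulate {n = zero} g f = refl
sumL-tabulate {n = suc n} g f = cong (f (g zero) +_) (sumL-tabulate (g ∘ suc) f)

length-filter : ∀ {A : Set} (g : A → Bool) xs → ι (List.length (List.filter (λ t → g t Data.Bool.≟ true) xs)) ≡ sumL xs (χ ∘ g)
length-filter g [] = refl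
length-filter g (x ∷ xs) with g x
... | true = trans (ι-suc _) (cong (𝟏 +_) (length-filter g xs))
... | false = trans (length-filter g xs) (zero-+ _)
  where
  zero-+ : ∀ x → x ≡ 𝟎 + x
  zero-+ x = solve 1 (λ a → a := (lit 0) :+ a) refl _

below : ∀ {n} → Fin n → Fin n → ℚ
below x y = χ ⌊ Fin.toℕ x ℕ.<? Fin.toℕ y ⌋

-- The sum over increasing pairs, by recursion on the number of vertices. The recursion matches that
-- of `cubic₂` and Pascal's rule for binomials.
sort₂ : ∀ {n} → (Fin n → Fin n → ℚ) → ℚ
sort₂ {zero} f = 𝟎
sort₂ {suc n} f = ∑ (λ z → f zero (suc z)) + sort₂ (λ y z → f (suc y) (suc z))

sort₃ : ∀ {n} → (Fin n → Fin n → Fin n → ℚ) → ℚ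
sort₃ {zero} f = 𝟎
sort₃ {suc n} f = sort₂ (λ y z → f zero (suc y) (suc z)) + sort₃ (λ x y z → f (suc x) (suc y) (suc z))

below-suc : ∀ {n} (x y : Fin n) → below (suc x) (suc y) ≡ below x y
below-suc x y with Fin.toℕ x ℕ.<? Fin.toℕ y | suc (Fin.toℕ x) ℕ.<? suc (Fin.toℕ y)
... | yes _ | yes _ = refl
... | no _ | no _ = refl
... | yes p | no q = ⊥-elim (q (ℕ.s≤s p))
... | no p | yes (ℕ.s≤s q) = ⊥-elim (p q)

private
  0*-+ : ∀ a b → 𝟎 * a + b ≡ b
  0*-+ a b = solve 2 (λ a b → (lit 0) :* a :+ b := b) refl _ _
  1*- : ∀ a → 𝟏 * a ≡ a
  1*- a = solve 1 (λ a → (lit 1) :* a := a) refl _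
  kill : ∀ a b → a * (𝟎 * b) ≡ 𝟎
  kill a b = solve 2 (λ a b → a :* ((lit 0) :* b) := (lit 0)) refl _ _

below-sum₂ : ∀ {n} (f : Fin n → Fin n → ℚ) → ∑ (λ y → ∑ (λ z → below y z * f y z)) ≡ sort₂ f
below-sum₂ {zero} f = refl
below-sum₂ {suc n} f = cong₂ _+_ (trans (0*-+ _ _) (∑-cong {n} (λ z → 1*- _)))
  (trans (∑-cong {n} (λ y → trans (0*-+ _ _) (∑-cong {n} (λ z → cong (_* f (suc y) (suc z)) (below-suc y z))))) (below-sum₂ (λ y z → f (suc y) (suc z))))

below-sum₃ : ∀ {n} (f : Fin n → Fin n → Fin n → ℚ) →
  ∑ (λ x → ∑ (λ y → ∑ (λ z → below x y * (below y z * f x y z)))) ≡ sort₃ f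
below-sum₃ {zero} f = refl
below-sum₃ {suc n} f = cong₂ _+_
  (trans (cong₂ _+_ (trans (∑-cong {suc n} (λ z → zero-* (below zero z * f zero zero z))) (∑-zero (suc n))) (∑-cong {n} (λ y → trans (cong₂ _+_ (kill 𝟏 _)
      (∑-cong {n} (λ z → trans (1*- _) (cong (_* f zero (suc y) (suc z)) (below-suc y z))))) (0+ _))))
    (trans (0+ _) (below-sum₂ (λ y z → f zero (suc y) (suc z)))))
  (trans (∑-cong {n} (λ x → trans (cong₂ _+_ (trans (∑-cong {suc n} (λ z → zero-* (below zero z * f (suc x) zero z))) (∑-zero (suc n)))
      (∑-cong {n} (λ y → trans (cong₂ _+_ (kill (below (suc x) (suc y)) _) (∑-cong {n} (λ z → cong₂ (λ a b → a * (b * f (suc x) (suc y) (suc z))) (below-suc x y) (below-suc y z)))) (0+ _)))) (0+ _)))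
    (below-sum₃ (λ x y z → f (suc x) (suc y) (suc z))))
  where
  0+ : ∀ a → 𝟎 + a ≡ a
  0+ a = solve 1 (λ a → (lit 0) :+ a := a) refl _

inducedEdges-sum : ∀ {n} (G : ThreeGraph n) (W : Vec Bool n) →
  ι (inducedEdges G W) ≡ sort₃ (λ x y z → χ (lookup W x) * (χ (lookup W y) * (χ (lookup W z) * χ (edge G x y z))))
inducedEdges-sum {n} G W = trans (length-filter _ (List.cartesianProduct (List.allFin n) (List.cartesianProduct (List.allFin n) (List.allFin n))))
  (trans (sumL-× (List.allFin n) (List.cartesianProduct (List.allFin n) (List.allFin n)) _)
  (trans (sumL-tabulate {n = n} id _) (trans (∑-cong {n} (λ x → trans (sumL-× (List.allFin n) (List.allFin n) _)
    (trans (sumL-tabulate {n = n} id _) (∑-cong {n} (λ y → trans (sumL-tabulate {n = n} id _) (∑-cong {n} (λ z →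
      trans (χ-∧ ⌊ Fin.toℕ x ℕ.<? Fin.toℕ y ⌋ _) (cong (below x y *_) (trans (χ-∧ ⌊ Fin.toℕ y ℕ.<? Fin.toℕ z ⌋ _) (cong (below y z *_)
        (trans (χ-∧ (lookup W x) _) (cong (χ (lookup W x) *_) (trans (χ-∧ (lookup W y) _) (cong (χ (lookup W y) *_) (χ-∧ (lookup W z) (edge G x y z))))))))))))))))
    (below-sum₃ {n} (λ x y z → χ (lookup W x) * (χ (lookup W y) * (χ (lookup W z) * χ (edge G x y z))))))))

-- Polynomials that are affine in each variable attain their minimum over the
-- cube at a vertex.
Affine : ∀ n → (Vec ℚ n → ℚ) → Set
Affine zero F = ⊤
Affine (suc n) F = (∀ v w → F (v ∷ w) ≡ (𝟏 - v) * F (𝟎 ∷ w) + v * F (𝟏 ∷ w)) × (∀ v → Affine n (λ w → F (v ∷ w)))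

Affine-const : ∀ n c → Affine n (λ _ → c)
Affine-const zero c = tt
Affine-const (suc n) c = (λ v w → split-unit v) , λ _ → Affine-const n c
  where
  split-unit : ∀ v → c ≡ (𝟏 - v) * c + v * c
  split-unit v = solve 2 (λ a b → a := ((lit 1) :- b) :* a :+ b :* a) refl _ _

Affine-+ : ∀ n {F G} → Affine n F → Affine n G → Affine n (λ w → F w + G w)
Affine-+ zero a b = tt
Affine-+ (suc n) {F} {G} (a , a′) (b , b′) = (λ v w → trans (cong₂ _+_ (a v w) (b v w)) (regroup v (F (𝟎 ∷ w)) (F (𝟏 ∷ w)) (G (𝟎 ∷ w)) (G (𝟏 ∷ w)))) , λ v → Affine-+ n (a′ v) (b′ v)
  where
  regroup : ∀ v p q r s → ((𝟏 - v) * p + v * q) + ((𝟏 - v) * r + v * s) ≡ (𝟏 - v) * (p + r) + v * (q + s)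
  regroup v p q r s = solve 5 (λ a b c d e → ((lit 1) :- a) :* b :+ a :* c :+ (((lit 1) :- a) :* d :+ a :* e) := ((lit 1) :- a) :* (b :+ d) :+ a :* (c :+ e)) refl _ _ _ _ _

Affine-* : ∀ n c {F} → Affine n F → Affine n (λ w → c * F w)
Affine-* zero c a = tt
Affine-* (suc n) c {F} (a , a′) = (λ v w → trans (cong (c *_) (a v w)) (regroup v (F (𝟎 ∷ w)) (F (𝟏 ∷ w)))) , λ v → Affine-* n c (a′ v)
  where
  regroup : ∀ v p q → c * ((𝟏 - v) * p + v * q) ≡ (𝟏 - v) * (c * p) + v * (c * q)
  regroup v p q = solve 4 (λ a b c d → a :* (((lit 1) :- b) :* c :+ b :* d) := ((lit 1) :- b) :* (a :* c) :+ b :* (a :* d)) refl _ _ _ _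

cube-minimum : ∀ {n m} (F : Vec ℚ n → ℚ) → Affine n F → (∀ (b : Vec Bool n) → m ≤ F (Vec.map χ b)) →
  ∀ w → (∀ i → Unit (lookup w i)) → m ≤ F w
cube-minimum {zero} F a p [] u = p []
cube-minimum {suc n} {m} F (a , a′) p (v ∷ w) u = ℚ.≤-trans (≤-by
    (*-monoˡ (≤⇒0≤ (proj₂ (u zero))) (cube-minimum (λ w → F (𝟎 ∷ w)) (a′ 𝟎) (λ b → p (false ∷ b)) w (u ∘ suc))
      ⊕ *-monoˡ (proj₁ (u zero)) (cube-minimum (λ w → F (𝟏 ∷ w)) (a′ 𝟏) (λ b → p (true ∷ b)) w (u ∘ suc)))
    (regroup v m (F (𝟎 ∷ w)) (F (𝟏 ∷ w)))) (≤-refl′ (sym (a v w)))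
  where
  regroup : ∀ v m p q → ((𝟏 - v) * p + v * q) - m ≡ ((𝟏 - v) * p + v * q) - ((𝟏 - v) * m + v * m)
  regroup v m p q = solve 4 (λ a b c d → ((lit 1) :- a) :* b :+ a :* c :- d := ((lit 1) :- a) :* b :+ a :* c :- (((lit 1) :- a) :* d :+ a :* d)) refl _ _ _ _

-- `cubic₁`, `cubic₂`, `cubic₃` are multilinear forms over increasing tuples. With all coefficients
-- 1 they are elementary symmetric polynomials, and on an indicator vector they count subsets.
cubic₁ : ∀ {n} → (Fin n → ℚ) → Vec ℚ n → ℚ
cubic₁ c [] = 𝟎
cubic₁ c (v ∷ w) = v * c zero + cubic₁ (c ∘ suc) w

cubic₂ : ∀ {n} → (Fin n → Fin n → ℚ) → Vec ℚ n → ℚ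
cubic₂ c [] = 𝟎
cubic₂ c (v ∷ w) = v * cubic₁ (λ z → c zero (suc z)) w + cubic₂ (λ y z → c (suc y) (suc z)) w

cubic₃ : ∀ {n} → (Fin n → Fin n → Fin n → ℚ) → Vec ℚ n → ℚ
cubic₃ c [] = 𝟎
cubic₃ c (v ∷ w) = v * cubic₂ (λ y z → c zero (suc y) (suc z)) w + cubic₃ (λ x y z → c (suc x) (suc y) (suc z)) w

private
  head-affine : ∀ v x y → v * x + y ≡ (𝟏 - v) * (𝟎 * x + y) + v * (𝟏 * x + y)
  head-affine v x y = solve 3 (λ a b c → a :* b :+ c := ((lit 1) :- a) :* ((lit 0) :* b :+ c) :+ a :* ((lit 1) :* b :+ c)) refl _ _ _

cubic₁-affine : ∀ n c → Affine n (cubic₁ c)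
cubic₁-affine zero c = tt
cubic₁-affine (suc n) c = (λ v w → head-affine v _ _) , λ v → Affine-+ n (Affine-const n _) (cubic₁-affine n _)

cubic₂-affine : ∀ n c → Affine n (cubic₂ c)
cubic₂-affine zero c = tt
cubic₂-affine (suc n) c = (λ v w → head-affine v _ _) , λ v → Affine-+ n (Affine-* n v (cubic₁-affine n _)) (cubic₂-affine n _)

cubic₃-affine : ∀ n c → Affine n (cubic₃ c)
cubic₃-affine zero c = tt
cubic₃-affine (suc n) c = (λ v w → head-affine v _ _) , λ v → Affine-+ n (Affine-* n v (cubic₂-affine n _)) (cubic₃-affine n _)

sort₂-* : ∀ {n} k (f : Fin n → Fin n → ℚ) → sort₂ (λ y z → k * f y z) ≡ k * sort₂ f
sort₂-* {zero} k f = sym (*-zero k)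
sort₂-* {suc n} k f = trans (cong₂ _+_ (∑-* {n} k _) (sort₂-* k (λ y z → f (suc y) (suc z)))) (distrib k _ _)
  where
  distrib : ∀ a b c → a * b + a * c ≡ a * (b + c)
  distrib a b c = solve 3 (λ a b c → a :* b :+ a :* c := a :* (b :+ c)) refl _ _ _

cubic₁-sum : ∀ {n} c (w : Vec ℚ n) → cubic₁ c w ≡ ∑ (λ z → lookup w z * c z)
cubic₁-sum c [] = refl
cubic₁-sum c (v ∷ w) = cong (v * c zero +_) (cubic₁-sum (c ∘ suc) w)

cubic₂-sort : ∀ {n} c (w : Vec ℚ n) → cubic₂ c w ≡ sort₂ (λ y z → lookup w y * (lookup w z * c y z))
cubic₂-sort c [] = refl
cubic₂-sort {suc n} c (v ∷ w) = cong₂ _+_ (trans (cong (v *_) (cubic₁-sum _ w)) (sym (∑-* {n} v _))) (cubic₂-sort (λ y z → c (suc y) (suc z)) w)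

cubic₃-sort : ∀ {n} c (w : Vec ℚ n) → cubic₃ c w ≡ sort₃ (λ x y z → lookup w x * (lookup w y * (lookup w z * c x y z)))
cubic₃-sort c [] = refl
cubic₃-sort {suc n} c (v ∷ w) = cong₂ _+_ (trans (cong (v *_) (cubic₂-sort _ w)) (sym (sort₂-* {n} v _))) (cubic₃-sort (λ x y z → c (suc x) (suc y) (suc z)) w)

sort₂-cong : ∀ {n} {f g : Fin n → Fin n → ℚ} → (∀ y z → f y z ≡ g y z) → sort₂ f ≡ sort₂ g
sort₂-cong {zero} e = refl
sort₂-cong {suc n} e = cong₂ _+_ (∑-cong {n} (λ z → e zero (suc z))) (sort₂-cong {n} (λ y z → e (suc y) (suc z)))

sort₃-cong : ∀ {n} {f g : Fin n → Fin n → Fin n → ℚ} → (∀ x y z → f x y z ≡ g x y z) → sort₃ f ≡ sort₃ g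
sort₃-cong {zero} e = refl
sort₃-cong {suc n} e = cong₂ _+_ (sort₂-cong {n} (λ y z → e zero (suc y) (suc z))) (sort₃-cong {n} (λ x y z → e (suc x) (suc y) (suc z)))

choose₁ : ∀ {n} (W : Vec Bool n) → cubic₁ (λ _ → 𝟏) (Vec.map χ W) ≡ ι ∣ W ∣
choose₁ [] = refl
choose₁ (true ∷ W) = trans (cong (𝟏 * 𝟏 +_) (choose₁ W)) (trans (cong (_+ ι ∣ W ∣) (1*- 𝟏)) (sym (ι-suc ∣ W ∣)))
choose₁ (false ∷ W) = trans (0*-+ 𝟏 _) (choose₁ W)

choose₂ : ∀ {n} (W : Vec Bool n) → cubic₂ (λ _ _ → 𝟏) (Vec.map χ W) ≡ ι (∣ W ∣ Comb.C 2)
choose₂ [] = refl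
choose₂ (true ∷ W) = trans (cong₂ (λ a b → 𝟏 * a + b) (choose₁ W) (choose₂ W))
  (trans (cong₂ (λ a b → a + b) (trans (1*- _) (cong ι (sym (nC1≡n ∣ W ∣)))) refl) (trans (sym (ι-+ (∣ W ∣ Comb.C 1) (∣ W ∣ Comb.C 2))) (cong ι (nCk+nC[k+1]≡[n+1]C[k+1] ∣ W ∣ 1))))
choose₂ (false ∷ W) = trans (0*-+ _ _) (choose₂ W)

choose₃ : ∀ {n} (W : Vec Bool n) → cubic₃ (λ _ _ _ → 𝟏) (Vec.map χ W) ≡ ι (∣ W ∣ Comb.C 3)
choose₃ [] = refl
choose₃ (true ∷ W) = trans (cong₂ (λ a b → 𝟏 * a + b) (choose₂ W) (choose₃ W))
  (trans (cong (_+ ι (∣ W ∣ Comb.C 3)) (1*- _)) (trans (sym (ι-+ (∣ W ∣ Comb.C 2) (∣ W ∣ Comb.C 3))) (cong ι (nCk+nC[k+1]≡[n+1]C[k+1] ∣ W ∣ 2))))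
choose₃ (false ∷ W) = trans (0*-+ _ _) (choose₃ W)

six-sort₂ : ∀ {n} (f : Fin n → Fin n → ℚ) → (∀ y z → f y z ≡ f z y) → (∀ y → f y y ≡ 𝟎) →
  ∑ (λ y → ∑ (λ z → f y z)) ≡ ι 2 * sort₂ f
six-sort₂ {zero} f s o = sym (*-zero (ι 2))
six-sort₂ {suc n} f s o = trans (cong₂ _+_ (cong (_+ ∑ (λ z → f zero (suc z))) (o zero))
    (trans (∑-+ {n} (λ y → f (suc y) zero) _) (cong₂ _+_ (∑-cong {n} (λ y → s (suc y) zero)) (six-sort₂ (λ y z → f (suc y) (suc z)) (λ y z → s _ _) (λ y → o _)))))
  (collect _ _)
  where
  collect : ∀ a b → (𝟎 + a) + (a + ι 2 * b) ≡ ι 2 * (a + b)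
  collect a b = solve 2 (λ a b → (lit 0) :+ a :+ (a :+ (lit 2) :* b) := (lit 2) :* (a :+ b)) refl _ _

six-sort₃ : ∀ {n} (f : Fin n → Fin n → Fin n → ℚ) → (∀ x y z → f x y z ≡ f y x z) → (∀ x y z → f x y z ≡ f x z y) →
  (∀ x z → f x x z ≡ 𝟎) → ∑ (λ x → ∑ (λ y → ∑ (λ z → f x y z))) ≡ ι 6 * sort₃ f
six-sort₃ {zero} f s t o = sym (*-zero (ι 6))
six-sort₃ {suc n} f s t o = trans (cong₂ _+_
    (cong₂ _+_ (trans (∑-cong {suc n} (λ z → o zero z)) (∑-zero (suc n)))
      (trans (∑-cong {n} (λ y → cong (_+ ∑ (λ z → f zero (suc y) (suc z))) (o′ zero (suc y)))) (trans (∑-cong {n} (λ y → 0+ _)) pair)))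
    (trans (∑-cong {n} (λ x → cong₂ _+_ (trans (cong (_+ ∑ (λ z → f (suc x) zero (suc z))) (trans (t (suc x) zero zero) (trans (s (suc x) zero zero) (o′ zero (suc x))))) (trans (0+ _) (∑-cong {n} (λ z → s (suc x) zero (suc z)))))
        (∑-+ {n} (λ y → f (suc x) (suc y) zero) _)))
      (trans (∑-+ {n} _ _) (cong₂ _+_ pair (trans (∑-+ {n} _ _) (cong₂ _+_
        (trans (∑-cong {n} (λ x → ∑-cong {n} (λ y → trans (t (suc x) (suc y) zero) (s (suc x) zero (suc y))))) pair)
        (six-sort₃ (λ x y z → f (suc x) (suc y) (suc z)) (λ x y z → s _ _ _) (λ x y z → t _ _ _) (λ x z → o _ _))))))))
  (collect _ _)
  where
  0+ : ∀ a → 𝟎 + a ≡ a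
  0+ a = solve 1 (λ a → (lit 0) :+ a := a) refl _
  o′ : ∀ x y → f x y x ≡ 𝟎
  o′ x y = trans (t x y x) (o x y)
  pair : ∑ (λ y → ∑ (λ z → f zero (suc y) (suc z))) ≡ ι 2 * sort₂ (λ y z → f zero (suc y) (suc z))
  pair = six-sort₂ (λ y z → f zero (suc y) (suc z)) (λ y z → t zero (suc y) (suc z))
    (λ y → trans (s zero (suc y) (suc y)) (trans (t (suc y) zero (suc y)) (o (suc y) zero)))
  collect : ∀ a b → (𝟎 + ι 2 * a) + (ι 2 * a + (ι 2 * a + ι 6 * b)) ≡ ι 6 * (a + b)
  collect a b = solve 2 (λ a b → (lit 0) :+ (lit 2) :* a :+ ((lit 2) :* a :+ ((lit 2) :* a :+ (lit 6) :* b)) := (lit 6) :* (a :+ b)) refl _ _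

sub-def : ∀ d a ε b → d * ι a - ε * ι b ≡ (d ℚ.* toℚ a) ℚ.- (ε ℚ.* toℚ b)
sub-def d a ε b = trans (+-def _ _) (cong₂ ℚ._+_ (trans (*-def d (ι a)) (cong (d ℚ.*_) (ι-def a)))
  (trans (neg-def _) (cong ℚ.-_ (trans (*-def ε (ι b)) (cong (ε ℚ.*_) (ι-def b))))))

dense-≤ : ∀ {n d ε} (G : ThreeGraph n) → Dense d ε G → ∀ (W : Vec Bool n) → d * ι (∣ W ∣ Comb.C 3) - ε * ι (n ℕ.^ 3) ≤ ι (inducedEdges G W)
dense-≤ {n} {d} {ε} G D W = subst₂ _≤_ (sym (sub-def d (∣ W ∣ Comb.C 3) ε (n ℕ.^ 3))) (sym (ι-def (inducedEdges G W))) (D W)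

≤-dense : ∀ {n d ε} (G : ThreeGraph n) → (∀ (W : Vec Bool n) → d * ι (∣ W ∣ Comb.C 3) - ε * ι (n ℕ.^ 3) ≤ ι (inducedEdges G W)) → Dense d ε G
≤-dense {n} {d} {ε} G D W = subst₂ _≤_ (sub-def d (∣ W ∣ Comb.C 3) ε (n ℕ.^ 3)) (ι-def (inducedEdges G W)) (D W)

-- Edges minus `d` times triples is affine in each single weight, so its minimum over the cube is
-- attained at an indicator vector, where it is the density hypothesis for a subset.
dense-weighted : ∀ {n d ε} (G : ThreeGraph n) → Dense d ε G → ∀ (w : Vec ℚ n) → (∀ i → Unit (lookup w i)) →
  - (ε * ι (n ℕ.^ 3)) ≤ cubic₃ (λ x y z → χ (edge G x y z)) w + - d * cubic₃ (λ _ _ _ → 𝟏) w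
dense-weighted {n} {d} {ε} G D = cube-minimum _
  (Affine-+ n (cubic₃-affine n _) (Affine-* n (- d) (cubic₃-affine n _)))
  (λ W → ≤-by (dense-≤ G D W) (trans (cong₂ (λ a b → a + - d * b - - (ε * ι (n ℕ.^ 3)))
      (trans (cubic₃-sort _ (Vec.map χ W)) (trans (sort₃-cong (λ x y z → cong₂ _*_ (Vec.lookup-map x χ W) (cong₂ _*_ (Vec.lookup-map y χ W) (cong (_* χ (edge G x y z)) (Vec.lookup-map z χ W))))) (sym (inducedEdges-sum G W)))) (choose₃ W))
    (regroup (ι (inducedEdges G W)) (ι (∣ W ∣ Comb.C 3)) (ε * ι (n ℕ.^ 3)))))
  where
  regroup : ∀ a b e → a + - d * b - - e ≡ a - (d * b - e)
  regroup a b e = solve 4 (λ a b c d → a :+ (:- b) :* c :- (:- d) := a :- (b :* c :- d)) refl _ _ _ _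

-- Dense triples of weighted positions

⊑-lookup₃ : ∀ {A : Set} {n} (xs : Vec A n) {i j k} → i Fin.< j → j Fin.< k → lookup xs i ∷ lookup xs j ∷ lookup xs k ∷ [] ⊑ xs
⊑-lookup₃ (x ∷ xs) {zero} {suc j} {suc k} p (ℕ.s≤s q) = keep (⊑-lookup₂ xs q)
⊑-lookup₃ (x ∷ xs) {suc i} {suc j} {suc k} (ℕ.s≤s p) (ℕ.s≤s q) = skip (⊑-lookup₃ xs p q)

module Indicator {n} (G : ThreeGraph n) where
  distinct₃ : Fin n → Fin n → Fin n → ℚ
  distinct₃ x y z = (𝟏 - δ x y) * ((𝟏 - δ y z) * (𝟏 - δ x z))

  distinct₃-unit : ∀ x y z → Unit (distinct₃ x y z)
  distinct₃-unit x y z = Unit-* (Unit-1- (Unit-δ x y)) (Unit-* (Unit-1- (Unit-δ y z)) (Unit-1- (Unit-δ x z)))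

  distinct₃-sym₁ : ∀ x y z → distinct₃ x y z ≡ distinct₃ y x z
  distinct₃-sym₁ x y z = trans (cong (λ e → (𝟏 - e) * ((𝟏 - δ y z) * (𝟏 - δ x z))) (δ-sym x y)) (swap (𝟏 - δ y x) (𝟏 - δ y z) (𝟏 - δ x z))
    where
    swap : ∀ a b c → a * (b * c) ≡ a * (c * b)
    swap a b c = solve 3 (λ a b c → a :* (b :* c) := a :* (c :* b)) refl _ _ _

  distinct₃-sym₂ : ∀ x y z → distinct₃ x y z ≡ distinct₃ x z y
  distinct₃-sym₂ x y z = trans (cong (λ e → (𝟏 - δ x y) * ((𝟏 - e) * (𝟏 - δ x z))) (δ-sym y z)) (swap (𝟏 - δ x y) (𝟏 - δ z y) (𝟏 - δ x z))
    where
    swap : ∀ a b c → a * (b * c) ≡ c * (b * a)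
    swap a b c = solve 3 (λ a b c → a :* (b :* c) := c :* (b :* a)) refl _ _ _

  distinct₃-diagonal : ∀ x z → distinct₃ x x z ≡ 𝟎
  distinct₃-diagonal x z = trans (cong (λ e → (𝟏 - e) * ((𝟏 - δ x z) * (𝟏 - δ x z))) (δ-diagonal x)) (vanish (𝟏 - δ x z))
    where
    vanish : ∀ a → (𝟏 - 𝟏) * (a * a) ≡ 𝟎
    vanish a = solve 1 (λ a → ((lit 1) :- (lit 1)) :* (a :* a) := (lit 0)) refl _

  distinct₃-≥ : ∀ x y z → 𝟏 - δ x y - δ y z - δ x z ≤ distinct₃ x y z
  distinct₃-≥ x y z = bound (δ x y) (δ y z) (δ x z) (Unit-δ x y) (Unit-δ y z) (Unit-δ x z)
    where
    bound : ∀ a b c → Unit a → Unit b → Unit c → 𝟏 - a - b - c ≤ (𝟏 - a) * ((𝟏 - b) * (𝟏 - c))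
    bound a b c ua ub uc = ≤-by (*-nonneg (*-nonneg (proj₁ ua) (proj₁ ub)) (≤⇒0≤ (proj₂ uc)) ⊕ *-nonneg (proj₁ ua) (proj₁ uc) ⊕ *-nonneg (proj₁ ub) (proj₁ uc)) (solve 3 (λ a b c → ((lit 1) :- a) :* (((lit 1) :- b) :* ((lit 1) :- c)) :- ((lit 1) :- a :- b :- c) := a :* b :* ((lit 1) :- c) :+ (a :* c :+ b :* c) :- ((lit 0) :+ ((lit 0) :+ (lit 0)))) refl _ _ _)

  -- The graph may take arbitrary values on triples with repeated vertices; the factor `distinct₃`
  -- removes them and keeps the symmetry.
  Ê : Fin n → Fin n → Fin n → ℚ
  Ê x y z = χ (edge G x y z) * distinct₃ x y z

  Ê-unit : ∀ x y z → Unit (Ê x y z)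
  Ê-unit x y z = Unit-* (Unit-χ (edge G x y z)) (distinct₃-unit x y z)

  Ê-sym₁ : ∀ x y z → Ê x y z ≡ Ê y x z
  Ê-sym₁ x y z = cong₂ (λ a b → χ a * b) (ThreeGraph.sym₁₂ G x y z) (distinct₃-sym₁ x y z)

  Ê-sym₂ : ∀ x y z → Ê x y z ≡ Ê x z y
  Ê-sym₂ x y z = cong₂ (λ a b → χ a * b) (ThreeGraph.sym₂₃ G x y z) (distinct₃-sym₂ x y z)

  Ê-edge : ∀ x y z → 𝟎 < Ê x y z → edge G x y z ≡ true
  Ê-edge x y z p with edge G x y z
  ... | true = refl
  ... | false = ⊥-elim (≤⇒≯ (≤-refl′ (zero-* _)) p)

sort₃-distinct : ∀ {n} (G : ThreeGraph n) (f : Fin n → Fin n → Fin n → ℚ) →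
  sort₃ (λ x y z → f x y z * Indicator.distinct₃ G x y z) ≡ sort₃ f
sort₃-distinct {n} G f = sort₃-off f (λ x y z → Indicator.distinct₃ G x y z) off
  where
  sort₂-off : ∀ {n} (f g : Fin n → Fin n → ℚ) → (∀ y z → y Fin.< z → g y z ≡ 𝟏) → sort₂ (λ y z → f y z * g y z) ≡ sort₂ f
  sort₂-off {zero} f g e = refl
  sort₂-off {suc n} f g e = cong₂ _+_ (∑-cong {n} (λ z → trans (cong (f zero (suc z) *_) (e zero (suc z) (ℕ.s≤s ℕ.z≤n))) (one _)))
    (sort₂-off (λ y z → f (suc y) (suc z)) (λ y z → g (suc y) (suc z)) (λ y z p → e (suc y) (suc z) (ℕ.s≤s p)))
    where
    one : ∀ a → a * 𝟏 ≡ a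
    one a = solve 1 (λ a → a :* (lit 1) := a) refl _
  sort₃-off : ∀ {n} (f g : Fin n → Fin n → Fin n → ℚ) → (∀ x y z → x Fin.< y → y Fin.< z → g x y z ≡ 𝟏) → sort₃ (λ x y z → f x y z * g x y z) ≡ sort₃ f
  sort₃-off {zero} f g e = refl
  sort₃-off {suc n} f g e = cong₂ _+_
    (sort₂-off (λ y z → f zero (suc y) (suc z)) (λ y z → g zero (suc y) (suc z)) (λ y z p → e zero (suc y) (suc z) (ℕ.s≤s ℕ.z≤n) (ℕ.s≤s p)))
    (sort₃-off (λ x y z → f (suc x) (suc y) (suc z)) (λ x y z → g (suc x) (suc y) (suc z)) (λ x y z p q → e (suc x) (suc y) (suc z) (ℕ.s≤s p) (ℕ.s≤s q)))
  off : ∀ x y z → x Fin.< y → y Fin.< z → Indicator.distinct₃ G x y z ≡ 𝟏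
  off x y z p q = trans (cong₂ (λ a b → (𝟏 - a) * b) (δ-off (Fin.<⇒≢ p)) (cong₂ (λ a b → (𝟏 - a) * (𝟏 - b)) (δ-off (Fin.<⇒≢ q)) (δ-off (Fin.<⇒≢ (ℕ.<-trans p q))))) unit
    where
    unit : (𝟏 - 𝟎) * ((𝟏 - 𝟎) * (𝟏 - 𝟎)) ≡ 𝟏
    unit = solve 0 (((lit 1) :- (lit 0)) :* (((lit 1) :- (lit 0)) :* ((lit 1) :- (lit 0))) := (lit 1)) refl

-- A probability weight `u` bounded by `K / n` becomes a vector in the unit cube after scaling by
-- `s = n / K`. Then `dense-weighted` applies, and its error `ε n³` turns into a multiple of `ε K³`.
module WeightedDensity {n d ε} (G : ThreeGraph n) (D : Dense d ε G) (d≥0 : 𝟎 ≤ d)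
  (u : Fin n → ℚ) (U : IsWeight u) {K k : ℚ} (k>0 : 𝟎 < k) (kK≡1 : k * K ≡ 𝟏) (n>0 : 𝟎 < ι n) (valid : ∀ x → ι n * u x ≤ K) where
  open Indicator G

  M : Mean (Fin n)
  M = weighted u U
  s : ℚ
  s = ι n * k
  s>0 : 𝟎 < s
  s>0 = *-pos n>0 k>0
  v : Vec ℚ n
  v = Vec.tabulate (λ x → s * u x)
  v≡ : ∀ x → lookup v x ≡ s * u x
  v≡ x = Vec.lookup∘tabulate _ x

  v-unit : ∀ x → Unit (lookup v x)
  v-unit x = subst Unit (sym (v≡ x)) (*-nonneg (ℚ.<⇒≤ s>0) (IsWeight.nonneg U x) ,
    ℚ.≤-trans (≤-by (*-monoˡ (ℚ.<⇒≤ k>0) (valid x)) (regroup (ι n) (u x))) (≤-refl′ kK≡1))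
    where
    regroup : ∀ m x → k * K - m * k * x ≡ k * K - k * (m * x)
    regroup m x = solve 4 (λ a b c d → a :* b :- c :* a :* d := a :* b :- a :* (c :* d)) refl _ _ _ _

  integral : (Fin n → Fin n → Fin n → ℚ) → ℚ
  integral f = 𝔼 M λ x → 𝔼 M λ y → 𝔼 M λ z → f x y z

  weigh : ∀ (f : Fin n → Fin n → Fin n → ℚ) → (∀ x y z → f x y z * distinct₃ x y z ≡ f y x z * distinct₃ y x z) →
    (∀ x y z → f x y z * distinct₃ x y z ≡ f x z y * distinct₃ x z y) →
    ι 6 * cubic₃ f v ≡ s * s * s * integral (λ x y z → f x y z * distinct₃ x y z)
  weigh f sym₁ sym₂ = trans (cong (ι 6 *_) (trans (cubic₃-sort f v) (trans (sort₃-cong {n} (λ x y z →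
        trans (cong₂ _*_ (v≡ x) (cong₂ _*_ (v≡ y) (cong (_* f x y z) (v≡ z)))) (regroup (u x) (u y) (u z) (f x y z))))
        (trans (sym (sort₃-distinct G (λ x y z → s * s * s * (u x * (u y * (u z * f x y z)))))) (sort₃-cong {n} (λ x y z → regroup′ (u x) (u y) (u z) (f x y z) (distinct₃ x y z)))))))
    (trans (sym (six-sort₃ {n} F (λ x y z → trans (cong (λ w → s * s * s * (u x * (u y * (u z * w)))) (sym₁ x y z)) (permute₁ (u x) (u y) (u z) _))
        (λ x y z → trans (cong (λ w → s * s * s * (u x * (u y * (u z * w)))) (sym₂ x y z)) (permute₂ (u x) (u y) (u z) _))
        (λ x z → trans (cong (λ w → s * s * s * (u x * (u x * (u z * (f x x z * w))))) (distinct₃-diagonal x z)) (vanish (u x) (u z) (f x x z)))))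
      (trans (∑-cong {n} (λ x → trans (∑-cong {n} (λ y → trans (∑-cong {n} (λ z → pull (s * s * s) (u x) (u y) (u z * (f x y z * distinct₃ x y z)))) (∑-* {n} (s * s * s * u x * u y) _)))
        (trans (∑-cong {n} (λ y → pull′ (s * s * s) (u x) (u y) _)) (∑-* {n} (s * s * s * u x) _))))
        (trans (∑-cong {n} (λ x → pull″ (s * s * s) (u x) _)) (∑-* {n} (s * s * s) _))))
    where
    F : Fin n → Fin n → Fin n → ℚ
    F x y z = s * s * s * (u x * (u y * (u z * (f x y z * distinct₃ x y z))))
    regroup : ∀ a b c e → s * a * (s * b * (s * c * e)) ≡ s * s * s * (a * (b * (c * e)))
    regroup a b c e = solve 6 (λ a b c d e f → a :* b :* c :* (a :* b :* d :* (a :* b :* e :* f)) := a :* b :* (a :* b) :* (a :* b) :* (c :* (d :* (e :* f)))) refl _ _ _ _ _ _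
    regroup′ : ∀ a b c e d → s * s * s * (a * (b * (c * e))) * d ≡ s * s * s * (a * (b * (c * (e * d))))
    regroup′ a b c e d = solve 7 (λ a b c d e f g → a :* b :* (a :* b) :* (a :* b) :* (c :* (d :* (e :* f))) :* g := a :* b :* (a :* b) :* (a :* b) :* (c :* (d :* (e :* (f :* g))))) refl _ _ _ _ _ _ _
    permute₁ : ∀ a b c e → s * s * s * (a * (b * (c * e))) ≡ s * s * s * (b * (a * (c * e)))
    permute₁ a b c e = solve 6 (λ a b c d e f → a :* b :* (a :* b) :* (a :* b) :* (c :* (d :* (e :* f))) := a :* b :* (a :* b) :* (a :* b) :* (d :* (c :* (e :* f)))) refl _ _ _ _ _ _
    permute₂ : ∀ a b c e → s * s * s * (a * (b * (c * e))) ≡ s * s * s * (a * (c * (b * e)))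
    permute₂ a b c e = solve 6 (λ a b c d e f → a :* b :* (a :* b) :* (a :* b) :* (c :* (d :* (e :* f))) := a :* b :* (a :* b) :* (a :* b) :* (c :* (e :* (d :* f)))) refl _ _ _ _ _ _
    vanish : ∀ a c e → s * s * s * (a * (a * (c * (e * 𝟎)))) ≡ 𝟎
    vanish a c e = solve 5 (λ a b c d e → a :* b :* (a :* b) :* (a :* b) :* (c :* (c :* (d :* (e :* (lit 0))))) := (lit 0)) refl _ _ _ _ _
    pull : ∀ t a b w → t * (a * (b * w)) ≡ t * a * b * w
    pull t a b w = solve 4 (λ a b c d → a :* (b :* (c :* d)) := a :* b :* c :* d) refl _ _ _ _
    pull′ : ∀ t a b w → t * a * b * w ≡ t * a * (b * w)
    pull′ t a b w = solve 4 (λ a b c d → a :* b :* c :* d := a :* b :* (c :* d)) refl _ _ _ _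
    pull″ : ∀ t a w → t * a * w ≡ t * (a * w)
    pull″ t a w = solve 3 (λ a b c → a :* b :* c := a :* (b :* c)) refl _ _ _

  collision : ℚ
  collision = 𝔼 M λ x → 𝔼 M λ y → δ x y

  n*collision : ι n * collision ≤ K
  n*collision = ℚ.≤-trans (≤-refl′ (sym (𝔼-* M (ι n) _)))
    (𝔼-≤ M (λ x → ℚ.≤-trans (≤-refl′ (cong (ι n *_) (trans (∑-cong {n} (λ y → swap (u y) (δ x y))) (∑-δ x u)))) (valid x)))
    where
    swap : ∀ a b → a * b ≡ b * a
    swap a b = solve 2 (λ a b → a :* b := b :* a) refl _ _

  distinct-mass : 𝟏 - ι 3 * collision ≤ integral (λ x y z → 𝟏 * distinct₃ x y z)
  distinct-mass = ℚ.≤-trans (≤-refl′ (sym three)) (𝔼-mono M λ x → 𝔼-mono M λ y → 𝔼-mono M λ z → ℚ.≤-trans (distinct₃-≥ x y z) (≤-refl′ (sym (one _))))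
    where
    one : ∀ a → 𝟏 * a ≡ a
    one a = solve 1 (λ a → (lit 1) :* a := a) refl _
    integral-sub : ∀ f g → integral (λ x y z → f x y z - g x y z) ≡ integral f - integral g
    integral-sub f g = trans (𝔼-cong M (λ x → trans (𝔼-cong M (λ y → 𝔼-sub M _ _)) (𝔼-sub M _ _))) (𝔼-sub M _ _)
    three : integral (λ x y z → 𝟏 - δ x y - δ y z - δ x z) ≡ 𝟏 - ι 3 * collision
    three = trans (integral-sub (λ x y z → 𝟏 - δ x y - δ y z) (λ x y z → δ x z)) (trans (cong₂ _-_ (trans (integral-sub (λ x y z → 𝟏 - δ x y) (λ x y z → δ y z))
        (cong₂ _-_ (trans (integral-sub (λ _ _ _ → 𝟏) (λ x y z → δ x y)) (cong₂ _-_
          (trans (𝔼-cong M (λ x → trans (𝔼-cong M (λ y → 𝔼-const M 𝟏)) (𝔼-const M 𝟏))) (𝔼-const M 𝟏))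
          (𝔼-cong M (λ x → 𝔼-cong M (λ y → 𝔼-const M (δ x y))))))
          (𝔼-const M collision)))
        (𝔼-cong M (λ x → 𝔼-const M _)))
      (collect collision))
      where
      collect : ∀ c → 𝟏 - c - c - c ≡ 𝟏 - ι 3 * c
      collect c = solve 1 (λ a → (lit 1) :- a :- a :- a := (lit 1) :- (lit 3) :* a) refl _

  -- Six times a form over increasing triples is the integral over all ordered triples of distinct
  -- vertices, up to `s³`. Triples with a repetition have mass at most `3 * collision`.
  weighted-density : d * (𝟏 - ι 3 * collision) ≤ integral Ê + ι 6 * ε * (K * K * K)
  weighted-density = *-cancel-≤ (*-pos (*-pos s>0 s>0) s>0)
      (ℚ.≤-trans (combine (s * s * s) (integral Ê) (integral (λ x y z → 𝟏 * distinct₃ x y z)) (𝟏 - ι 3 * collision) (ε * ι (n ℕ.^ 3))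
        (cubic₃ (λ x y z → χ (edge G x y z)) v) (cubic₃ (λ _ _ _ → 𝟏) v) (*-nonneg (*-nonneg (ℚ.<⇒≤ s>0) (ℚ.<⇒≤ s>0)) (ℚ.<⇒≤ s>0))
        (dense-weighted G D v v-unit) distinct-mass
        (weigh (λ x y z → χ (edge G x y z)) Ê-sym₁ Ê-sym₂)
        (weigh (λ _ _ _ → 𝟏) (λ x y z → cong (𝟏 *_) (distinct₃-sym₁ x y z)) (λ x y z → cong (𝟏 *_) (distinct₃-sym₂ x y z))))
        (≤-refl′ (trans (cong (λ z → s * s * s * integral Ê + ι 6 * (ε * z)) n³) (collect (integral Ê)))))
    where
    combine : ∀ t a o c e p q → 𝟎 ≤ t → - e ≤ p + - d * q → c ≤ o → ι 6 * p ≡ t * a → ι 6 * q ≡ t * o → t * (d * c) ≤ t * a + ι 6 * e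
    combine t a o c e p q t≥0 le co P Q = ≤-by (*-monoˡ (ι-nonneg 6) le ⊕ *-monoˡ (*-nonneg t≥0 d≥0) co)
      (trans (trans (cong (λ z → z + ι 6 * e - t * (d * c)) (sym P)) (expand p q e (t * (d * c)))) (trans (cong (λ z → ι 6 * (p + - d * q) + d * z - (ι 6 * - e + t * (d * c))) Q) (regroup t c o (ι 6 * (p + - d * q)) (ι 6 * - e))))
      where
      expand : ∀ p q e w → ι 6 * p + ι 6 * e - w ≡ ι 6 * (p + - d * q) + d * (ι 6 * q) - (ι 6 * - e + w)
      expand p q e w = solve 5 (λ a b c d e → (lit 6) :* a :+ (lit 6) :* b :- c := (lit 6) :* (a :+ (:- d) :* e) :+ d :* ((lit 6) :* e) :- ((lit 6) :* (:- b) :+ c)) refl _ _ _ _ _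
      regroup : ∀ t c o x y → x + d * (t * o) - (y + t * (d * c)) ≡ (x + t * d * o) - (y + t * d * c)
      regroup t c o x y = solve 6 (λ a b c d e f → a :+ b :* (c :* d) :- (e :+ c :* (b :* f)) := a :+ c :* b :* d :- (e :+ c :* b :* f)) refl _ _ _ _ _ _
    n³ : ι (n ℕ.^ 3) ≡ s * s * s * (K * K * K)
    n³ = trans (trans (ι-* n _) (cong (ι n *_) (trans (ι-* n _) (cong (ι n *_) (trans (ι-* n 1) (unit (ι n)))))))
      (sym (trans (regroup (ι n)) (trans (cong (λ z → ι n * ι n * ι n * (z * z * z)) kK≡1) (ones (ι n)))))
      where
      unit : ∀ m → m * 𝟏 ≡ m
      unit m = solve 1 (λ a → a :* (lit 1) := a) refl _
      regroup : ∀ m → m * k * (m * k) * (m * k) * (K * K * K) ≡ m * m * m * (k * K * (k * K) * (k * K))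
      regroup m = solve 3 (λ a b c → a :* b :* (a :* b) :* (a :* b) :* (c :* c :* c) := a :* a :* a :* (b :* c :* (b :* c) :* (b :* c))) refl _ _ _
      ones : ∀ m → m * m * m * (𝟏 * 𝟏 * 𝟏) ≡ m * (m * m)
      ones m = solve 1 (λ a → a :* a :* a :* ((lit 1) :* (lit 1) :* (lit 1)) := a :* (a :* a)) refl _
    collect : ∀ a → s * s * s * a + ι 6 * (ε * (s * s * s * (K * K * K))) ≡ s * s * s * (a + ι 6 * ε * (K * K * K))
    collect a = helper s
      where
      helper : ∀ s → s * s * s * a + ι 6 * (ε * (s * s * s * (K * K * K))) ≡ s * s * s * (a + ι 6 * ε * (K * K * K))
      helper s = solve 4 (λ a b c d → a :* a :* a :* b :+ (lit 6) :* (c :* (a :* a :* a :* (d :* d :* d))) := a :* a :* a :* (b :+ (lit 6) :* c :* (d :* d :* d))) refl _ _ _ _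

-- By symmetry three different indices may be sorted. If two coincide, a summand 27 on the right
-- exceeds the trivial bound.
sorted-triple-bound : ∀ {s} (e : Fin s → Fin s → Fin s → ℚ) {c} → (∀ i j k → e i j k ≡ e j i k) → (∀ i j k → e i j k ≡ e i k j) →
  (∀ i j k → e i j k ≤ ι 27) → 𝟎 ≤ c → (∀ {i j k} → i Fin.< j → j Fin.< k → e i j k ≤ c) →
  ∀ i j k → e i j k ≤ c + ι 27 * (δ i j + δ j k + δ i k)
sorted-triple-bound {s} e {c} sym₁ sym₂ top c≥0 sorted i j k = by-order (Fin.<-cmp i j) (Fin.<-cmp j k) (Fin.<-cmp i k)
  where
  Δ : ℚ
  Δ = δ i j + δ j k + δ i k
  from-sorted : e i j k ≤ c → e i j k ≤ c + ι 27 * Δ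
  from-sorted p = ≤-by (p ⊕ *-monoˡ (ι-nonneg 27) (proj₁ (Unit-δ i j) ⊕ proj₁ (Unit-δ j k) ⊕ proj₁ (Unit-δ i k))) (regroup (e i j k) (δ i j) (δ j k) (δ i k))
    where
    regroup : ∀ e x y z → c + ι 27 * (x + y + z) - e ≡ (c + ι 27 * (x + (y + z))) - (e + ι 27 * (𝟎 + (𝟎 + 𝟎)))
    regroup e x y z = solve 5 (λ a b c d e → a :+ (lit 27) :* (b :+ c :+ d) :- e := a :+ (lit 27) :* (b :+ (c :+ d)) :- (e :+ (lit 27) :* ((lit 0) :+ ((lit 0) :+ (lit 0))))) refl _ _ _ _ _
  collide : 𝟏 ≤ Δ → e i j k ≤ c + ι 27 * Δ
  collide p = ≤-by (top i j k ⊕ *-monoˡ (ι-nonneg 27) p ⊕ c≥0) (regroup (e i j k) Δ)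
    where
    regroup : ∀ e x → c + ι 27 * x - e ≡ (ι 27 + (ι 27 * x + c)) - (e + (ι 27 * 𝟏 + 𝟎))
    regroup e x = solve 3 (λ a b c → a :+ (lit 27) :* b :- c := (lit 27) :+ ((lit 27) :* b :+ a) :- (c :+ ((lit 27) :* (lit 1) :+ (lit 0)))) refl _ _ _
  collide₁ : i ≡ j → 𝟏 ≤ Δ
  collide₁ refl = ≤-by (≤-refl′ (sym (δ-diagonal i)) ⊕ proj₁ (Unit-δ i k) ⊕ proj₁ (Unit-δ i k)) (regroup (δ i i) (δ i k))
    where
    regroup : ∀ a b → a + b + b - 𝟏 ≡ (a + (b + b)) - (𝟏 + (𝟎 + 𝟎))
    regroup a b = solve 2 (λ a b → a :+ b :+ b :- (lit 1) := a :+ (b :+ b) :- ((lit 1) :+ ((lit 0) :+ (lit 0)))) refl _ _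
  collide₂ : j ≡ k → 𝟏 ≤ Δ
  collide₂ refl = ≤-by (≤-refl′ (sym (δ-diagonal j)) ⊕ proj₁ (Unit-δ i j) ⊕ proj₁ (Unit-δ i j)) (regroup (δ j j) (δ i j))
    where
    regroup : ∀ a b → b + a + b - 𝟏 ≡ (a + (b + b)) - (𝟏 + (𝟎 + 𝟎))
    regroup a b = solve 2 (λ a b → a :+ b :+ a :- (lit 1) := b :+ (a :+ a) :- ((lit 1) :+ ((lit 0) :+ (lit 0)))) refl _ _
  collide₃ : i ≡ k → 𝟏 ≤ Δ
  collide₃ refl = ≤-by (≤-refl′ (sym (δ-diagonal i)) ⊕ proj₁ (Unit-δ i j) ⊕ proj₁ (Unit-δ j i)) (regroup (δ i i) (δ i j) (δ j i))
    where
    regroup : ∀ a b d → b + d + a - 𝟏 ≡ (a + (b + d)) - (𝟏 + (𝟎 + 𝟎))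
    regroup a b d = solve 3 (λ a b c → a :+ b :+ c :- (lit 1) := c :+ (a :+ b) :- ((lit 1) :+ ((lit 0) :+ (lit 0)))) refl _ _ _
  reorder : ∀ {x y z} → x Fin.< y → y Fin.< z → e i j k ≡ e x y z → e i j k ≤ c + ι 27 * Δ
  reorder p q eq = from-sorted (ℚ.≤-trans (≤-refl′ eq) (sorted p q))
  by-order : Relation.Binary.Definitions.Tri (i Fin.< j) (i ≡ j) (j Fin.< i) → Relation.Binary.Definitions.Tri (j Fin.< k) (j ≡ k) (k Fin.< j) →
    Relation.Binary.Definitions.Tri (i Fin.< k) (i ≡ k) (k Fin.< i) → e i j k ≤ c + ι 27 * Δ
  by-order (tri≈ _ p _) _ _ = collide (collide₁ p)
  by-order _ (tri≈ _ p _) _ = collide (collide₂ p)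
  by-order _ _ (tri≈ _ p _) = collide (collide₃ p)
  by-order (tri< p _ _) (tri< q _ _) _ = reorder p q refl
  by-order (tri< p _ _) (tri> _ _ q) (tri< r _ _) = reorder r q (sym₂ i j k)
  by-order (tri< p _ _) (tri> _ _ q) (tri> _ _ r) = reorder r p (trans (sym₂ i j k) (sym₁ i k j))
  by-order (tri> _ _ p) (tri< q _ _) (tri< r _ _) = reorder p r (sym₁ i j k)
  by-order (tri> _ _ p) (tri< q _ _) (tri> _ _ r) = reorder q r (trans (sym₁ i j k) (sym₂ j i k))
  by-order (tri> _ _ p) (tri> _ _ q) _ = reorder q p (trans (sym₂ i j k) (trans (sym₁ i k j) (sym₂ k i j)))

-- The density hypothesis controls a single weight only. Applied to the average of the weights in
-- the list, it controls the mean density over all triples of its positions.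
module AverageWeight {N n s} (w : Fin N → Fin n → ℚ) (W : ∀ p → IsWeight (w p)) (L : Vec (Fin N) s) {y : ℚ} (y≥0 : 𝟎 ≤ y) (sy≡1 : ι s * y ≡ 𝟏) where
  average : Fin n → ℚ
  average x = y * ∑ (λ i → w (lookup L i) x)

  average-weight : IsWeight average
  average-weight = record
    { nonneg = λ x → *-nonneg y≥0 (∑-nonneg {s} (λ i → IsWeight.nonneg (W (lookup L i)) x))
    ; sum-1 = trans (∑-* {n} y _) (trans (cong (y *_) (trans (∑-swap {n} {s} (λ x i → w (lookup L i) x))
        (trans (∑-cong {s} (λ i → IsWeight.sum-1 (W (lookup L i)))) (∑-const s 𝟏)))) (trans (swap y (ι s)) sy≡1)) }
    where
    swap : ∀ a b → a * (b * 𝟏) ≡ b * a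
    swap a b = solve 2 (λ a b → a :* (b :* (lit 1)) := b :* a) refl _ _

  average-valid : ∀ {K} → (∀ p x → ι n * w p x ≤ K) → ∀ x → ι n * average x ≤ K
  average-valid {K} V x = ℚ.≤-trans (≤-refl′ (trans (regroup (ι n) _) (cong (y *_) (sym (∑-* {s} (ι n) _)))))
    (ℚ.≤-trans (*-monoˡ y≥0 (ℚ.≤-trans (∑-mono {s} (λ i → V (lookup L i) x)) (≤-refl′ (∑-const s K))))
      (≤-refl′ (trans (regroup′ (ι s)) (trans (cong (_* K) sy≡1) (one K)))))
    where
    regroup : ∀ m t → m * (y * t) ≡ y * (m * t)
    regroup m t = solve 3 (λ a b c → a :* (b :* c) := b :* (a :* c)) refl _ _ _
    regroup′ : ∀ m → y * (m * K) ≡ m * y * K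
    regroup′ m = solve 3 (λ a b c → a :* (b :* c) := b :* a :* c) refl _ _ _
    one : ∀ t → 𝟏 * t ≡ t
    one t = solve 1 (λ a → (lit 1) :* a := a) refl _

  average-𝔼 : ∀ (f : Fin n → ℚ) → ∑ (λ x → average x * f x) ≡ ∑ (λ i → y * ∑ (λ x → w (lookup L i) x * f x))
  average-𝔼 f = trans (∑-cong {n} (λ x → trans (regroup _ (f x)) (cong (y *_) (sym (∑-*ʳ {s} (f x) _)))))
    (trans (∑-* {n} y _) (trans (cong (y *_) (∑-swap {n} {s} _)) (sym (∑-* {s} y _))))
    where
    regroup : ∀ t f → y * t * f ≡ y * (t * f)
    regroup t f = solve 3 (λ a b c → a :* b :* c := a :* (b :* c)) refl _ _ _

  private
    μ : Fin s → Mean (Fin n)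
    μ i = weighted (w (lookup L i)) (W (lookup L i))

  average-triple : ∀ (f : Fin n → Fin n → Fin n → ℚ) →
    𝔼 (weighted average average-weight) (λ a → 𝔼 (weighted average average-weight) λ b → 𝔼 (weighted average average-weight) λ c → f a b c) ≡
    ∑ (λ i → ∑ (λ j → ∑ (λ k → y * y * y * 𝔼 (μ i) (λ a → 𝔼 (μ j) λ b → 𝔼 (μ k) λ c → f a b c))))
  average-triple f = trans (average-𝔼 (λ a → 𝔼 U λ b → 𝔼 U λ c → f a b c)) (∑-cong {s} λ i →
      trans (cong (y *_) (𝔼-cong (μ i) inner)) (trans (lift (μ i) (λ j a → ∑ {s} λ k → y * 𝔼 (μ j) λ b → y * 𝔼 (μ k) (f a b)))
        (∑-cong {s} λ j → trans (lift (μ i) (λ k a → y * 𝔼 (μ j) λ b → y * 𝔼 (μ k) (f a b))) (∑-cong {s} λ k → pull i j k))))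
    where
    U : Mean (Fin n)
    U = weighted average average-weight
    lift : ∀ (M : Mean (Fin n)) (g : Fin s → Fin n → ℚ) → y * 𝔼 M (λ a → ∑ {s} λ j → g j a) ≡ ∑ {s} λ j → y * 𝔼 M (g j)
    lift M g = trans (cong (y *_) (𝔼-∑ {n = s} M g)) (sym (∑-* {s} y _))
    inner : ∀ a → 𝔼 U (λ b → 𝔼 U λ c → f a b c) ≡ ∑ {s} λ j → ∑ {s} λ k → y * 𝔼 (μ j) λ b → y * 𝔼 (μ k) (f a b)
    inner a = trans (average-𝔼 (λ b → 𝔼 U λ c → f a b c)) (∑-cong {s} λ j →
      trans (cong (y *_) (𝔼-cong (μ j) (λ b → average-𝔼 (f a b)))) (lift (μ j) (λ k b → y * 𝔼 (μ k) (f a b))))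
    pull : ∀ i j k → y * 𝔼 (μ i) (λ a → y * 𝔼 (μ j) λ b → y * 𝔼 (μ k) (f a b)) ≡ y * y * y * 𝔼 (μ i) (λ a → 𝔼 (μ j) λ b → 𝔼 (μ k) (f a b))
    pull i j k = trans (cong (y *_) (trans (𝔼-* (μ i) y _) (cong (y *_) (trans (𝔼-cong (μ i) (λ a → 𝔼-* (μ j) y _)) (𝔼-* (μ i) y _)))))
      (regroup (𝔼 (μ i) (λ a → 𝔼 (μ j) λ b → 𝔼 (μ k) (f a b))))
      where
      regroup : ∀ e → y * (y * (y * e)) ≡ y * y * y * e
      regroup e = solve 2 (λ a b → a :* (a :* (a :* b)) := a :* a :* a :* b) refl _ _

-- The averaged weight has 27 times density at least `1 + 2η`. This is a mean over `s³` triples of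
-- positions, and those with a repetition contribute at most `81 / s < η`; hence some increasing
-- triple reaches `1 + η`.
dense-triples : ∀ {N n d ε η s} (G : ThreeGraph n) (D : Dense d ε G) → 𝟎 ≤ d → 𝟎 < η → ι 27 * d ≡ 𝟏 + ι 4 * η →
  ∀ (w : Fin N → Fin n → ℚ) (W : ∀ p → IsWeight (w p)) {K k} → 𝟎 < k → k * ι K ≡ 𝟏 → 𝟎 < ι n → (∀ p x → ι n * w p x ≤ ι K) →
  ι 81 * (d * ι K) ≤ ι n * η → ι 162 * ε * (ι K * ι K * ι K) ≤ η → ι 81 < ι s * η → (r : ℕ) (L : Vec (Fin N) s) →
  let open Indicator G in DenseTriples (Regularise.system r Ê Ê-unit Ê-sym₁ Ê-sym₂ w W) η L
dense-triples {N} {n} {d} {ε} {η} {s} G D d≥0 η>0 d≡ w W {K} {k} k>0 kK≡1 n>0 V small₁ small₂ many r L = search (Fin.any? λ i → Fin.any? λ j → Fin.any? λ h →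
    (i Fin.<? j) ×-dec ((j Fin.<? h) ×-dec (𝟏 + η ℚ.≤? ι 27 * e i j h)))
  where
  open Indicator G
  S : System
  S = Regularise.system r Ê Ê-unit Ê-sym₁ Ê-sym₂ w W
  open System S using (μ; fubini)

  e : Fin s → Fin s → Fin s → ℚ
  e i j h = Overlap.density S (lookup L i) (lookup L j) (lookup L h)

  e-sym₁ : ∀ i j h → e i j h ≡ e j i h
  e-sym₁ i j h = trans (fubini (lookup L i) (lookup L j) _) (𝔼-cong (μ (lookup L j)) λ b → 𝔼-cong (μ (lookup L i)) λ a → 𝔼-cong (μ (lookup L h)) λ c → Ê-sym₁ a b c)

  e-sym₂ : ∀ i j h → e i j h ≡ e i h j
  e-sym₂ i j h = 𝔼-cong (μ (lookup L i)) λ a → trans (fubini (lookup L j) (lookup L h) _) (𝔼-cong (μ (lookup L h)) λ c → 𝔼-cong (μ (lookup L j)) λ b → Ê-sym₂ a b c)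

  e-top : ∀ i j h → ι 27 * e i j h ≤ ι 27
  e-top i j h = ≤-by (*-monoˡ (ι-nonneg 27) (𝔼-≤ (μ (lookup L i)) λ a → 𝔼-≤ (μ (lookup L j)) λ b → 𝔼-≤ (μ (lookup L h)) λ c → proj₂ (Ê-unit a b c))) (regroup (e i j h))
    where
    regroup : ∀ x → ι 27 - ι 27 * x ≡ ι 27 * 𝟏 - ι 27 * x
    regroup x = solve 1 (λ a → (lit 27) :- (lit 27) :* a := (lit 27) :* (lit 1) :- (lit 27) :* a) refl _

  s>0 : 𝟎 < ι s
  s>0 = ℚ.≰⇒> (λ p → ≤⇒≯ (ℚ.≤-trans (*-monoʳ (ℚ.<⇒≤ η>0) p) (≤-refl′ (zero-* η))) (ℚ.<-trans (ι-pos 80) many))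

  search : Dec (∃ λ i → ∃ λ j → ∃ λ h → i Fin.< j × j Fin.< h × 𝟏 + η ≤ ι 27 * e i j h) → DenseTriples S η L
  search (yes (i , j , h , p , q , big)) = lookup L i , lookup L j , lookup L h , ⊑-lookup₃ L p q , big
  search (no none) = ⊥-elim (with-reciprocal (reciprocal (ι s) s>0))
    where
    with-reciprocal : (Σ ℚ λ y → 𝟎 < y × ι s * y ≡ 𝟏) → ⊥
    with-reciprocal (y , y>0 , sy≡1) = ≤⇒≯ (ℚ.≤-trans lower upper) strict
      where
      open AverageWeight w W L (ℚ.<⇒≤ y>0) sy≡1
      U : Mean (Fin n)
      U = weighted average average-weight
      I coll : ℚ
      I = 𝔼 U λ a → 𝔼 U λ b → 𝔼 U λ c → Ê a b c
      coll = 𝔼 U λ a → 𝔼 U λ b → δ a b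

      coll-small : ι 81 * (d * coll) ≤ η
      coll-small = *-cancel-≤ n>0 (ℚ.≤-trans (≤-by (*-monoˡ (*-nonneg (ι-nonneg 81) d≥0) (WeightedDensity.n*collision {ε = ε} G D d≥0 average average-weight k>0 kK≡1 n>0 (average-valid V))) (regroup (ι n) coll (ι K))) small₁)
        where
        regroup : ∀ n c K → ι 81 * (d * K) - n * (ι 81 * (d * c)) ≡ ι 81 * d * K - ι 81 * d * (n * c)
        regroup n c K = solve 4 (λ a b c d → (lit 81) :* (a :* b) :- c :* ((lit 81) :* (a :* d)) := (lit 81) :* a :* b :- (lit 81) :* a :* (c :* d)) refl _ _ _ _

      lower : 𝟏 + ι 2 * η ≤ ι 27 * I
      lower = combine I coll d η ε (ι K * ι K * ι K) d≡
          (WeightedDensity.weighted-density {ε = ε} G D d≥0 average average-weight k>0 kK≡1 n>0 (average-valid V)) coll-small small₂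
        where
        combine : ∀ I c d η ε Q → ι 27 * d ≡ 𝟏 + ι 4 * η → d * (𝟏 - ι 3 * c) ≤ I + ι 6 * ε * Q → ι 81 * (d * c) ≤ η → ι 162 * ε * Q ≤ η → 𝟏 + ι 2 * η ≤ ι 27 * I
        combine I c d η ε Q e p q r = ≤-by (*-monoˡ (ι-nonneg 27) p ⊕ q ⊕ r)
          (trans (regroup I η) (trans (cong (λ z → ι 27 * I - z + ι 2 * η) (sym e)) (regroup′ I c d η ε Q)))
          where
          regroup : ∀ I η → ι 27 * I - (𝟏 + ι 2 * η) ≡ ι 27 * I - (𝟏 + ι 4 * η) + ι 2 * η
          regroup I η = solve 2 (λ a b → (lit 27) :* a :- ((lit 1) :+ (lit 2) :* b) := (lit 27) :* a :- ((lit 1) :+ (lit 4) :* b) :+ (lit 2) :* b) refl _ _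
          regroup′ : ∀ I c d η ε Q → ι 27 * I - ι 27 * d + ι 2 * η ≡
            (ι 27 * (I + ι 6 * ε * Q) + (η + η)) - (ι 27 * (d * (𝟏 - ι 3 * c)) + (ι 81 * (d * c) + ι 162 * ε * Q))
          regroup′ I c d η ε Q = solve 6 (λ a b c d e f → (lit 27) :* a :- (lit 27) :* b :+ (lit 2) :* c := (lit 27) :* (a :+ (lit 6) :* d :* e) :+ (c :+ c) :- ((lit 27) :* (b :* ((lit 1) :- (lit 3) :* f)) :+ ((lit 81) :* (b :* f) :+ (lit 162) :* d :* e))) refl _ _ _ _ _ _

      bound : ∀ i j h → ι 27 * e i j h ≤ (𝟏 + η) + ι 27 * (δ i j + δ j h + δ i h)
      bound = sorted-triple-bound (λ i j h → ι 27 * e i j h) (λ i j h → cong (ι 27 *_) (e-sym₁ i j h)) (λ i j h → cong (ι 27 *_) (e-sym₂ i j h))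
        e-top (+-nonneg 0≤1 (ℚ.<⇒≤ η>0)) (λ {i} {j} {h} p q → ℚ.<⇒≤ (ℚ.≰⇒> (λ big → none (i , j , h , p , q , big))))

      Y : ℚ
      Y = y * y * y

      upper : ι 27 * I ≤ 𝟏 + η + ι 81 * y
      upper = ℚ.≤-trans (≤-refl′ (trans (cong (ι 27 *_) (average-triple Ê)) (trans (sym (∑-* {s} (ι 27) _)) (∑-cong {s} λ i →
          trans (sym (∑-* {s} (ι 27) _)) (∑-cong {s} λ j → trans (sym (∑-* {s} (ι 27) _)) (∑-cong {s} λ h → swap Y (e i j h)))))))
        (ℚ.≤-trans (∑-mono {s} λ i → ∑-mono {s} λ j → ∑-mono {s} λ h → *-monoˡ (*-nonneg (*-nonneg (ℚ.<⇒≤ y>0) (ℚ.<⇒≤ y>0)) (ℚ.<⇒≤ y>0)) (bound i j h))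
          (≤-refl′ (trans (∑-cong {s} λ i → trans (∑-cong {s} λ j → trans (∑-* {s} Y _) (cong (Y *_) (inner i j))) (trans (∑-* {s} Y _) (cong (Y *_) (middle i))))
            (trans (∑-const s _) (trans (collect (ι s) (𝟏 + η)) (trans (cong (λ z → z * z * z * (𝟏 + η) + ι 81 * (z * z * y)) sy≡1) (ones (𝟏 + η) y)))))))
        where
        swap : ∀ a b → ι 27 * (a * b) ≡ a * (ι 27 * b)
        swap a b = solve 2 (λ a b → (lit 27) :* (a :* b) := a :* ((lit 27) :* b)) refl _ _
        inner : ∀ i j → ∑ {s} (λ h → (𝟏 + η) + ι 27 * (δ i j + δ j h + δ i h)) ≡ ι s * ((𝟏 + η) + ι 27 * δ i j) + ι 54
        inner i j = trans (∑-cong {s} (λ h → regroup (δ i j) (δ j h) (δ i h))) (trans (∑-+ {s} (λ h → (𝟏 + η) + ι 27 * δ i j) _)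
            (cong₂ _+_ (∑-const s _) (trans (∑-+ {s} (λ h → ι 27 * δ j h) (λ h → ι 27 * δ i h)) (trans (cong₂ _+_ (trans (∑-* {s} (ι 27) (δ j)) (cong (ι 27 *_) (∑-δ′ j))) (trans (∑-* {s} (ι 27) (δ i)) (cong (ι 27 *_) (∑-δ′ i)))) fifty-four))))
          where
          regroup : ∀ a b c → (𝟏 + η) + ι 27 * (a + b + c) ≡ ((𝟏 + η) + ι 27 * a) + (ι 27 * b + ι 27 * c)
          regroup a b c = solve 4 (λ a b c d → (lit 1) :+ a :+ (lit 27) :* (b :+ c :+ d) := (lit 1) :+ a :+ (lit 27) :* b :+ ((lit 27) :* c :+ (lit 27) :* d)) refl _ _ _ _
          fifty-four : ι 27 * 𝟏 + ι 27 * 𝟏 ≡ ι 54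
          fifty-four = solve 0 ((lit 27) :* (lit 1) :+ (lit 27) :* (lit 1) := (lit 54)) refl
        middle : ∀ i → ∑ {s} (λ j → ι s * ((𝟏 + η) + ι 27 * δ i j) + ι 54) ≡ ι s * (ι s * (𝟏 + η) + ι 54) + ι s * ι 27
        middle i = trans (∑-cong {s} (λ j → regroup (ι s) (δ i j))) (trans (∑-+ {s} (λ j → ι s * (𝟏 + η) + ι 54) _)
            (cong₂ _+_ (∑-const s _) (trans (∑-* {s} (ι s * ι 27) (δ i)) (trans (cong (ι s * ι 27 *_) (∑-δ′ i)) (one (ι s * ι 27))))))
          where
          regroup : ∀ t a → t * ((𝟏 + η) + ι 27 * a) + ι 54 ≡ (t * (𝟏 + η) + ι 54) + t * ι 27 * a
          regroup t a = solve 3 (λ a b c → a :* ((lit 1) :+ b :+ (lit 27) :* c) :+ (lit 54) := a :* ((lit 1) :+ b) :+ (lit 54) :+ a :* (lit 27) :* c) refl _ _ _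
          one : ∀ t → t * 𝟏 ≡ t
          one t = solve 1 (λ a → a :* (lit 1) := a) refl _
        collect : ∀ t c → t * (Y * (t * (t * c + ι 54) + t * ι 27)) ≡ (t * y) * (t * y) * (t * y) * c + ι 81 * ((t * y) * (t * y) * y)
        collect t c = helper y
          where
          helper : ∀ y → t * (y * y * y * (t * (t * c + ι 54) + t * ι 27)) ≡ (t * y) * (t * y) * (t * y) * c + ι 81 * ((t * y) * (t * y) * y)
          helper y = solve 3 (λ a b c → a :* (b :* b :* b :* (a :* (a :* c :+ (lit 54)) :+ a :* (lit 27))) := a :* b :* (a :* b) :* (a :* b) :* c :+ (lit 81) :* (a :* b :* (a :* b) :* b)) refl _ _ _
        ones : ∀ c y → 𝟏 * 𝟏 * 𝟏 * c + ι 81 * (𝟏 * 𝟏 * y) ≡ c + ι 81 * y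
        ones c y = solve 2 (λ a b → (lit 1) :* (lit 1) :* (lit 1) :* a :+ (lit 81) :* ((lit 1) :* (lit 1) :* b) := a :+ (lit 81) :* b) refl _ _

      strict : 𝟏 + η + ι 81 * y < 𝟏 + ι 2 * η
      strict = subst₂ _<_ (regroup y η) (regroup′ η) (+-mono-< 81y<η (ℚ.≤-refl {𝟏 + η}))
        where
        regroup : ∀ y η → ι 81 * y + (𝟏 + η) ≡ 𝟏 + η + ι 81 * y
        regroup y η = solve 2 (λ a b → (lit 81) :* a :+ ((lit 1) :+ b) := (lit 1) :+ b :+ (lit 81) :* a) refl _ _
        regroup′ : ∀ η → η + (𝟏 + η) ≡ 𝟏 + ι 2 * η
        regroup′ η = solve 1 (λ a → a :+ ((lit 1) :+ a) := (lit 1) :+ (lit 2) :* a) refl _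
        81y<η : ι 81 * y < η
        81y<η = ℚ.≰⇒> (λ p → ≤⇒≯ (ℚ.≤-trans (≤-by (*-monoˡ (ι-nonneg s) p) (regroup″ (ι s) y)) (≤-refl′ (trans (cong (ι 81 *_) sy≡1) (unit (ι 81))))) many)
          where
          regroup″ : ∀ t y → ι 81 * (t * y) - t * η ≡ t * (ι 81 * y) - t * η
          regroup″ t y = solve 3 (λ a b c → (lit 81) :* (a :* b) :- a :* c := a :* ((lit 81) :* b) :- a :* c) refl _ _ _
          unit : ∀ t → t * 𝟏 ≡ t
          unit t = solve 1 (λ a → a :* (lit 1) := a) refl _

-- The copy of H^k in a blow-up of H¹

Searchable : Set → Set₁
Searchable A = ∀ {Q : A → Set} → (∀ x → Dec (Q x)) → Dec (Σ A Q)

searchable-Vec : ∀ {A} → Searchable A → ∀ k → Searchable (Vec A k)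
searchable-Vec s zero Q? with Q? []
... | yes q = yes ([] , q)
... | no q = no λ { ([] , r) → q r }
searchable-Vec s (suc k) Q? with s (λ x → searchable-Vec s k (λ xs → Q? (x ∷ xs)))
... | yes (x , xs , q) = yes (x ∷ xs , q)
... | no q = no λ { (x ∷ xs , r) → q (x , xs , r) }

all-searchable : ∀ {A} → Searchable A → ∀ {Q : A → Set} → (∀ x → Dec (Q x)) → Dec (∀ x → Q x)
all-searchable s {Q} Q? with s {λ x → ¬ Q x} (λ x → case Q? x of λ { (yes q) → no (λ r → r q) ; (no q) → yes q })
... | yes (x , q) = no (λ f → q (f x))
... | no q = yes (λ x → case Q? x of λ { (yes r) → r ; (no r) → ⊥-elim (q (x , r)) })

BlownUp : ∀ {n} → ThreeGraph n → ℕ → Set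
BlownUp {n} G t = Σ (Vec (Vec (Fin n) t) 8) λ X → Distinct (Vec.concat X) ×
  (∀ (c : Vec (Fin t) 8) → 𝟎 < flower Ê Ê Ê Ê (Vec.zipWith lookup X c))
  where open Indicator G

-- The search is finite. `regularise` proves decidable goals only, and this is the goal to which it
-- is applied.
blownUp? : ∀ {n} (G : ThreeGraph n) t → Dec (BlownUp G t)
blownUp? {n} G t = searchable-Vec (searchable-Vec Fin.any? t) 8 (λ X → distinct? (Vec.concat X) ×-dec
  all-searchable (searchable-Vec Fin.any? 8) (λ c → 𝟎 ℚ.<? flower Ê Ê Ê Ê (Vec.zipWith lookup X c)))
  where open Indicator G

distinct-lookup : ∀ {A : Set} {n} (L : Vec A n) → Distinct L → ∀ {i j} → lookup L i ≡ lookup L j → i ≡ j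
distinct-lookup L D {i} {j} e with Fin.<-cmp i j
... | tri< p _ _ = ⊥-elim (D _ _ (⊑-lookup₂ L p) e)
... | tri≈ _ p _ = p
... | tri> _ _ p = ⊥-elim (D _ _ (⊑-lookup₂ L p) (sym e))

module Embed {n} (G : ThreeGraph n) {t} (X : Vec (Vec (Fin n) t) 8) (D : Distinct (Vec.concat X))
  (positive : ∀ (c : Vec (Fin t) 8) → 𝟎 < flower (Indicator.Ê G) (Indicator.Ê G) (Indicator.Ê G) (Indicator.Ê G) (Vec.zipWith lookup X c)) where
  open Indicator G

  at : Fin 8 → Fin t → Fin n
  at r i = lookup (lookup X r) i

  at-injective : ∀ r r′ {i i′} → at r i ≡ at r′ i′ → i ≡ i′
  at-injective r r′ {i} {i′} e = proj₂ (Fin.combine-injective r i r′ i′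
    (distinct-lookup (Vec.concat X) D (trans (Vec.lookup-concat X r i) (trans e (sym (Vec.lookup-concat X r′ i′))))))

  Good : Fin 8 → Fin 8 → Fin 8 → Set
  Good p q r = ∀ i j h → edge G (at p i) (at q j) (at r h) ≡ true

  pattern α = zero
  pattern β = suc zero
  pattern u₁ = suc (suc zero)
  pattern v₁ = suc (suc (suc zero))
  pattern u₂ = suc (suc (suc (suc zero)))
  pattern v₂ = suc (suc (suc (suc (suc zero))))
  pattern u₃ = suc (suc (suc (suc (suc (suc zero)))))
  pattern v₃ = suc (suc (suc (suc (suc (suc (suc zero))))))

  Positive : Vec (Fin n) 8 → Set
  Positive ρ = ((E ρ u₁ α β × E ρ u₁ v₁ β × E ρ u₁ v₁ v₂) × (E ρ u₂ α β × E ρ u₂ v₂ β × E ρ u₂ v₂ v₃) × (E ρ u₃ α β × E ρ u₃ v₃ β × E ρ u₃ v₃ v₁))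
    where
    E : Vec (Fin n) 8 → Fin 8 → Fin 8 → Fin 8 → Set
    E ρ p q r = edge G (lookup ρ p) (lookup ρ q) (lookup ρ r) ≡ true

  split-positive : ∀ ρ → 𝟎 < flower Ê Ê Ê Ê ρ → Positive ρ
  split-positive (a ∷ b ∷ c₁ ∷ d₁ ∷ c₂ ∷ d₂ ∷ c₃ ∷ d₃ ∷ []) p =
      three (*-pos-left (nonneg₂ (nonneg₃ c₂ a b c₂ d₂ b c₂ d₂ d₃) (nonneg₃ c₃ a b c₃ d₃ b c₃ d₃ d₁)) p) ,
      three (*-pos-left (nonneg₃ c₃ a b c₃ d₃ b c₃ d₃ d₁) rest) , three (*-pos-right (nonneg₃ c₂ a b c₂ d₂ b c₂ d₂ d₃) rest)
    where
    nonneg₂ : ∀ {x y} → 𝟎 ≤ x → 𝟎 ≤ y → 𝟎 ≤ x * y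
    nonneg₂ = *-nonneg
    nonneg₃ : ∀ x y z x′ y′ z′ x″ y″ z″ → 𝟎 ≤ Ê x y z * (Ê x′ y′ z′ * Ê x″ y″ z″)
    nonneg₃ x y z x′ y′ z′ x″ y″ z″ = *-nonneg (proj₁ (Ê-unit x y z)) (*-nonneg (proj₁ (Ê-unit x′ y′ z′)) (proj₁ (Ê-unit x″ y″ z″)))
    rest : 𝟎 < (Ê c₂ a b * (Ê c₂ d₂ b * Ê c₂ d₂ d₃)) * (Ê c₃ a b * (Ê c₃ d₃ b * Ê c₃ d₃ d₁))
    rest = *-pos-right (nonneg₃ c₁ a b c₁ d₁ b c₁ d₁ d₂) p
    three : ∀ {x y z x′ y′ z′ x″ y″ z″} → 𝟎 < Ê x y z * (Ê x′ y′ z′ * Ê x″ y″ z″) →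
      edge G x y z ≡ true × edge G x′ y′ z′ ≡ true × edge G x″ y″ z″ ≡ true
    three {x} {y} {z} {x′} {y′} {z′} {x″} {y″} {z″} q =
      let q′ = *-pos-right (proj₁ (Ê-unit x y z)) q in
      Ê-edge x y z (*-pos-left (*-nonneg (proj₁ (Ê-unit x′ y′ z′)) (proj₁ (Ê-unit x″ y″ z″))) q) ,
      Ê-edge x′ y′ z′ (*-pos-left (proj₁ (Ê-unit x″ y″ z″)) q′) , Ê-edge x″ y″ z″ (*-pos-right (proj₁ (Ê-unit x′ y′ z′)) q′)

  -- Clone `i` at role `p`, clone `j` at role `q` and clone `h` at all other roles: the clones at
  -- three prescribed roles can be chosen freely.
  choice : Fin 8 → Fin 8 → Fin t → Fin t → Fin t → Fin 8 → Fin t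
  choice p q i j h s = if ⌊ s Fin.≟ p ⌋ then i else (if ⌊ s Fin.≟ q ⌋ then j else h)

  chosen : ∀ p q i j h → Positive (Vec.tabulate (λ s → at s (choice p q i j h s)))
  chosen p q i j h = subst Positive (zip-tabulate X (choice p q i j h)) (split-positive (Vec.zipWith lookup X (Vec.tabulate (choice p q i j h))) (positive (Vec.tabulate (choice p q i j h))))
    where
    zip-tabulate : ∀ {m} (X : Vec (Vec (Fin n) t) m) (c : Fin m → Fin t) →
      Vec.zipWith lookup X (Vec.tabulate c) ≡ Vec.tabulate (λ s → lookup (lookup X s) (c s))
    zip-tabulate [] c = refl
    zip-tabulate (x ∷ X) c = cong (lookup x (c zero) ∷_) (zip-tabulate X (c ∘ suc))

  good-u₁αβ : Good u₁ α β
  good-u₁αβ i j h = proj₁ (proj₁ (chosen u₁ α i j h))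
  good-u₂αβ : Good u₂ α β
  good-u₂αβ i j h = proj₁ (proj₁ (proj₂ (chosen u₂ α i j h)))
  good-u₃αβ : Good u₃ α β
  good-u₃αβ i j h = proj₁ (proj₂ (proj₂ (chosen u₃ α i j h)))
  good-u₁v₁β : Good u₁ v₁ β
  good-u₁v₁β i j h = proj₁ (proj₂ (proj₁ (chosen u₁ v₁ i j h)))
  good-u₂v₂β : Good u₂ v₂ β
  good-u₂v₂β i j h = proj₁ (proj₂ (proj₁ (proj₂ (chosen u₂ v₂ i j h))))
  good-u₃v₃β : Good u₃ v₃ β
  good-u₃v₃β i j h = proj₁ (proj₂ (proj₂ (proj₂ (chosen u₃ v₃ i j h))))
  good-u₁v₁v₂ : Good u₁ v₁ v₂
  good-u₁v₁v₂ i j h = proj₂ (proj₂ (proj₁ (chosen u₁ v₁ i j h)))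
  good-u₂v₂v₃ : Good u₂ v₂ v₃
  good-u₂v₂v₃ i j h = proj₂ (proj₂ (proj₁ (proj₂ (chosen u₂ v₂ i j h))))
  good-u₃v₃v₁ : Good u₃ v₃ v₁
  good-u₃v₃v₁ i j h = proj₂ (proj₂ (proj₂ (proj₂ (chosen u₃ v₃ i j h))))

  swap₁ : ∀ {p q r} → Good p q r → Good q p r
  swap₁ g i j h = trans (ThreeGraph.sym₁₂ G _ _ _) (g j i h)
  swap₂ : ∀ {p q r} → Good p q r → Good p r q
  swap₂ g i j h = trans (ThreeGraph.sym₂₃ G _ _ _) (g i h j)

  -- Along a petal of H^k, read from its end, the vertices map to
  -- v, u, b, a, u₁, b, a, u₁, ...
  cyclic : ℕ → Fin 8
  cyclic 0 = β
  cyclic 1 = α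
  cyclic 2 = u₁
  cyclic (suc (suc (suc m))) = cyclic m

  role : Fin 8 → Fin 8 → ℕ → Fin 8
  role u v 0 = v
  role u v 1 = u
  role u v (suc (suc m)) = cyclic m

  cyclic-good : ∀ m → Good (cyclic (suc (suc m))) (cyclic (suc m)) (cyclic m)
  cyclic-good 0 = good-u₁αβ
  cyclic-good 1 = swap₁ (swap₂ good-u₁αβ)
  cyclic-good 2 = swap₂ (swap₁ good-u₁αβ)
  cyclic-good (suc (suc (suc m))) = cyclic-good m

  role-good : ∀ {u v} → Good u α β → Good u v β → ∀ m → Good (role u v (suc (suc m))) (role u v (suc m)) (role u v m)
  role-good p q 0 = swap₁ (swap₂ q)
  role-good p q 1 = swap₂ (swap₁ p)
  role-good p q (suc (suc m)) = cyclic-good m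

  module _ {k′ : ℕ} (t≡ : t ≡ 2 ℕ.+ 3 ℕ.* suc (suc k′)) where
    private
      k : ℕ
      k = suc k′

    number : Label k → Fin (2 ℕ.+ 3 ℕ.* suc k)
    number va = zero
    number vb = suc zero
    number (vc i) = suc (suc (Fin.combine (zero {2}) i))
    number (vd i) = suc (suc (Fin.combine {3} (suc zero) i))
    number (ve i) = suc (suc (Fin.combine {3} (suc (suc zero)) i))

    number-injective : ∀ {x y} → number x ≡ number y → x ≡ y
    number-injective {va} {va} e = refl
    number-injective {vb} {vb} e = refl
    number-injective {vc i} {vc j} e = cong vc (proj₂ (Fin.combine-injective (zero {2}) i zero j (Fin.suc-injective (Fin.suc-injective e))))
    number-injective {vd i} {vd j} e = cong vd (proj₂ (Fin.combine-injective {3} (suc zero) i (suc zero) j (Fin.suc-injective (Fin.suc-injective e))))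
    number-injective {ve i} {ve j} e = cong ve (proj₂ (Fin.combine-injective {3} (suc (suc zero)) i (suc (suc zero)) j (Fin.suc-injective (Fin.suc-injective e))))
    number-injective {vc i} {vd j} e = case proj₁ (Fin.combine-injective {3} zero i (suc zero) j (Fin.suc-injective (Fin.suc-injective e))) of λ ()
    number-injective {vc i} {ve j} e = case proj₁ (Fin.combine-injective {3} zero i (suc (suc zero)) j (Fin.suc-injective (Fin.suc-injective e))) of λ ()
    number-injective {vd i} {vc j} e = case proj₁ (Fin.combine-injective {3} (suc zero) i zero j (Fin.suc-injective (Fin.suc-injective e))) of λ ()
    number-injective {vd i} {ve j} e = case proj₁ (Fin.combine-injective {3} (suc zero) i (suc (suc zero)) j (Fin.suc-injective (Fin.suc-injective e))) of λ ()
    number-injective {ve i} {vc j} e = case proj₁ (Fin.combine-injective {3} (suc (suc zero)) i zero j (Fin.suc-injective (Fin.suc-injective e))) of λ ()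
    number-injective {ve i} {vd j} e = case proj₁ (Fin.combine-injective {3} (suc (suc zero)) i (suc zero) j (Fin.suc-injective (Fin.suc-injective e))) of λ ()
    number-injective {va} {vb} ()
    number-injective {va} {vc _} ()
    number-injective {va} {vd _} ()
    number-injective {va} {ve _} ()
    number-injective {vb} {va} ()
    number-injective {vb} {vc _} ()
    number-injective {vb} {vd _} ()
    number-injective {vb} {ve _} ()
    number-injective {vc _} {va} ()
    number-injective {vc _} {vb} ()
    number-injective {vd _} {va} ()
    number-injective {vd _} {vb} ()
    number-injective {ve _} {va} ()
    number-injective {ve _} {vb} ()

    index : Label k → Fin t
    index x = subst Fin (sym t≡) (number x)

    -- A homomorphism of H^k onto roles of H¹. The index of `role` is the distance from the end of
    -- the petal, so `b` and `a` count as distances `k + 1` and `k + 2`. From distance 2 on the role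
    -- does not depend on the petal, and the three petals agree on `a` and `b`.
    labelRole : Label k → Fin 8
    labelRole va = cyclic k
    labelRole vb = cyclic k′
    labelRole (vc i) = role u₁ v₁ (k ℕ.∸ Fin.toℕ i)
    labelRole (vd i) = role u₂ v₂ (k ℕ.∸ Fin.toℕ i)
    labelRole (ve i) = role u₃ v₃ (k ℕ.∸ Fin.toℕ i)

    -- Each vertex of H^k has its own clone number. Vertices of equal role become different clones,
    -- and equal images force equal numbers.
    embedding : Label k → Fin n
    embedding x = at (labelRole x) (index x)

    ∸-pred : ∀ m i → suc i ℕ.≤ m → m ℕ.∸ i ≡ suc (m ℕ.∸ suc i)
    ∸-pred (suc m) zero p = refl
    ∸-pred (suc m) (suc i) (ℕ.s≤s p) = ∸-pred m i p

    consecutive : ∀ {u v} → Good u α β → Good u v β → ∀ (i j l : Fin (suc k)) → Fin.toℕ j ≡ suc (Fin.toℕ i) → Fin.toℕ l ≡ suc (Fin.toℕ j) →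
      Good (role u v (k ℕ.∸ Fin.toℕ i)) (role u v (k ℕ.∸ Fin.toℕ j)) (role u v (k ℕ.∸ Fin.toℕ l))
    consecutive {u} {v} p q i j l e e′ = subst₂ (λ a b → Good (role u v a) (role u v b) (role u v (k ℕ.∸ Fin.toℕ l)))
        (sym (trans (∸-pred k (Fin.toℕ i) i<k) (cong suc (trans (cong (k ℕ.∸_) (sym e)) j-depth)))) (sym j-depth) (role-good p q (k ℕ.∸ Fin.toℕ l))
      where
      j<k : suc (Fin.toℕ j) ℕ.≤ k
      j<k = subst (ℕ._≤ k) e′ (ℕ.≤-pred (Fin.toℕ<n l))
      i<k : suc (Fin.toℕ i) ℕ.≤ k
      i<k = subst (ℕ._≤ k) e (ℕ.<⇒≤ j<k)
      j-depth : k ℕ.∸ Fin.toℕ j ≡ suc (k ℕ.∸ Fin.toℕ l)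
      j-depth = trans (∸-pred k (Fin.toℕ j) j<k) (cong (λ z → suc (k ℕ.∸ z)) (sym e′))

    second : ∀ {u v} → Good u α β → Good u v β → ∀ (j : Fin (suc k)) → Fin.toℕ j ≡ 1 → Good (cyclic k′) (role u v k) (role u v (k ℕ.∸ Fin.toℕ j))
    second {u} {v} p q j e = subst (λ z → Good (cyclic k′) (role u v k) (role u v (k ℕ.∸ z))) (sym e) (role-good p q k′)

    last : ∀ {u v v′} → Good u v v′ → ∀ (i : Fin (suc k)) → suc (Fin.toℕ i) ≡ k →
      Good (role u v (k ℕ.∸ Fin.toℕ i)) (role u v (k ℕ.∸ Fin.toℕ (Fin.fromℕ k))) v′
    last {u} {v} {v′} g i e = subst₂ (λ a b → Good (role u v a) (role u v b) v′) (sym one) (sym end) g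
      where
      end : k ℕ.∸ Fin.toℕ (Fin.fromℕ k) ≡ 0
      end = trans (cong (k ℕ.∸_) (Fin.toℕ-fromℕ k)) (ℕ.n∸n≡0 k)
      one : k ℕ.∸ Fin.toℕ i ≡ 1
      one = trans (∸-pred k (Fin.toℕ i) (ℕ.≤-reflexive e)) (cong suc (trans (cong (k ℕ.∸_) e) (ℕ.n∸n≡0 k)))

    last-role : ∀ u v → role u v (k ℕ.∸ Fin.toℕ (Fin.fromℕ k)) ≡ v
    last-role u v = cong (role u v) (trans (cong (k ℕ.∸_) (Fin.toℕ-fromℕ k)) (ℕ.n∸n≡0 k))

    good-edge : ∀ {x y z} → HEdge k x y z → Good (labelRole x) (labelRole y) (labelRole z)
    good-edge abc₀ = role-good good-u₁αβ good-u₁v₁β k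
    good-edge abd₀ = role-good good-u₂αβ good-u₂v₂β k
    good-edge abe₀ = role-good good-u₃αβ good-u₃v₃β k
    good-edge (bc₀c₁ j e) = second good-u₁αβ good-u₁v₁β j e
    good-edge (bd₀d₁ j e) = second good-u₂αβ good-u₂v₂β j e
    good-edge (be₀e₁ j e) = second good-u₃αβ good-u₃v₃β j e
    good-edge (ccc i j l e e′) = consecutive good-u₁αβ good-u₁v₁β i j l e e′
    good-edge (ddd i j l e e′) = consecutive good-u₂αβ good-u₂v₂β i j l e e′
    good-edge (eee i j l e e′) = consecutive good-u₃αβ good-u₃v₃β i j l e e′
    good-edge (cckdk i e) = subst (Good _ _) (sym (last-role u₂ v₂)) (last good-u₁v₁v₂ i e)
    good-edge (ddkek i e) = subst (Good _ _) (sym (last-role u₃ v₃)) (last good-u₂v₂v₃ i e)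
    good-edge (eekck i e) = subst (Good _ _) (sym (last-role u₁ v₁)) (last good-u₃v₃v₁ i e)

    contains : ContainsH k G
    contains = embedding ,
      (λ {x} {y} e → number-injective (subst-injective (sym t≡) (at-injective (labelRole x) (labelRole y) e))) ,
      λ x y z h → good-edge h (index x) (index y) (index z)
      where
      subst-injective : ∀ {a b} (e : a ≡ b) {x y : Fin a} → subst Fin e x ≡ subst Fin e y → x ≡ y
      subst-injective refl p = p

-- The upper bound

⊑-tabulate : ∀ {A : Set} {n} (f : Fin n → A) {q} → q ∷ [] ⊑ Vec.tabulate f → ∃ λ i → q ≡ f i
⊑-tabulate {n = suc n} f (keep t) = zero , refl
⊑-tabulate {n = suc n} f (skip t) with ⊑-tabulate (f ∘ suc) t
... | i , e = suc i , e

distinct-tabulate : ∀ {A : Set} {n} (f : Fin n → A) → (∀ {i j} → f i ≡ f j → i ≡ j) → Distinct (Vec.tabulate f)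
distinct-tabulate {n = suc n} f inj = Distinct-∷ (λ q t e → case ⊑-tabulate (f ∘ suc) t of λ { (i , e′) → case inj (trans e e′) of λ () })
  (distinct-tabulate (f ∘ suc) (λ e → Fin.suc-injective (inj e)))

exceedℚ : ∀ x {c} → 𝟎 < c → Σ ℕ λ m → x < ι m * c
exceedℚ x c>0 with natural-bound x
... | b , x≤b with exceed b c>0
...   | m , b< = m , ℚ.≤-<-trans x≤b b<

-- The surplus of `27 d` over 1 is divided into four parts: one for repeated vertices, one for the
-- error `ε`, one for repeated positions in the list; the last one survives as the density of a
-- triple.
record Excess (d : ℚ) : Set where
  field
    η   : ℚ
    η>0 : 𝟎 < η
    d≡  : ι 27 * d ≡ 𝟏 + ι 4 * η
    d≥0 : 𝟎 ≤ d

excess : ∀ d → 1/27 < d → Excess d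
excess d d> with fraction 3 (*-pos (ι-pos 26) (<⇒0< d>))
... | η , η>0 , e = record
  { η = η ; η>0 = η>0
  ; d≡ = trans (regroup d 1/27) (cong₂ _+_ 1/27-def (sym e))
  ; d≥0 = *-cancel-≤ (ι-pos 26) (ℚ.≤-trans (≤-by (0≤1) (regroup′ 𝟏)) (ℚ.≤-trans (≤-refl′ (sym 1/27-def)) (*-monoˡ (ι-nonneg 27) (ℚ.<⇒≤ d>)))) }
  where
  regroup : ∀ d c → ι 27 * d ≡ ι 27 * c + ι 27 * (d - c)
  regroup d c = solve 2 (λ a b → (lit 27) :* a := (lit 27) :* b :+ (lit 27) :* (a :- b)) refl _ _
  regroup′ : ∀ a → a - ι 27 * 𝟎 ≡ a - 𝟎
  regroup′ a = solve 1 (λ a → a :- (lit 27) :* (lit 0) := a :- (lit 0)) refl _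

flower-unit : ∀ {V : Set} (E : V → V → V → ℚ) → (∀ x y z → Unit (E x y z)) → ∀ ρ → Unit (flower E E E E ρ)
flower-unit E u (α ∷ β ∷ u₁ ∷ v₁ ∷ u₂ ∷ v₂ ∷ u₃ ∷ v₃ ∷ []) = Unit-* (petal-unit _ _ _ _ _ _ _ _ _) (Unit-* (petal-unit _ _ _ _ _ _ _ _ _) (petal-unit _ _ _ _ _ _ _ _ _))
  where
  petal-unit : ∀ x y z x′ y′ z′ x″ y″ z″ → Unit (E x y z * (E x′ y′ z′ * E x″ y″ z″))
  petal-unit x y z x′ y′ z′ x″ y″ z″ = Unit-* (u x y z) (Unit-* (u x′ y′ z′) (u x″ y″ z″))

-- The dependence runs downwards. The number of positions and the flower density `ξ` depend on `η`;
-- the cap `K` on these; `β` on `ξ` and `t`; then `ε` and the least number of vertices on all of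
-- them. `n₁` makes collisions rare, and `n₂` makes the weight of all `8t` clones less than `β`.
record UpperConstants (d : ℚ) (t : ℕ) : Set₁ where
  field
    excessᶠ : Excess d
  open Excess excessᶠ public
  field
    s₀   : ℕ
    s₀>  : ι 81 < ι s₀ * η
    N r  : ℕ
    ε₁   : ℚ
    ξ    : ℚ
    ξ>0  : 𝟎 < ξ
    core : ∀ (S : System) → let open System S in
      Regular r ε₁ → (L : Vec P N) → Distinct L → (∀ (K : Vec P s₀) → K ⊑ L → DenseTriples S η K) →
      Σ (Vec P 8) λ ps → ξ ≤ 𝔼 (μ* ps) (flower E E E E)
    reg  : Regularisation N r ε₁
  K : ℕ
  K = proj₁ reg
  field
    β    : ℚ
    β>0  : 𝟎 < β
    fits : ∀ b → b < β → Small (8 ℕ.* t) ξ b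
    ε    : ℚ
    ε>0  : 𝟎 < ε
    ε≤   : ι 162 * ε * (ι K * ι K * ι K) ≤ η
    n₁ n₂ : ℕ
    n₁>  : ι 81 * (d * ι K) < ι n₁ * η
    n₂>  : ι (8 ℕ.* t) * ι K < ι n₂ * β

upperConstants : ∀ d → 1/27 < d → ∀ t → UpperConstants d t
upperConstants d d> t = from-s₀ (exceed 81 η>0)
  where
  ex : Excess d
  ex = excess d d>
  open Excess ex
  from-s₀ : (Σ ℕ λ s₀ → ι 81 < ι s₀ * η) → UpperConstants d t
  from-s₀ (s₀ , s₀>) = from-flower (flower-density η η>0 s₀)
    where
    from-flower : FlowerDensity η s₀ → UpperConstants d t
    from-flower (N , r , ε₁ , ε₁>0 , ξ , ξ>0 , core) = from-reg (regularise N r ε₁ ε₁>0) (small-enough (8 ℕ.* t) ξ>0)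
      where
      from-reg : Regularisation N r ε₁ → (Σ ℚ λ β → 𝟎 < β × (∀ b → b < β → Small (8 ℕ.* t) ξ b)) → UpperConstants d t
      from-reg reg (β , β>0 , fits) = from-bounds (fraction (162 ℕ.* (K ℕ.* (K ℕ.* K))) η>0) (exceedℚ (ι 81 * (d * ι K)) η>0) (exceedℚ (ι (8 ℕ.* t) * ι K) β>0)
        where
        K : ℕ
        K = proj₁ reg
        from-bounds : (Σ ℚ λ ε → 𝟎 < ε × ι (suc (162 ℕ.* (K ℕ.* (K ℕ.* K)))) * ε ≡ η) → (Σ ℕ λ m → ι 81 * (d * ι K) < ι m * η) →
          (Σ ℕ λ m → ι (8 ℕ.* t) * ι K < ι m * β) → UpperConstants d t
        from-bounds (ε , ε>0 , ε≡) (n₁ , n₁>) (n₂ , n₂>) = record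
          { excessᶠ = ex ; s₀> = s₀> ; ξ>0 = ξ>0 ; core = core ; reg = reg ; β>0 = β>0 ; fits = fits ; ε = ε ; ε>0 = ε>0
          ; ε≤ = cube-fits (ι K) (trans (cong (_* ε) (trans (cong (𝟏 +_) (sym (trans (ι-* 162 (K ℕ.* (K ℕ.* K))) (cong (ι 162 *_) (trans (ι-* K (K ℕ.* K)) (cong (ι K *_) (ι-* K K))))))) (sym (ι-suc (162 ℕ.* (K ℕ.* (K ℕ.* K))))))) ε≡)
          ; n₁> = n₁> ; n₂> = n₂> }
          where
          cube-fits : ∀ κ → (𝟏 + ι 162 * (κ * (κ * κ))) * ε ≡ η → ι 162 * ε * (κ * κ * κ) ≤ η
          cube-fits κ e = ℚ.≤-trans (≤-by (ℚ.<⇒≤ ε>0) (regroup κ ε)) (≤-refl′ e)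
            where
            regroup : ∀ κ ε → (𝟏 + ι 162 * (κ * (κ * κ))) * ε - ι 162 * ε * (κ * κ * κ) ≡ ε - 𝟎
            regroup κ ε = solve 2 (λ a b → ((lit 1) :+ (lit 162) :* (a :* (a :* a))) :* b :- (lit 162) :* b :* (a :* a :* a) := b :- (lit 0)) refl _ _

module Upper {d t} (U : UpperConstants d t) where
  open UpperConstants U

  blownUp : ∀ {n} → suc (n₁ ℕ.+ n₂) ℕ.≤ suc n → (G : ThreeGraph (suc n)) → Dense d ε G → BlownUp G t
  blownUp {n} n≥ G D = proj₂ (proj₂ reg) Ê Ê-unit Ê-sym₁ Ê-sym₂ (blownUp? G t) from-weights
    where
    open Indicator G
    open Regularise {N} r Ê Ê-unit Ê-sym₁ Ê-sym₂

    from-weights : ∀ w (W : ∀ p → IsWeight (w p)) → Valid (ι K) w → System.Regular (system w W) r ε₁ → BlownUp G t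
    from-weights w W V regular = with-reciprocals (reciprocal (ι K) (proj₁ (proj₂ reg))) (reciprocal (ι (suc n)) (ι-pos n))
      where
      with-reciprocals : (Σ ℚ λ k → 𝟎 < k × ι K * k ≡ 𝟏) → (Σ ℚ λ m → 𝟎 < m × ι (suc n) * m ≡ 𝟏) → BlownUp G t
      with-reciprocals (k , k>0 , Kk) (m , m>0 , nm) = finish (core (system w W) regular (Vec.allFin N) (distinct-tabulate id id)
          (λ L _ → dense-triples {ε = ε} G D d≥0 η>0 d≡ w W k>0 (trans (swap k (ι K)) Kk) (ι-pos n) V
            (ℚ.≤-trans (ℚ.<⇒≤ n₁>) (*-monoʳ (ℚ.<⇒≤ η>0) (ι-mono (ℕ.≤-trans (ℕ.m≤m+n n₁ n₂) (ℕ.≤-trans (ℕ.n≤1+n _) n≥))))) ε≤ s₀> r L))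
        where
        swap : ∀ a b → a * b ≡ b * a
        swap a b = solve 2 (λ a b → a :* b := b :* a) refl _ _
        κ b : ℚ
        -- The cap on a single weight, `K` over the number of vertices; `b` then bounds the weight
        -- of all vertices used by the clones.
        κ = ι K * m
        b = ι (8 ℕ.* t) * κ
        w≤κ : ∀ p x → w p x ≤ κ
        w≤κ p x = *-cancel-≤ (ι-pos n) (ℚ.≤-trans (V p x) (≤-refl′ (trans (sym (one (ι K))) (trans (cong (ι K *_) (sym nm)) (rotate (ι K) (ι (suc n)) m)))))
          where
          one : ∀ a → a * 𝟏 ≡ a
          one a = solve 1 (λ a → a :* (lit 1) := a) refl _
          rotate : ∀ a b c → a * (b * c) ≡ b * (a * c)
          rotate a b c = solve 3 (λ a b c → a :* (b :* c) := b :* (a :* c)) refl _ _ _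
        b<β : b < β
        b<β = ℚ.≰⇒> (λ p → ≤⇒≯ (ℚ.≤-trans (*-monoʳ (ℚ.<⇒≤ β>0) (ι-mono (ℕ.≤-trans (ℕ.m≤n+m n₂ n₁) (ℕ.≤-trans (ℕ.n≤1+n _) n≥))))
          (ℚ.≤-trans (*-monoˡ (ι-nonneg (suc n)) p) (≤-refl′ (trans (regroup (ι (suc n)) (ι (8 ℕ.* t)) (ι K) m) (trans (cong (ι (8 ℕ.* t) * ι K *_) nm) (one (ι (8 ℕ.* t) * ι K))))))) n₂>)
          where
          regroup : ∀ n t k m → n * (t * (k * m)) ≡ t * k * (n * m)
          regroup n t k m = solve 4 (λ a b c d → a :* (b :* (c :* d)) := b :* c :* (a :* d)) refl _ _ _ _
          one : ∀ a → a * 𝟏 ≡ a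
          one a = solve 1 (λ a → a :* (lit 1) := a) refl _
        finish : (Σ (Vec (Fin N) 8) λ ps → ξ ≤ 𝔼 (System.μ* (system w W) ps) (flower Ê Ê Ê Ê)) → BlownUp G t
        finish (ps , dense) =
          let (X , D , _ , pos) = Blowup.clones κ w W w≤κ (*-nonneg (ι-nonneg K) (ℚ.<⇒≤ m>0)) t ps {b = b} (flower Ê Ê Ê Ê) (flower-unit Ê Ê-unit)
                (fits b b<β) ξ>0 dense [] ℚ.≤-refl
          in X , D , pos

upper-bound : ∀ k → 1 ℕ.≤ k → (d : ℚ) → 1/27 < d → Σ ℚ λ ε → 0ℚ < ε × Σ ℕ λ N → (n : ℕ) → N ℕ.≤ n → (G : ThreeGraph n) → Dense d ε G → ContainsH k G
upper-bound (suc k) _ d d> = ε , subst (_< ε) 𝟎-def ε>0 , suc (n₁ ℕ.+ n₂) , λ where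
    (suc n) n≥ G D → let (X , distinct , pos) = blownUp n≥ G D in Embed.contains G X distinct pos refl
  where
  U : UpperConstants d (2 ℕ.+ 3 ℕ.* suc (suc k))
  U = upperConstants d d> _
  open UpperConstants U
  open Upper U

-- The lower bound: the construction

module Construction (L m T : ℕ) (digit : Fin T → Fin m → Fin 3) where
  size : ℕ
  size = L ℕ.* (m ℕ.* T)

  Vertex : Set
  Vertex = Fin size

  vertex : Fin L → Fin m → Fin T → Vertex
  vertex i a t = Fin.combine i (Fin.combine a t)

  block : Vertex → Fin L
  block x = proj₁ (Fin.remQuot {L} (m ℕ.* T) x)
  label : Vertex → Fin m
  label x = proj₁ (Fin.remQuot {m} T (proj₂ (Fin.remQuot {L} (m ℕ.* T) x)))
  table : Vertex → Fin T
  table x = proj₂ (Fin.remQuot {m} T (proj₂ (Fin.remQuot {L} (m ℕ.* T) x)))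

  block-vertex : ∀ i a t → block (vertex i a t) ≡ i
  block-vertex i a t = cong proj₁ (Fin.remQuot-combine {L} {m ℕ.* T} i (Fin.combine a t))
  label-vertex : ∀ i a t → label (vertex i a t) ≡ a
  label-vertex i a t = trans (cong (λ z → proj₁ (Fin.remQuot {m} T (proj₂ z))) (Fin.remQuot-combine {L} {m ℕ.* T} i (Fin.combine a t)))
    (cong proj₁ (Fin.remQuot-combine {m} {T} a t))
  table-vertex : ∀ i a t → table (vertex i a t) ≡ t
  table-vertex i a t = trans (cong (λ z → proj₂ (Fin.remQuot {m} T (proj₂ z))) (Fin.remQuot-combine {L} {m ℕ.* T} i (Fin.combine a t)))
    (cong proj₂ (Fin.remQuot-combine {m} {T} a t))

  block-mono : ∀ {x y} → x Fin.< y → ¬ block y Fin.< block x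
  block-mono {x} {y} x<y p = ℕ.<-asym x<y (subst₂ Fin._<_ (Fin.combine-remQuot {L} (m ℕ.* T) y) (Fin.combine-remQuot {L} (m ℕ.* T) x)
    (Fin.combine-monoˡ-< (proj₂ (Fin.remQuot {L} (m ℕ.* T) y)) (proj₂ (Fin.remQuot {L} (m ℕ.* T) x)) p))

  block-reflects : ∀ {x y} → block x Fin.< block y → x Fin.< y
  block-reflects {x} {y} p = subst₂ Fin._<_ (Fin.combine-remQuot {L} (m ℕ.* T) x) (Fin.combine-remQuot {L} (m ℕ.* T) y)
    (Fin.combine-monoˡ-< (proj₂ (Fin.remQuot {L} (m ℕ.* T) x)) (proj₂ (Fin.remQuot {L} (m ℕ.* T) y)) p)

  -- The random colouring made explicit: the later vertex `y` carries a table with one colour for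
  -- each label, and it is read at the label of the earlier vertex `x`. When all tables occur
  -- equally often, entries at different labels are independent and uniform.
  colour : Vertex → Vertex → Fin 3
  colour x y = digit (table y) (label x)

  precedes : Vertex → Vertex → Bool
  precedes x y = ⌊ block x Fin.<? block y ⌋

  hasColour : Fin 3 → Vertex → Vertex → Bool
  hasColour c x y = ⌊ c Fin.≟ colour x y ⌋

  pattern 0ᶜ = zero
  pattern 1ᶜ = suc zero
  pattern 2ᶜ = suc (suc zero)

  sorted : Vertex → Vertex → Vertex → Bool
  sorted x y z = precedes x y ∧ (precedes y z ∧ (hasColour 0ᶜ x y ∧ (hasColour 1ᶜ y z ∧ hasColour 2ᶜ x z)))

  ∨₆ : Bool → Bool → Bool → Bool → Bool → Bool → Bool
  ∨₆ a b c d e f = a ∨ (b ∨ (c ∨ (d ∨ (e ∨ f))))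

  graph : ThreeGraph size
  graph = record
    { E = λ x y z → ∨₆ (sorted x y z) (sorted x z y) (sorted y x z) (sorted y z x) (sorted z x y) (sorted z y x)
    ; sym₁₂ = λ x y z → permute₁ (sorted x y z) (sorted x z y) (sorted y x z) (sorted y z x) (sorted z x y) (sorted z y x)
    ; sym₂₃ = λ x y z → permute₂ (sorted x y z) (sorted x z y) (sorted y x z) (sorted y z x) (sorted z x y) (sorted z y x) }
    where
    permute₁ : ∀ a b c d e f → ∨₆ a b c d e f ≡ ∨₆ c d a b f e
    permute₁ false false false false false false = refl
    permute₁ true b true d e f = refl
    permute₁ true b false true e f = refl
    permute₁ true b false false e f = refl
    permute₁ false true true d e f = refl
    permute₁ false true false true e f = refl
    permute₁ false true false false e f = refl
    permute₁ false false true d e f = refl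
    permute₁ false false false true e f = refl
    permute₁ false false false false true true = refl
    permute₁ false false false false true false = refl
    permute₁ false false false false false true = refl
    permute₂ : ∀ a b c d e f → ∨₆ a b c d e f ≡ ∨₆ b a e f c d
    permute₂ true true c d e f = refl
    permute₂ true false c d e f = refl
    permute₂ false true c d e f = refl
    permute₂ false false true d true f = refl
    permute₂ false false true d false true = refl
    permute₂ false false true d false false = refl
    permute₂ false false false true true f = refl
    permute₂ false false false true false true = refl
    permute₂ false false false true false false = refl
    permute₂ false false false false true f = refl
    permute₂ false false false false false true = refl
    permute₂ false false false false false false = refl

  sorted⇒edge : ∀ x y z → sorted x y z ≡ true → edge graph x y z ≡ true
  sorted⇒edge x y z e rewrite e = refl

  -- The order and the colour of a pair of vertices; along a tight path the
  -- status of each pair of consecutive vertices determines the next one.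
  Status : Set
  Status = Bool × Fin 3

  Has : Vertex → Vertex → Status → Set
  Has x y (true , c) = block x Fin.< block y × c ≡ colour x y
  Has x y (false , c) = block y Fin.< block x × c ≡ colour y x

  Has-unique : ∀ {x y} s s′ → Has x y s → Has x y s′ → s ≡ s′
  Has-unique (true , c) (true , c′) (_ , p) (_ , q) = cong (true ,_) (trans p (sym q))
  Has-unique (false , c) (false , c′) (_ , p) (_ , q) = cong (false ,_) (trans p (sym q))
  Has-unique (true , c) (false , c′) (p , _) (q , _) = ⊥-elim (ℕ.<-asym p q)
  Has-unique (false , c) (true , c′) (p , _) (q , _) = ⊥-elim (ℕ.<-asym p q)

  next : Status → Status
  next (true , 0ᶜ) = true , 1ᶜ
  next (true , 1ᶜ) = false , 2ᶜ
  next (true , 2ᶜ) = false , 1ᶜ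
  next (false , 0ᶜ) = true , 2ᶜ
  next (false , 1ᶜ) = false , 0ᶜ
  next (false , 2ᶜ) = true , 0ᶜ

  from-dec : ∀ {A : Set} (a : Dec A) → ⌊ a ⌋ ≡ true → A
  from-dec (yes a) _ = a

  ∧-elim : ∀ a {b} → a ∧ b ≡ true → a ≡ true × b ≡ true
  ∧-elim true e = refl , e

  ∨-elim : ∀ a {b} → a ∨ b ≡ true → a ≡ true ⊎ b ≡ true
  ∨-elim true e = inj₁ refl
  ∨-elim false e = inj₂ e

  unsort : ∀ x y z → sorted x y z ≡ true →
    block x Fin.< block y × block y Fin.< block z × 0ᶜ ≡ colour x y × 1ᶜ ≡ colour y z × 2ᶜ ≡ colour x z
  unsort x y z e =
    let (e₁ , f₁) = ∧-elim (precedes x y) e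
        (e₂ , f₂) = ∧-elim (precedes y z) f₁
        (e₃ , f₃) = ∧-elim (hasColour 0ᶜ x y) f₂
        (e₄ , e₅) = ∧-elim (hasColour 1ᶜ y z) f₃
    in from-dec (block x Fin.<? block y) e₁ , from-dec (block y Fin.<? block z) e₂ , from-dec (0ᶜ Fin.≟ colour x y) e₃ ,
       from-dec (1ᶜ Fin.≟ colour y z) e₄ , from-dec (2ᶜ Fin.≟ colour x z) e₅

  edge-status : ∀ u v w → edge graph u v w ≡ true → Σ Status λ s → Has u v s × Has v w (next s)
  edge-status u v w e = [ (λ p → let (a , b , c , d , f) = unsort u v w p in (true , 0ᶜ) , (a , c) , (b , d)) , (λ e →
    [ (λ p → let (a , b , c , d , f) = unsort u w v p in (true , 2ᶜ) , (ℕ.<-trans a b , f) , (b , d)) , (λ e →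
    [ (λ p → let (a , b , c , d , f) = unsort v u w p in (false , 0ᶜ) , (a , c) , (ℕ.<-trans a b , f)) , (λ e →
    [ (λ p → let (a , b , c , d , f) = unsort v w u p in (false , 2ᶜ) , (ℕ.<-trans a b , f) , (a , c)) , (λ e →
    [ (λ p → let (a , b , c , d , f) = unsort w u v p in (true , 1ᶜ) , (b , d) , (ℕ.<-trans a b , f)) ,
      (λ p → let (a , b , c , d , f) = unsort w v u p in (false , 1ᶜ) , (b , d) , (a , c)) ]′
    (∨-elim (sorted w u v) e)) ]′ (∨-elim (sorted v w u) e)) ]′ (∨-elim (sorted v u w) e)) ]′ (∨-elim (sorted u w v) e)) ]′ (∨-elim (sorted u v w) e)

  follow : ∀ {u v w s} → edge graph u v w ≡ true → Has u v s → Has v w (next s)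
  follow {u} {v} {w} {s} e h with edge-status u v w e
  ... | s′ , h′ , g = subst (λ z → Has v w (next z)) (Has-unique s′ s h′ h) g

  iterate : ℕ → Status → Status
  iterate zero s = s
  iterate (suc n) s = next (iterate n s)

  module _ {k} (f : Label k → Vertex) (hom : ∀ x y z → HEdge k x y z → edge graph (f x) (f y) (f z) ≡ true) where
    -- The status after `n` steps depends only on the status of the pair `ab` and on `n`. All petals
    -- start at `ab` and have the same length, so they arrive with the same status.
    along : (p : Fin (suc k) → Label k) → HEdge k va vb (p zero) → (∀ j → Fin.toℕ j ≡ 1 → HEdge k vb (p zero) (p j)) →
      (∀ i j l → Fin.toℕ j ≡ suc (Fin.toℕ i) → Fin.toℕ l ≡ suc (Fin.toℕ j) → HEdge k (p i) (p j) (p l)) →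
      ∀ {s} → Has (f va) (f vb) s → ∀ n i j → Fin.toℕ i ≡ n → Fin.toℕ j ≡ suc n → Has (f (p i)) (f (p j)) (iterate (2 ℕ.+ n) s)
    along p start second step h zero zero j e e′ = follow (hom _ _ _ (second j e′)) (follow (hom _ _ _ start) h)
    along p start second step h (suc n) i j e e′ = follow (hom _ _ _ (step i⁻ i j (trans e (cong suc (sym i⁻≡))) (trans e′ (cong suc (sym e)))))
        (along p start second step h n i⁻ i i⁻≡ e)
      where
      n<k : n ℕ.< suc k
      n<k = ℕ.<-trans (ℕ.n<1+n n) (subst (ℕ._< suc k) e (Fin.toℕ<n i))
      i⁻ : Fin (suc k)
      i⁻ = Fin.fromℕ< n<k
      i⁻≡ : Fin.toℕ i⁻ ≡ n
      i⁻≡ = Fin.toℕ-fromℕ< n<k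

  cycle-free : ∀ s {x y z} → Has x y s → Has y z s → Has z x s → ⊥
  cycle-free (true , _) (p , _) (q , _) (r , _) = ℕ.<-irrefl refl (ℕ.<-trans p (ℕ.<-trans q r))
  cycle-free (false , _) (p , _) (q , _) (r , _) = ℕ.<-irrefl refl (ℕ.<-trans r (ℕ.<-trans q p))

  H-free : ∀ k → 1 ℕ.≤ k → ¬ ContainsH k graph
  H-free (suc k′) _ (f , _ , hom) = from-status (edge-status (f va) (f vb) (f (vc zero)) (hom _ _ _ abc₀))
    where
    k : ℕ
    k = suc k′
    i : Fin (suc k)
    i = Fin.fromℕ< (ℕ.n<1+n k′ `then` ℕ.n<1+n k)
      where
      _`then`_ : ∀ {a b c} → a ℕ.< b → b ℕ.< c → a ℕ.< c
      _`then`_ = ℕ.<-trans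
    i≡ : Fin.toℕ i ≡ k′
    i≡ = Fin.toℕ-fromℕ< _
    from-status : (Σ Status λ s → Has (f va) (f vb) s × Has (f vb) (f (vc zero)) (next s)) → ⊥
    from-status (s , h , _) = cycle-free (next (iterate (2 ℕ.+ k′) s))
      (follow (hom _ _ _ (cckdk i (cong suc i≡))) (along f hom vc abc₀ bc₀c₁ ccc h k′ i (Fin.fromℕ k) i≡ (Fin.toℕ-fromℕ k)))
      (follow (hom _ _ _ (ddkek i (cong suc i≡))) (along f hom vd abd₀ bd₀d₁ ddd h k′ i (Fin.fromℕ k) i≡ (Fin.toℕ-fromℕ k)))
      (follow (hom _ _ _ (eekck i (cong suc i≡))) (along f hom ve abe₀ be₀e₁ eee h k′ i (Fin.fromℕ k) i≡ (Fin.toℕ-fromℕ k)))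

-- The lower bound: the density

-- Ternary expansion: the numbers below `3^m` enumerate all tables of `m` colours.
digits : ∀ m → Fin (3 ℕ.^ m) → Fin m → Fin 3
digits (suc m) t zero = proj₁ (Fin.remQuot {3} (3 ℕ.^ m) t)
digits (suc m) t (suc a) = digits m (proj₂ (Fin.remQuot {3} (3 ℕ.^ m) t)) a

∑-split : ∀ m {n} (f : Fin (m ℕ.+ n) → ℚ) → ∑ f ≡ ∑ {m} (λ i → f (i Fin.↑ˡ n)) + ∑ {n} (λ j → f (m Fin.↑ʳ j))
∑-split zero f = zero-+ _
  where
  zero-+ : ∀ x → x ≡ 𝟎 + x
  zero-+ x = solve 1 (λ a → a := (lit 0) :+ a) refl _
∑-split (suc m) {n} f = trans (cong (f zero +_) (∑-split m {n} (f ∘ suc))) (assoc (f zero) _ _)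
  where
  assoc : ∀ a b c → a + (b + c) ≡ a + b + c
  assoc a b c = solve 3 (λ a b c → a :+ (b :+ c) := a :+ b :+ c) refl _ _ _

∑-combine : ∀ m {n} (f : Fin (m ℕ.* n) → ℚ) → ∑ f ≡ ∑ {m} (λ i → ∑ {n} (λ j → f (Fin.combine i j)))
∑-combine zero f = refl
∑-combine (suc m) {n} f = trans (∑-split n {m ℕ.* n} f) (cong (∑ {n} (λ j → f (j Fin.↑ˡ (m ℕ.* n))) +_) (∑-combine m {n} (λ j → f (n Fin.↑ʳ j))))

record Inverse (n : ℕ) : Set where
  field
    value  : ℚ
    nonneg : 𝟎 ≤ value
    unit   : ι n * value ≡ 𝟏

open Inverse public using (value)

uniform : ∀ {n} → Inverse n → Mean (Fin n)
uniform {n} I = weighted (λ _ → value I) (record { nonneg = λ _ → Inverse.nonneg I ; sum-1 = trans (∑-const n (value I)) (Inverse.unit I) })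

_*ᴵ_ : ∀ {m n} → Inverse m → Inverse n → Inverse (m ℕ.* n)
_*ᴵ_ {m} {n} I J = record
  { value = value I * value J ; nonneg = *-nonneg (Inverse.nonneg I) (Inverse.nonneg J)
  ; unit = trans (cong (_* (value I * value J)) (ι-* m n)) (trans (interchange (ι m) (ι n) (value I) (value J)) (trans (cong₂ _*_ (Inverse.unit I) (Inverse.unit J)) one)) }
  where
  interchange : ∀ a b c d → (a * b) * (c * d) ≡ (a * c) * (b * d)
  interchange a b c d = solve 4 (λ a b c d → a :* b :* (c :* d) := a :* c :* (b :* d)) refl _ _ _ _
  one : 𝟏 * 𝟏 ≡ 𝟏
  one = solve 0 ((lit 1) :* (lit 1) := (lit 1)) refl

uniform-combine : ∀ {m n} (I : Inverse m) (J : Inverse n) (f : Fin (m ℕ.* n) → ℚ) →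
  𝔼 (uniform (I *ᴵ J)) f ≡ 𝔼 (uniform I) (λ i → 𝔼 (uniform J) (λ j → f (Fin.combine i j)))
uniform-combine {m} {n} I J f = trans (∑-combine m {n} _) (∑-cong {m} (λ i →
  trans (∑-cong {n} (λ j → assoc (value I) (value J) (f (Fin.combine i j)))) (∑-* {n} (value I) _)))
  where
  assoc : ∀ a b c → a * b * c ≡ a * (b * c)
  assoc a b c = solve 3 (λ a b c → a :* b :* c := a :* (b :* c)) refl _ _ _

uniform-fubini : ∀ {m n} (I : Inverse m) (J : Inverse n) (f : Fin m → Fin n → ℚ) →
  𝔼 (uniform I) (λ i → 𝔼 (uniform J) (λ j → f i j)) ≡ 𝔼 (uniform J) (λ j → 𝔼 (uniform I) (λ i → f i j))
uniform-fubini I J f = weighted-fubini (λ _ → value I) (λ _ → value J) f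

inverse : ∀ n → Inverse (suc n)
inverse n with reciprocal (ι (suc n)) (ι-pos n)
... | y , y>0 , e = record { value = y ; nonneg = ℚ.<⇒≤ y>0 ; unit = e }

module Digits (third : Inverse 3) where
  ⅓ : ℚ
  ⅓ = value third

  power : ∀ m → Inverse (3 ℕ.^ m)
  power zero = record { value = 𝟏 ; nonneg = 0≤1 ; unit = one }
    where
    one : 𝟏 * 𝟏 ≡ 𝟏
    one = solve 0 ((lit 1) :* (lit 1) := (lit 1)) refl
  power (suc m) = third *ᴵ power m

  deviates : Fin 3 → Fin 3 → ℚ
  deviates c e = δ c e - ⅓

  deviates-mean : ∀ c → 𝔼 (uniform third) (deviates c) ≡ 𝟎
  deviates-mean c = trans (𝔼-sub (uniform third) (δ c) (λ _ → ⅓)) (trans (cong₂ _-_ (trans (∑-* {3} ⅓ (δ c)) (cong (⅓ *_) (∑-δ′ c))) (𝔼-const (uniform third) ⅓)) (cancel ⅓))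
    where
    cancel : ∀ a → a * 𝟏 - a ≡ 𝟎
    cancel a = solve 1 (λ a → a :* (lit 1) :- a := (lit 0)) refl _

  digits-mean : ∀ m c a → 𝔼 (uniform (power m)) (λ t → deviates c (digits m t a)) ≡ 𝟎
  digits-mean (suc m) c zero = trans (uniform-combine third (power m) _) (trans (𝔼-cong (uniform third) (λ e →
    trans (𝔼-cong (uniform (power m)) (λ r → cong (deviates c) (cong proj₁ (Fin.remQuot-combine {3} {3 ℕ.^ m} e r)))) (𝔼-const (uniform (power m)) _))) (deviates-mean c))
  digits-mean (suc m) c (suc a) = trans (uniform-combine third (power m) _) (trans (𝔼-cong (uniform third) (λ e →
    trans (𝔼-cong (uniform (power m)) (λ r → cong (λ z → deviates c (digits m (proj₂ z) a)) (Fin.remQuot-combine {3} {3 ℕ.^ m} e r))) (digits-mean m c a)))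
    (𝔼-const (uniform third) 𝟎))

  -- Different digits of a uniform number are independent, and each deviation has mean zero.
  digits-orthogonal : ∀ m c a a′ → a ≢ a′ → 𝔼 (uniform (power m)) (λ t → deviates c (digits m t a) * deviates c (digits m t a′)) ≡ 𝟎
  digits-orthogonal (suc m) c zero zero p = ⊥-elim (p refl)
  digits-orthogonal (suc m) c zero (suc a) p = trans (uniform-combine third (power m) _) (trans (𝔼-cong (uniform third) (λ e →
    trans (𝔼-cong (uniform (power m)) (λ r → cong (λ z → deviates c (proj₁ z) * deviates c (digits m (proj₂ z) a)) (Fin.remQuot-combine {3} {3 ℕ.^ m} e r)))
      (trans (𝔼-* (uniform (power m)) _ _) (trans (cong (deviates c e *_) (digits-mean m c a)) (*-zero _))))) (𝔼-const (uniform third) 𝟎))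
  digits-orthogonal (suc m) c (suc a) zero p = trans (𝔼-cong (uniform (power (suc m))) (λ t → swap (deviates c (digits (suc m) t (suc a))) (deviates c (digits (suc m) t zero))))
    (digits-orthogonal (suc m) c zero (suc a) (λ ()))
    where
    swap : ∀ a b → a * b ≡ b * a
    swap a b = solve 2 (λ a b → a :* b := b :* a) refl _ _
  digits-orthogonal (suc m) c (suc a) (suc a′) p = trans (uniform-combine third (power m) _) (trans (𝔼-cong (uniform third) (λ e →
    trans (𝔼-cong (uniform (power m)) (λ r → cong (λ z → deviates c (digits m (proj₂ z) a) * deviates c (digits m (proj₂ z) a′)) (Fin.remQuot-combine {3} {3 ℕ.^ m} e r)))
      (digits-orthogonal m c a a′ (λ q → p (cong suc q))))) (𝔼-const (uniform third) 𝟎))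

module LowerDensity (L m : ℕ) (third : Inverse 3) (IL : Inverse L) (Im : Inverse m) {ρ : ℚ} (ρ≥0 : 𝟎 ≤ ρ) (ρ-large : value Im ≤ ρ * ρ) where
  open Digits third
  open Construction L m (3 ℕ.^ m) (digits m)

  IT : Inverse (3 ℕ.^ m)
  IT = power m
  I : Inverse size
  I = IL *ᴵ (Im *ᴵ IT)
  M : Mean Vertex
  M = uniform I
  UL : Mean (Fin L)
  UL = uniform IL
  Um : Mean (Fin m)
  Um = uniform Im
  UT : Mean (Fin (3 ℕ.^ m))
  UT = uniform IT

  coordinates : ∀ (f : Vertex → ℚ) → 𝔼 M f ≡ 𝔼 UL (λ i → 𝔼 Um λ a → 𝔼 UT λ t → f (vertex i a t))
  coordinates f = trans (uniform-combine IL (Im *ᴵ IT) f) (𝔼-cong UL (λ i → uniform-combine Im IT _))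

  relabel : Vertex → Fin m → Vertex
  relabel x a = vertex (block x) a (table x)
  retable : Vertex → Fin (3 ℕ.^ m) → Vertex
  retable x t = vertex (block x) (label x) t

  resample-label : ∀ (f : Vertex → ℚ) → 𝔼 M f ≡ 𝔼 M (λ x → 𝔼 Um λ a → f (relabel x a))
  resample-label f = trans (coordinates f) (sym (trans (coordinates _) (𝔼-cong UL (λ i → trans
    (𝔼-cong Um (λ a′ → 𝔼-cong UT (λ t → 𝔼-cong Um (λ a → cong₂ (λ j s → f (vertex j a s)) (block-vertex i a′ t) (table-vertex i a′ t)))))
    (trans (𝔼-const Um _) (uniform-fubini IT Im _))))))

  resample-table : ∀ (f : Vertex → ℚ) → 𝔼 M f ≡ 𝔼 M (λ x → 𝔼 UT λ t → f (retable x t))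
  resample-table f = trans (coordinates f) (sym (trans (coordinates _) (𝔼-cong UL (λ i → 𝔼-cong Um (λ a → trans
    (𝔼-cong UT (λ t′ → 𝔼-cong UT (λ t → cong₂ (λ j s → f (vertex j s t)) (block-vertex i a t′) (label-vertex i a t′)))) (𝔼-const UT _))))))

  block-mean : ∀ (f : Fin L → ℚ) → 𝔼 M (λ x → f (block x)) ≡ 𝔼 UL f
  block-mean f = trans (coordinates _) (𝔼-cong UL (λ i → trans (𝔼-cong Um (λ a → trans (𝔼-cong UT (λ t → cong f (block-vertex i a t))) (𝔼-const UT _))) (𝔼-const Um _)))

  ⅓-unit : Unit ⅓
  ⅓-unit = Inverse.nonneg third , ℚ.≤-trans (≤-by (*-monoˡ (ι-nonneg 2) (Inverse.nonneg third)) (regroup ⅓)) (≤-refl′ (Inverse.unit third))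
    where
    regroup : ∀ a → ι 3 * a - a ≡ ι 2 * a - ι 2 * 𝟎
    regroup a = solve 1 (λ a → (lit 3) :* a :- a := (lit 2) :* a :- (lit 2) :* (lit 0)) refl _

  -- The functions t ↦ δ c (t a) - ⅓ are orthogonal for different a, so that a
  -- given g correlates with few of them.
  correlate : ∀ c (F : Fin m → ℚ) (g : Fin (3 ℕ.^ m) → ℚ) → (∀ a → Unit (F a)) → (∀ t → Unit (g t)) →
    ⅓ * 𝔼 Um (λ a → 𝔼 UT λ t → F a * g t) ≤ ρ + 𝔼 Um (λ a → 𝔼 UT λ t → F a * g t * δ c (digits m t a))
  correlate c F g uF ug = ≤-by (proj₁ (square-bound Um F u uF ρ≥0 small))
    (trans (cong (λ z → ρ + 𝔼 Um (λ a → 𝔼 UT λ t → F a * g t * δ c (digits m t a)) - z) (sym (𝔼-* Um ⅓ _)))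
      (trans (regroup ρ _ _) (cong (_- - ρ) (trans (sym (𝔼-sub Um _ _)) (𝔼-cong Um pointwise)))))
    where
    u : Fin m → ℚ
    u a = 𝔼 UT (λ t → deviates c (digits m t a) * g t)
    regroup : ∀ ρ x y → ρ + x - y ≡ (x - y) - - ρ
    regroup ρ x y = solve 3 (λ a b c → a :+ b :- c := b :- c :- (:- a)) refl _ _ _
    pointwise : ∀ a → 𝔼 UT (λ t → F a * g t * δ c (digits m t a)) - ⅓ * 𝔼 UT (λ t → F a * g t) ≡ F a * u a
    pointwise a = trans (cong (λ z → 𝔼 UT (λ t → F a * g t * δ c (digits m t a)) - z) (sym (𝔼-* UT ⅓ _)))
      (trans (sym (𝔼-sub UT _ _)) (trans (𝔼-cong UT (λ t → collect (F a) (g t) (δ c (digits m t a)) ⅓)) (𝔼-* UT (F a) _)))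
      where
      collect : ∀ f g d z → f * g * d - z * (f * g) ≡ f * ((d - z) * g)
      collect f g d z = solve 4 (λ a b c d → a :* b :* c :- d :* (a :* b) := a :* ((c :- d) :* b)) refl _ _ _ _
    norm : ∀ a → 𝔼 UT (λ t → deviates c (digits m t a) * deviates c (digits m t a)) ≤ 𝟏
    norm a = 𝔼-≤ UT (λ t → bound (Unit-δ c (digits m t a)))
      where
      bound : ∀ {d} → Unit d → (d - ⅓) * (d - ⅓) ≤ 𝟏
      bound {d} ud = square-≤ d ⅓ ud ⅓-unit
        where
        square-≤ : ∀ s t → Unit s → Unit t → (s - t) * (s - t) ≤ 𝟏
        square-≤ s t us ut = ≤-by (*-nonneg (≤⇒0≤ {s - t} {𝟏} (≤-by (proj₂ us ⊕ proj₁ ut) (solve 2 (λ a b → (lit 1) :- (a :- b) := (lit 1) :+ b :- (a :+ (lit 0))) refl _ _))) (≤⇒0≤ { - 𝟏} {s - t} (≤-by (proj₁ us ⊕ proj₂ ut) (solve 2 (λ a b → a :- b :- (:- (lit 1)) := a :+ (lit 1) :- ((lit 0) :+ b)) refl _ _)))) (solve 2 (λ a b → (lit 1) :- (a :- b) :* (a :- b) := ((lit 1) :- (a :- b)) :* (a :- b :- (:- (lit 1))) :- (lit 0)) refl _ _)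
    squares : ∑ {m} (λ a → u a * u a) ≤ 𝟏
    squares = ℚ.≤-trans (bessel UT {m} {𝟎} (λ a t → deviates c (digits m t a)) g norm
      (λ a a′ p → ≤-by {a = 𝟎} {b = 𝟎} ℚ.≤-refl (trans (cong (λ z → z - - 𝟎) (digits-orthogonal m c a a′ p)) (solve 0 ((lit 0) :- (:- (lit 0)) := (lit 0) :- (lit 0)) refl)) , ≤-refl′ (digits-orthogonal m c a a′ p))
      (𝔼-≤ UT (λ t → proj₂ (Unit-* (ug t) (ug t)))) ℚ.≤-refl) (≤-refl′ (one (ι m)))
      where
      one : ∀ z → 𝟏 + 𝟎 * z ≡ 𝟏
      one z = solve 1 (λ a → (lit 1) :+ (lit 0) :* a := (lit 1)) refl _
    small : 𝔼 Um (λ a → u a * u a) ≤ ρ * ρ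
    small = ℚ.≤-trans (≤-refl′ (∑-* {m} (value Im) _)) (ℚ.≤-trans (*-monoˡ (Inverse.nonneg Im) squares) (ℚ.≤-trans (≤-refl′ (unit (value Im))) ρ-large))
      where
      unit : ∀ z → z * 𝟏 ≡ z
      unit z = solve 1 (λ a → a :* (lit 1) := a) refl _

  -- `F` sees of `z` only the block, and `g` sees of `x` only the block. The label of `x` and the
  -- table of `z` can therefore be resampled independently: `F` becomes a function of the label and
  -- `g` of the table, and `correlate` applies to the colour, which is the entry of the table at the
  -- label.
  replace-colour : ∀ c (F g : Vertex → Fin L → ℚ) → (∀ x i → Unit (F x i)) → (∀ x i → Unit (g x i)) →
    ⅓ * 𝔼 M (λ x → 𝔼 M λ z → F x (block z) * g z (block x)) ≤ ρ + 𝔼 M (λ x → 𝔼 M λ z → F x (block z) * g z (block x) * δ c (colour x z))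
  replace-colour c F g uF ug = ℚ.≤-trans (≤-refl′ (trans (cong (⅓ *_) (resample _)) (trans (sym (𝔼-* M ⅓ _)) (𝔼-cong M (λ x → sym (𝔼-* M ⅓ _))))))
    (ℚ.≤-trans (𝔼-mono M (λ x → 𝔼-mono M (λ z → ℚ.≤-trans (≤-refl′ (cong (⅓ *_) (𝔼-cong Um (λ a → 𝔼-cong UT (λ t → fix x z a t)))))
        (ℚ.≤-trans (correlate c (λ a → F (relabel x a) (block z)) (λ t → g (retable z t) (block x)) (λ a → uF _ _) (λ t → ug _ _))
          (≤-refl′ (cong (ρ +_) (𝔼-cong Um (λ a → 𝔼-cong UT (λ t → sym (cong₂ _*_ (fix x z a t) (cong₂ (λ s b → δ c (digits m s b)) (table-vertex _ _ _) (label-vertex _ _ _)))))))))))) 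
      (≤-refl′ (trans (𝔼-cong M (λ x → trans (𝔼-+ M _ _) (cong₂ _+_ (𝔼-const M ρ) refl))) (trans (𝔼-+ M _ _) (cong₂ _+_ (𝔼-const M ρ) (sym (resample _)))))))
    where
    resample : ∀ (G : Vertex → Vertex → ℚ) → 𝔼 M (λ x → 𝔼 M λ z → G x z) ≡ 𝔼 M (λ x → 𝔼 M λ z → 𝔼 Um λ a → 𝔼 UT λ t → G (relabel x a) (retable z t))
    resample G = trans (resample-label (λ x → 𝔼 M λ z → G x z)) (𝔼-cong M (λ x → trans (𝔼-cong Um (λ a → resample-table (G (relabel x a)))) (uniform-fubini Im I _)))
    fix : ∀ x z a t → F (relabel x a) (block (retable z t)) * g (retable z t) (block (relabel x a)) ≡ F (relabel x a) (block z) * g (retable z t) (block x)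
    fix x z a t = cong₂ (λ i j → F (relabel x a) i * g (retable z t) j) (block-vertex _ _ _) (block-vertex _ _ _)

  χ-δ : ∀ {n} (i j : Fin n) → χ ⌊ i Fin.≟ j ⌋ ≡ δ i j
  χ-δ i j = from (i Fin.≟ j)
    where
    from : (d : Dec (i ≡ j)) → χ ⌊ d ⌋ ≡ δ i j
    from (yes refl) = sym (δ-diagonal i)
    from (no p) = sym (δ-off p)

  module _ (W : Vec Bool size) where
    A : Vertex → ℚ
    A x = χ (lookup W x)
    A-unit : ∀ x → Unit (A x)
    A-unit x = Unit-χ (lookup W x)

    lt : Fin L → Fin L → ℚ
    lt i j = χ ⌊ i Fin.<? j ⌋
    lt-unit : ∀ i j → Unit (lt i j)
    lt-unit i j = Unit-χ ⌊ i Fin.<? j ⌋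

    J : Fin 3 → Vertex → Vertex → ℚ
    J c x y = δ c (colour x y)
    J-unit : ∀ c x y → Unit (J c x y)
    J-unit c x y = Unit-δ c (colour x y)

    Sum : (Vertex → Vertex → Vertex → ℚ) → ℚ
    Sum f = 𝔼 M λ x → 𝔼 M λ y → 𝔼 M λ z → f x y z

    -- Triples of `W` in increasing blocks, with the three colour conditions imposed one at a time.
    -- Each condition multiplies the mean by a third, up to `ρ`.
    B₀ B₁ B₂ B₃ : Vertex → Vertex → Vertex → ℚ
    B₀ x y z = (A x * lt (block x) (block y)) * (A y * (A z * lt (block y) (block z)))
    B₁ x y z = B₀ x y z * J 0ᶜ x y
    B₂ x y z = B₁ x y z * J 1ᶜ y z
    B₃ x y z = B₂ x y z * J 2ᶜ x z

    ⅓-in : ∀ f → ⅓ * 𝔼 M f ≡ 𝔼 M (λ x → ⅓ * f x)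
    ⅓-in f = sym (𝔼-* M ⅓ f)

    ρ-out : ∀ f → 𝔼 M (λ x → ρ + f x) ≡ ρ + 𝔼 M f
    ρ-out f = trans (𝔼-+ M _ _) (cong (_+ 𝔼 M f) (𝔼-const M ρ))

    step₁ : ⅓ * Sum B₀ ≤ ρ + Sum B₁
    step₁ = ℚ.≤-trans (≤-refl′ (cong (⅓ *_) (𝔼-cong M λ x → 𝔼-cong M λ y → pull x y)))
      (ℚ.≤-trans (replace-colour 0ᶜ (λ x j → A x * lt (block x) j) (λ y _ → A y * rest y) (λ x j → Unit-* (A-unit x) (lt-unit (block x) j)) (λ y _ → Unit-* (A-unit y) (rest-unit y)))
        (≤-refl′ (cong (ρ +_) (𝔼-cong M λ x → 𝔼-cong M λ y → trans (cong (_* J 0ᶜ x y) (sym (pull x y))) (sym (𝔼-*ʳ M (J 0ᶜ x y) _))))))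
      where
      rest : Vertex → ℚ
      rest y = 𝔼 M λ z → A z * lt (block y) (block z)
      rest-unit : ∀ y → Unit (rest y)
      rest-unit y = Unit-𝔼 M λ z → Unit-* (A-unit z) (lt-unit (block y) (block z))
      pull : ∀ x y → 𝔼 M (λ z → B₀ x y z) ≡ (A x * lt (block x) (block y)) * (A y * rest y)
      pull x y = trans (𝔼-* M (A x * lt (block x) (block y)) _) (cong (A x * lt (block x) (block y) *_) (𝔼-* M (A y) _))

    -- For fixed `x` the earlier condition on the colour of `xy` is a function of `y` alone and can
    -- be absorbed into `F`.
    step₂ : ⅓ * Sum B₁ ≤ ρ + Sum B₂
    step₂ = ℚ.≤-trans (≤-refl′ (⅓-in _)) (ℚ.≤-trans (𝔼-mono M λ x → ℚ.≤-trans
        (≤-refl′ (cong (⅓ *_) (𝔼-cong M λ y → 𝔼-cong M λ z → arrange x y z)))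
        (ℚ.≤-trans (replace-colour 1ᶜ (F x) (λ z _ → A z) (λ y j → F-unit x y j) (λ z _ → A-unit z))
          (≤-refl′ (cong (ρ +_) (𝔼-cong M λ y → 𝔼-cong M λ z → cong (_* J 1ᶜ y z) (sym (arrange x y z)))))))
        (≤-refl′ (ρ-out _)))
      where
      F : Vertex → Vertex → Fin L → ℚ
      F x y j = (A x * lt (block x) (block y)) * (A y * lt (block y) j) * J 0ᶜ x y
      F-unit : ∀ x y j → Unit (F x y j)
      F-unit x y j = Unit-* (Unit-* (Unit-* (A-unit x) (lt-unit (block x) (block y))) (Unit-* (A-unit y) (lt-unit (block y) j))) (J-unit 0ᶜ x y)
      arrange : ∀ x y z → B₁ x y z ≡ F x y (block z) * A z
      arrange x y z = regroup (A x * lt (block x) (block y)) (A y) (A z) (lt (block y) (block z)) (J 0ᶜ x y)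
        where
        regroup : ∀ p a b l j → p * (a * (b * l)) * j ≡ p * (a * l) * j * b
        regroup p a b l j = solve 5 (λ a b c d e → a :* (b :* (c :* d)) :* e := a :* (b :* d) :* e :* c) refl _ _ _ _ _

    -- Here `y` is fixed and integrated last, so that the condition on `xy` belongs to `x` and the
    -- condition on `yz` to `z`.
    step₃ : ⅓ * Sum B₂ ≤ ρ + Sum B₃
    step₃ = ℚ.≤-trans (≤-refl′ (trans (cong (⅓ *_) (uniform-fubini I I _)) (⅓-in _))) (ℚ.≤-trans (𝔼-mono M λ y → ℚ.≤-trans
        (≤-refl′ (cong (⅓ *_) (𝔼-cong M λ x → 𝔼-cong M λ z → arrange x y z)))
        (ℚ.≤-trans (replace-colour 2ᶜ (λ x _ → F x y) (λ z _ → g z y) (λ x _ → F-unit x y) (λ z _ → g-unit z y))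
          (≤-refl′ (cong (ρ +_) (𝔼-cong M λ x → 𝔼-cong M λ z → cong (_* J 2ᶜ x z) (sym (arrange x y z)))))))
        (≤-refl′ (trans (ρ-out _) (cong (ρ +_) (uniform-fubini I I _)))))
      where
      F g : Vertex → Vertex → ℚ
      F x y = (A x * lt (block x) (block y)) * J 0ᶜ x y
      g z y = (A y * (A z * lt (block y) (block z))) * J 1ᶜ y z
      F-unit : ∀ x y → Unit (F x y)
      F-unit x y = Unit-* (Unit-* (A-unit x) (lt-unit (block x) (block y))) (J-unit 0ᶜ x y)
      g-unit : ∀ z y → Unit (g z y)
      g-unit z y = Unit-* (Unit-* (A-unit y) (Unit-* (A-unit z) (lt-unit (block y) (block z)))) (J-unit 1ᶜ y z)
      arrange : ∀ x y z → B₂ x y z ≡ F x y * g z y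
      arrange x y z = regroup (A x * lt (block x) (block y)) (A y * (A z * lt (block y) (block z))) (J 0ᶜ x y) (J 1ᶜ y z)
        where
        regroup : ∀ p q j k → p * q * j * k ≡ p * j * (q * k)
        regroup p q j k = solve 4 (λ a b c d → a :* b :* c :* d := a :* c :* (b :* d)) refl _ _ _ _

    colours : Sum B₀ ≤ ι 27 * Sum B₃ + ι 81 * ρ
    colours = combine ⅓ (Sum B₀) (Sum B₁) (Sum B₂) (Sum B₃) (Inverse.unit third) step₁ step₂ step₃
      where
      combine : ∀ t a b c e → ι 3 * t ≡ 𝟏 → t * a ≤ ρ + b → t * b ≤ ρ + c → t * c ≤ ρ + e → a ≤ ι 27 * e + ι 81 * ρ
      -- The errors add up to (3 + 9 + 27) `ρ`; the remaining `42 ρ` of the bound are slack.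
      combine t a b c e h p q r = ℚ.≤-trans (third-step a b p) (≤-by (*-monoˡ (ι-nonneg 3) (third-step b c q) ⊕ *-monoˡ (ι-nonneg 9) (third-step c e r) ⊕ *-monoˡ (ι-nonneg 42) ρ≥0) (regroup b c e ρ))
        where
        third-step : ∀ x y → t * x ≤ ρ + y → x ≤ ι 3 * (ρ + y)
        third-step x y s = ℚ.≤-trans (≤-refl′ (trans (one x) (trans (cong (_* x) (sym h)) (assoc t x)))) (*-monoˡ (ι-nonneg 3) s)
          where
          one : ∀ x → x ≡ 𝟏 * x
          one x = solve 1 (λ a → a := (lit 1) :* a) refl _
          assoc : ∀ t x → ι 3 * t * x ≡ ι 3 * (t * x)
          assoc t x = solve 2 (λ a b → (lit 3) :* a :* b := (lit 3) :* (a :* b)) refl _ _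
        regroup : ∀ b c e ρ → ι 27 * e + ι 81 * ρ - ι 3 * (ρ + b) ≡
          (ι 3 * (ι 3 * (ρ + c)) + (ι 9 * (ι 3 * (ρ + e)) + ι 42 * ρ)) - (ι 3 * b + (ι 9 * c + ι 42 * 𝟎))
        regroup b c e ρ = solve 4 (λ a b c d → (lit 27) :* a :+ (lit 81) :* b :- (lit 3) :* (b :+ c) := (lit 3) :* ((lit 3) :* (b :+ d)) :+ ((lit 9) :* ((lit 3) :* (b :+ a)) :+ (lit 42) :* b) :- ((lit 3) :* c :+ ((lit 9) :* d :+ (lit 42) :* (lit 0)))) refl _ _ _ _

    y : ℚ
    y = value I
    y³ : ℚ
    y³ = y * y * y

    Sum-∑ : ∀ f → Sum f ≡ y³ * ∑ {size} (λ a → ∑ {size} λ b → ∑ {size} λ c → f a b c)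
    Sum-∑ f = trans (∑-cong {size} λ a → cong (y *_) (trans (∑-cong {size} λ b → cong (y *_) (∑-* {size} y _)) (trans (∑-* {size} y _) (cong (y *_) (∑-* {size} y _)))))
      (trans (∑-* {size} y _) (trans (cong (y *_) (trans (∑-* {size} y _) (cong (y *_) (∑-* {size} y _)))) (assoc _)))
      where
      assoc : ∀ s → y * (y * (y * s)) ≡ y * y * y * s
      assoc s = solve 4 (λ a b c d → a :* (b :* c) :* (a :* (b :* c) :* (a :* (b :* c) :* d)) := a :* (b :* c) :* (a :* (b :* c)) :* (a :* (b :* c)) :* d) refl _ _ _ _

    Sum-mono : ∀ {f g} → (∀ a b c → f a b c ≤ g a b c) → Sum f ≤ Sum g
    Sum-mono p = 𝔼-mono M λ a → 𝔼-mono M λ b → 𝔼-mono M λ c → p a b c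

    edges : Sum B₃ ≤ y³ * ι (inducedEdges graph W)
    edges = ℚ.≤-trans (Sum-mono pointwise) (≤-refl′ (trans (Sum-∑ _) (cong (y³ *_) (trans (below-sum₃ {size} (λ a b c → A a * (A b * (A c * χ (edge graph a b c))))) (sym (inducedEdges-sum graph W))))))
      where
      indicator : ∀ a b c → B₃ a b c ≡ (A a * (A b * A c)) * χ (sorted a b c)
      indicator a b c = trans (regroup (A a) (A b) (A c) (lt (block a) (block b)) (lt (block b) (block c)) (J 0ᶜ a b) (J 1ᶜ b c) (J 2ᶜ a c))
        (cong (A a * (A b * A c) *_) (sym (trans (χ-∧ (precedes a b) _) (cong (lt (block a) (block b) *_) (trans (χ-∧ (precedes b c) _) (cong (lt (block b) (block c) *_)
          (trans (χ-∧ (hasColour 0ᶜ a b) _) (cong₂ _*_ (χ-δ 0ᶜ (colour a b)) (trans (χ-∧ (hasColour 1ᶜ b c) _) (cong₂ _*_ (χ-δ 1ᶜ (colour b c)) (χ-δ 2ᶜ (colour a c))))))))))))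
        where
        regroup : ∀ a b c l k i j h → (a * l) * (b * (c * k)) * i * j * h ≡ (a * (b * c)) * (l * (k * (i * (j * h))))
        regroup a b c l k i j h = solve 8 (λ a b c d e f g h → a :* b :* (c :* (d :* e)) :* f :* g :* h := a :* (c :* d) :* (b :* (e :* (f :* (g :* h))))) refl _ _ _ _ _ _ _ _
      A-nonneg : ∀ x → 𝟎 ≤ A x
      A-nonneg x = proj₁ (A-unit x)
      below-yes : ∀ {a b : Vertex} → a Fin.< b → below a b ≡ 𝟏
      below-yes {a} {b} p = from (Fin.toℕ a ℕ.<? Fin.toℕ b)
        where
        from : (d : Dec (Fin.toℕ a ℕ.< Fin.toℕ b)) → χ ⌊ d ⌋ ≡ 𝟏
        from (yes _) = refl
        from (no q) = ⊥-elim (q p)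
      bound : ∀ a b c s → sorted a b c ≡ s → (A a * (A b * A c)) * χ s ≤ below a b * (below b c * (A a * (A b * (A c * χ (edge graph a b c)))))
      bound a b c false _ = ℚ.≤-trans (≤-refl′ (*-zero _)) (*-nonneg (proj₁ (Unit-χ ⌊ Fin.toℕ a ℕ.<? Fin.toℕ b ⌋)) (*-nonneg (proj₁ (Unit-χ ⌊ Fin.toℕ b ℕ.<? Fin.toℕ c ⌋)) (*-nonneg (A-nonneg a) (*-nonneg (A-nonneg b) (*-nonneg (A-nonneg c) (proj₁ (Unit-χ (edge graph a b c))))))))
      bound a b c true e = let (p , q , _) = unsort a b c e in ≤-refl′ (sym (trans (cong₂ (λ s t → s * (t * (A a * (A b * (A c * χ (edge graph a b c)))))) (below-yes (block-reflects p)) (below-yes (block-reflects q)))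
        (trans (cong (λ s → 𝟏 * (𝟏 * (A a * (A b * (A c * χ s))))) (sorted⇒edge a b c e)) (ones (A a) (A b) (A c)))))
        where
        ones : ∀ a b c → 𝟏 * (𝟏 * (a * (b * (c * 𝟏)))) ≡ a * (b * c) * 𝟏
        ones a b c = solve 3 (λ a b c → (lit 1) :* ((lit 1) :* (a :* (b :* (c :* (lit 1))))) := a :* (b :* c) :* (lit 1)) refl _ _ _
      pointwise : ∀ a b c → B₃ a b c ≤ below a b * (below b c * (A a * (A b * (A c * χ (edge graph a b c)))))
      pointwise a b c = ℚ.≤-trans (≤-refl′ (indicator a b c)) (bound a b c (sorted a b c) refl)

    -- Vertices are numbered block by block, so an increasing triple has increasing blocks unless
    -- two consecutive members share one. Each of these two coincidences has probability `1 / L`.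
    triples : y³ * ι (∣ W ∣ Comb.C 3) ≤ Sum B₀ + ι 2 * value IL
    triples = ℚ.≤-trans (≤-refl′ (trans (cong (y³ *_) (trans (sym (choose₃ W)) (trans (cubic₃-sort (λ _ _ _ → 𝟏) (Vec.map χ W)) (trans (sort₃-cong {size} (λ a b c →
          cong₂ _*_ (Vec.lookup-map a χ W) (cong₂ _*_ (Vec.lookup-map b χ W) (cong (_* 𝟏) (Vec.lookup-map c χ W))))) (sym (below-sum₃ {size} (λ a b c → A a * (A b * (A c * 𝟏)))))))))
          (sym (Sum-∑ _))))
        (ℚ.≤-trans (Sum-mono pointwise) (≤-refl′ (trans (Sum-+ _ _) (trans (cong (_+ Sum (λ a b c → δ (block b) (block c))) (Sum-+ B₀ _)) (trans (cong₂ (λ s t → Sum B₀ + s + t) same₁ same₂) (collect (Sum B₀) (value IL)))))))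
      where
      Sum-+ : ∀ f g → Sum (λ a b c → f a b c + g a b c) ≡ Sum f + Sum g
      Sum-+ f g = trans (𝔼-cong M λ a → trans (𝔼-cong M λ b → 𝔼-+ M _ _) (𝔼-+ M _ _)) (𝔼-+ M _ _)
      same : ∀ i → 𝔼 M (λ x → δ i (block x)) ≡ value IL
      same i = trans (block-mean (δ i)) (trans (∑-* {L} (value IL) (δ i)) (trans (cong (value IL *_) (∑-δ′ i)) (unit (value IL))))
        where
        unit : ∀ z → z * 𝟏 ≡ z
        unit z = solve 1 (λ a → a :* (lit 1) := a) refl _
      same₁ : Sum (λ a b c → δ (block a) (block b)) ≡ value IL
      same₁ = trans (𝔼-cong M λ a → trans (𝔼-cong M λ b → 𝔼-const M _) (same (block a))) (𝔼-const M _)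
      same₂ : Sum (λ a b c → δ (block b) (block c)) ≡ value IL
      same₂ = trans (𝔼-cong M λ a → trans (𝔼-cong M λ b → same (block b)) (𝔼-const M _)) (𝔼-const M _)
      collect : ∀ s t → s + t + t ≡ s + ι 2 * t
      collect s t = solve 2 (λ a b → a :+ b :+ b := a :+ (lit 2) :* b) refl _ _
      below-≤ : ∀ a b → below a b ≤ lt (block a) (block b) + δ (block a) (block b)
      below-≤ a b = from (Fin.toℕ a ℕ.<? Fin.toℕ b) (block a Fin.<? block b)
        where
        from : (d : Dec (Fin.toℕ a ℕ.< Fin.toℕ b)) (e : Dec (block a Fin.< block b)) → χ ⌊ d ⌋ ≤ χ ⌊ e ⌋ + δ (block a) (block b)
        from (no _) e = +-nonneg (proj₁ (Unit-χ ⌊ e ⌋)) (proj₁ (Unit-δ _ _))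
        from (yes _) (yes _) = ≤-by (proj₁ (Unit-δ (block a) (block b))) (regroup (δ (block a) (block b)))
          where
          regroup : ∀ d → 𝟏 + d - 𝟏 ≡ d - 𝟎
          regroup d = solve 1 (λ a → (lit 1) :+ a :- (lit 1) := a :- (lit 0)) refl _
        from (yes p) (no q) = ≤-refl′ (sym (trans (cong (𝟎 +_) (trans (cong (δ (block a)) (sym equal)) (δ-diagonal (block a)))) zero-one))
          where
          equal : block a ≡ block b
          equal = Fin.toℕ-injective (ℕ.≤-antisym (ℕ.≮⇒≥ (block-mono p)) (ℕ.≮⇒≥ q))
          zero-one : 𝟎 + 𝟏 ≡ 𝟏
          zero-one = solve 0 ((lit 0) :+ (lit 1) := (lit 1)) refl
      pointwise : ∀ a b c → below a b * (below b c * (A a * (A b * (A c * 𝟏)))) ≤ B₀ a b c + δ (block a) (block b) + δ (block b) (block c)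
      pointwise a b c = estimate (A-unit a) (A-unit b) (A-unit c) (Unit-χ ⌊ Fin.toℕ a ℕ.<? Fin.toℕ b ⌋) (Unit-χ ⌊ Fin.toℕ b ℕ.<? Fin.toℕ c ⌋)
          (lt-unit (block a) (block b)) (lt-unit (block b) (block c)) (proj₁ (Unit-δ (block a) (block b))) (proj₁ (Unit-δ (block b) (block c))) (below-≤ a b) (below-≤ b c)
        where
        estimate : ∀ {a b c s t l k d e} → Unit a → Unit b → Unit c → Unit s → Unit t → Unit l → Unit k → 𝟎 ≤ d → 𝟎 ≤ e → s ≤ l + d → t ≤ k + e →
          s * (t * (a * (b * (c * 𝟏)))) ≤ (a * l) * (b * (c * k)) + d + e
        estimate {a} {b} {c} {s} {t} {l} {k} {d} {e} ua ub uc us ut ul uk d≥0 e≥0 p q =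
          ≤-by (*-monoʳ (proj₁ w) (st) ⊕ *-≤ʳ {a * (b * c)} {d} (proj₂ w) d≥0 ⊕ *-≤ʳ {a * (b * c)} {e} (proj₂ w) e≥0)
            (regroup a b c s t l k d e)
          where
          w : Unit (a * (b * c))
          w = Unit-* ua (Unit-* ub uc)
          st : s * t ≤ l * k + d + e
          st = ℚ.≤-trans (*-monoʳ (proj₁ ut) p) (≤-by (*-monoˡ (proj₁ ul) q ⊕ *-≤ˡ d≥0 (proj₂ ut) ⊕ *-≤ʳ (proj₂ ul) e≥0) (rearrange l k d e t))
            where
            rearrange : ∀ l k d e t → l * k + d + e - (l + d) * t ≡ (l * (k + e) + (d + e)) - (l * t + (d * t + l * e))
            rearrange l k d e t = solve 5 (λ a b c d e → a :* b :+ c :+ d :- (a :+ c) :* e := a :* (b :+ d) :+ (c :+ d) :- (a :* e :+ (c :* e :+ a :* d))) refl _ _ _ _ _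
          regroup : ∀ a b c s t l k d e → (a * l) * (b * (c * k)) + d + e - s * (t * (a * (b * (c * 𝟏)))) ≡
            ((l * k + d + e) * (a * (b * c)) + (d + e)) - (s * t * (a * (b * c)) + (a * (b * c) * d + a * (b * c) * e))
          regroup a b c s t l k d e = solve 9 (λ a b c d e f g h i → a :* b :* (c :* (d :* e)) :+ f :+ g :- h :* (i :* (a :* (c :* (d :* (lit 1))))) := (b :* e :+ f :+ g) :* (a :* (c :* d)) :+ (f :+ g) :- (h :* i :* (a :* (c :* d)) :+ (a :* (c :* d) :* f :+ a :* (c :* d) :* g))) refl _ _ _ _ _ _ _ _ _

    -- Chain `triples`, `colours` and `edges` and multiply by the cube of the number of vertices;
    -- the total error `81 ρ + 2 / L` is absorbed by `27 ε`.
    density : ∀ {d ε} → ι 27 * d ≤ 𝟏 → ι 81 * ρ + ι 2 * value IL ≤ ι 27 * ε →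
      d * ι (∣ W ∣ Comb.C 3) - ε * ι (size ℕ.^ 3) ≤ ι (inducedEdges graph W)
    density {d} {ε} d≤ small = *-cancel-≤ (ι-pos 26) (ℚ.≤-trans (combine (ι (∣ W ∣ Comb.C 3)) (ι (inducedEdges graph W)) (ι size) (ι (size ℕ.^ 3)) d ε y cube (Inverse.unit I)
        (ι-nonneg (∣ W ∣ Comb.C 3)) (ι-nonneg size) d≤
        (ℚ.≤-trans triples (≤-by (colours ⊕ *-monoˡ (ι-nonneg 27) edges ⊕ small) (regroup (Sum B₀) (Sum B₃) (value IL) (y³ * ι (inducedEdges graph W)) ρ ε))))
        ℚ.≤-refl)
      where
      regroup : ∀ a b v e ρ ε → ι 27 * e + ι 27 * ε - (a + ι 2 * v) ≡ ((ι 27 * b + ι 81 * ρ) + (ι 27 * e + ι 27 * ε)) - (a + (ι 27 * b + (ι 81 * ρ + ι 2 * v)))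
      regroup a b v e ρ ε = solve 6 (λ a b c d e f → (lit 27) :* a :+ (lit 27) :* b :- (c :+ (lit 2) :* d) := (lit 27) :* e :+ (lit 81) :* f :+ ((lit 27) :* a :+ (lit 27) :* b) :- (c :+ ((lit 27) :* e :+ ((lit 81) :* f :+ (lit 2) :* d)))) refl _ _ _ _ _ _
      cube : ι (size ℕ.^ 3) ≡ ι size * ι size * ι size
      cube = trans (ι-* size _) (trans (cong (ι size *_) (trans (ι-* size _) (cong (ι size *_) (ι-* size 1)))) (one (ι size)))
        where
        one : ∀ n → n * (n * (n * 𝟏)) ≡ n * n * n
        one n = solve 1 (λ a → a :* (a :* (a :* (lit 1))) := a :* a :* a) refl _
      combine : ∀ c e n n³ d ε y → n³ ≡ n * n * n → n * y ≡ 𝟏 → 𝟎 ≤ c → 𝟎 ≤ n → ι 27 * d ≤ 𝟏 → y * y * y * c ≤ ι 27 * (y * y * y * e) + ι 27 * ε →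
        ι 27 * (d * c - ε * n³) ≤ ι 27 * e
      combine c e n n³ d ε y refl ny c≥0 n≥0 p q = ≤-by (*-monoʳ c≥0 p ⊕ scaled) (rearrange c e (n * n * n) d ε)
        where
        unscale : ∀ x → n * n * n * (y * y * y * x) ≡ x
        unscale x = trans (regroup₁ n y x) (trans (cong (λ z → z * z * z * x) ny) (ones x))
          where
          regroup₁ : ∀ n y x → n * n * n * (y * y * y * x) ≡ (n * y) * (n * y) * (n * y) * x
          regroup₁ n y x = solve 3 (λ a b c → a :* a :* a :* (b :* b :* b :* c) := a :* b :* (a :* b) :* (a :* b) :* c) refl _ _ _
          ones : ∀ x → 𝟏 * 𝟏 * 𝟏 * x ≡ x
          ones x = solve 1 (λ a → (lit 1) :* (lit 1) :* (lit 1) :* a := a) refl _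
        scaled : c ≤ ι 27 * e + ι 27 * ε * (n * n * n)
        scaled = ℚ.≤-trans (≤-refl′ (sym (unscale c))) (ℚ.≤-trans (*-monoˡ (*-nonneg (*-nonneg n≥0 n≥0) n≥0) q)
          (≤-refl′ (trans (distrib (n * n * n) (y * y * y * e) ε) (cong (λ z → ι 27 * z + ι 27 * ε * (n * n * n)) (unscale e)))))
          where
          distrib : ∀ m x ε → m * (ι 27 * x + ι 27 * ε) ≡ ι 27 * (m * x) + ι 27 * ε * m
          distrib m x ε = solve 3 (λ a b c → a :* ((lit 27) :* b :+ (lit 27) :* c) := (lit 27) :* (a :* b) :+ (lit 27) :* c :* a) refl _ _ _
        rearrange : ∀ c e m d ε → ι 27 * e - ι 27 * (d * c - ε * m) ≡ (𝟏 * c + (ι 27 * e + ι 27 * ε * m)) - (ι 27 * d * c + c)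
        rearrange c e m d ε = solve 5 (λ a b c d e → (lit 27) :* a :- (lit 27) :* (b :* c :- d :* e) := (lit 1) :* c :+ ((lit 27) :* a :+ (lit 27) :* d :* e) :- ((lit 27) :* b :* c :+ c)) refl _ _ _ _ _

lower-bound : ∀ k → 1 ℕ.≤ k → (d : ℚ) → d < 1/27 → (ε : ℚ) → 0ℚ < ε → (N : ℕ) →
  Σ ℕ λ n → N ℕ.≤ n × Σ (ThreeGraph n) λ G → Dense d ε G × ¬ ContainsH k G
lower-bound k k≥1 d d< ε ε>0 N = choose (fraction 3 (subst (_< ε) (sym 𝟎-def) ε>0))
  where
  choose : (Σ ℚ λ c → 𝟎 < c × ι 4 * c ≡ ε) → Σ ℕ λ n → N ℕ.≤ n × Σ (ThreeGraph n) λ G → Dense d ε G × ¬ ContainsH k G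
  choose (c , c>0 , c≡) = with-sizes (exceed 2 c>0) (exceed 1 (*-pos c>0 c>0))
    where
    with-sizes : (Σ ℕ λ l → ι 2 < ι l * c) → (Σ ℕ λ m → ι 1 < ι m * (c * c)) → Σ ℕ λ n → N ℕ.≤ n × Σ (ThreeGraph n) λ G → Dense d ε G × ¬ ContainsH k G
    with-sizes (l , l>) (m , m>) = size , large , graph , ≤-dense graph (λ W → density W d≤ small) , H-free k k≥1
      where
      -- Adding `N` to the number of blocks makes the graph have at least `N` vertices.
      open Construction (suc (l ℕ.+ N)) (suc m) (3 ℕ.^ suc m) (digits (suc m))
      inverse-≤ : ∀ n {x a} (I : Inverse n) → x ≤ ι n * a → value I * x ≤ a
      inverse-≤ n {x} {a} I p = ℚ.≤-trans (*-monoˡ (Inverse.nonneg I) p) (≤-refl′ (trans (assoc (value I) (ι n) a) (trans (cong (_* a) (Inverse.unit I)) (one a))))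
        where
        assoc : ∀ v n a → v * (n * a) ≡ n * v * a
        assoc v n a = solve 3 (λ a b c → a :* (b :* c) := b :* a :* c) refl _ _ _
        one : ∀ a → 𝟏 * a ≡ a
        one a = solve 1 (λ a → (lit 1) :* a := a) refl _
      IL : Inverse (suc (l ℕ.+ N))
      IL = inverse (l ℕ.+ N)
      Im : Inverse (suc m)
      Im = inverse m
      ρ-large : value Im ≤ c * c
      ρ-large = ℚ.≤-trans (≤-refl′ (sym (unit (value Im)))) (inverse-≤ (suc m) Im (ℚ.≤-trans (ℚ.<⇒≤ m>) (*-monoʳ (ℚ.<⇒≤ (*-pos c>0 c>0)) (ι-mono (ℕ.n≤1+n m)))))
        where
        unit : ∀ z → z * 𝟏 ≡ z
        unit z = solve 1 (λ a → a :* (lit 1) := a) refl _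
      2/L≤c : ι 2 * value IL ≤ c
      2/L≤c = ℚ.≤-trans (≤-refl′ (swap (value IL))) (inverse-≤ (suc (l ℕ.+ N)) IL (ℚ.≤-trans (ℚ.<⇒≤ l>) (*-monoʳ (ℚ.<⇒≤ c>0) (ι-mono (ℕ.≤-trans (ℕ.m≤m+n l N) (ℕ.n≤1+n _))))))
        where
        swap : ∀ z → ι 2 * z ≡ z * ι 2
        swap z = solve 1 (λ a → (lit 2) :* a := a :* (lit 2)) refl _
      open LowerDensity (suc (l ℕ.+ N)) (suc m) (inverse 2) IL Im (ℚ.<⇒≤ c>0) ρ-large using (density)
      d≤ : ι 27 * d ≤ 𝟏
      d≤ = ℚ.≤-trans (*-monoˡ (ι-nonneg 27) (ℚ.<⇒≤ d<)) (≤-refl′ 1/27-def)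
      -- With `c = ε / 4` in the role of `ρ` and as a bound for `2 / L`, the error is at most
      -- `82 c`, while `27 ε` is `108 c`.
      small : ι 81 * c + ι 2 * value IL ≤ ι 27 * ε
      small = ℚ.≤-trans (≤-by (2/L≤c ⊕ *-nonneg (ι-nonneg 26) (ℚ.<⇒≤ c>0)) (regroup c (value IL))) (≤-refl′ (cong (ι 27 *_) c≡))
        where
        regroup : ∀ c v → ι 27 * (ι 4 * c) - (ι 81 * c + ι 2 * v) ≡ (c + ι 26 * c) - (ι 2 * v + 𝟎)
        regroup c v = solve 2 (λ a b → (lit 27) :* ((lit 4) :* a) :- ((lit 81) :* a :+ (lit 2) :* b) := a :+ (lit 26) :* a :- ((lit 2) :* b :+ (lit 0))) refl _ _
      large : N ℕ.≤ size
      large = ℕ.≤-trans (ℕ.≤-trans (ℕ.m≤n+m N l) (ℕ.n≤1+n _)) (ℕ.m≤m*n (suc (l ℕ.+ N)) (suc m ℕ.* 3 ℕ.^ suc m) {{ℕ.>-nonZero (ℕ.*-mono-≤ {1} {suc m} {1} {3 ℕ.^ suc m} (ℕ.s≤s ℕ.z≤n) (ℕ.m^n>0 3 (suc m)))}})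

theorem5p4 : (k : ℕ) → 1 ℕ.≤ k →
    ((d : ℚ) → d < 1/27 → (ε : ℚ) → 0ℚ < ε → (N : ℕ) →
       Σ ℕ λ n → N ℕ.≤ n × Σ (ThreeGraph n) λ G → Dense d ε G × ¬ ContainsH k G)
    ×
    ((d : ℚ) → 1/27 < d → Σ ℚ λ ε → 0ℚ < ε × Σ ℕ λ N →
       (n : ℕ) → N ℕ.≤ n → (G : ThreeGraph n) → Dense d ε G → ContainsH k G)
theorem5p4 k k≥1 = lower-bound k k≥1 , upper-bound k k≥1
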